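{- Let $(K, v)$ be a Henselian discrete valued field whose residue field $\widehat K$ is finite, and let $q = \mathrm{char}(\widehat K)$. Let $E$ be a Galois extension of $K$ such that $\dim(E) \le 1$. Then $\widehat E(p) = \widehat E$ for every prime $p \neq q$. Moreover, if the value group $v(E)$ is $q$-indivisible (i.e. $v(E) \neq q v(E)$), then $\widehat E(q) = \widehat E$; in particular, $\widehat E$ is algebraically closed.
   Context: A field $F$ has dimension $\le 1$ (written $\dim(F)\le 1$) if the Brauer group $\mathrm{Br}(F')$ is trivial for every algebraic field extension $F'/F$. A valuation $v$ of $K$ is Henselian if it extends uniquely (up to equivalence) to every algebraic extension of $K$; it is discrete if its value group is infinite cyclic. Since $v$ is Henselian, it extends uniquely to a valuation of $E$, again denoted $v$; $v(E)$ is its value group and $\widehat E$ its residue field. For a field $F$ and a prime $p$, $F(p)$ denotes the maximal $p$-extension of $F$ inside a separable closure of $F$. -}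

module Defs where

open import Level using (Level) renaming (suc to lsuc)
open import Algebra.Bundles using (AbelianGroup; CommutativeRing; RawRing; Ring)
open import Algebra.Morphism.Structures
  using (IsGroupMonomorphism; IsGroupIsomorphism; IsRingHomomorphism; IsRingIsomorphism)
import Algebra.Definitions.RawMonoid as RawMonoidDefs
import Algebra.Morphism.Construct.Identity as Identity
import Algebra.Properties.AbelianGroup as AbelianGroupProperties
import Algebra.Properties.CommutativeSemigroup as CommutativeSemigroupProperties
import Algebra.Properties.Group as GroupProperties
import Algebra.Properties.Ring as RingProperties
open import Data.Bool.Base using (if_then_else_)
open import Data.Fin.Base using (Fin)
import Data.Fin.Properties as Fin
open import Data.Integer.Base using (+-0-rawGroup)
open import Data.List.Base using (List; []; _∷_; map)
open import Data.Maybe.Base using (zipWith) renaming (map to map⁺)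
open import Data.Nat.Base as ℕ using (ℕ; zero; suc)
open import Data.Nat.Divisibility using (_∣_)
open import Data.Product.Base using (Σ; ∃; ∃-syntax; _×_; _,_; proj₁; proj₂)
open import Data.Sum.Base using (_⊎_; inj₁; inj₂)
open import Data.Empty using (⊥-elim)
open import Function.Base using (id)
open import Function.Bundles using (Inverse; _⇔_; module Equivalence)
open import Relation.Binary.Core using (Rel)
open import Relation.Binary.Structures using (IsDecTotalOrder; IsEquivalence)
open import Relation.Binary.Morphism.Structures using (IsOrderMonomorphism; IsOrderIsomorphism)
import Relation.Binary.PropositionalEquality.Properties as ≡
import Relation.Binary.Reasoning.Setoid as SetoidReasoning
import Relation.Binary.Construct.Add.Supremum.Equality as SupEquality
import Relation.Binary.Construct.Add.Supremum.NonStrict as SupOrder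
open import Relation.Nullary.Construct.Add.Supremum using (_⁺; ⊤⁺; [_])
open import Relation.Nullary.Decidable.Core using (does; yes; no)
open import Relation.Nullary.Negation.Core using (¬_)

private
  variable
    ℓ : Level

-- Carrier and equality share one level, so that quotients
-- F[X]/(f) and residue fields of a field at level ℓ are again at level ℓ.
record Field (ℓ : Level) : Set (lsuc ℓ) where
  field
    commutativeRing : CommutativeRing ℓ ℓ
  open CommutativeRing commutativeRing public
  field
    1≉0     : ¬ (1# ≈ 0#)
    inverse : ∀ x → ¬ (x ≈ 0#) → ∃[ y ] x * y ≈ 1#

record Extension (F : Field ℓ) : Set (lsuc ℓ) where
  private module F = Field F
  field
    top            : Field ℓ
    ι              : F.Carrier → Field.Carrier top
    ι-homomorphism : IsRingHomomorphism F.rawRing (Field.rawRing top) ι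
  open Field top public

-- F-embeddings. An intermediate field of Ω/F is given as an extension M of F
-- together with an F-embedding of M into Ω; the subset of Ω it stands for is
-- the image of the embedding.
record _↪_ {F : Field ℓ} (L M : Extension F) : Set ℓ where
  private
    module L = Extension L
    module M = Extension M
  field
    ⟦_⟧          : L.Carrier → M.Carrier
    homomorphism : IsRingHomomorphism L.rawRing M.rawRing ⟦_⟧
    fixes        : ∀ a → ⟦ L.ι a ⟧ M.≈ M.ι a

record Automorphism {F : Field ℓ} (L : Extension F) : Set ℓ where
  private module L = Extension L
  field
    ⟦_⟧         : L.Carrier → L.Carrier
    isomorphism : IsRingIsomorphism L.rawRing L.rawRing ⟦_⟧
    fixes       : ∀ a → ⟦ L.ι a ⟧ L.≈ L.ι a

InBase : {F : Field ℓ} (L : Extension F) → Extension.Carrier L → Set ℓ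
InBase L x = ∃[ a ] ι a ≈ x
  where open Extension L

IsFinite : Field ℓ → Set ℓ
IsFinite F = ∃[ n ] Inverse (≡.setoid (Fin n)) (Field.setoid F)

HasCharacteristic : Field ℓ → ℕ → Set ℓ
HasCharacteristic F q = ∀ n → (n ·1 ≈ 0#) ⇔ (q ∣ n)
  where
  open Field F
  _·1 : ℕ → Carrier
  n ·1 = RawMonoidDefs._×_ (RawRing.+-rawMonoid rawRing) n 1#

-- A polynomial is the list of its coefficients, constant term first;
-- trailing zeros are allowed and are disregarded by _≈ₚ_.
module Polynomial (F : Field ℓ) where
  open Field F

  Poly : Set ℓ
  Poly = List Carrier

  coeff : Poly → ℕ → Carrier
  coeff []      _       = 0#
  coeff (a ∷ p) zero    = a
  coeff (a ∷ p) (suc n) = coeff p n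

  infix 4 _≈ₚ_ _∣ₚ_
  infixl 6 _+ₚ_
  infixl 7 _*ₚ_

  _≈ₚ_ : Rel Poly ℓ
  p ≈ₚ q = ∀ n → coeff p n ≈ coeff q n

  _+ₚ_ : Poly → Poly → Poly
  []      +ₚ q       = q
  (a ∷ p) +ₚ []      = a ∷ p
  (a ∷ p) +ₚ (b ∷ q) = (a + b) ∷ (p +ₚ q)

  _*ₚ_ : Poly → Poly → Poly
  []      *ₚ q = []
  (a ∷ p) *ₚ q = map (a *_) q +ₚ (0# ∷ (p *ₚ q))

  -- (a + X p)′ = p + X p′
  derivative : Poly → Poly
  derivative []      = []
  derivative (a ∷ p) = p +ₚ (0# ∷ derivative p)

  eval : Poly → Carrier → Carrier
  eval []      x = 0#
  eval (a ∷ p) x = a + x * eval p x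

  _∣ₚ_ : Rel Poly ℓ
  p ∣ₚ q = ∃[ r ] r *ₚ p ≈ₚ q

  IsMonic : Poly → Set ℓ
  IsMonic p = ∃[ n ] coeff p n ≈ 1# × (∀ m → n ℕ.< m → coeff p m ≈ 0#)

  IsNonzero : Poly → Set ℓ
  IsNonzero p = ∃[ n ] ¬ (coeff p n ≈ 0#)

  IsNonconstant : Poly → Set ℓ
  IsNonconstant p = ∃[ n ] ¬ (coeff p (suc n) ≈ 0#)

  IsSeparablePoly : Poly → Set ℓ
  IsSeparablePoly p = ∃[ r ] ∃[ s ] r *ₚ p +ₚ s *ₚ derivative p ≈ₚ (1# ∷ [])

IsAlgebraicallyClosed : Field ℓ → Set ℓ
IsAlgebraicallyClosed F = ∀ p → IsNonconstant p → ∃[ x ] eval p x ≈ 0#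
  where
  open Field F
  open Polynomial F

IsSeparablyClosed : Field ℓ → Set ℓ
IsSeparablyClosed F = ∀ p → IsNonconstant p → IsSeparablePoly p → ∃[ x ] eval p x ≈ 0#
  where
  open Field F
  open Polynomial F

module _ {F : Field ℓ} (L : Extension F) where
  private module F[X] = Polynomial F
  open Extension L
  open Polynomial top using (eval)

  evalAt : F[X].Poly → Carrier → Carrier
  evalAt p x = eval (map ι p) x

  IsAlgebraic : Set ℓ
  IsAlgebraic = ∀ x → ∃[ p ] F[X].IsNonzero p × evalAt p x ≈ 0#

  record IsMinimalPolynomial (x : Carrier) (m : F[X].Poly) : Set ℓ where
    field
      monic   : F[X].IsMonic m
      root    : evalAt m x ≈ 0#
      minimal : ∀ p → evalAt p x ≈ 0# → m F[X].∣ₚ p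

  IsSeparable : Set ℓ
  IsSeparable = ∀ x → ∃[ m ] IsMinimalPolynomial x m × F[X].IsSeparablePoly m

  record IsSeparableClosure : Set ℓ where
    field
      separable       : IsSeparable
      separablyClosed : IsSeparablyClosed top

  -- L/F may have infinite degree; F is the fixed field of Aut(L/F).
  record IsGalois : Set ℓ where
    field
      algebraic  : IsAlgebraic
      fixedField : ∀ x → (∀ (σ : Automorphism L) → Automorphism.⟦_⟧ σ x ≈ x) → InBase L x

record FAlgebra (F : Field ℓ) : Set (lsuc ℓ) where
  private module F = Field F
  field
    ring : Ring ℓ ℓ
  open Ring ring public
  field
    ι              : F.Carrier → Carrier
    ι-homomorphism : IsRingHomomorphism F.rawRing rawRing ι
    ι-central      : ∀ a x → ι a * x ≈ x * ι a

extensionAlgebra : {F : Field ℓ} → Extension F → FAlgebra F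
extensionAlgebra L = record
  { ring           = ring
  ; ι              = ι
  ; ι-homomorphism = ι-homomorphism
  ; ι-central      = λ a → *-comm (ι a)
  } where open Extension L

trivialExtension : (F : Field ℓ) → Extension F
trivialExtension F = record
  { top            = F
  ; ι              = id
  ; ι-homomorphism = Identity.isRingHomomorphism (Field.rawRing F) (Field.refl F)
  }

module _ {F : Field ℓ} (A : FAlgebra F) where
  private module F = Field F
  open FAlgebra A
  open RawMonoidDefs (RawRing.+-rawMonoid rawRing) using (sum)

  linearCombination : ∀ {n} → (Fin n → F.Carrier) → (Fin n → Carrier) → Carrier
  linearCombination c b = sum (λ i → ι (c i) * b i)

  record IsBasis {n : ℕ} (b : Fin n → Carrier) : Set ℓ where
    field
      spanning    : ∀ x → ∃[ c ] linearCombination c b ≈ x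
      independent : ∀ c → linearCombination c b ≈ 0# → ∀ i → c i F.≈ F.0#

  HasDimension : ℕ → Set ℓ
  HasDimension n = Σ (Fin n → Carrier) IsBasis

  record IsTwoSidedIdeal (I : Carrier → Set ℓ) : Set ℓ where
    field
      I-resp-≈ : ∀ {x y} → x ≈ y → I x → I y
      I-0      : I 0#
      I-+      : ∀ {x y} → I x → I y → I (x + y)
      I-*ˡ     : ∀ a {x} → I x → I (a * x)
      I-*ʳ     : ∀ a {x} → I x → I (x * a)

  record IsCentralSimple : Set (lsuc ℓ) where
    field
      finiteDimensional : ∃ HasDimension
      central           : ∀ x → (∀ y → x * y ≈ y * x) → ∃[ a ] ι a ≈ x
      1≉0               : ¬ (1# ≈ 0#)
      simple            : ∀ (I : Carrier → Set ℓ) → IsTwoSidedIdeal I →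
                          (∀ x → I x → x ≈ 0#) ⊎ (∀ x → I x)

  diagonal : ∀ n → Carrier → Fin n → Fin n → Carrier
  diagonal n x i j = if does (i Fin.≟ j) then x else 0#

  matrixRing : ℕ → RawRing ℓ ℓ
  matrixRing n = record
    { Carrier = Fin n → Fin n → Carrier
    ; _≈_     = λ M N → ∀ i j → M i j ≈ N i j
    ; _+_     = λ M N i j → M i j + N i j
    ; _*_     = λ M N i j → sum (λ k → M i k * N k j)
    ; -_      = λ M i j → - M i j
    ; 0#      = λ _ _ → 0#
    ; 1#      = diagonal n 1#
    }

-- Mₘ(A) ≅ Mₙ(B) as F-algebras for some m, n ≥ 1
BrauerEquivalent : {F : Field ℓ} → FAlgebra F → FAlgebra F → Set ℓ
BrauerEquivalent {F = F} A B =
  ∃[ m ] ∃[ n ] ∃[ f ]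
    IsRingIsomorphism (matrixRing A (suc m)) (matrixRing B (suc n)) f ×
    (∀ a → RawRing._≈_ (matrixRing B (suc n))
             (f (diagonal A (suc m) (A.ι a))) (diagonal B (suc n) (B.ι a)))
  where
  module A = FAlgebra A
  module B = FAlgebra B

-- The elements of Br(F) are the Brauer classes of central simple F-algebras
-- and its identity is the class of F.
BrauerGroupTrivial : Field ℓ → Set (lsuc ℓ)
BrauerGroupTrivial F =
  ∀ (A : FAlgebra F) → IsCentralSimple A →
  BrauerEquivalent A (extensionAlgebra (trivialExtension F))

Dim≤1 : Field ℓ → Set (lsuc ℓ)
Dim≤1 F = ∀ (L : Extension F) → IsAlgebraic L → BrauerGroupTrivial (Extension.top L)

IsFinitePExtension : {F : Field ℓ} → ℕ → Extension F → Set ℓ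
IsFinitePExtension p N =
  IsGalois N × ∃[ k ] HasDimension (extensionAlgebra N) (p ℕ.^ k)

-- Membership in F(p) ⊆ Ω, the compositum in Ω of all finite Galois extensions
-- of F of p-power degree: x lies in every intermediate field M of Ω/F that
-- contains all of them.
InMaximalPExtension : {F : Field ℓ} → ℕ → (Ω : Extension F) → Extension.Carrier Ω → Set (lsuc ℓ)
InMaximalPExtension {F = F} p Ω x =
  ∀ (M : Extension F) (ψ : M ↪ Ω) →
  (∀ (N : Extension F) (φ : N ↪ Ω) → IsFinitePExtension p N →
     ∀ y → ∃[ z ] _↪_.⟦_⟧ ψ z ≈ _↪_.⟦_⟧ φ y) →
  ∃[ z ] _↪_.⟦_⟧ ψ z ≈ x
  where open Extension Ω

-- F(p) = F, for whichever separable closure Ω of F is used to form F(p)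
MaximalPExtensionTrivial : ℕ → Field ℓ → Set (lsuc ℓ)
MaximalPExtensionTrivial p F =
  ∀ (Ω : Extension F) → IsSeparableClosure Ω →
  ∀ x → InMaximalPExtension p Ω x ⇔ InBase Ω x

-- Written multiplicatively by the library, additively in the mathematics.
-- Decidability of the order is automatic under excluded middle; it is what
-- makes nonzero residues invertible below.
record OrderedAbelianGroup (ℓ : Level) : Set (lsuc ℓ) where
  infix 4 _≤_
  field
    abelianGroup : AbelianGroup ℓ ℓ
  open AbelianGroup abelianGroup public
  field
    _≤_             : Rel Carrier ℓ
    isDecTotalOrder : IsDecTotalOrder _≈_ _≤_
    ∙-monoʳ-≤       : ∀ z {x y} → x ≤ y → z ∙ x ≤ z ∙ y

  open SupEquality _≈_ public
  open SupOrder _≤_ public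

  infixl 6 _⊕_
  _⊕_ : Carrier ⁺ → Carrier ⁺ → Carrier ⁺
  _⊕_ = zipWith _∙_

IsDivisibleBy : ℕ → OrderedAbelianGroup ℓ → Set ℓ
IsDivisibleBy n Γ = ∀ γ → ∃[ δ ] n · δ ≈ γ
  where
  open OrderedAbelianGroup Γ
  open RawMonoidDefs rawMonoid using () renaming (_×_ to _·_)

record Valuation (F : Field ℓ) : Set (lsuc ℓ) where
  private module F = Field F
  field
    valueGroup : OrderedAbelianGroup ℓ
  open OrderedAbelianGroup valueGroup
  field
    v          : F.Carrier → Carrier ⁺
    v-cong     : ∀ {x y} → x F.≈ y → v x ≈⁺ v y
    v-∞        : ∀ x → v x ≈⁺ ⊤⁺ ⇔ x F.≈ F.0#
    v-*        : ∀ x y → v (x F.* y) ≈⁺ v x ⊕ v y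
    -- min (v x) (v y) ≤ v (x + y), the order being total
    v-+        : ∀ x y → (v x ≤⁺ v (x F.+ y)) ⊎ (v y ≤⁺ v (x F.+ y))
    -- valueGroup is the value group v(F), not just a group containing it
    surjective : ∀ γ → ∃[ x ] v x ≈⁺ [ γ ]

record Extends {F : Field ℓ} (L : Extension F) (v : Valuation F)
               (w : Valuation (Extension.top L)) : Set ℓ where
  private
    module v = Valuation v
    module w = Valuation w
    module Γ = OrderedAbelianGroup v.valueGroup
    module Δ = OrderedAbelianGroup w.valueGroup
  field
    j       : Γ.Carrier → Δ.Carrier
    j-group : IsGroupMonomorphism Γ.rawGroup Δ.rawGroup j
    j-order : IsOrderMonomorphism Γ._≈_ Δ._≈_ Γ._≤_ Δ._≤_ j
    extends : ∀ x → w.v (Extension.ι L x) Δ.≈⁺ map⁺ j (v.v x)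

record Equivalent {F : Field ℓ} (v w : Valuation F) : Set ℓ where
  private
    module v = Valuation v
    module w = Valuation w
    module Γ = OrderedAbelianGroup v.valueGroup
    module Δ = OrderedAbelianGroup w.valueGroup
  field
    j        : Γ.Carrier → Δ.Carrier
    j-group  : IsGroupIsomorphism Γ.rawGroup Δ.rawGroup j
    j-order  : IsOrderIsomorphism Γ._≈_ Δ._≈_ Γ._≤_ Δ._≤_ j
    commutes : ∀ x → w.v x Δ.≈⁺ map⁺ j (v.v x)

record IsHenselian {F : Field ℓ} (v : Valuation F) : Set (lsuc ℓ) where
  field
    extension : ∀ (L : Extension F) → IsAlgebraic L → ∃[ w ] Extends L v w
    unique    : ∀ (L : Extension F) → IsAlgebraic L →
                ∀ w w′ → Extends L v w → Extends L v w′ → Equivalent w w′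

IsDiscrete : {F : Field ℓ} → Valuation F → Set ℓ
IsDiscrete v = ∃[ f ] IsGroupIsomorphism +-0-rawGroup Γ.rawGroup f
  where module Γ = OrderedAbelianGroup (Valuation.valueGroup v)

module Residue {F : Field ℓ} (V : Valuation F) where
  open Field F
  open Valuation V
  open OrderedAbelianGroup valueGroup using (_≤⁺_; _≈⁺_; _⊕_; ε)

  InValuationRing : Carrier → Set ℓ
  InValuationRing x = [ ε ] ≤⁺ v x

  -- v x > 0
  InMaximalIdeal : Carrier → Set ℓ
  InMaximalIdeal x = ¬ (v x ≤⁺ [ ε ])

  infix 4 _≡ᵥ_
  _≡ᵥ_ : Rel (Σ Carrier InValuationRing) ℓ
  (x , _) ≡ᵥ (y , _) = InMaximalIdeal (x - y)

  private
    module Γ = OrderedAbelianGroup valueGroup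
    module ≤ = IsDecTotalOrder Γ.isDecTotalOrder
    module ≤⁺ = IsDecTotalOrder (Γ.≤⁺-isDecTotalOrder Γ.isDecTotalOrder)
    open Γ using ([_]) renaming (⊤⁺≈⊤⁺ to ∙≈∙)

    ≤⊕ : ∀ {a b} → [ ε ] ≤⁺ a → b ≤⁺ a ⊕ b
    ≤⊕ {a = ⊤⁺}              _           = _ Γ.≤⊤⁺
    ≤⊕ {a = [ _ ]} {b = ⊤⁺}  _           = _ Γ.≤⊤⁺
    ≤⊕ {a = [ a ]} {b = [ b ]} ([ 0≤a ]) =
      [ ≤.≤-respˡ-≈ (Γ.identityʳ b) (≤.≤-respʳ-≈ (Γ.comm b a) (Γ.∙-monoʳ-≤ b 0≤a)) ]

    ⊕-cong : ∀ {a a′ b b′} → a ≈⁺ a′ → b ≈⁺ b′ → a ⊕ b ≈⁺ a′ ⊕ b′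
    ⊕-cong ∙≈∙   _     = ∙≈∙
    ⊕-cong [ _ ] ∙≈∙   = ∙≈∙
    ⊕-cong [ p ] [ q ] = [ Γ.∙-cong p q ]

    ⊕-identityˡ : ∀ a → [ ε ] ⊕ a ≈⁺ a
    ⊕-identityˡ ⊤⁺    = ∙≈∙
    ⊕-identityˡ [ a ] = [ Γ.identityˡ a ]

    ⊕-idempotent : ∀ {a} → ¬ (a ≈⁺ ⊤⁺) → a ≈⁺ a ⊕ a → a ≈⁺ [ ε ]
    ⊕-idempotent {a = ⊤⁺}    a≉∞ _     = ⊥-elim (a≉∞ ∙≈∙)
    ⊕-idempotent {a = [ a ]} _   [ p ] =
      [ GroupProperties.identityˡ-unique Γ.group a a (Γ.sym p) ]

    ⊕-torsionFree : ∀ {a} → a ⊕ a ≈⁺ [ ε ] → a ≈⁺ [ ε ]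
    ⊕-torsionFree {a = [ a ]} [ p ] with ≤.total a ε
    ... | inj₁ a≤0 = [ ≤.antisym a≤0
      (≤.≤-respˡ-≈ p (≤.≤-respʳ-≈ (Γ.identityʳ a) (Γ.∙-monoʳ-≤ a a≤0))) ]
    ... | inj₂ 0≤a = [ ≤.antisym
      (≤.≤-respʳ-≈ p (≤.≤-respˡ-≈ (Γ.identityʳ a) (Γ.∙-monoʳ-≤ a 0≤a))) 0≤a ]

    open RingProperties ring using (-1*x≈-x; -‿involutive; -0#≈0#; x[y-z]≈xy-xz; [y-z]x≈yx-zx)
    module ≤R = ≤⁺ using () renaming (≤-respˡ-≈ to ˡ; ≤-respʳ-≈ to ʳ)
    module E = ≤⁺.Eq

    v-0 : v 0# ≈⁺ ⊤⁺
    v-0 = Equivalence.from (v-∞ 0#) refl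

    v-1 : v 1# ≈⁺ [ ε ]
    v-1 = ⊕-idempotent (λ v1≈∞ → 1≉0 (Equivalence.to (v-∞ 1#) v1≈∞))
      (E.trans (v-cong (sym (*-identityˡ 1#))) (v-* 1# 1#))

    v-neg : ∀ x → v (- x) ≈⁺ v x
    v-neg x = E.trans (v-cong (sym (-1*x≈-x x))) (E.trans (v-* (- 1#) x)
      (E.trans (⊕-cong v-[-1] E.refl) (⊕-identityˡ (v x))))
      where
      v-[-1] : v (- 1#) ≈⁺ [ ε ]
      v-[-1] = ⊕-torsionFree (E.trans (E.sym (v-* (- 1#) (- 1#)))
        (E.trans (v-cong (trans (-1*x≈-x (- 1#)) (-‿involutive 1#))) v-1))

    O-+ : ∀ {x y} → InValuationRing x → InValuationRing y → InValuationRing (x + y)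
    O-+ {x} {y} x∈O y∈O with v-+ x y
    ... | inj₁ p = ≤⁺.trans x∈O p
    ... | inj₂ p = ≤⁺.trans y∈O p

    O-* : ∀ {x y} → InValuationRing x → InValuationRing y → InValuationRing (x * y)
    O-* {x} {y} x∈O y∈O = ≤R.ʳ (E.sym (v-* x y)) (≤⁺.trans y∈O (≤⊕ x∈O))

    O-neg : ∀ {x} → InValuationRing x → InValuationRing (- x)
    O-neg {x} = ≤R.ʳ (E.sym (v-neg x))

    O-0 : InValuationRing 0#
    O-0 = ≤R.ʳ (E.sym v-0) (_ Γ.≤⊤⁺)

    O-1 : InValuationRing 1#
    O-1 = ≤⁺.reflexive (E.sym v-1)

    M-resp : ∀ {x y} → x ≈ y → InMaximalIdeal x → InMaximalIdeal y
    M-resp x≈y x∈M p = x∈M (≤R.ˡ (v-cong (sym x≈y)) p)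

    M-0 : InMaximalIdeal 0#
    M-0 p with ≤R.ˡ v-0 p
    ... | ()

    M-+ : ∀ {x y} → InMaximalIdeal x → InMaximalIdeal y → InMaximalIdeal (x + y)
    M-+ {x} {y} x∈M y∈M p with v-+ x y
    ... | inj₁ q = x∈M (≤⁺.trans q p)
    ... | inj₂ q = y∈M (≤⁺.trans q p)

    M-neg : ∀ {x} → InMaximalIdeal x → InMaximalIdeal (- x)
    M-neg {x} x∈M p = x∈M (≤R.ˡ (v-neg x) p)

    M-*ˡ : ∀ {x y} → InValuationRing x → InMaximalIdeal y → InMaximalIdeal (x * y)
    M-*ˡ {x} {y} x∈O y∈M p = y∈M (≤⁺.trans (≤⊕ x∈O) (≤R.ˡ (v-* x y) p))

    ≈⇒≡ᵥ : ∀ {x y} → x ≈ y → InMaximalIdeal (x - y)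
    ≈⇒≡ᵥ {x} {y} x≈y = M-resp (sym (trans (+-congʳ x≈y) (-‿inverseʳ y))) M-0

    module +P = AbelianGroupProperties +-abelianGroup
    open CommutativeSemigroupProperties +-commutativeSemigroup using (interchange)
    open SetoidReasoning setoid

    neg-flip : ∀ x y → - (x - y) ≈ y - x
    neg-flip = +P.⁻¹-anti-homo‿-

    telescope : ∀ x y z → (x - y) + (y - z) ≈ x - z
    telescope x y z = begin
      (x - y) + (y - z)   ≈⟨ +-assoc x (- y) (y - z) ⟩
      x + (- y + (y - z)) ≈⟨ +-congˡ (+P.\\-leftDividesʳ y (- z)) ⟩
      x - z               ∎

    +-split : ∀ x x′ y y′ → (x - x′) + (y - y′) ≈ (x + y) - (x′ + y′)
    +-split x x′ y y′ = trans (interchange x (- x′) y (- y′)) (+-congˡ (+P.⁻¹-∙-comm x′ y′))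

    *-split : ∀ x x′ y y′ → x * (y - y′) + y′ * (x - x′) ≈ x * y - x′ * y′
    *-split x x′ y y′ = begin
      x * (y - y′) + y′ * (x - x′)            ≈⟨ +-cong (x[y-z]≈xy-xz x y y′) (*-comm y′ (x - x′)) ⟩
      (x * y - x * y′) + (x - x′) * y′        ≈⟨ +-congˡ ([y-z]x≈yx-zx y′ x x′) ⟩
      (x * y - x * y′) + (x * y′ - x′ * y′)   ≈⟨ telescope (x * y) (x * y′) (x′ * y′) ⟩
      x * y - x′ * y′                         ∎

    neg-split : ∀ x y → - (x - y) ≈ (- x) - (- y)
    neg-split x y = sym (+P.⁻¹-∙-comm x (- y))

    ≡ᵥ-isEquivalence : IsEquivalence _≡ᵥ_
    ≡ᵥ-isEquivalence = record
      { refl  = ≈⇒≡ᵥ refl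
      ; sym   = λ {a} {b} p → M-resp (neg-flip (proj₁ a) (proj₁ b)) (M-neg p)
      ; trans = λ {a} {b} {c} p q → M-resp (telescope (proj₁ a) (proj₁ b) (proj₁ c)) (M-+ p q)
      }

  residueRing : CommutativeRing ℓ ℓ
  residueRing = record
    { Carrier = Σ Carrier InValuationRing
    ; _≈_ = _≡ᵥ_
    ; _+_ = λ (x , x∈O) (y , y∈O) → x + y , O-+ x∈O y∈O
    ; _*_ = λ (x , x∈O) (y , y∈O) → x * y , O-* x∈O y∈O
    ; -_  = λ (x , x∈O) → - x , O-neg x∈O
    ; 0#  = 0# , O-0
    ; 1#  = 1# , O-1
    ; isCommutativeRing = record
      { isRing = record
        { +-isAbelianGroup = record
          { isGroup = record
            { isMonoid = record
              { isSemigroup = record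
                { isMagma = record
                  { isEquivalence = ≡ᵥ-isEquivalence
                  ; ∙-cong = λ {a} {a′} {b} {b′} p q →
                      M-resp (+-split (proj₁ a) (proj₁ a′) (proj₁ b) (proj₁ b′)) (M-+ p q)
                  }
                ; assoc = λ a b c → ≈⇒≡ᵥ (+-assoc (proj₁ a) (proj₁ b) (proj₁ c))
                }
              ; identity = (λ a → ≈⇒≡ᵥ (+-identityˡ (proj₁ a))) , (λ a → ≈⇒≡ᵥ (+-identityʳ (proj₁ a)))
              }
            ; inverse = (λ a → ≈⇒≡ᵥ (-‿inverseˡ (proj₁ a))) , (λ a → ≈⇒≡ᵥ (-‿inverseʳ (proj₁ a)))
            ; ⁻¹-cong = λ {a} {b} p → M-resp (neg-split (proj₁ a) (proj₁ b)) (M-neg p)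
            }
          ; comm = λ a b → ≈⇒≡ᵥ (+-comm (proj₁ a) (proj₁ b))
          }
        ; *-cong = λ {a} {a′} {b} {b′} p q →
            M-resp (*-split (proj₁ a) (proj₁ a′) (proj₁ b) (proj₁ b′))
              (M-+ (M-*ˡ (proj₂ a) q) (M-*ˡ (proj₂ b′) p))
        ; *-assoc = λ a b c → ≈⇒≡ᵥ (*-assoc (proj₁ a) (proj₁ b) (proj₁ c))
        ; *-identity = (λ a → ≈⇒≡ᵥ (*-identityˡ (proj₁ a))) , (λ a → ≈⇒≡ᵥ (*-identityʳ (proj₁ a)))
        ; distrib = (λ a b c → ≈⇒≡ᵥ (distribˡ (proj₁ a) (proj₁ b) (proj₁ c)))
                  , (λ a b c → ≈⇒≡ᵥ (distribʳ (proj₁ a) (proj₁ b) (proj₁ c)))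
        }
      ; *-comm = λ a b → ≈⇒≡ᵥ (*-comm (proj₁ a) (proj₁ b))
      }
    }

  private
    x-0≈x : ∀ x → x - 0# ≈ x
    x-0≈x x = trans (+-congˡ -0#≈0#) (+-identityʳ x)

    residueInverse : ∀ a → ¬ (a ≡ᵥ (0# , O-0)) →
                     Σ (Σ Carrier InValuationRing) λ b →
                       InMaximalIdeal (proj₁ a * proj₁ b - 1#)
    residueInverse (x , x∈O) x∉M with v x ≤⁺.≤? [ ε ]
    ... | no  x∈M = ⊥-elim (x∉M (M-resp (sym (x-0≈x x)) x∈M))
    ... | yes x≤0 with inverse x (λ x≈0 → M-resp (sym x≈0) M-0 x≤0)
    ...   | y , xy≈1 = (y , ≤⁺.reflexive (E.sym v-y)) , ≈⇒≡ᵥ xy≈1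
      where
      v-y : v y ≈⁺ [ ε ]
      v-y = E.trans (E.sym (⊕-identityˡ (v y)))
        (E.trans (⊕-cong (≤⁺.antisym x∈O x≤0) E.refl)
        (E.trans (E.sym (v-* x y)) (E.trans (v-cong xy≈1) v-1)))

  residueField : Field ℓ
  residueField = record
    { commutativeRing = residueRing
    ; 1≉0 = λ 1∈M → M-resp (x-0≈x 1#) 1∈M (≤⁺.reflexive v-1)
    ; inverse = residueInverse
    }

open Residue public using (residueField)

{-# OPTIONS --safe #-}

-- Let k be the residue field of E; it is algebraic over a finite field, so its algebraic
-- extensions consist of roots of unity and 0.  The point is that no algebraic extension N of k
-- has an endomorphism τ over k of prime order r, if r ≠ q or v(E) ≠ r v(E).
--
-- Suppose v(E) = r v(E) and r ≠ q.  Let b ∈ E have value v(π)/n, where n is a power of r and π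
-- is a uniformiser of K.  Since E/K is Galois, P = ∏ (X - bᵢ), taken over the conjugates of b,
-- has coefficients in K, so P(bX)/b^deg(P) reduces to a product of linear factors over k in
-- which only exponents divisible by n occur and which has the root 1.  Hence k contains every
-- n-th root of unity of N.  An eigenvector x of τ with eigenvalue χ ≠ 1, χʳ = 1, is a root of
-- unity, and x^m ∈ k for some m prime to r; thus χ^m = 1, a contradiction.
--
-- Suppose v(E) ≠ r v(E), and τ moves a root of unity y to yⁱ.  Some root of unity ζ in an
-- algebraic extension of E reduces to a root of the minimal polynomial of y.  Since v extends
-- uniquely, E(ζ)/E is unramified, and ζ ↦ ζⁱ defines an automorphism σ of E(ζ) of order r.  If π
-- now has a value outside r v(E), then the cyclic algebra (E(ζ)/E₁, σ, π) over the fixed field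
-- E₁ of σ is a division algebra, so Br(E₁) ≠ 0, contradicting dim(E) ≤ 1.
module Submission where

open import Level using (Level; Setω; _⊔_) renaming (suc to lsuc)
open import Defs
open import Algebra.Bundles using (CommutativeRing; RawRing; Ring)
import Algebra.Definitions.RawMonoid as RawMonoidDefs
import Algebra.Morphism.Construct.Composition as Composition
import Algebra.Morphism.Construct.Identity as Identity
open import Algebra.Morphism.Structures using (IsRingHomomorphism; IsRingIsomorphism; IsGroupHomomorphism; IsGroupMonomorphism; IsGroupIsomorphism)
import Algebra.Properties.AbelianGroup as AbelianGroupProperties
import Algebra.Properties.CommutativeSemiring.Exp as CommutativeExp
import Algebra.Properties.Group as GroupProperties
import Algebra.Properties.Monoid.Mult.TCOptimised as OptimisedMult
import Algebra.Properties.Ring as RingProperties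
import Algebra.Properties.Semiring.Exp as Exp
import Algebra.Properties.Semiring.Mult as Mult
import Algebra.Properties.Semiring.Sum as SemiringSum
import Algebra.Solver.Ring as RingSolver
open import Algebra.Solver.Ring.AlmostCommutativeRing using (fromCommutativeRing; _-Raw-AlmostCommutative⟶_; AlmostCommutativeRing)
open import Axiom.ExcludedMiddle using (ExcludedMiddle)
open import Data.Empty using (⊥; ⊥-elim)
open import Data.Fin.Base as Fin using (Fin; zero; suc; toℕ; fromℕ; inject₁; punchIn; combine; remQuot; _↑ˡ_; _↑ʳ_)
import Data.Fin.Properties as Fin
import Data.Fin.Relation.Unary.Top as Top
open import Data.Integer.Base as ℤ using (ℤ; +_; -[1+_])
import Data.Integer.Properties as ℤ
open import Data.List.Base using (List; []; _∷_; map; foldr; length; tabulate; applyUpTo)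
import Data.List.Properties as List
open import Data.List.Relation.Binary.Sublist.Propositional using (_⊆_; []; _∷_; _∷ʳ_)
import Data.List.Relation.Binary.Sublist.Propositional.Properties as Sublist
open import Data.List.Relation.Unary.All as All using (All; []; _∷_)
import Data.List.Relation.Unary.All.Properties as All
open import Data.List.Relation.Unary.AllPairs as AllPairs using (AllPairs; []; _∷_)
import Data.List.Relation.Unary.AllPairs.Properties as AllPairs
open import Data.List.Relation.Unary.Any as Any using (Any; here; there)
import Data.List.Relation.Unary.Any.Properties as Any
open import Data.Maybe.Base using (just; nothing) renaming (map to map⁺)
open import Data.Nat.Base as ℕ using (ℕ; zero; suc; z≤n; s≤s)
import Data.Nat.Coprimality as Coprime
open import Data.Nat.Divisibility using (_∣_)
import Data.Nat.Divisibility as ∣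
import Data.Nat.DivMod as DivMod
import Data.Nat.GCD as GCD
open import Data.Nat.ListAction using (product)
import Data.Nat.Primality as Primality
open import Data.Nat.Primality using (Prime)
open import Data.Nat.Primality.Factorisation using (PrimeFactorisation; factorise)
import Data.Nat.Properties as ℕ
open import Data.Product.Base as Product using (Σ; ∃; ∃-syntax; _×_; _,_; proj₁; proj₂)
open import Data.Sum.Base as Sum using (_⊎_; inj₁; inj₂)
import Data.Vec.Functional as Vector
import Data.Vec.Functional.Properties as Vector
open import Function.Base using (id; _∘_)
open import Function.Bundles using (Inverse; module Equivalence; mk⇔)
open import Relation.Binary.Definitions using (WeaklyDecidable; Tri; tri<; tri≈; tri>)
open import Relation.Binary.Morphism.Structures using (IsOrderMonomorphism; IsOrderIsomorphism)
open import Relation.Binary.PropositionalEquality as ≡ using (_≡_; _≢_)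
import Relation.Binary.Reasoning.Setoid as SetoidReasoning
open import Relation.Binary.Structures using (IsDecTotalOrder)
open import Relation.Nullary.Construct.Add.Supremum using (_⁺; ⊤⁺; [_])
open import Relation.Nullary.Decidable.Core using (Dec; yes; no)
open import Relation.Nullary.Negation.Core using (¬_)


-- The overview stops at endomorphisms of prime order. A nonzero element y of N is a root of unity,
-- so τ raises it to a power, with a finite period, and some iterate of τ has prime period at y
-- unless τ fixes y. If every prime is covered, y has no conjugate but itself and lies in k. If only
-- q is not covered, a Galois extension of degree a power of p ≠ q might still have an automorphism
-- of order q; then 1 would be a sum of q conjugates of some z, and the degree, which is the trace
-- of 1, would be q Tr(z) = 0 in k. The eigenvector exists because a polynomial in which only
-- exponents divisible by r occur has the same value at τ as at 1, namely 0, and because it is a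
-- product of linear factors over k. It is sought in the kernel of 1 + τ + ... + τ^(r-1), which
-- contains τ(y) - y; there the eigenvalue 1 would give r z = 0. No form of Hensel's lemma is
-- derived. Uniqueness of the extended valuation is applied directly: it makes embeddings over K
-- preserve comparisons of values.

private
  variable
    ℓ : Level

EM : Setω
EM = ∀ {a} → ExcludedMiddle a

-- The library's ring solver run with integer coefficients, so that it can cancel.
module ℤSolver {c ℓ} (R : CommutativeRing c ℓ) where
  open CommutativeRing R
  open RingProperties ring using (-0#≈0#; -‿distribˡ-*; -‿involutive)
  open AbelianGroupProperties +-abelianGroup using (⁻¹-∙-comm)
  open OptimisedMult +-monoid using (×-homo-+; 1+×) renaming (_×_ to _·_)
  open SetoidReasoning setoid

  private
    fromℤ : ℤ → Carrier
    fromℤ (+ n)    = n · 1#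
    fromℤ -[1+ n ] = - (suc n · 1#)

    fromℤ-⊖ : ∀ m n → fromℤ (m ℤ.⊖ n) ≈ m · 1# - n · 1#
    fromℤ-⊖ zero    zero    = sym (-‿inverseʳ 0#)
    fromℤ-⊖ zero    (suc n) = sym (+-identityˡ _)
    fromℤ-⊖ (suc m) zero    = sym (trans (+-congˡ -0#≈0#) (+-identityʳ _))
    fromℤ-⊖ (suc m) (suc n) = begin
      fromℤ (suc m ℤ.⊖ suc n)                  ≡⟨ ≡.cong fromℤ (ℤ.[1+m]⊖[1+n]≡m⊖n m n) ⟩
      fromℤ (m ℤ.⊖ n)                          ≈⟨ fromℤ-⊖ m n ⟩
      m · 1# - n · 1#                          ≈⟨ +-identityˡ _ ⟨
      0# + (m · 1# - n · 1#)                   ≈⟨ +-congʳ (-‿inverseʳ 1#) ⟨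
      (1# - 1#) + (m · 1# - n · 1#)            ≈⟨ +-assoc _ _ _ ⟩
      1# + (- 1# + (m · 1# - n · 1#))          ≈⟨ +-congˡ (+-assoc _ _ _) ⟨
      1# + ((- 1# + m · 1#) - n · 1#)          ≈⟨ +-congˡ (+-congʳ (+-comm _ _)) ⟩
      1# + ((m · 1# - 1#) - n · 1#)            ≈⟨ +-congˡ (+-assoc _ _ _) ⟩
      1# + (m · 1# + (- 1# - n · 1#))          ≈⟨ +-assoc _ _ _ ⟨
      (1# + m · 1#) + (- 1# - n · 1#)          ≈⟨ +-congˡ (⁻¹-∙-comm _ _) ⟩
      (1# + m · 1#) - (1# + n · 1#)            ≈⟨ +-cong (1+× m 1#) (-‿cong (1+× n 1#)) ⟨
      suc m · 1# - suc n · 1#                  ∎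

    +-homo : ∀ i j → fromℤ (i ℤ.+ j) ≈ fromℤ i + fromℤ j
    +-homo (+ m)    (+ n)    = ×-homo-+ 1# m n
    +-homo (+ m)    -[1+ n ] = fromℤ-⊖ m (suc n)
    +-homo -[1+ m ] (+ n)    = trans (fromℤ-⊖ n (suc m)) (+-comm _ _)
    +-homo -[1+ m ] -[1+ n ] = begin
      - (suc (suc (m ℕ.+ n)) · 1#)      ≡⟨ ≡.cong (λ k → - (k · 1#)) (≡.cong suc (ℕ.+-suc m n)) ⟨
      - ((suc m ℕ.+ suc n) · 1#)        ≈⟨ -‿cong (×-homo-+ 1# (suc m) (suc n)) ⟩
      - (suc m · 1# + suc n · 1#)       ≈⟨ ⁻¹-∙-comm _ _ ⟨
      - (suc m · 1#) - suc n · 1#       ∎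

    -‿homo : ∀ i → fromℤ (ℤ.- i) ≈ - fromℤ i
    -‿homo (+ zero)  = sym -0#≈0#
    -‿homo (+ suc n) = refl
    -‿homo -[1+ n ]  = sym (-‿involutive _)

    pos-homo : ∀ m j → fromℤ (+ m ℤ.* j) ≈ (m · 1#) * fromℤ j
    pos-homo zero    j = trans (reflexive (≡.cong fromℤ (ℤ.*-zeroˡ j))) (sym (zeroˡ _))
    pos-homo (suc m) j = begin
      fromℤ (+ suc m ℤ.* j)              ≡⟨ ≡.cong fromℤ (ℤ.suc-* (+ m) j) ⟩
      fromℤ (j ℤ.+ + m ℤ.* j)            ≈⟨ +-homo j (+ m ℤ.* j) ⟩
      fromℤ j + fromℤ (+ m ℤ.* j)        ≈⟨ +-cong (sym (*-identityˡ _)) (pos-homo m j) ⟩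
      1# * fromℤ j + (m · 1#) * fromℤ j  ≈⟨ distribʳ _ _ _ ⟨
      (1# + m · 1#) * fromℤ j            ≈⟨ *-congʳ (1+× m 1#) ⟨
      (suc m · 1#) * fromℤ j             ∎

    *-homo : ∀ i j → fromℤ (i ℤ.* j) ≈ fromℤ i * fromℤ j
    *-homo (+ m)    j = pos-homo m j
    *-homo -[1+ m ] j = begin
      fromℤ (-[1+ m ] ℤ.* j)         ≡⟨ ≡.cong fromℤ (ℤ.neg-distribˡ-* (+ suc m) j) ⟨
      fromℤ (ℤ.- (+ suc m ℤ.* j))    ≈⟨ -‿homo (+ suc m ℤ.* j) ⟩
      - fromℤ (+ suc m ℤ.* j)        ≈⟨ -‿cong (pos-homo (suc m) j) ⟩
      - ((suc m · 1#) * fromℤ j)     ≈⟨ -‿distribˡ-* _ _ ⟩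
      - (suc m · 1#) * fromℤ j       ∎

    almost : AlmostCommutativeRing c ℓ
    almost = fromCommutativeRing R

    morphism : ℤ.+-*-rawRing -Raw-AlmostCommutative⟶ almost
    morphism = record
      { ⟦_⟧    = fromℤ
      ; +-homo = +-homo
      ; *-homo = *-homo
      ; -‿homo = -‿homo
      ; 0-homo = refl
      ; 1-homo = refl
      }

    coeff≟ : WeaklyDecidable (λ i j → fromℤ i ≈ fromℤ j)
    coeff≟ i j with i ℤ.≟ j
    ... | yes i≡j = just (reflexive (≡.cong fromℤ i≡j))
    ... | no _    = nothing

  open RingSolver ℤ.+-*-rawRing almost morphism coeff≟ public
    using (solve; _:=_; _:+_; _:*_; _:-_; :-_; con; var)


-- Solved over an abstract ring and instantiated at polynomial rings, so that the solver treats
-- polynomials as atoms instead of unfolding their operations.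
module RingIdentities {c ℓ} (R : CommutativeRing c ℓ) where
  open CommutativeRing R
  open ℤSolver R

  [x-y]z≈xz-yz : ∀ x y z → (x - y) * z ≈ x * z - y * z
  [x-y]z≈xz-yz = solve 3 (λ x y z → (x :- y) :* z := x :* z :- y :* z) refl

  x≈[x-y]+y : ∀ x y → x ≈ (x - y) + y
  x≈[x-y]+y = solve 2 (λ x y → x := (x :- y) :+ y) refl

  x+y≈[z+x]+[y-z] : ∀ x y z → x + y ≈ (z + x) + (y - z)
  x+y≈[z+x]+[y-z] = solve 3 (λ x y z → x :+ y := (z :+ x) :+ (y :- z)) refl

  [xy]z≈[xz]y : ∀ x y z → (x * y) * z ≈ (x * z) * y
  [xy]z≈[xz]y = solve 3 (λ x y z → (x :* y) :* z := (x :* z) :* y) refl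

  [x+y]-1x≈y : ∀ x y → (x + y) + (- 1#) * x ≈ y
  [x+y]-1x≈y = solve 2 (λ x y → (x :+ y) :+ (:- con (+ 1)) :* x := y) refl

  linear-+ : ∀ a a′ b b′ x y → (a + a′) * x + (b + b′) * y ≈ (a * x + b * y) + (a′ * x + b′ * y)
  linear-+ = solve 6 (λ a a′ b b′ x y → (a :+ a′) :* x :+ (b :+ b′) :* y := (a :* x :+ b :* y) :+ (a′ :* x :+ b′ :* y)) refl

  linear-* : ∀ c a b x y → (c * a) * x + (c * b) * y ≈ c * (a * x + b * y)
  linear-* = solve 5 (λ c a b x y → (c :* a) :* x :+ (c :* b) :* y := c :* (a :* x :+ b :* y)) refl

  bezout : ∀ a b x y → - b * y ≈ x * a - (a * x + b * y)
  bezout = solve 4 (λ a b x y → (:- b) :* y := x :* a :- (a :* x :+ b :* y)) refl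

  remainder : ∀ q g r → - q * g ≈ r - (q * g + r)
  remainder = solve 3 (λ q g r → (:- q) :* g := r :- (q :* g :+ r)) refl

-- Fields

module FieldProperties (F : Field ℓ) where
  open Field F
  open ℤSolver commutativeRing public
  open Exp semiring public using (_^_; ^-congˡ; ^-congʳ; ^-homo-*; ^-assocʳ)
  open CommutativeExp commutativeSemiring public using (^-distrib-*)
  open RingProperties ring public using (-0#≈0#; -‿involutive)
  open SetoidReasoning setoid

  x-y≈0⇒x≈y : ∀ {x y} → x - y ≈ 0# → x ≈ y
  x-y≈0⇒x≈y {x} {y} p = begin
    x           ≈⟨ solve 2 (λ x y → x := (x :- y) :+ y) refl x y ⟩
    (x - y) + y ≈⟨ +-congʳ p ⟩
    0# + y      ≈⟨ +-identityˡ y ⟩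
    y           ∎

  x≈y⇒x-y≈0 : ∀ {x y} → x ≈ y → x - y ≈ 0#
  x≈y⇒x-y≈0 {x} {y} p = trans (+-congʳ p) (-‿inverseʳ y)

  *-cancel-0 : ∀ {x y} → ¬ (x ≈ 0#) → x * y ≈ 0# → y ≈ 0#
  *-cancel-0 {x} {y} x≉0 xy≈0 with inverse x x≉0
  ... | z , xz≈1 = begin
    y           ≈⟨ *-identityˡ y ⟨
    1# * y      ≈⟨ *-congʳ xz≈1 ⟨
    x * z * y   ≈⟨ solve 3 (λ x y z → x :* z :* y := z :* (x :* y)) refl x y z ⟩
    z * (x * y) ≈⟨ *-congˡ xy≈0 ⟩
    z * 0#      ≈⟨ zeroʳ z ⟩
    0#          ∎

  *-cancelˡ : ∀ {x y z} → ¬ (x ≈ 0#) → x * y ≈ x * z → y ≈ z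
  *-cancelˡ {x} {y} {z} x≉0 p = x-y≈0⇒x≈y (*-cancel-0 x≉0 (begin
    x * (y - z)     ≈⟨ solve 3 (λ x y z → x :* (y :- z) := x :* y :- x :* z) refl x y z ⟩
    x * y - x * z   ≈⟨ x≈y⇒x-y≈0 p ⟩
    0#              ∎))

  *-nonzero : ∀ {x y} → ¬ (x ≈ 0#) → ¬ (y ≈ 0#) → ¬ (x * y ≈ 0#)
  *-nonzero x≉0 y≉0 p = y≉0 (*-cancel-0 x≉0 p)

  ^-nonzero : ∀ {x} n → ¬ (x ≈ 0#) → ¬ (x ^ n ≈ 0#)
  ^-nonzero zero    x≉0 = 1≉0
  ^-nonzero (suc n) x≉0 = *-nonzero x≉0 (^-nonzero n x≉0)

  1^n≈1 : ∀ n → 1# ^ n ≈ 1#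
  1^n≈1 zero    = refl
  1^n≈1 (suc n) = trans (*-identityˡ _) (1^n≈1 n)

  inverse-nonzero : ∀ {x y} → x * y ≈ 1# → ¬ (y ≈ 0#)
  inverse-nonzero {x} p y≈0 = 1≉0 (trans (sym p) (trans (*-congˡ y≈0) (zeroʳ x)))

  -- x / 0# = 0#
  module Division (em : EM) where
    infixl 7 _/_
    _/_ : Carrier → Carrier → Carrier
    x / y with em {P = y ≈ 0#}
    ... | yes _  = 0#
    ... | no y≉0 = x * proj₁ (inverse y y≉0)

    y*x/y≈x : ∀ {x y} → ¬ (y ≈ 0#) → y * (x / y) ≈ x
    y*x/y≈x {x} {y} y≉0 with em {P = y ≈ 0#}
    ... | yes y≈0 = ⊥-elim (y≉0 y≈0)
    ... | no y≉0′ with inverse y y≉0′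
    ...   | z , yz≈1 = begin
      y * (x * z) ≈⟨ solve 3 (λ x y z → y :* (x :* z) := x :* (y :* z)) refl x y z ⟩
      x * (y * z) ≈⟨ *-congˡ yz≈1 ⟩
      x * 1#      ≈⟨ *-identityʳ x ⟩
      x           ∎

module Homomorphism {F G : Field ℓ} {φ : Field.Carrier F → Field.Carrier G}
                    (hom : IsRingHomomorphism (Field.rawRing F) (Field.rawRing G) φ) where
  private
    module F = Field F
    module G = Field G
    module FP = FieldProperties F
    module GP = FieldProperties G
  open IsRingHomomorphism hom public using (+-homo; *-homo; 0#-homo; 1#-homo; -‿homo) renaming (⟦⟧-cong to φ-cong)

  minus-homo : ∀ x y → φ (x F.- y) G.≈ φ x G.- φ y
  minus-homo x y = G.trans (+-homo x (F.- y)) (G.+-congˡ (-‿homo y))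

  ^-homo : ∀ x n → φ (x FP.^ n) G.≈ φ x GP.^ n
  ^-homo x zero    = 1#-homo
  ^-homo x (suc n) = G.trans (*-homo x (x FP.^ n)) (G.*-congˡ (^-homo x n))

  φ-nonzero : ∀ {x} → ¬ (x F.≈ F.0#) → ¬ (φ x G.≈ G.0#)
  φ-nonzero {x} x≉0 φx≈0 with F.inverse x x≉0
  ... | y , xy≈1 = G.1≉0 (G.trans (G.sym 1#-homo) (G.trans (φ-cong (F.sym xy≈1))
    (G.trans (*-homo x y) (G.trans (G.*-congʳ φx≈0) (G.zeroˡ _)))))

  φ-injective : EM → ∀ {x y} → φ x G.≈ φ y → x F.≈ y
  φ-injective em {x} {y} p with em {P = x F.- y F.≈ F.0#}
  ... | yes q = FP.x-y≈0⇒x≈y q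
  ... | no ¬q = ⊥-elim (φ-nonzero ¬q (G.trans (minus-homo x y) (GP.x≈y⇒x-y≈0 p)))

-- Polynomials

module PolynomialRing (F : Field ℓ) where
  open Field F
  open FieldProperties F
  open Polynomial F public
  open SetoidReasoning setoid

  -- _≈ₚ_ as a record, from which the two polynomials can be inferred
  infix 4 _≋_
  record _≋_ (p q : Poly) : Set ℓ where
    constructor mk
    field at : p ≈ₚ q
  open _≋_ public

  ≋-refl : ∀ {p} → p ≋ p
  ≋-refl = mk λ _ → refl

  ≋-sym : ∀ {p q} → p ≋ q → q ≋ p
  ≋-sym e = mk λ n → sym (at e n)

  ≋-trans : ∀ {p q r} → p ≋ q → q ≋ r → p ≋ r
  ≋-trans e f = mk λ n → trans (at e n) (at f n)

  infixr 7 _•_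
  _•_ : Carrier → Poly → Poly
  a • p = map (a *_) p

  -ₚ_ : Poly → Poly
  -ₚ p = map -_ p

  coeff-+ : ∀ p q n → coeff (p +ₚ q) n ≈ coeff p n + coeff q n
  coeff-+ []      q       n       = sym (+-identityˡ _)
  coeff-+ (a ∷ p) []      n       = sym (+-identityʳ _)
  coeff-+ (a ∷ p) (b ∷ q) zero    = refl
  coeff-+ (a ∷ p) (b ∷ q) (suc n) = coeff-+ p q n

  coeff-• : ∀ a p n → coeff (a • p) n ≈ a * coeff p n
  coeff-• a []      n       = sym (zeroʳ a)
  coeff-• a (b ∷ p) zero    = refl
  coeff-• a (b ∷ p) (suc n) = coeff-• a p n

  coeff-neg : ∀ p n → coeff (-ₚ p) n ≈ - coeff p n
  coeff-neg []      n       = sym -0#≈0#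
  coeff-neg (b ∷ p) zero    = refl
  coeff-neg (b ∷ p) (suc n) = coeff-neg p n

  ∷-cong : ∀ {a b p q} → a ≈ b → p ≋ q → a ∷ p ≋ b ∷ q
  ∷-cong a≈b e = mk λ { zero → a≈b ; (suc n) → at e n }

  0∷[]≋[] : 0# ∷ [] ≋ []
  0∷[]≋[] = mk λ { zero → refl ; (suc n) → refl }

  +ₚ-cong : ∀ {p p′ q q′} → p ≋ p′ → q ≋ q′ → p +ₚ q ≋ p′ +ₚ q′
  +ₚ-cong {p} {p′} {q} {q′} e f = mk λ n →
    trans (coeff-+ p q n) (trans (+-cong (at e n) (at f n)) (sym (coeff-+ p′ q′ n)))

  •-cong : ∀ {a b p q} → a ≈ b → p ≋ q → a • p ≋ b • q
  •-cong {a} {b} {p} {q} a≈b e = mk λ n →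
    trans (coeff-• a p n) (trans (*-cong a≈b (at e n)) (sym (coeff-• b q n)))

  coeff-suc-* : ∀ a p q n → coeff ((a ∷ p) *ₚ q) (suc n) ≈ a * coeff q (suc n) + coeff (p *ₚ q) n
  coeff-suc-* a p q n = trans (coeff-+ (a • q) (0# ∷ p *ₚ q) (suc n)) (+-congʳ (coeff-• a q (suc n)))

  +ₚ-assoc : ∀ p q r → (p +ₚ q) +ₚ r ≋ p +ₚ (q +ₚ r)
  +ₚ-assoc p q r = mk λ n → begin
    coeff ((p +ₚ q) +ₚ r) n             ≈⟨ coeff-+ (p +ₚ q) r n ⟩
    coeff (p +ₚ q) n + coeff r n        ≈⟨ +-congʳ (coeff-+ p q n) ⟩
    coeff p n + coeff q n + coeff r n   ≈⟨ +-assoc _ _ _ ⟩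
    coeff p n + (coeff q n + coeff r n) ≈⟨ +-congˡ (coeff-+ q r n) ⟨
    coeff p n + coeff (q +ₚ r) n        ≈⟨ coeff-+ p (q +ₚ r) n ⟨
    coeff (p +ₚ (q +ₚ r)) n             ∎

  +ₚ-comm : ∀ p q → p +ₚ q ≋ q +ₚ p
  +ₚ-comm p q = mk λ n → trans (coeff-+ p q n) (trans (+-comm _ _) (sym (coeff-+ q p n)))

  +ₚ-identityʳ : ∀ p → p +ₚ [] ≋ p
  +ₚ-identityʳ p = mk λ n → trans (coeff-+ p [] n) (+-identityʳ _)

  -ₚ-inverseʳ : ∀ p → p +ₚ (-ₚ p) ≋ []
  -ₚ-inverseʳ p = mk λ n → trans (coeff-+ p (-ₚ p) n) (trans (+-congˡ (coeff-neg p n)) (-‿inverseʳ _))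

  0•p≋[] : ∀ p → 0# • p ≋ []
  0•p≋[] p = mk λ n → trans (coeff-• 0# p n) (zeroˡ _)

  1•p≋p : ∀ p → 1# • p ≋ p
  1•p≋p p = mk λ n → trans (coeff-• 1# p n) (*-identityˡ _)

  •-distrib-+ : ∀ a p q → a • (p +ₚ q) ≋ (a • p) +ₚ (a • q)
  •-distrib-+ a p q = mk λ n → begin
    coeff (a • (p +ₚ q)) n              ≈⟨ coeff-• a (p +ₚ q) n ⟩
    a * coeff (p +ₚ q) n                ≈⟨ *-congˡ (coeff-+ p q n) ⟩
    a * (coeff p n + coeff q n)         ≈⟨ distribˡ _ _ _ ⟩
    a * coeff p n + a * coeff q n       ≈⟨ +-cong (coeff-• a p n) (coeff-• a q n) ⟨
    coeff (a • p) n + coeff (a • q) n   ≈⟨ coeff-+ (a • p) (a • q) n ⟨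
    coeff ((a • p) +ₚ (a • q)) n        ∎

  •-assoc : ∀ a b p → a • b • p ≋ (a * b) • p
  •-assoc a b p = mk λ n → begin
    coeff (a • b • p) n    ≈⟨ coeff-• a (b • p) n ⟩
    a * coeff (b • p) n    ≈⟨ *-congˡ (coeff-• b p n) ⟩
    a * (b * coeff p n)    ≈⟨ *-assoc _ _ _ ⟨
    a * b * coeff p n      ≈⟨ coeff-• (a * b) p n ⟨
    coeff ((a * b) • p) n  ∎

  private
    0∷-+ : ∀ p q → 0# ∷ (p +ₚ q) ≋ (0# ∷ p) +ₚ (0# ∷ q)
    0∷-+ p q = ∷-cong (sym (+-identityˡ 0#)) ≋-refl

    +ₚ-interchange : ∀ p q r s → (p +ₚ q) +ₚ (r +ₚ s) ≋ (p +ₚ r) +ₚ (q +ₚ s)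
    +ₚ-interchange p q r s = mk λ n → begin
      coeff ((p +ₚ q) +ₚ (r +ₚ s)) n   ≈⟨ expand p q r s n ⟩
      (coeff p n + coeff q n) + (coeff r n + coeff s n)
        ≈⟨ solve 4 (λ p q r s → (p :+ q) :+ (r :+ s) := (p :+ r) :+ (q :+ s)) refl _ _ _ _ ⟩
      (coeff p n + coeff r n) + (coeff q n + coeff s n) ≈⟨ expand p r q s n ⟨
      coeff ((p +ₚ r) +ₚ (q +ₚ s)) n   ∎
      where
      expand : ∀ p q r s n → coeff ((p +ₚ q) +ₚ (r +ₚ s)) n ≈ (coeff p n + coeff q n) + (coeff r n + coeff s n)
      expand p q r s n = trans (coeff-+ (p +ₚ q) (r +ₚ s) n) (+-cong (coeff-+ p q n) (coeff-+ r s n))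

  *ₚ-zeroʳ : ∀ p → p *ₚ [] ≋ []
  *ₚ-zeroʳ []      = ≋-refl
  *ₚ-zeroʳ (a ∷ p) = ≋-trans (∷-cong refl (*ₚ-zeroʳ p)) 0∷[]≋[]

  *ₚ-congʳ : ∀ p {q r} → q ≋ r → p *ₚ q ≋ p *ₚ r
  *ₚ-congʳ []      e = ≋-refl
  *ₚ-congʳ (a ∷ p) e = +ₚ-cong (•-cong refl e) (∷-cong refl (*ₚ-congʳ p e))

  *ₚ-distribˡ : ∀ p q r → p *ₚ (q +ₚ r) ≋ (p *ₚ q) +ₚ (p *ₚ r)
  *ₚ-distribˡ []      q r = ≋-refl
  *ₚ-distribˡ (a ∷ p) q r = ≋-trans
    (+ₚ-cong (•-distrib-+ a q r) (≋-trans (∷-cong refl (*ₚ-distribˡ p q r)) (0∷-+ (p *ₚ q) (p *ₚ r))))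
    (+ₚ-interchange (a • q) (a • r) (0# ∷ p *ₚ q) (0# ∷ p *ₚ r))

  -- The product recurses on its left factor; this is the mirror recursion, which makes
  -- commutativity an immediate induction.
  *ₚ-∷ʳ : ∀ p b q → p *ₚ (b ∷ q) ≋ (b • p) +ₚ (0# ∷ p *ₚ q)
  *ₚ-∷ʳ []      b q = ≋-sym 0∷[]≋[]
  *ₚ-∷ʳ (a ∷ p) b q = ∷-cong (+-congʳ (*-comm a b)) (≋-trans
    (+ₚ-cong ≋-refl (*ₚ-∷ʳ p b q))
    (≋-trans (≋-sym (+ₚ-assoc (a • q) (b • p) (0# ∷ p *ₚ q)))
    (≋-trans (+ₚ-cong (+ₚ-comm (a • q) (b • p)) ≋-refl)
             (+ₚ-assoc (b • p) (a • q) (0# ∷ p *ₚ q)))))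

  *ₚ-comm : ∀ p q → p *ₚ q ≋ q *ₚ p
  *ₚ-comm []      q = ≋-sym (*ₚ-zeroʳ q)
  *ₚ-comm (a ∷ p) q = ≋-trans (+ₚ-cong ≋-refl (∷-cong refl (*ₚ-comm p q))) (≋-sym (*ₚ-∷ʳ q a p))

  *ₚ-cong : ∀ {p p′ q q′} → p ≋ p′ → q ≋ q′ → p *ₚ q ≋ p′ *ₚ q′
  *ₚ-cong {p} {p′} {q} {q′} e f = ≋-trans (*ₚ-congʳ p f)
    (≋-trans (*ₚ-comm p q′) (≋-trans (*ₚ-congʳ q′ e) (*ₚ-comm q′ p′)))

  *ₚ-distribʳ : ∀ r p q → (p +ₚ q) *ₚ r ≋ (p *ₚ r) +ₚ (q *ₚ r)
  *ₚ-distribʳ r p q = ≋-trans (*ₚ-comm (p +ₚ q) r)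
    (≋-trans (*ₚ-distribˡ r p q) (+ₚ-cong (*ₚ-comm r p) (*ₚ-comm r q)))

  •-*ₚ : ∀ a p q → (a • p) *ₚ q ≋ a • (p *ₚ q)
  •-*ₚ a []      q = ≋-refl
  •-*ₚ a (b ∷ p) q = ≋-trans
    (+ₚ-cong (≋-sym (•-assoc a b q)) (∷-cong (sym (zeroʳ a)) (•-*ₚ a p q)))
    (≋-sym (•-distrib-+ a (b • q) (0# ∷ p *ₚ q)))

  0∷-*ₚ : ∀ p q → (0# ∷ p) *ₚ q ≋ 0# ∷ (p *ₚ q)
  0∷-*ₚ p q = +ₚ-cong {q = 0# ∷ p *ₚ q} (0•p≋[] q) ≋-refl

  *ₚ-assoc : ∀ p q r → (p *ₚ q) *ₚ r ≋ p *ₚ (q *ₚ r)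
  *ₚ-assoc []      q r = ≋-refl
  *ₚ-assoc (a ∷ p) q r = ≋-trans (*ₚ-distribʳ r (a • q) (0# ∷ p *ₚ q))
    (+ₚ-cong (•-*ₚ a q r) (≋-trans (0∷-*ₚ (p *ₚ q) r) (∷-cong refl (*ₚ-assoc p q r))))

  1ₚ : Poly
  1ₚ = 1# ∷ []

  *ₚ-identityˡ : ∀ p → 1ₚ *ₚ p ≋ p
  *ₚ-identityˡ p = ≋-trans (+ₚ-cong (1•p≋p p) 0∷[]≋[]) (+ₚ-identityʳ p)

  polynomialRing : CommutativeRing ℓ ℓ
  polynomialRing = record
    { Carrier = Poly
    ; _≈_ = _≋_
    ; _+_ = _+ₚ_
    ; _*_ = _*ₚ_
    ; -_ = -ₚ_
    ; 0# = []
    ; 1# = 1ₚ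
    ; isCommutativeRing = record
      { isRing = record
        { +-isAbelianGroup = record
          { isGroup = record
            { isMonoid = record
              { isSemigroup = record
                { isMagma = record
                  { isEquivalence = record { refl = ≋-refl ; sym = ≋-sym ; trans = ≋-trans }
                  ; ∙-cong = +ₚ-cong
                  }
                ; assoc = +ₚ-assoc
                }
              ; identity = (λ p → ≋-refl) , +ₚ-identityʳ
              }
            ; inverse = (λ p → ≋-trans (+ₚ-comm (-ₚ p) p) (-ₚ-inverseʳ p)) , -ₚ-inverseʳ
            ; ⁻¹-cong = λ {p} {q} e → mk λ n → trans (coeff-neg p n) (trans (-‿cong (at e n)) (sym (coeff-neg q n)))
            }
          ; comm = +ₚ-comm
          }
        ; *-cong = *ₚ-cong
        ; *-assoc = *ₚ-assoc
        ; *-identity = *ₚ-identityˡ , (λ p → ≋-trans (*ₚ-comm p 1ₚ) (*ₚ-identityˡ p))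
        ; distrib = *ₚ-distribˡ , *ₚ-distribʳ
        }
      ; *-comm = *ₚ-comm
      }
    }

  infixr 5 _⊚_
  -- Substitution p(q(X)) by Horner's scheme. In a simple extension both inverses and the
  -- endomorphism x ↦ xⁱ are obtained by it.
  _⊚_ : Poly → Poly → Poly
  []      ⊚ q = []
  (a ∷ p) ⊚ q = (a ∷ []) +ₚ (q *ₚ (p ⊚ q))

  eval-zero : ∀ p x → p ≋ [] → eval p x ≈ 0#
  eval-zero []      x e = refl
  eval-zero (a ∷ p) x e = begin
    a + x * eval p x  ≈⟨ +-cong (at e 0) (*-congˡ (eval-zero p x (mk λ n → at e (suc n)))) ⟩
    0# + x * 0#       ≈⟨ trans (+-identityˡ _) (zeroʳ x) ⟩
    0#                ∎

  eval-cong : ∀ {p q x y} → p ≋ q → x ≈ y → eval p x ≈ eval q y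
  eval-cong {[]}    {q}     {x} {y} e x≈y = sym (eval-zero q y (≋-sym e))
  eval-cong {a ∷ p} {[]}    {x} {y} e x≈y = eval-zero (a ∷ p) x e
  eval-cong {a ∷ p} {b ∷ q} {x} {y} e x≈y =
    +-cong (at e 0) (*-cong x≈y (eval-cong {p} {q} (mk λ n → at e (suc n)) x≈y))

  eval-+ : ∀ p q x → eval (p +ₚ q) x ≈ eval p x + eval q x
  eval-+ []      q       x = sym (+-identityˡ _)
  eval-+ (a ∷ p) []      x = sym (+-identityʳ _)
  eval-+ (a ∷ p) (b ∷ q) x = begin
    a + b + x * eval (p +ₚ q) x            ≈⟨ +-congˡ (*-congˡ (eval-+ p q x)) ⟩
    a + b + x * (eval p x + eval q x)      ≈⟨ solve 5 (λ a b x p q → a :+ b :+ x :* (p :+ q) := (a :+ x :* p) :+ (b :+ x :* q)) refl _ _ _ _ _ ⟩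
    (a + x * eval p x) + (b + x * eval q x) ∎

  eval-• : ∀ a p x → eval (a • p) x ≈ a * eval p x
  eval-• a []      x = sym (zeroʳ a)
  eval-• a (b ∷ p) x = begin
    a * b + x * eval (a • p) x  ≈⟨ +-congˡ (*-congˡ (eval-• a p x)) ⟩
    a * b + x * (a * eval p x)  ≈⟨ solve 4 (λ a b x p → a :* b :+ x :* (a :* p) := a :* (b :+ x :* p)) refl _ _ _ _ ⟩
    a * (b + x * eval p x)      ∎

  eval-* : ∀ p q x → eval (p *ₚ q) x ≈ eval p x * eval q x
  eval-* []      q x = sym (zeroˡ _)
  eval-* (a ∷ p) q x = begin
    eval ((a • q) +ₚ (0# ∷ p *ₚ q)) x                  ≈⟨ eval-+ (a • q) (0# ∷ p *ₚ q) x ⟩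
    eval (a • q) x + (0# + x * eval (p *ₚ q) x)        ≈⟨ +-cong (eval-• a q x) (+-congˡ (*-congˡ (eval-* p q x))) ⟩
    a * eval q x + (0# + x * (eval p x * eval q x))
      ≈⟨ solve 4 (λ a x p q → a :* q :+ (con (+ 0) :+ x :* (p :* q)) := (a :+ x :* p) :* q) refl _ _ _ _ ⟩
    (a + x * eval p x) * eval q x                      ∎

  eval-neg : ∀ p x → eval (-ₚ p) x ≈ - eval p x
  eval-neg []      x = sym -0#≈0#
  eval-neg (a ∷ p) x = begin
    - a + x * eval (-ₚ p) x ≈⟨ +-congˡ (*-congˡ (eval-neg p x)) ⟩
    - a + x * - eval p x    ≈⟨ solve 3 (λ a x p → :- a :+ x :* (:- p) := :- (a :+ x :* p)) refl _ _ _ ⟩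
    - (a + x * eval p x)    ∎

  eval-1 : ∀ x → eval 1ₚ x ≈ 1#
  eval-1 x = trans (+-congˡ (zeroʳ x)) (+-identityʳ 1#)

  infix 8 X^_
  X^_ : ℕ → Poly
  X^ zero  = 1ₚ
  X^ suc n = 0# ∷ X^ n

  eval-X^ : ∀ n x → eval (X^ n) x ≈ x ^ n
  eval-X^ zero    x = eval-1 x
  eval-X^ (suc n) x = trans (+-identityˡ _) (*-congˡ (eval-X^ n x))

  X-_ : Carrier → Poly
  X- a = - a ∷ 1# ∷ []

  eval-X- : ∀ a x → eval (X- a) x ≈ x - a
  eval-X- a x = solve 2 (λ a x → (:- a) :+ x :* (con (+ 1) :+ x :* con (+ 0)) := x :- a) refl a x

module _ {F G : Field ℓ} {φ : Field.Carrier F → Field.Carrier G}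
         (hom : IsRingHomomorphism (Field.rawRing F) (Field.rawRing G) φ) where
  private
    module F = Field F
    module G = Field G
    module F[X] = PolynomialRing F
    module G[X] = PolynomialRing G
  open Homomorphism {F = F} {G = G} hom
  open G[X] using (_≋_; mk; at)

  coeff-map : ∀ p n → G[X].coeff (map φ p) n G.≈ φ (F[X].coeff p n)
  coeff-map []      n       = G.sym 0#-homo
  coeff-map (a ∷ p) zero    = G.refl
  coeff-map (a ∷ p) (suc n) = coeff-map p n

  map-cong-≋ : ∀ {p q} → p F[X].≋ q → map φ p ≋ map φ q
  map-cong-≋ {p} {q} e = mk λ n → G.trans (coeff-map p n) (G.trans (φ-cong (F[X].at e n)) (G.sym (coeff-map q n)))

  map-+ₚ : ∀ p q → map φ (p F[X].+ₚ q) ≋ map φ p G[X].+ₚ map φ q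
  map-+ₚ p q = mk λ n → G.trans (coeff-map (p F[X].+ₚ q) n) (G.trans (φ-cong (F[X].coeff-+ p q n))
    (G.trans (+-homo _ _) (G.trans (G.+-cong (G.sym (coeff-map p n)) (G.sym (coeff-map q n)))
      (G.sym (G[X].coeff-+ (map φ p) (map φ q) n)))))

  map-• : ∀ a p → map φ (a F[X].• p) ≋ φ a G[X].• map φ p
  map-• a p = mk λ n → G.trans (coeff-map (a F[X].• p) n) (G.trans (φ-cong (F[X].coeff-• a p n))
    (G.trans (*-homo _ _) (G.trans (G.*-congˡ (G.sym (coeff-map p n))) (G.sym (G[X].coeff-• (φ a) (map φ p) n)))))

  map-*ₚ : ∀ p q → map φ (p F[X].*ₚ q) ≋ map φ p G[X].*ₚ map φ q
  map-*ₚ []      q = G[X].≋-refl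
  map-*ₚ (a ∷ p) q = G[X].≋-trans (map-+ₚ (a F[X].• q) (F.0# ∷ p F[X].*ₚ q))
    (G[X].+ₚ-cong (map-• a q) (G[X].∷-cong 0#-homo (map-*ₚ p q)))

  eval-map : ∀ p x → G[X].eval (map φ p) (φ x) G.≈ φ (F[X].eval p x)
  eval-map []      x = G.sym 0#-homo
  eval-map (a ∷ p) x = G.sym (G.trans (+-homo _ _) (G.+-congˡ (G.trans (*-homo _ _) (G.*-congˡ (G.sym (eval-map p x))))))

-- Degrees and division

module Degree (F : Field ℓ) where
  open Field F
  open FieldProperties F
  open PolynomialRing F
  open SetoidReasoning setoid
  private module P = RingIdentities polynomialRing

  -- A degree bound instead of a degree: trailing zeros are allowed, so the degree cannot be read
  -- off from the list. The bound is strict, so that 0 characterises the zero polynomial.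
  record Below (n : ℕ) (p : Poly) : Set ℓ where
    constructor below
    field vanish : ∀ m → n ℕ.≤ m → coeff p m ≈ 0#
  open Below public

  record Monic (n : ℕ) (p : Poly) : Set ℓ where
    constructor monic
    field
      leading : coeff p n ≈ 1#
      bounded : Below (suc n) p
  open Monic public

  infix 4 _divides_
  _divides_ : Poly → Poly → Set ℓ
  g divides p = ∃[ r ] r *ₚ g ≋ p

  below-length : ∀ p → Below (length p) p
  below-length []      = below λ _ _ → refl
  below-length (a ∷ p) = below λ { (suc m) (s≤s l≤m) → vanish (below-length p) m l≤m }

  below-cong : ∀ {n p q} → p ≋ q → Below n p → Below n q
  below-cong e b = below λ m n≤m → trans (sym (at e m)) (vanish b m n≤m)

  below-mono : ∀ {m n p} → m ℕ.≤ n → Below m p → Below n p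
  below-mono m≤n b = below λ k n≤k → vanish b k (ℕ.≤-trans m≤n n≤k)

  below-+ : ∀ {n p q} → Below n p → Below n q → Below n (p +ₚ q)
  below-+ {n} {p} {q} b c = below λ m n≤m →
    trans (coeff-+ p q m) (trans (+-cong (vanish b m n≤m) (vanish c m n≤m)) (+-identityˡ 0#))

  below-neg : ∀ {n p} → Below n p → Below n (-ₚ p)
  below-neg {n} {p} b = below λ m n≤m → trans (coeff-neg p m) (trans (-‿cong (vanish b m n≤m)) -0#≈0#)

  below-• : ∀ a {n p} → Below n p → Below n (a • p)
  below-• a {n} {p} b = below λ m n≤m → trans (coeff-• a p m) (trans (*-congˡ (vanish b m n≤m)) (zeroʳ a))

  below-∷ : ∀ a {n p} → Below n p → Below (suc n) (a ∷ p)
  below-∷ a b = below λ { (suc m) (s≤s n≤m) → vanish b m n≤m }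

  below-tail : ∀ {a n p} → Below (suc n) (a ∷ p) → Below n p
  below-tail b = below λ m n≤m → vanish b (suc m) (s≤s n≤m)

  below-pred : ∀ {n p} → Below (suc n) p → coeff p n ≈ 0# → Below n p
  below-pred {n} {p} b p≈0 = below go
    where
    go : ∀ m → n ℕ.≤ m → coeff p m ≈ 0#
    go m n≤m with ℕ.m≤n⇒m<n∨m≡n n≤m
    ... | inj₁ n<m    = vanish b m n<m
    ... | inj₂ ≡.refl = p≈0

  below-0 : ∀ {p} → Below 0 p → p ≋ []
  below-0 b = mk λ n → vanish b n z≤n

  []-below : ∀ {n p} → p ≋ [] → Below n p
  []-below e = below λ m _ → at e m

  -- One strict and one weak bound, deg p < m and deg q ≤ n, make the sum of the bounds a strict one
  -- without any subtraction.
  below-* : ∀ {m n p q} → Below m p → Below (suc n) q → Below (m ℕ.+ n) (p *ₚ q)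
  below-* {m}     {n} {[]}    {q} b c = []-below ≋-refl
  below-* {zero}  {n} {a ∷ p} {q} b c = []-below (*ₚ-cong (below-0 b) (≋-refl {q}))
  below-* {suc m} {n} {a ∷ p} {q} b c = below λ { (suc k) (s≤s m+n≤k) → begin
    coeff ((a ∷ p) *ₚ q) (suc k)            ≈⟨ coeff-suc-* a p q k ⟩
    a * coeff q (suc k) + coeff (p *ₚ q) k  ≈⟨ +-cong (*-congˡ (vanish c (suc k) (s≤s (ℕ.m+n≤o⇒n≤o m m+n≤k))))
                                                      (vanish (below-* {m} {n} {p} {q} (below-tail b) c) k m+n≤k) ⟩
    a * 0# + 0#                             ≈⟨ trans (+-identityʳ _) (zeroʳ a) ⟩
    0#                                      ∎ }

  top-coeff-* : ∀ {m n p q} → Below (suc m) p → Below (suc n) q →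
                coeff (p *ₚ q) (m ℕ.+ n) ≈ coeff p m * coeff q n
  top-coeff-* {m}     {n} {[]}    {q} b c = sym (zeroˡ _)
  top-coeff-* {zero}  {n} {a ∷ p} {q} b c = begin
    coeff ((a • q) +ₚ (0# ∷ p *ₚ q)) n        ≈⟨ coeff-+ (a • q) (0# ∷ p *ₚ q) n ⟩
    coeff (a • q) n + coeff (0# ∷ p *ₚ q) n   ≈⟨ +-cong (coeff-• a q n)
                                                   (at (≋-trans (∷-cong refl (*ₚ-cong (below-0 (below-tail b)) (≋-refl {q}))) 0∷[]≋[]) n) ⟩
    a * coeff q n + 0#                        ≈⟨ +-identityʳ _ ⟩
    a * coeff q n                             ∎
  top-coeff-* {suc m} {n} {a ∷ p} {q} b c = begin
    coeff ((a ∷ p) *ₚ q) (suc (m ℕ.+ n))                      ≈⟨ coeff-suc-* a p q (m ℕ.+ n) ⟩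
    a * coeff q (suc (m ℕ.+ n)) + coeff (p *ₚ q) (m ℕ.+ n)    ≈⟨ +-cong (*-congˡ (vanish c _ (s≤s (ℕ.m≤n+m n m))))
                                                                  (top-coeff-* {m} {n} {p} {q} (below-tail b) c) ⟩
    a * 0# + coeff p m * coeff q n                            ≈⟨ trans (+-congʳ (zeroʳ a)) (+-identityˡ _) ⟩
    coeff p m * coeff q n                                     ∎

  monic-cong : ∀ {n p q} → p ≋ q → Monic n p → Monic n q
  monic-cong e m = monic (trans (sym (at e _)) (leading m)) (below-cong e (bounded m))

  monic-1ₚ : Monic 0 1ₚ
  monic-1ₚ = monic refl (below λ { (suc m) _ → refl })

  monic-X- : ∀ a → Monic 1 (X- a)
  monic-X- a = monic refl (below λ { (suc (suc m)) _ → refl ; (suc zero) (s≤s ()) })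

  monic-* : ∀ {m n p q} → Monic m p → Monic n q → Monic (m ℕ.+ n) (p *ₚ q)
  monic-* {m} {n} {p} {q} b c = monic
    (trans (top-coeff-* {m} {n} {p} {q} (bounded b) (bounded c)) (trans (*-cong (leading b) (leading c)) (*-identityˡ 1#)))
    (below-* {suc m} {n} {p} {q} (bounded b) (bounded c))

  -- Starting from the length of q, the bound is lowered step by step: as g is monic, the top
  -- coefficient of q is a coefficient of q g, in a position where q g vanishes.
  below-quotient : ∀ {k n q g} → Monic n g → Below (k ℕ.+ n) (q *ₚ g) → Below k q
  below-quotient {k} {n} {q} {g} mg b = descend (length q) (below-mono (ℕ.m≤m+n (length q) k) (below-length q))
    where
    descend : ∀ N → Below (N ℕ.+ k) q → Below k q
    descend zero    c = c
    descend (suc N) c = descend N (below-pred c (begin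
      coeff q (N ℕ.+ k)                    ≈⟨ *-identityʳ _ ⟨
      coeff q (N ℕ.+ k) * 1#               ≈⟨ *-congˡ (leading mg) ⟨
      coeff q (N ℕ.+ k) * coeff g n        ≈⟨ top-coeff-* {N ℕ.+ k} {n} {q} {g} c (bounded mg) ⟨
      coeff (q *ₚ g) (N ℕ.+ k ℕ.+ n)       ≈⟨ vanish b _ (ℕ.+-monoˡ-≤ n (ℕ.m≤n+m k N)) ⟩
      0#                                   ∎))

  monic-quotient : ∀ {k n q g} → Monic n g → Monic (k ℕ.+ n) (q *ₚ g) → Monic k q
  monic-quotient {k} {n} {q} {g} mg m = monic
    (begin
      coeff q k                ≈⟨ *-identityʳ _ ⟨
      coeff q k * 1#           ≈⟨ *-congˡ (leading mg) ⟨
      coeff q k * coeff g n    ≈⟨ top-coeff-* {k} {n} {q} {g} bq (bounded mg) ⟨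
      coeff (q *ₚ g) (k ℕ.+ n) ≈⟨ leading m ⟩
      1#                       ∎)
    bq
    where
    bq : Below (suc k) q
    bq = below-quotient {g = g} mg (bounded m)

  monic-cancel : ∀ {n g p q} → Monic n g → p *ₚ g ≋ q *ₚ g → p ≋ q
  monic-cancel {n} {g} {p} {q} mg e = P-eq (below-0 (below-quotient {q = p +ₚ (-ₚ q)} {g = g} mg ([]-below
    (≋-trans (P.[x-y]z≈xz-yz p q g)
      (≋-trans (+ₚ-cong e (≋-refl { -ₚ (q *ₚ g)})) (-ₚ-inverseʳ (q *ₚ g)))))))
    where
    P-eq : p +ₚ (-ₚ q) ≋ [] → p ≋ q
    P-eq z = ≋-trans (P.x≈[x-y]+y p q) (+ₚ-cong z (≋-refl {q}))

  monic-nonzero : ∀ {n p} → Monic n p → ¬ (p ≋ [])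
  monic-nonzero m e = 1≉0 (trans (sym (leading m)) (at e _))

  monic-0 : ∀ {p} → Monic 0 p → p ≋ 1ₚ
  monic-0 m = mk λ { zero → leading m ; (suc n) → vanish (bounded m) (suc n) (s≤s z≤n) }

  -- From p = q g + r, the candidate remainder a + X r of a + X p has degree at most n; subtracting
  -- c g, with c its coefficient at n, brings the degree below n.
  division : ∀ {n g} → Monic n g → ∀ p → ∃[ q ] ∃[ r ] p ≋ q *ₚ g +ₚ r × Below n r
  division mg [] = [] , [] , ≋-refl , []-below ≋-refl
  division {n} {g} mg (a ∷ p) with division mg p
  ... | q , r , e , b = c ∷ q , r′ , eq , below-pred (below-+ (below-∷ a b) (below-neg (below-• c (bounded mg)))) (begin
      coeff ((a ∷ r) +ₚ (-ₚ (c • g))) n   ≈⟨ coeff-+ (a ∷ r) (-ₚ (c • g)) n ⟩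
      c + coeff (-ₚ (c • g)) n            ≈⟨ +-congˡ (trans (coeff-neg (c • g) n) (-‿cong (trans (coeff-• c g n) (*-congˡ (leading mg))))) ⟩
      c - c * 1#                          ≈⟨ trans (+-congˡ (-‿cong (*-identityʳ c))) (-‿inverseʳ c) ⟩
      0#                                  ∎)
    where
    c = coeff (a ∷ r) n
    r′ = (a ∷ r) +ₚ (-ₚ (c • g))
    eq : a ∷ p ≋ (c ∷ q) *ₚ g +ₚ r′
    eq = ≋-trans (∷-cong (sym (+-identityˡ a)) e) (P.x+y≈[z+x]+[y-z] (0# ∷ q *ₚ g) (a ∷ r) (c • g))

  eval-below-1 : ∀ {r} x → Below 1 r → eval r x ≈ coeff r 0
  eval-below-1 {[]}    x b = refl
  eval-below-1 {a ∷ r} x b = trans (+-congˡ (trans (*-congˡ (eval-zero r x (below-0 (below-tail b)))) (zeroʳ x))) (+-identityʳ a)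

  factor : ∀ {p a} → eval p a ≈ 0# → X- a divides p
  factor {p} {a} root with division (monic-X- a) p
  ... | q , r , e , b = q , ≋-trans (≋-sym (≋-trans (+ₚ-cong (≋-refl {q *ₚ (X- a)}) r≋[]) (+ₚ-identityʳ _))) (≋-sym e)
    where
    r≋[] : r ≋ []
    r≋[] = below-0 (below-pred b (begin
      coeff r 0                               ≈⟨ eval-below-1 a b ⟨
      eval r a                                ≈⟨ +-identityˡ _ ⟨
      0# + eval r a                           ≈⟨ +-congʳ (trans (*-congˡ (trans (eval-X- a a) (-‿inverseʳ a))) (zeroʳ _)) ⟨
      eval q a * eval (X- a) a + eval r a     ≈⟨ +-congʳ (eval-* q (X- a) a) ⟨
      eval (q *ₚ (X- a)) a + eval r a         ≈⟨ eval-+ (q *ₚ (X- a)) r a ⟨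
      eval (q *ₚ (X- a) +ₚ r) a               ≈⟨ eval-cong e refl ⟨
      eval p a                                ≈⟨ root ⟩
      0#                                      ∎))

  divides-trans : ∀ {f g h} → f divides g → g divides h → f divides h
  divides-trans {f} (r , e) (s , e′) = s *ₚ r , ≋-trans (*ₚ-assoc s r f) (≋-trans (*ₚ-congʳ s e) e′)

  Distinct : List Carrier → Set ℓ
  Distinct = AllPairs λ x y → ¬ (x ≈ y)

  distinct-⊆ : ∀ {xs ys} → xs ⊆ ys → Distinct ys → Distinct xs
  distinct-⊆ []           []       = []
  distinct-⊆ (_ ∷ʳ s)     (_ ∷ ds) = distinct-⊆ s ds
  distinct-⊆ (≡.refl ∷ s) (d ∷ ds) = Sublist.All-resp-⊆ s d ∷ distinct-⊆ s ds

  self-members : ∀ xs → All (λ x → Any (x ≈_) xs) xs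
  self-members []       = []
  self-members (x ∷ xs) = here refl ∷ All.map there (self-members xs)

  Root : Poly → Carrier → Set ℓ
  Root p x = eval p x ≈ 0#

  roots-bound : ∀ {xs p} → Distinct xs → All (Root p) xs → Below (length xs) p → p ≋ []
  roots-bound {[]}     {p} _        _        b = below-0 b
  roots-bound {x ∷ xs} {p} (d ∷ ds) (r ∷ rs) b with factor {p} {x} r
  ... | q , e = ≋-trans (≋-sym e) (*ₚ-cong {q = X- x} (roots-bound ds (roots d rs)
      (below-quotient {q = q} {g = X- x} (monic-X- x) (≡.subst (λ n → Below n (q *ₚ (X- x))) (ℕ.+-comm 1 (length xs)) (below-cong (≋-sym e) b)))) ≋-refl)
    where
    roots : ∀ {ys} → All (λ y → ¬ (x ≈ y)) ys → All (Root p) ys → All (Root q) ys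
    roots []       []       = []
    roots (x≉y ∷ ds) (r ∷ rs) = *-cancel-0 (λ y-x≈0 → x≉y (sym (x-y≈0⇒x≈y y-x≈0)))
      (trans (*-comm _ _) (trans (*-congˡ (sym (eval-X- x _))) (trans (sym (eval-* q (X- x) _)) (trans (eval-cong e refl) r)))) ∷ roots ds rs

  linears : List Carrier → Poly
  linears = foldr (λ a p → p *ₚ (X- a)) 1ₚ

  monic-linears : ∀ as → Monic (length as) (linears as)
  monic-linears []       = monic-1ₚ
  monic-linears (a ∷ as) = ≡.subst (λ n → Monic n (linears (a ∷ as))) (ℕ.+-comm (length as) 1)
    (monic-* {p = linears as} {q = X- a} (monic-linears as) (monic-X- a))

  eval-linears-∷ : ∀ a as x → eval (linears (a ∷ as)) x ≈ eval (linears as) x * (x - a)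
  eval-linears-∷ a as x = trans (eval-* (linears as) (X- a) x) (*-congˡ (eval-X- a x))

  linears-root⁻ : ∀ {as x} → Any (x ≈_) as → eval (linears as) x ≈ 0#
  linears-root⁻ {a ∷ as} {x} (here x≈a)  = trans (eval-linears-∷ a as x) (trans (*-congˡ (x≈y⇒x-y≈0 x≈a)) (zeroʳ _))
  linears-root⁻ {a ∷ as} {x} (there any) = trans (eval-linears-∷ a as x) (trans (*-congʳ (linears-root⁻ any)) (zeroˡ _))

module ClassicalDegree (em : EM) (F : Field ℓ) where
  open Field F
  open FieldProperties F
  open PolynomialRing F
  open Degree F
  open SetoidReasoning setoid
  private module P = RingIdentities polynomialRing

  linears-root : ∀ {as x} → eval (linears as) x ≈ 0# → Any (x ≈_) as
  linears-root {[]}     {x} r = ⊥-elim (1≉0 (trans (sym (eval-1 x)) r))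
  linears-root {a ∷ as} {x} r with em {P = eval (linears as) x ≈ 0#}
  ... | yes r′ = there (linears-root r′)
  ... | no ¬r′ = here (x-y≈0⇒x≈y (*-cancel-0 ¬r′ (trans (sym (eval-linears-∷ a as x)) r)))

  unit-degree : ∀ {n g h} → Monic (suc n) g → h *ₚ g ≋ 1ₚ → ⊥
  unit-degree {n} {g} {h} mg e = monic-nonzero monic-1ₚ (≋-trans (≋-sym e)
    (*ₚ-cong {h} {[]} {g} {g} (below-0 (below-quotient {0} {suc n} {h} {g} mg
      (below-mono (s≤s z≤n) (below-cong (≋-sym e) (bounded monic-1ₚ))))) ≋-refl))

  monic-factor : ∀ {a n g g₁} → Monic (suc n) g → g₁ *ₚ (X- a) ≋ g → Monic n g₁
  monic-factor {a} {n} {g} {g₁} mg g₁≋ = monic-quotient {n} {1} {g₁} {X- a} (monic-X- a)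
    (≡.subst (λ k → Monic k (g₁ *ₚ (X- a))) (ℕ.+-comm 1 n) (monic-cong (≋-sym g₁≋) mg))

  private
    cancel-factorˡ : ∀ {a h g g₁ p} → g₁ *ₚ (X- a) ≋ g → h *ₚ g ≋ p *ₚ (X- a) → h *ₚ g₁ ≋ p
    cancel-factorˡ {a} {h} {g} {g₁} {p} g₁≋ e = monic-cancel {1} {X- a} {h *ₚ g₁} {p} (monic-X- a)
      (≋-trans (*ₚ-assoc h g₁ (X- a)) (≋-trans (*ₚ-congʳ h g₁≋) e))

    cancel-factorʳ : ∀ {a h h₁ g p} → h₁ *ₚ (X- a) ≋ h → h *ₚ g ≋ p *ₚ (X- a) → h₁ *ₚ g ≋ p
    cancel-factorʳ {a} {h} {h₁} {g} {p} h₁≋ e = monic-cancel {1} {X- a} {h₁ *ₚ g} {p} (monic-X- a)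
      (≋-trans (P.[xy]z≈[xz]y h₁ g (X- a)) (≋-trans (*ₚ-cong {h₁ *ₚ (X- a)} {h} {g} {g} h₁≋ ≋-refl) e))

    cofactor-root : ∀ {a as g h} → h *ₚ g ≋ linears (a ∷ as) → ¬ (eval g a ≈ 0#) → eval h a ≈ 0#
    cofactor-root {a} {as} {g} {h} e ga≉0 = *-cancel-0 ga≉0 (trans (*-comm _ _) (trans (sym (eval-* h g a))
      (trans (eval-cong e refl) (linears-root⁻ {a ∷ as} (here refl)))))

  -- The roots are recorded as a sublist, so that distinctness, or being powers of a fixed root of
  -- unity, passes to the divisor.
  Splits : List Carrier → ℕ → Poly → Set ℓ
  Splits as n g = ∃[ bs ] g ≋ linears bs × length bs ≡ n × bs ⊆ as

  -- Takes the place of unique factorisation: a is a root of g or of the cofactor h, the factor X -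
  -- a is cancelled from whichever has it, and the induction proceeds on `as`.
  divisor-of-linears : ∀ as {n g h} → Monic n g → h *ₚ g ≋ linears as → Splits as n g
  divisor-of-linears []       {zero}  {g} {h} mg e = [] , monic-0 mg , ≡.refl , []
  divisor-of-linears []       {suc n} {g} {h} mg e = ⊥-elim (unit-degree {n} {g} {h} mg e)
  divisor-of-linears (a ∷ as) {n}     {g} {h} mg e = go em n mg
    where
    go : Dec (eval g a ≈ 0#) → ∀ n → Monic n g → Splits (a ∷ as) n g
    go (yes ga≈0) zero    mg = ⊥-elim (1≉0 (trans (sym (eval-1 a)) (trans (eval-cong (≋-sym (monic-0 mg)) refl) ga≈0)))
    go (yes ga≈0) (suc n) mg =
      let g₁ , g₁≋ = factor {g} {a} ga≈0
          bs , g₁≋bs , len , sub = divisor-of-linears as {n} {g₁} {h} (monic-factor {a} {n} {g} {g₁} mg g₁≋)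
                                     (cancel-factorˡ {a} {h} {g} {g₁} {linears as} g₁≋ e)
      in a ∷ bs , ≋-trans (≋-sym g₁≋) (*ₚ-cong {g₁} {linears bs} {X- a} {X- a} g₁≋bs ≋-refl) ,
         ≡.cong suc len , ≡.refl ∷ sub
    go (no ga≉0) n mg =
      let h₁ , h₁≋ = factor {h} {a} (cofactor-root {a} {as} {g} {h} e ga≉0)
          bs , g≋bs , len , sub = divisor-of-linears as {n} {g} {h₁} mg (cancel-factorʳ {a} {h} {h₁} {g} {linears as} h₁≋ e)
      in bs , g≋bs , len , a ∷ʳ sub

  exact-degree : ∀ {p} → ¬ (p ≋ []) → ∃[ n ] ¬ (coeff p n ≈ 0#) × Below (suc n) p
  exact-degree {p} p≉0 = go (length p) (below-length p)
    where
    go : ∀ n → Below n p → ∃[ n ] ¬ (coeff p n ≈ 0#) × Below (suc n) p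
    go zero    b = ⊥-elim (p≉0 (below-0 b))
    go (suc n) b with em {P = coeff p n ≈ 0#}
    ... | yes z = go n (below-pred b z)
    ... | no ¬z = n , ¬z , b

  scale-monic : ∀ {n p} → ¬ (coeff p n ≈ 0#) → Below (suc n) p → ∃[ c ] ¬ (c ≈ 0#) × Monic n (c • p)
  scale-monic {n} {p} ¬z b with inverse (coeff p n) ¬z
  ... | c , e = c , inverse-nonzero e , monic (trans (coeff-• c p n) (trans (*-comm c _) e)) (below-• c b)

  nonzero⇒≉[] : ∀ {p} → IsNonzero p → ¬ (p ≋ [])
  nonzero⇒≉[] (n , ¬z) e = ¬z (at e n)

  •≋* : ∀ c p → c • p ≋ (c ∷ []) *ₚ p
  •≋* c p = ≋-sym (≋-trans (+ₚ-cong (≋-refl {c • p}) 0∷[]≋[]) (+ₚ-identityʳ _))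

least : EM → ∀ {a} (P : ℕ → Set a) → ∃ P → ∃[ n ] P n × (∀ m → m ℕ.< n → ¬ P m)
least em P (n , pn) = go n n pn ℕ.≤-refl
  where
  go : ∀ N n → P n → n ℕ.≤ N → ∃[ n ] P n × (∀ m → m ℕ.< n → ¬ P m)
  go N n pn n≤N with em {P = ∃[ m ] m ℕ.< n × P m}
  ... | no ¬e = n , pn , λ m m<n pm → ¬e (m , m<n , pm)
  go zero    n pn n≤N | yes (m , m<n , pm) with ℕ.≤-trans m<n n≤N
  ... | ()
  go (suc N) n pn n≤N | yes (m , m<n , pm) = go N m pm (ℕ.≤-pred (ℕ.≤-trans m<n n≤N))

module Ideal (em : EM) (F : Field ℓ) where
  open Field F
  open FieldProperties F
  open PolynomialRing F
  open Degree F
  open ClassicalDegree em F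
  private module P = RingIdentities polynomialRing

  record IsIdeal (I : Poly → Set ℓ) : Set ℓ where
    field
      resp : ∀ {p q} → p ≋ q → I p → I q
      add  : ∀ {p q} → I p → I q → I (p +ₚ q)
      mult : ∀ r {p} → I p → I (r *ₚ p)

  -- A monic element of least degree divides all others, because a nonzero remainder could be made
  -- monic of smaller degree. Applied to the relations of an algebraic element this yields minimal
  -- polynomials; applied to the ideal of p and g it yields inverses modulo g.
  generator : ∀ {I} → IsIdeal I → ∀ {p} → ¬ (p ≋ []) → I p →
              ∃[ n ] ∃[ g ] Monic n g × I g × (∀ q → I q → g divides q)
  generator {I} ideal {p} p≉0 Ip with least em (λ n → ∃[ g ] Monic n g × I g) start
    where
    open IsIdeal ideal
    monicise : ∀ {n p} → ¬ (coeff p n ≈ 0#) → Below (suc n) p → I p → ∃[ g ] Monic n g × I g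
    monicise {p = p} ¬z b Ip with scale-monic {p = p} ¬z b
    ... | c , _ , m = c • p , m , resp (≋-sym (•≋* c p)) (mult (c ∷ []) Ip)
    start : ∃[ n ] ∃[ g ] Monic n g × I g
    start with exact-degree p≉0
    ... | n , ¬z , b = n , monicise ¬z b Ip
  ... | n , (g , mg , Ig) , minimal = n , g , mg , Ig , div
    where
    open IsIdeal ideal
    div : ∀ q → I q → g divides q
    div q Iq with division mg q
    ... | s , r , e , b with em {P = r ≋ []}
    ...   | yes r≋[] = s , ≋-trans (≋-sym (≋-trans (+ₚ-cong (≋-refl {s *ₚ g}) r≋[]) (+ₚ-identityʳ _))) (≋-sym e)
    ...   | no r≉[] with exact-degree r≉[]
    ...     | m , ¬z , b′ with scale-monic {p = r} ¬z b′
    ...       | c , _ , mr = ⊥-elim (minimal m m<n (c • r , mr , resp (≋-sym (•≋* c r)) (mult (c ∷ []) Ir)))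
      where
      m<n : m ℕ.< n
      m<n with m ℕ.<? n
      ... | yes m<n = m<n
      ... | no m≮n = ⊥-elim (¬z (vanish b m (ℕ.≮⇒≥ m≮n)))
      Ir : I r
      Ir = resp (≋-trans (+ₚ-cong e (≋-refl {(-ₚ 1ₚ) *ₚ (s *ₚ g)}))
             (P.[x+y]-1x≈y (s *ₚ g) r))
           (add Iq (mult (-ₚ 1ₚ) (mult s Ig)))

-- Minimal polynomials

module _ {F : Field ℓ} (L : Extension F) where
  private
    module F = Field F
    module L = Extension L
    module F[X] = PolynomialRing F
    module L[X] = PolynomialRing L.top
    hom = L.ι-homomorphism

  evalAt-cong : ∀ {p q x y} → p F[X].≋ q → x L.≈ y → evalAt L p x L.≈ evalAt L q y
  evalAt-cong e x≈y = L[X].eval-cong (map-cong-≋ {F = F} {G = L.top} hom e) x≈y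

  evalAt-+ : ∀ p q x → evalAt L (p F[X].+ₚ q) x L.≈ evalAt L p x L.+ evalAt L q x
  evalAt-+ p q x = L.trans (L[X].eval-cong (map-+ₚ {F = F} {G = L.top} hom p q) L.refl) (L[X].eval-+ (map L.ι p) (map L.ι q) x)

  evalAt-* : ∀ p q x → evalAt L (p F[X].*ₚ q) x L.≈ evalAt L p x L.* evalAt L q x
  evalAt-* p q x = L.trans (L[X].eval-cong (map-*ₚ {F = F} {G = L.top} hom p q) L.refl) (L[X].eval-* (map L.ι p) (map L.ι q) x)

  evalAt-1 : ∀ x → evalAt L F[X].1ₚ x L.≈ L.1#
  evalAt-1 x = L.trans (L[X].eval-cong {map L.ι F[X].1ₚ} {L[X].1ₚ} (L[X].∷-cong (Homomorphism.1#-homo {F = F} {G = L.top} hom) L[X].≋-refl) L.refl) (L[X].eval-1 x)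

  module MinimalPolynomial (em : EM) (x : L.Carrier) where
    open F[X]
    open Degree F

    minimalPolynomial : ∀ {p} → ¬ (p ≋ []) → evalAt L p x L.≈ L.0# →
      ∃[ n ] ∃[ g ] Monic n g × evalAt L g x L.≈ L.0# × (∀ q → evalAt L q x L.≈ L.0# → g divides q)
    minimalPolynomial = Ideal.generator em F record
      { resp = λ e r → L.trans (evalAt-cong (≋-sym e) L.refl) r
      ; add  = λ {p} {q} r s → L.trans (evalAt-+ p q x) (L.trans (L.+-cong r s) (L.+-identityˡ L.0#))
      ; mult = λ s {p} r → L.trans (evalAt-* s p x) (L.trans (L.*-congˡ r) (L.zeroʳ _))
      }

    divides-evalAt : ∀ {g p} → g divides p → evalAt L g x L.≈ L.0# → evalAt L p x L.≈ L.0#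
    divides-evalAt {g} (r , e) root = L.trans (evalAt-cong (≋-sym e) L.refl)
      (L.trans (evalAt-* r g x) (L.trans (L.*-congˡ root) (L.zeroʳ _)))

-- Linear algebra

module Dependence (em : EM) (F : Field ℓ) where
  open Field F hiding (zero)
  open FieldProperties F
  open Division em
  open SemiringSum semiring
  open SetoidReasoning setoid

  Nontrivial : ∀ {n} → (Fin n → Carrier) → Set ℓ
  Nontrivial c = ∃[ i ] ¬ (c i ≈ 0#)

  private
    sum-zero : ∀ {n} (t : Fin n → Carrier) → (∀ i → t i ≈ 0#) → sum t ≈ 0#
    sum-zero {n} t z = trans (sum-cong-≋ z) (sum-replicate-zero n)

    eliminate : ∀ {n} (c′ a : Fin (suc n) → Carrier) (k : Fin (suc (suc n))) (t : Fin (suc (suc n)) → Carrier) →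
                sum (λ i → Vector.insertAt c′ k (- sum (λ i → c′ i * a i)) i * t i) ≈
                sum (λ i → c′ i * (t (punchIn k i) - a i * t k))
    eliminate c′ a k t = begin
      sum (λ i → c i * t i)                                           ≈⟨ sum-remove {i = k} (λ i → c i * t i) ⟩
      c k * t k + sum (λ i → c (punchIn k i) * t (punchIn k i))
        ≈⟨ +-cong (*-congʳ (reflexive (Vector.insertAt-lookup c′ k s)))
                  (sum-cong-≋ {x = λ i → c (punchIn k i) * t (punchIn k i)} {y = λ i → c′ i * t (punchIn k i)}
                    (λ i → *-congʳ (reflexive (Vector.insertAt-punchIn c′ k s i)))) ⟩
      - sum (λ i → c′ i * a i) * t k + sum (λ i → c′ i * t (punchIn k i))
        ≈⟨ +-congʳ (solve 2 (λ s t → (:- s) :* t := s :* (:- t)) refl (sum (λ i → c′ i * a i)) (t k)) ⟩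
      sum (λ i → c′ i * a i) * (- t k) + sum (λ i → c′ i * t (punchIn k i))
        ≈⟨ +-congʳ (*-distribʳ-sum (- t k) (λ i → c′ i * a i)) ⟩
      sum (λ i → c′ i * a i * (- t k)) + sum (λ i → c′ i * t (punchIn k i))
        ≈⟨ ∑-distrib-+ (λ i → c′ i * a i * (- t k)) (λ i → c′ i * t (punchIn k i)) ⟨
      sum (λ i → c′ i * a i * (- t k) + c′ i * t (punchIn k i))
        ≈⟨ sum-cong-≋ (λ i → solve 4 (λ c a t u → c :* a :* (:- t) :+ c :* u := c :* (u :- a :* t)) refl (c′ i) (a i) (t k) (t (punchIn k i))) ⟩
      sum (λ i → c′ i * (t (punchIn k i) - a i * t k))                ∎
      where
      s = - sum (λ i → c′ i * a i)
      c = Vector.insertAt c′ k s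

  -- Gaussian elimination. A pivot with nonzero first coordinate clears that coordinate from the
  -- other vectors; a relation among the cleared vectors lifts by giving the pivot the coefficient -
  -- Σ cᵢ aᵢ, as computed in `eliminate`.
  dependent : ∀ n (v : Fin (suc n) → Fin n → Carrier) →
              ∃[ c ] Nontrivial c × (∀ j → sum (λ i → c i * v i j) ≈ 0#)
  dependent zero    v = (λ _ → 1#) , (zero , 1≉0) , λ ()
  dependent (suc n) v with em {P = ∃[ k ] ¬ (v k zero ≈ 0#)}
  ... | no ¬∃ = c , (suc (proj₁ nt) , proj₂ nt) , relation
    where
    rec = dependent n (λ i j → v (suc i) (suc j))
    nt  = proj₁ (proj₂ rec)
    c : Fin (suc (suc n)) → Carrier
    -- Without a pivot the first coordinate vanishes throughout, so n + 1 of the n + 2 vectors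
    -- already satisfy a relation in the other n coordinates.
    c zero    = 0#
    c (suc i) = proj₁ rec i
    column : ∀ i → v i zero ≈ 0#
    column i with em {P = v i zero ≈ 0#}
    ... | yes z = z
    ... | no ¬z = ⊥-elim (¬∃ (i , ¬z))
    relation : ∀ j → sum (λ i → c i * v i j) ≈ 0#
    relation zero    = sum-zero (λ i → c i * v i zero) (λ i → trans (*-congˡ (column i)) (zeroʳ _))
    relation (suc j) = trans (+-cong (zeroˡ _) (proj₂ (proj₂ rec) j)) (+-identityˡ 0#)
  ... | yes (k , pivot) = Vector.insertAt c′ k s , nontrivial , relation
    where
    a : Fin (suc n) → Carrier
    a i = v (punchIn k i) zero / v k zero
    rec = dependent n (λ i j → v (punchIn k i) (suc j) - a i * v k (suc j))
    c′ = proj₁ rec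
    s  = - sum (λ i → c′ i * a i)
    nontrivial : Nontrivial (Vector.insertAt c′ k s)
    nontrivial = let i , ¬z = proj₁ (proj₂ rec) in
      punchIn k i , λ z → ¬z (trans (sym (reflexive (Vector.insertAt-punchIn c′ k s i))) z)
    relation : ∀ j → sum (λ i → Vector.insertAt c′ k s i * v i j) ≈ 0#
    relation zero    = trans (eliminate c′ a k (λ i → v i zero)) (sum-zero (λ i → c′ i * (v (punchIn k i) zero - a i * v k zero)) λ i →
      trans (*-congˡ (x≈y⇒x-y≈0 (sym (trans (*-comm _ _) (y*x/y≈x pivot))))) (zeroʳ _))
    relation (suc j) = trans (eliminate c′ a k (λ i → v i (suc j))) (proj₂ (proj₂ rec) j)

module Span (em : EM) {F : Field ℓ} (A : FAlgebra F) where
  private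
    module F = Field F
    module FS = SemiringSum F.semiring
  open FAlgebra A hiding (zero)
  open SemiringSum semiring
  open Dependence em F using (Nontrivial; dependent)
  open SetoidReasoning setoid
  open IsRingHomomorphism ι-homomorphism using (+-homo; *-homo; 0#-homo; 1#-homo; -‿homo) renaming (⟦⟧-cong to ι-cong)
  open RingProperties ring using (-‿distribˡ-*)

  lc : ∀ {n} → (Fin n → F.Carrier) → (Fin n → Carrier) → Carrier
  lc = linearCombination A

  InSpan : ∀ {n} → (Fin n → Carrier) → Carrier → Set ℓ
  InSpan b x = ∃[ c ] lc c b ≈ x

  Independent : ∀ {n} → (Fin n → Carrier) → Set ℓ
  Independent {n} b = ∀ c → lc {n} c b ≈ 0# → ∀ i → c i F.≈ F.0#

  ι-sum : ∀ {n} (t : Fin n → F.Carrier) → ι (FS.sum t) ≈ sum (λ i → ι (t i))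
  ι-sum {zero}  t = 0#-homo
  ι-sum {suc n} t = trans (+-homo _ _) (+-congˡ (ι-sum (t ∘ suc)))

  lc-cong : ∀ {n} {c d : Fin n → F.Carrier} {a b : Fin n → Carrier} →
            (∀ i → c i F.≈ d i) → (∀ i → a i ≈ b i) → lc c a ≈ lc d b
  lc-cong p q = sum-cong-≋ λ i → *-cong (ι-cong (p i)) (q i)

  lc-zero : ∀ {n} {c : Fin n → F.Carrier} (b : Fin n → Carrier) → (∀ i → c i F.≈ F.0#) → lc c b ≈ 0#
  lc-zero {n} b z = trans (sum-cong-≋ λ i → trans (*-congʳ (trans (ι-cong (z i)) 0#-homo)) (zeroˡ (b i))) (sum-replicate-zero n)

  lc-+ : ∀ {n} (c d : Fin n → F.Carrier) b → lc (λ i → c i F.+ d i) b ≈ lc c b + lc d b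
  lc-+ c d b = trans (sum-cong-≋ λ i → trans (*-congʳ (+-homo (c i) (d i))) (distribʳ _ _ _)) (∑-distrib-+ (λ i → ι (c i) * b i) _)

  lc-• : ∀ {n} a (c : Fin n → F.Carrier) b → lc (λ i → a F.* c i) b ≈ ι a * lc c b
  lc-• a c b = trans (sum-cong-≋ λ i → trans (*-congʳ (*-homo a (c i))) (*-assoc _ _ _))
                     (sym (*-distribˡ-sum (ι a) (λ i → ι (c i) * b i)))

  lc-lc : ∀ {m n} (c : Fin m → F.Carrier) (v : Fin m → Fin n → F.Carrier) b →
          lc c (λ i → lc (v i) b) ≈ lc (λ j → FS.sum (λ i → c i F.* v i j)) b
  lc-lc c v b = begin
    sum (λ i → ι (c i) * lc (v i) b)                       ≈⟨ sum-cong-≋ (λ i → lc-• (c i) (v i) b) ⟨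
    sum (λ i → sum (λ j → ι (c i F.* v i j) * b j))        ≈⟨ ∑-comm (λ i j → ι (c i F.* v i j) * b j) ⟩
    sum (λ j → sum (λ i → ι (c i F.* v i j) * b j))        ≈⟨ sum-cong-≋ (λ j → *-distribʳ-sum (b j) (λ i → ι (c i F.* v i j))) ⟨
    sum (λ j → sum (λ i → ι (c i F.* v i j)) * b j)        ≈⟨ sum-cong-≋ (λ j → *-congʳ (ι-sum (λ i → c i F.* v i j))) ⟨
    lc (λ j → FS.sum (λ i → c i F.* v i j)) b              ∎

  span-resp : ∀ {n} {b : Fin n → Carrier} {x y} → x ≈ y → InSpan b x → InSpan b y
  span-resp e (c , p) = c , trans p e

  span-lc : ∀ {m n} {b : Fin n → Carrier} {x : Fin m → Carrier} → (∀ i → InSpan b (x i)) → ∀ c → InSpan b (lc c x)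
  span-lc {b = b} s c = _ , trans (sym (lc-lc c (λ i → proj₁ (s i)) b)) (lc-cong {c = c} (λ _ → F.refl) (λ i → proj₂ (s i)))

  span-+ : ∀ {n} {b : Fin n → Carrier} {x y} → InSpan b x → InSpan b y → InSpan b (x + y)
  span-+ {b = b} (c , p) (d , q) = _ , trans (lc-+ c d b) (+-cong p q)

  span-• : ∀ {n} {b : Fin n → Carrier} a {x} → InSpan b x → InSpan b (ι a * x)
  span-• {b = b} a (c , p) = _ , trans (lc-• a c b) (*-congˡ p)

  span-0 : ∀ {n} {b : Fin n → Carrier} → InSpan b 0#
  span-0 {b = b} = (λ _ → F.0#) , lc-zero b (λ _ → F.refl)

  span-sum : ∀ {m n} {b : Fin n → Carrier} {x : Fin m → Carrier} → (∀ i → InSpan b (x i)) → InSpan b (sum x)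
  span-sum {zero}  s = span-0
  span-sum {suc m} s = span-+ (s zero) (span-sum (s ∘ suc))

  span-basis : ∀ {n} (b : Fin n → Carrier) i → InSpan b (b i)
  span-basis {suc n} b zero    = δ , trans (+-cong (trans (*-congʳ 1#-homo) (*-identityˡ _)) (lc-zero (b ∘ suc) (λ _ → F.refl))) (+-identityʳ _)
    where
    δ : Fin (suc n) → F.Carrier
    δ zero    = F.1#
    δ (suc _) = F.0#
  span-basis {suc n} b (suc i) with span-basis (b ∘ suc) i
  ... | c , p = c′ , trans (+-cong (trans (*-congʳ 0#-homo) (zeroˡ _)) p) (+-identityˡ _)
    where
    c′ : Fin (suc n) → F.Carrier
    c′ zero    = F.0#
    c′ (suc j) = c j

  span-dependent : ∀ {n} {b : Fin n → Carrier} (x : Fin (suc n) → Carrier) → (∀ i → InSpan b (x i)) →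
                   ∃[ c ] Nontrivial c × lc c x ≈ 0#
  span-dependent {n} {b} x s with dependent n (λ i → proj₁ (s i))
  ... | c , nt , rel = c , nt , (begin
    lc c x                                 ≈⟨ lc-cong {c = c} (λ _ → F.refl) (λ i → proj₂ (s i)) ⟨
    lc c (λ i → lc (proj₁ (s i)) b)        ≈⟨ lc-lc c (λ i → proj₁ (s i)) b ⟩
    lc (λ j → FS.sum (λ i → c i F.* proj₁ (s i) j)) b ≈⟨ lc-zero b rel ⟩
    0#                                     ∎)

  private
    independent-tail : ∀ {n} {b : Fin (suc n) → Carrier} → Independent b → Independent (b ∘ suc)
    independent-tail {n} ind c p i = ind c′ (trans (+-cong (trans (*-congʳ 0#-homo) (zeroˡ _)) p) (+-identityˡ _)) (suc i)
      where
      c′ : Fin (suc n) → F.Carrier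
      c′ zero    = F.0#
      c′ (suc j) = c j

    independent-cons : ∀ {n} {b : Fin n → Carrier} x → Independent b → ¬ InSpan b x → Independent (x Vector.∷ b)
    independent-cons {n} {b} x ind x∉ c p with em {P = c zero F.≈ F.0#}
    ... | yes z = λ { zero → z
                    ; (suc i) → ind (c ∘ suc) (trans (sym (trans (+-congʳ (trans (*-congʳ (trans (ι-cong z) 0#-homo)) (zeroˡ x))) (+-identityˡ _))) p) i }
    ... | no ¬z with F.inverse (c zero) ¬z
    ...   | d , e = ⊥-elim (x∉ (_ , (begin
      lc (λ i → (F.- d) F.* c (suc i)) b          ≈⟨ lc-• (F.- d) (c ∘ suc) b ⟩
      ι (F.- d) * s                               ≈⟨ *-congʳ (-‿homo d) ⟩
      - ι d * s                                   ≈⟨ -‿distribˡ-* (ι d) s ⟨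
      - (ι d * s)                                 ≈⟨ +-identityˡ _ ⟨
      0# - ι d * s                                ≈⟨ +-congʳ (trans (*-congˡ p) (zeroʳ (ι d))) ⟨
      ι d * (ι (c zero) * x + s) - ι d * s        ≈⟨ +-congʳ (distribˡ _ _ _) ⟩
      (ι d * (ι (c zero) * x) + ι d * s) - ι d * s ≈⟨ +-assoc _ _ _ ⟩
      ι d * (ι (c zero) * x) + (ι d * s - ι d * s) ≈⟨ +-congˡ (-‿inverseʳ _) ⟩
      ι d * (ι (c zero) * x) + 0#                 ≈⟨ +-identityʳ _ ⟩
      ι d * (ι (c zero) * x)                      ≈⟨ *-assoc _ _ _ ⟨
      ι d * ι (c zero) * x                        ≈⟨ *-congʳ (*-homo d (c zero)) ⟨
      ι (d F.* c zero) * x                        ≈⟨ *-congʳ (ι-cong (F.trans (F.*-comm _ _) e)) ⟩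
      ι F.1# * x                                  ≈⟨ trans (*-congʳ 1#-homo) (*-identityˡ x) ⟩
      x                                           ∎)))
      where s = lc (c ∘ suc) b

  -- If m > n, dropping vectors leaves n + 1 independent ones in the span of n, against
  -- `span-dependent`.
  independent≤spanning : ∀ {m n} {a : Fin m → Carrier} {b : Fin n → Carrier} →
                         Independent a → (∀ x → InSpan b x) → m ℕ.≤ n
  independent≤spanning {m} {n} {a} {b} ind sp with m ℕ.≤? n
  ... | yes m≤n = m≤n
  ... | no m≰n = ⊥-elim (go m a ind (ℕ.≰⇒> m≰n))
    where
    go : ∀ m (a : Fin m → Carrier) → Independent a → n ℕ.< m → ⊥
    go m a ind n<m with ℕ.m≤n⇒m<n∨m≡n n<m
    go m       a ind n<m | inj₂ ≡.refl with span-dependent a (λ i → sp (a i))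
    ... | c , (i , ¬z) , p = ¬z (ind c p i)
    go (suc m) a ind _   | inj₁ (s≤s n<m) = go m (a ∘ suc) (independent-tail {b = a} ind) n<m

  -- An independent family is enlarged by vectors outside its span until none is left; the bound N
  -- on independent families limits the number of enlargements, and `k` counts those that remain.
  bounded⇒hasDimension : ∀ N → (∀ {m} (b : Fin m → Carrier) → Independent b → m ℕ.≤ N) → ∃ (HasDimension A)
  bounded⇒hasDimension N bound = go N 0 (λ ()) (λ _ _ ()) ℕ.≤-refl
    where
    go : ∀ k m (b : Fin m → Carrier) → Independent b → N ℕ.≤ m ℕ.+ k → ∃ (HasDimension A)
    go k m b ind N≤ with em {P = ∃[ x ] ¬ InSpan b x}
    ... | no ¬∃ = m , b , record { spanning = spanning ; independent = ind }
      where
      spanning : ∀ x → InSpan b x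
      spanning x with em {P = InSpan b x}
      ... | yes s = s
      ... | no ¬s = ⊥-elim (¬∃ (x , ¬s))
    go zero    m b ind N≤ | yes (x , x∉) = ⊥-elim (ℕ.<-irrefl ≡.refl
      (ℕ.≤-trans (bound (x Vector.∷ b) (independent-cons x ind x∉)) (≡.subst (N ℕ.≤_) (ℕ.+-identityʳ m) N≤)))
    go (suc k) m b ind N≤ | yes (x , x∉) =
      go k (suc m) (x Vector.∷ b) (independent-cons x ind x∉) (≡.subst (N ℕ.≤_) (ℕ.+-suc m k) N≤)

  spanning⇒hasDimension : ∀ {n} {b : Fin n → Carrier} → (∀ x → InSpan b x) → ∃ (HasDimension A)
  spanning⇒hasDimension {n} sp = bounded⇒hasDimension n λ b ind → independent≤spanning ind sp

module SumCombine {c ℓ} (R : Ring c ℓ) where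
  open Ring R hiding (zero)
  open SemiringSum semiring

  sum-++ : ∀ m {n} (t : Fin (m ℕ.+ n) → Carrier) → sum t ≈ sum (λ i → t (i ↑ˡ n)) + sum (λ j → t (m ↑ʳ j))
  sum-++ zero    t = sym (+-identityˡ _)
  sum-++ (suc m) t = trans (+-congˡ (sum-++ m (t ∘ suc))) (sym (+-assoc _ _ _))

  sum-combine : ∀ m {n} (t : Fin (m ℕ.* n) → Carrier) → sum t ≈ sum (λ (i : Fin m) → sum (λ (j : Fin n) → t (combine i j)))
  sum-combine zero        t = refl
  sum-combine (suc m) {n} t = trans (sum-++ n t) (+-congˡ (sum-combine m (λ k → t (n ↑ʳ k))))

-- Algebraic extensions

compose : {F : Field ℓ} (G : Extension F) → Extension (Extension.top G) → Extension F
compose G H = record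
  { top            = H.top
  ; ι              = λ a → H.ι (G.ι a)
  ; ι-homomorphism = Composition.isRingHomomorphism H.trans G.ι-homomorphism H.ι-homomorphism
  }
  where
  module G = Extension G
  module H = Extension H

evalAt-compose : {F : Field ℓ} (G : Extension F) (H : Extension (Extension.top G)) → ∀ p x →
                 Extension._≈_ H (evalAt (compose G H) p (Extension.ι H x)) (Extension.ι H (evalAt G p x))
evalAt-compose G H p x = H.trans (H.reflexive (≡.cong (λ q → PolynomialRing.eval H.top q (H.ι x)) (List.map-∘ p)))
  (eval-map {F = G.top} {G = H.top} H.ι-homomorphism (map G.ι p) x)
  where
  module G = Extension G
  module H = Extension H

-- Finite subalgebras and transitivity of algebraic extensions

module FiniteSubring (em : EM) {F : Field ℓ} (L : Extension F) where
  private
    module F = Field F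
    module F[X] = PolynomialRing F
  open Extension L hiding (zero)
  open FieldProperties top
  open PolynomialRing top using (eval; coeff; eval-zero; eval-1; eval-cong; ≋-sym)
  open Degree top using (Below; Monic; vanish; leading; bounded; below-0; below-tail; monic-0; below)
  open Span em (extensionAlgebra L)
  open SemiringSum semiring
  open SetoidReasoning setoid
  open Homomorphism {F = F} {G = top} ι-homomorphism using (0#-homo; 1#-homo; -‿homo; φ-cong)

  eval-below : ∀ {n p} x → Below n p → eval p x ≈ sum {n} (λ i → coeff p (toℕ i) * x ^ toℕ i)
  eval-below {n}     {[]}    x b = sym (trans (sum-cong-≋ {n} {x = λ i → 0# * x ^ toℕ i} {y = λ i → 0#} λ i → zeroˡ _) (sum-replicate-zero n))
  eval-below {zero}  {a ∷ p} x b = eval-zero (a ∷ p) x (below-0 b)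
  eval-below {suc n} {a ∷ p} x b = +-cong (sym (*-identityʳ a)) (begin
    x * eval p x                                              ≈⟨ *-congˡ (eval-below {n} {p} x (below-tail b)) ⟩
    x * sum (λ (i : Fin n) → coeff p (toℕ i) * x ^ toℕ i)     ≈⟨ *-distribˡ-sum x (λ (i : Fin n) → coeff p (toℕ i) * x ^ toℕ i) ⟩
    sum (λ (i : Fin n) → x * (coeff p (toℕ i) * x ^ toℕ i))   ≈⟨ sum-cong-≋ (λ (i : Fin n) →
      solve 3 (λ x c y → x :* (c :* y) := c :* (x :* y)) refl x (coeff p (toℕ i)) (x ^ toℕ i)) ⟩
    sum (λ (i : Fin n) → coeff p (toℕ i) * (x * x ^ toℕ i))   ∎)

  monic-root : ∀ {n p x} → Monic n p → eval p x ≈ 0# → x ^ n ≈ sum {n} (λ i → - coeff p (toℕ i) * x ^ toℕ i)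
  monic-root {n} {p} {x} m root = begin
    x ^ n                ≈⟨ solve 2 (λ s y → y := s :+ y :- s) refl s (x ^ n) ⟩
    s + x ^ n - s        ≈⟨ +-congʳ (+-congˡ (trans (*-congʳ top-coeff) (*-identityˡ _))) ⟨
    s + last′ - s        ≈⟨ +-congʳ (+-cong (sum-cong-≋ {n} {x = λ i → term (toℕ i)} {y = λ i → term (toℕ (inject₁ i))} (λ i → reflexive (≡.cong term (≡.sym (Fin.toℕ-inject₁ i)))))
                                            (reflexive (≡.cong term (≡.sym (Fin.toℕ-fromℕ n))))) ⟩
    sum {n} (λ i → term (toℕ (inject₁ i))) + term (toℕ (fromℕ n)) - s ≈⟨ +-congʳ (sum-init-last {n} (λ i → term (toℕ i))) ⟨
    sum {suc n} (λ i → term (toℕ i)) - s ≈⟨ +-congʳ (trans (sym (eval-below {p = p} x (bounded m))) root) ⟩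
    0# - s               ≈⟨ solve 1 (λ s → con (+ 0) :- s := s :* (:- con (+ 1))) refl s ⟩
    s * - 1#             ≈⟨ *-distribʳ-sum (- 1#) (λ (i : Fin n) → term (toℕ i)) ⟩
    sum {n} (λ i → term (toℕ i) * - 1#) ≈⟨ sum-cong-≋ {n} (λ i →
      solve 2 (λ c y → c :* y :* (:- con (+ 1)) := (:- c) :* y) refl (coeff p (toℕ i)) (x ^ toℕ i)) ⟩
    sum {n} (λ i → - coeff p (toℕ i) * x ^ toℕ i) ∎
    where
    term : ℕ → Carrier
    term i = coeff p i * x ^ i
    s = sum {n} (λ i → term (toℕ i))
    last′ = term n
    top-coeff : coeff p n ≈ 1#
    top-coeff = leading m

  private
    coeff-tabulate : ∀ {n} (c : Fin n → F.Carrier) i → F[X].coeff (tabulate c) (toℕ i) ≡ c i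
    coeff-tabulate c zero    = ≡.refl
    coeff-tabulate c (suc i) = coeff-tabulate (c ∘ suc) i

  evalAt-tabulate : ∀ {n} (c : Fin n → F.Carrier) x → evalAt L (tabulate c) x ≈ lc c (λ i → x ^ toℕ i)
  evalAt-tabulate {zero}  c x = refl
  evalAt-tabulate {suc n} c x = +-cong (sym (*-identityʳ _)) (begin
    x * evalAt L (tabulate (c ∘ suc)) x               ≈⟨ *-congˡ (evalAt-tabulate (c ∘ suc) x) ⟩
    x * lc (c ∘ suc) (λ (i : Fin n) → x ^ toℕ i)      ≈⟨ *-distribˡ-sum x (λ (i : Fin n) → ι (c (suc i)) * x ^ toℕ i) ⟩
    sum (λ (i : Fin n) → x * (ι (c (suc i)) * x ^ toℕ i)) ≈⟨ sum-cong-≋ (λ (i : Fin n) →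
      solve 3 (λ x c y → x :* (c :* y) := c :* (x :* y)) refl x (ι (c (suc i))) (x ^ toℕ i)) ⟩
    lc (c ∘ suc) (λ (i : Fin n) → x ^ suc (toℕ i))    ∎)

  Algebraic : Carrier → Set ℓ
  Algebraic x = ∃[ p ] F[X].IsNonzero p × evalAt L p x ≈ 0#

  -- The n + 1 powers up to xⁿ lie in a space spanned by n elements, and a linear relation between
  -- them is the polynomial.
  powers-in-span : ∀ {n} {b : Fin n → Carrier} {x} → (∀ m → InSpan b (x ^ m)) → Algebraic x
  powers-in-span {x = x} s with span-dependent (λ i → x ^ toℕ i) (λ i → s (toℕ i))
  ... | c , (i , ¬z) , e = tabulate c , (toℕ i , λ z → ¬z (F.trans (F.reflexive (≡.sym (coeff-tabulate c i))) z)) ,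
                           trans (evalAt-tabulate c x) e

  finite⇒algebraic : ∀ {n} {b : Fin n → Carrier} → (∀ x → InSpan b x) → IsAlgebraic L
  finite⇒algebraic s x = powers-in-span λ m → s (x ^ m)

  evalAt-below : ∀ {n p} x → Degree.Below F n p → evalAt L p x ≈ lc {n} (λ i → F[X].coeff p (toℕ i)) (λ i → x ^ toℕ i)
  evalAt-below {n} {p} x b = trans
    (eval-below {n} {map ι p} x (below λ m n≤m → trans (coeff-map {F = F} {G = top} ι-homomorphism p m) (trans (φ-cong (Degree.vanish b m n≤m)) 0#-homo)))
    (sum-cong-≋ {n} λ i → *-congʳ (coeff-map {F = F} {G = top} ι-homomorphism p (toℕ i)))

  generated⇒algebraic : ∀ n x → (∀ y → ∃[ p ] Degree.Below F n p × evalAt L p x ≈ y) → IsAlgebraic L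
  generated⇒algebraic n x gen = finite⇒algebraic {n} {λ i → x ^ toℕ i} λ y →
    let p , b , e = gen y in _ , trans (sym (evalAt-below {n} {p} x b)) e

  -- A subalgebra spanned by finitely many elements. It contains the powers of each of its elements,
  -- so these are algebraic by `powers-in-span`.
  record Subring : Set ℓ where
    field
      size   : ℕ
      gen    : Fin size → Carrier
      closed : ∀ i j → InSpan gen (gen i * gen j)
      one    : InSpan gen 1#

  mult-span : ∀ {m n} {b : Fin m → Carrier} {b′ : Fin n → Carrier} y → (∀ i → InSpan b′ (y * b i)) →
              ∀ {x} → InSpan b x → InSpan b′ (y * x)
  mult-span {b = b} y s {x} (c , e) = span-resp (begin
      lc c (λ i → y * b i)              ≈⟨ sum-cong-≋ (λ i → solve 3 (λ c y b → c :* (y :* b) := y :* (c :* b)) refl (ι (c i)) y (b i)) ⟩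
      sum (λ i → y * (ι (c i) * b i))   ≈⟨ *-distribˡ-sum y (λ i → ι (c i) * b i) ⟨
      y * lc c b                        ≈⟨ *-congˡ e ⟩
      y * x                             ∎) (span-lc s c)

  module _ (S : Subring) where
    open Subring S

    ∈-* : ∀ {x y} → InSpan gen x → InSpan gen y → InSpan gen (x * y)
    ∈-* {x} s t = mult-span x (λ i → span-resp (*-comm _ _) (mult-span (gen i) (closed i) s)) t

    ∈-^ : ∀ {x} n → InSpan gen x → InSpan gen (x ^ n)
    ∈-^ zero    s = one
    ∈-^ (suc n) s = ∈-* s (∈-^ n s)

    -- The products xʲ gᵢ with j ≤ d span the enlarged subalgebra: the equation for x, whose
    -- coefficients lie in the old one, rewrites x^(d+1).
    adjoin : ∀ {d x} {s : Fin (suc d) → Carrier} → (∀ i → InSpan gen (s i)) →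
             x ^ suc d ≈ sum (λ i → s i * x ^ toℕ i) →
             Σ Subring λ T → (∀ {y} → InSpan gen y → InSpan (Subring.gen T) y) × InSpan (Subring.gen T) x
    adjoin {d} {x} {s} s∈ rel = record { size = _ ; gen = gen′ ; closed = closed′ ; one = incl one } ,
                                incl , span-resp (*-identityʳ x) (x* (incl one))
      where
      gen′ : Fin (suc d ℕ.* size) → Carrier
      gen′ k = x ^ toℕ (proj₁ (remQuot {suc d} size k)) * gen (proj₂ (remQuot {suc d} size k))

      gen′-combine : ∀ j i → gen′ (combine j i) ≈ x ^ toℕ j * gen i
      gen′-combine j i = reflexive (≡.cong (λ (k : Fin (suc d) × Fin size) → x ^ toℕ (proj₁ k) * gen (proj₂ k)) (Fin.remQuot-combine {suc d} j i))

      power* : ∀ (j : Fin (suc d)) {y} → InSpan gen y → InSpan gen′ (x ^ toℕ j * y)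
      power* j = mult-span (x ^ toℕ j) (λ i → span-resp (gen′-combine j i) (span-basis gen′ (combine j i)))

      incl : ∀ {y} → InSpan gen y → InSpan gen′ y
      incl y∈ = span-resp (*-identityˡ _) (power* zero y∈)

      next : ∀ (j : Fin (suc d)) i → InSpan gen′ (x * (x ^ toℕ j * gen i))
      next j i with suc (toℕ j) ℕ.<? suc d
      ... | yes j+1<d = span-resp (begin
        x ^ toℕ (Fin.fromℕ< j+1<d) * gen i ≈⟨ *-congʳ (reflexive (≡.cong (x ^_) (Fin.toℕ-fromℕ< j+1<d))) ⟩
        x ^ suc (toℕ j) * gen i            ≈⟨ *-assoc _ _ _ ⟩
        x * (x ^ toℕ j * gen i)            ∎) (power* (Fin.fromℕ< j+1<d) (span-basis gen i))
      -- Here j = d, so the next power of x is eliminated by its equation.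
      ... | no j+1≮d = span-resp (begin
        sum (λ l → x ^ toℕ l * (s l * gen i))   ≈⟨ sum-cong-≋ (λ l → solve 3 (λ y s g → y :* (s :* g) := s :* y :* g) refl (x ^ toℕ l) (s l) (gen i)) ⟩
        sum (λ l → s l * x ^ toℕ l * gen i)     ≈⟨ *-distribʳ-sum (gen i) (λ l → s l * x ^ toℕ l) ⟨
        sum (λ l → s l * x ^ toℕ l) * gen i     ≈⟨ *-congʳ rel ⟨
        x ^ suc d * gen i                       ≈⟨ *-congʳ (reflexive (≡.cong (x ^_) (≡.cong suc (≡.sym j≡d)))) ⟩
        x ^ suc (toℕ j) * gen i                 ≈⟨ *-assoc _ _ _ ⟩
        x * (x ^ toℕ j * gen i)                 ∎) (span-sum λ l → power* l (∈-* (s∈ l) (span-basis gen i)))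
        where
        j≡d : toℕ j ≡ d
        j≡d = ℕ.≤-antisym (ℕ.≤-pred (Fin.toℕ<n j)) (ℕ.≤-pred (ℕ.≮⇒≥ j+1≮d))

      via-combine : ∀ {y} → (∀ j i → InSpan gen′ (y * (x ^ toℕ j * gen i))) → ∀ {z} → InSpan gen′ z → InSpan gen′ (y * z)
      via-combine {y} f = mult-span y λ k → f (proj₁ (remQuot {suc d} size k)) (proj₂ (remQuot {suc d} size k))

      x* : ∀ {z} → InSpan gen′ z → InSpan gen′ (x * z)
      x* = via-combine next

      x^* : ∀ n {z} → InSpan gen′ z → InSpan gen′ (x ^ n * z)
      x^* zero    z∈ = span-resp (sym (*-identityˡ _)) z∈
      x^* (suc n) z∈ = span-resp (sym (*-assoc _ _ _)) (x* (x^* n z∈))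

      gen* : ∀ i {z} → InSpan gen′ z → InSpan gen′ (gen i * z)
      gen* i = via-combine λ j l → span-resp (solve 3 (λ y g h → y :* (g :* h) := g :* (y :* h)) refl (x ^ toℕ j) (gen i) (gen l))
        (power* j (closed i l))

      closed′ : ∀ k l → InSpan gen′ (gen′ k * gen′ l)
      closed′ k l = span-resp (sym (*-assoc _ _ _))
        (x^* (toℕ (proj₁ (remQuot {suc d} size k))) (gen* (proj₂ (remQuot {suc d} size k)) (span-basis gen′ l)))

    ι∈ : ∀ a → InSpan gen (ι a)
    ι∈ a = span-resp (*-identityʳ _) (span-• a one)

    ∈-neg : ∀ {x} → InSpan gen x → InSpan gen (- x)
    ∈-neg {x} x∈ = span-resp (trans (*-congʳ (trans (-‿homo F.1#) (-‿cong 1#-homo))) (solve 1 (λ x → (:- con (+ 1)) :* x := :- x) refl x))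
                     (span-• (F.- F.1#) x∈)

    adjoin-root : ∀ {n p x} → Monic n p → (∀ n → InSpan gen (coeff p n)) → eval p x ≈ 0# →
                  Σ Subring λ T → (∀ {y} → InSpan gen y → InSpan (Subring.gen T) y) × InSpan (Subring.gen T) x
    adjoin-root {zero}  {p} {x} m p∈ root = ⊥-elim (1≉0 (trans (sym (eval-1 x)) (trans (eval-cong (≋-sym (monic-0 m)) refl) root)))
    adjoin-root {suc d} {p} {x} m p∈ root = adjoin {d} {x} {λ i → - coeff p (toℕ i)} (λ i → ∈-neg (p∈ (toℕ i))) (monic-root {suc d} {p} m root)

  base : Subring
  base = record { size = 1 ; gen = λ _ → 1# ; closed = λ _ _ → span-resp {1} {λ _ → 1#} (sym (*-identityˡ 1#)) (span-basis {1} (λ _ → 1#) zero)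
                ; one = span-basis {1} (λ _ → 1#) zero }

monic-map : {F : Field ℓ} (L : Extension F) → ∀ {n p} → Degree.Monic F n p → Degree.Monic (Extension.top L) n (map (Extension.ι L) p)
monic-map {F = F} L {n} {p} m = L.monic (trans (coeff-map {F = F} {G = top} ι-homomorphism p n) (trans (φ-cong (F.leading m)) 1#-homo))
  (L.below λ k n<k → trans (coeff-map {F = F} {G = top} ι-homomorphism p k) (trans (φ-cong (F.vanish (F.bounded m) k n<k)) 0#-homo))
  where
  open Extension L
  open Homomorphism {F = F} {G = top} ι-homomorphism using (0#-homo; 1#-homo; φ-cong)
  module F = Degree F
  module L = Degree top

monic-algebraic : (em : EM) → {F : Field ℓ} (L : Extension F) → ∀ {x} → FiniteSubring.Algebraic em L x →
                  ∃[ n ] ∃[ p ] Degree.Monic F n p × Extension._≈_ L (evalAt L p x) (Extension.0# L)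
monic-algebraic em {F = F} L {x} (p , nz , root) with ClassicalDegree.exact-degree em F (ClassicalDegree.nonzero⇒≉[] em F nz)
... | n , ¬z , b with ClassicalDegree.scale-monic em F {p = p} ¬z b
...   | c , _ , m = n , c • p , m , trans (evalAt-cong L {c • p} {(c ∷ []) *ₚ p} (•≋* c p) refl)
        (trans (evalAt-* L (c ∷ []) p x) (trans (*-congˡ root) (zeroʳ _)))
  where
  open Extension L
  open PolynomialRing F using (_•_; _*ₚ_)
  open ClassicalDegree em F using (•≋*)

module _ (em : EM) {F : Field ℓ} (G : Extension F) (H : Extension (Extension.top G)) where
  private
    module G = Extension G
    module H = Extension H
  open FiniteSubring em (compose G H)
  open Span em (extensionAlgebra (compose G H)) using (InSpan; span-0)
  open PolynomialRing H.top using (coeff)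

  private
    adjoin-all : ∀ ys → All Algebraic ys → Σ Subring λ T → All (InSpan (Subring.gen T)) ys
    adjoin-all []       []       = base , []
    adjoin-all (y ∷ ys) (a ∷ as) with adjoin-all ys as | monic-algebraic em (compose G H) a
    ... | S , all | n , p , m , root with adjoin-root S (monic-map (compose G H) m) p∈ root
      where
      p∈ : ∀ n → InSpan (Subring.gen S) (coeff (map (λ a → H.ι (G.ι a)) p) n)
      p∈ n = Span.span-resp em (extensionAlgebra (compose G H)) (H.sym (coeff-map {F = F} {G = H.top} (Extension.ι-homomorphism (compose G H)) p n)) (ι∈ S _)
    ...   | T , incl , y∈ = T , y∈ ∷ All.map incl all

    coeff∈ : ∀ {n} {b : Fin n → H.Carrier} {p} → All (InSpan b) p → ∀ m → InSpan b (coeff p m)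
    coeff∈ []       m       = span-0
    coeff∈ (a ∷ as) zero    = a
    coeff∈ (a ∷ as) (suc m) = coeff∈ as m

  -- The coefficients of an equation of x over G lie in a finite subalgebra over F. Adjoining x to
  -- it keeps it finite, so the powers of x lie in the span of finitely many elements.
  algebraic-trans : IsAlgebraic G → IsAlgebraic H → IsAlgebraic (compose G H)
  algebraic-trans algG algH x with monic-algebraic em H (algH x)
  ... | n , p , m , root with adjoin-all (map H.ι p) (all p)
    where
    all : ∀ p → All Algebraic (map H.ι p)
    all []      = []
    all (a ∷ p) with algG a
    ... | f , nz , r = (f , nz , H.trans (evalAt-compose G H f a)
                         (H.trans (Homomorphism.φ-cong {F = G.top} {G = H.top} H.ι-homomorphism r)
                                  (Homomorphism.0#-homo {F = G.top} {G = H.top} H.ι-homomorphism))) ∷ all p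
  ...   | S , all∈ with adjoin-root S (monic-map H m) (coeff∈ all∈) root
  ...     | T , _ , x∈ = powers-in-span λ n → ∈-^ T n x∈

-- Adjoining roots

module _ {c ℓ} (R : CommutativeRing c ℓ) where
  open CommutativeRing R
  open ℤSolver R

  record IsRingIdeal (I : Carrier → Set ℓ) : Set (c ⊔ ℓ) where
    field
      resp : ∀ {x y} → x ≈ y → I x → I y
      zero∈ : I 0#
      add  : ∀ {x y} → I x → I y → I (x + y)
      mult : ∀ r {x} → I x → I (r * x)

  -- A record, so that x and y can be inferred from the type of a proof, which I (x - y) alone would
  -- not allow.
  record _≡[_]_ (x : Carrier) (I : Carrier → Set ℓ) (y : Carrier) : Set ℓ where
    constructor congruent
    field difference : I (x - y)

  quotientRing : {I : Carrier → Set ℓ} → IsRingIdeal I → CommutativeRing c ℓ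
  quotientRing {I} ideal = record
    { Carrier = Carrier
    ; _≈_ = _≡[ I ]_
    ; _+_ = _+_
    ; _*_ = _*_
    ; -_ = -_
    ; 0# = 0#
    ; 1# = 1#
    ; isCommutativeRing = record
      { isRing = record
        { +-isAbelianGroup = record
          { isGroup = record
            { isMonoid = record
              { isSemigroup = record
                { isMagma = record
                  { isEquivalence = record
                    { refl = eq refl
                    ; sym = λ {x} {y} (congruent p) → congruent (resp (solve 2 (λ x y → (:- con (+ 1)) :* (x :- y) := y :- x) refl x y) (mult (- 1#) p))
                    ; trans = λ {x} {y} {z} (congruent p) (congruent q) → congruent (resp (solve 3 (λ x y z → (x :- y) :+ (y :- z) := x :- z) refl x y z) (add p q))
                    }
                  ; ∙-cong = λ {x} {x′} {y} {y′} (congruent p) (congruent q) →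
                      congruent (resp (solve 4 (λ x x′ y y′ → (x :- x′) :+ (y :- y′) := (x :+ y) :- (x′ :+ y′)) refl x x′ y y′) (add p q))
                  }
                ; assoc = λ x y z → eq (+-assoc x y z)
                }
              ; identity = (λ x → eq (+-identityˡ x)) , (λ x → eq (+-identityʳ x))
              }
            ; inverse = (λ x → eq (-‿inverseˡ x)) , (λ x → eq (-‿inverseʳ x))
            ; ⁻¹-cong = λ {x} {y} (congruent p) → congruent (resp (solve 2 (λ x y → (:- con (+ 1)) :* (x :- y) := (:- x) :- (:- y)) refl x y) (mult (- 1#) p))
            }
          ; comm = λ x y → eq (+-comm x y)
          }
        ; *-cong = λ {x} {x′} {y} {y′} (congruent p) (congruent q) →
            congruent (resp (solve 4 (λ x x′ y y′ → y :* (x :- x′) :+ x′ :* (y :- y′) := x :* y :- x′ :* y′) refl x x′ y y′)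
                 (add (mult y p) (mult x′ q)))
        ; *-assoc = λ x y z → eq (*-assoc x y z)
        ; *-identity = (λ x → eq (*-identityˡ x)) , (λ x → eq (*-identityʳ x))
        ; distrib = (λ x y z → eq (distribˡ x y z)) , (λ x y z → eq (distribʳ x y z))
        }
      ; *-comm = λ x y → eq (*-comm x y)
      }
    }
    where
    open IsRingIdeal ideal
    eq : ∀ {x y} → x ≈ y → x ≡[ I ] y
    eq {x} {y} x≈y = congruent (resp (sym (trans (+-congʳ x≈y) (-‿inverseʳ y))) zero∈)

-- Irreducibility of g says that no divisor of g has a smaller positive degree.
module Kronecker (em : EM) (F : Field ℓ) {n : ℕ} {g : PolynomialRing.Poly F} (mg : Degree.Monic F (suc n) g)
                 (irreducible : ∀ {m h} → Degree.Monic F (suc m) h → Degree._divides_ F h g → n ℕ.≤ m) where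
  open Field F hiding (zero)
  open PolynomialRing F
  open Degree F
  open ClassicalDegree em F
  private
    module P = CommutativeRing polynomialRing
    module I = RingIdentities polynomialRing

  ideal : IsRingIdeal polynomialRing (g divides_)
  ideal = record
    { resp = λ e (r , e′) → r , ≋-trans e′ e
    ; zero∈ = [] , ≋-refl
    ; add  = λ (r , e) (s , e′) → r +ₚ s , ≋-trans (*ₚ-distribʳ g r s) (+ₚ-cong e e′)
    ; mult = λ s (r , e) → s *ₚ r , ≋-trans (*ₚ-assoc s r g) (*ₚ-congʳ s e)
    }

  private
    x-0≋x : ∀ p → p +ₚ (-ₚ []) ≋ p
    x-0≋x p = +ₚ-identityʳ p

    combination : (p : Poly) → Poly → Set ℓ
    combination p q = ∃[ a ] ∃[ b ] (a *ₚ p) +ₚ (b *ₚ g) ≋ q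

    combination-ideal : ∀ p → Ideal.IsIdeal em F (combination p)
    combination-ideal p = record
      { resp = λ e (a , b , e′) → a , b , ≋-trans e′ e
      ; add  = λ (a , b , e) (a′ , b′ , e′) → a +ₚ a′ , b +ₚ b′ , ≋-trans (I.linear-+ a a′ b b′ p g) (+ₚ-cong e e′)
      ; mult = λ s (a , b , e) → s *ₚ a , s *ₚ b , ≋-trans (I.linear-* s a b p g) (*ₚ-congʳ s e)
      }

    g∈ : ∀ p → combination p g
    g∈ p = [] , 1ₚ , *ₚ-identityˡ g

    p∈ : ∀ p → combination p p
    p∈ p = 1ₚ , [] , ≋-trans (+ₚ-cong (*ₚ-identityˡ p) (≋-refl {[]})) (+ₚ-identityʳ p)

    unit-case : ∀ p {h a b} → Monic 0 h → (a *ₚ p) +ₚ (b *ₚ g) ≋ h → g divides (p *ₚ a +ₚ (-ₚ 1ₚ))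
    unit-case p {h} {a} {b} mh e = -ₚ b , ≋-trans (I.bezout a b p g)
      (+ₚ-cong {p *ₚ a} {p *ₚ a} { -ₚ ((a *ₚ p) +ₚ (b *ₚ g))} { -ₚ 1ₚ} ≋-refl
        (P.-‿cong {(a *ₚ p) +ₚ (b *ₚ g)} {1ₚ} (≋-trans e (monic-0 mh))))

    -- Irreducibility bounds the degree of h from below by that of g, so the cofactor of h in g is a
    -- nonzero constant and can be inverted.
    nonunit-case : ∀ {m h} → Monic (suc m) h → h divides g → g divides h
    nonunit-case {m} {h} mh (u , uh≋g) = (d ∷ []) , ≋-trans (*ₚ-congʳ (d ∷ []) (≋-trans (≋-sym uh≋g) (≋-trans (*ₚ-cong {u} {c ∷ []} {h} {h} u≋c ≋-refl) (≋-sym (•≋* c h)))))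
              (≋-trans (≋-sym (•≋* d (c • h))) (≋-trans (•-assoc d c h) (≋-trans (•-cong {d * c} {1#} {h} {h} (trans (*-comm d c) (proj₂ (inverse c c≉0))) ≋-refl) (1•p≋p h))))
      where
      bu : Below 1 u
      bu = below-quotient {1} {suc m} {u} {h} mh (below-cong (≋-sym uh≋g)
             (below-mono (s≤s (s≤s (irreducible mh (u , uh≋g)))) (bounded mg)))
      c = coeff u 0
      u≋c : u ≋ c ∷ []
      u≋c = mk λ { zero → refl ; (suc k) → vanish bu (suc k) (s≤s z≤n) }
      c≉0 : ¬ (c ≈ 0#)
      c≉0 c≈0 = monic-nonzero mg (≋-trans (≋-sym uh≋g) (*ₚ-cong {u} {[]} {h} {h} (≋-trans u≋c (≋-trans (∷-cong c≈0 (≋-refl {[]})) 0∷[]≋[])) ≋-refl))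
      d = proj₁ (inverse c c≉0)

    -- The monic generator h of the ideal of p and g divides both. If h is constant, Bézout's
    -- identity gives the inverse; otherwise g divides h by `nonunit-case`, hence p, which is
    -- excluded.
    quotient-inverse : ∀ p → ¬ (g divides (p +ₚ (-ₚ []))) → ∃[ q ] g divides (p *ₚ q +ₚ (-ₚ 1ₚ))
    quotient-inverse p g∤p = go (Ideal.generator em F (combination-ideal p) {g} (monic-nonzero mg) (g∈ p))
      where
      go : (∃[ n ] ∃[ h ] Monic n h × combination p h × (∀ q → combination p q → h divides q)) → ∃[ q ] g divides (p *ₚ q +ₚ (-ₚ 1ₚ))
      go (zero  , h , mh , (a , b , e) , div) = a , unit-case p {h} {a} {b} mh e
      go (suc m , h , mh , _ , div) = ⊥-elim (g∤p (divides-trans {g} {h} (nonunit-case mh (div g (g∈ p)))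
        (divides-trans {h} {p} (div p (p∈ p)) (1ₚ , ≋-trans (*ₚ-identityˡ p) (≋-sym (x-0≋x p))))))

  quotientField : Field ℓ
  quotientField = record
    { commutativeRing = quotientRing polynomialRing ideal
    ; 1≉0 = λ (congruent (r , e)) → unit-degree {n} {g} {r} mg (≋-trans e (x-0≋x 1ₚ))
    ; inverse = λ p p≉0 → Product.map₂ congruent (quotient-inverse p (λ d → p≉0 (congruent d)))
    }

  private module Q = Field quotientField

  ≋⇒≈ : ∀ {p q} → p ≋ q → p Q.≈ q
  ≋⇒≈ {p} {q} e = congruent ([] , ≋-sym (≋-trans (+ₚ-cong e (≋-refl { -ₚ q})) (-ₚ-inverseʳ q)))

  kronecker : Extension F
  kronecker = record
    { top = quotientField
    ; ι = λ a → a ∷ []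
    ; ι-homomorphism = record
      { isSemiringHomomorphism = record
        { isNearSemiringHomomorphism = record
          { +-isMonoidHomomorphism = record
            { isMagmaHomomorphism = record
              { isRelHomomorphism = record { cong = λ e → ≋⇒≈ (∷-cong e (≋-refl {[]})) }
              ; homo = λ a b → Q.refl {(a + b) ∷ []}
              }
            ; ε-homo = ≋⇒≈ 0∷[]≋[]
            }
          ; *-homo = λ a b → ≋⇒≈ (∷-cong (sym (+-identityʳ (a * b))) (≋-refl {[]}))
          }
        ; 1#-homo = Q.refl {1ₚ}
        }
      ; -‿homo = λ a → Q.refl {(- a) ∷ []}
      }
    }

  generic : Poly
  generic = X^ 1

  evalAt-generic : ∀ p → evalAt kronecker p generic Q.≈ p
  evalAt-generic []      = Q.refl {[]}
  evalAt-generic (a ∷ p) = Q.trans {evalAt kronecker (a ∷ p) generic} {(a ∷ []) Q.+ generic Q.* p} {a ∷ p}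
    (Q.+-congˡ {a ∷ []} {generic Q.* evalAt kronecker p generic} {generic Q.* p}
      (Q.*-congˡ {generic} {evalAt kronecker p generic} {p} (evalAt-generic p)))
    (≋⇒≈ (≋-trans (+ₚ-cong (≋-refl {a ∷ []}) (≋-trans (0∷-*ₚ 1ₚ p) (∷-cong refl (*ₚ-identityˡ p)))) (∷-cong (+-identityʳ a) (≋-refl {p}))))

  kronecker-root : ∀ {f} → g divides f → evalAt kronecker f generic Q.≈ Q.0#
  kronecker-root {f} (r , e) = Q.trans (evalAt-generic f) (congruent (r , ≋-trans e (≋-sym (x-0≋x f))))

  kronecker-algebraic : IsAlgebraic kronecker
  kronecker-algebraic = FiniteSubring.generated⇒algebraic em kronecker (suc n) generic λ p →
    let q , r , e , b = division mg p in
    r , b , Q.trans (evalAt-generic r) (congruent (-ₚ q , ≋-trans (I.remainder q g r)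
      (+ₚ-cong (≋-refl {r}) (P.-‿cong {(q *ₚ g) +ₚ r} {p} (≋-sym e)))))

-- Splitting fields

module RootExtension (em : EM) (F : Field ℓ) where
  open Field F hiding (zero)
  open PolynomialRing F
  open Degree F
  open ClassicalDegree em F

  private
    MonicDivisor : Poly → ℕ → Set ℓ
    MonicDivisor f n = ∃[ g ] Monic (suc n) g × g divides f

    some-divisor : ∀ f → IsNonconstant f → ∃ (MonicDivisor f)
    some-divisor f (k , ¬z) = go (exact-degree {f} λ e → ¬z (at e (suc k)))
      where
      go : (∃[ n ] ¬ (coeff f n ≈ 0#) × Below (suc n) f) → ∃ (MonicDivisor f)
      go (zero , ¬z′ , b) = ⊥-elim (¬z (vanish b (suc k) (s≤s z≤n)))
      go (suc n , ¬z′ , b) = let c , c≉0 , m = scale-monic {suc n} {f} ¬z′ b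
                                 d , cd≈1 = inverse c c≉0 in
        n , c • f , m , (d ∷ []) , ≋-trans (≋-sym (•≋* d (c • f))) (≋-trans (•-assoc d c f)
          (≋-trans (•-cong {d * c} {1#} {f} {f} (trans (*-comm d c) cd≈1) ≋-refl) (1•p≋p f)))

  -- A monic divisor of least positive degree serves as the irreducible factor, so no factorisation
  -- of f is required.
  root-extension : ∀ f → IsNonconstant f →
                   Σ (Extension F) λ L → IsAlgebraic L × ∃[ x ] Extension._≈_ L (evalAt L f x) (Extension.0# L)
  root-extension f nc = go (least em (MonicDivisor f) (some-divisor f nc))
    where
    go : (∃[ n ] MonicDivisor f n × (∀ m → m ℕ.< n → ¬ MonicDivisor f m)) → _
    go (n , (g , mg , g∣f) , minimal) = K.kronecker , K.kronecker-algebraic , K.generic , K.kronecker-root g∣f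
      where
      irreducible : ∀ {m h} → Monic (suc m) h → h divides g → n ℕ.≤ m
      irreducible {m} {h} mh h∣g = ℕ.≮⇒≥ λ m<n → minimal m m<n (h , mh , divides-trans {h} {g} {f} h∣g g∣f)
      module K = Kronecker em F mg irreducible

trivial-algebraic : (F : Field ℓ) → IsAlgebraic (trivialExtension F)
trivial-algebraic F x = X- x , (1 , 1≉0) , trans (reflexive (≡.cong (λ p → eval p x) (List.map-id (X- x)))) (trans (eval-X- x x) (-‿inverseʳ x))
  where
  open Field F
  open PolynomialRing F

SplitsSomewhere : (F : Field ℓ) → PolynomialRing.Poly F → Set (lsuc ℓ)
SplitsSomewhere F f = Σ (Extension F) λ L → IsAlgebraic L ×
  ∃[ rs ] PolynomialRing._≋_ (Extension.top L) (map (Extension.ι L) f) (Degree.linears (Extension.top L) rs)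

compose-splitting : {F : Field ℓ} (L : Extension F) (M : Extension (Extension.top L)) → ∀ f f₁ x rs →
  let module L = PolynomialRing (Extension.top L) ; module M = PolynomialRing (Extension.top M) in
  f₁ L.*ₚ (L.X- x) L.≋ map (Extension.ι L) f →
  map (Extension.ι M) f₁ M.≋ Degree.linears (Extension.top M) rs →
  map (Extension.ι (compose L M)) f M.≋ Degree.linears (Extension.top M) (Extension.ι M x ∷ rs)
compose-splitting L M f f₁ x rs e e′ = ≡.subst (_≋ Degree.linears M.top (M.ι x ∷ rs)) (≡.sym (List.map-∘ f))
    (≋-trans (map-cong-≋ {F = L.top} {G = M.top} M.ι-homomorphism (L[X].≋-sym e))
    (≋-trans (map-*ₚ {F = L.top} {G = M.top} M.ι-homomorphism f₁ (L[X].X- x))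
      (*ₚ-cong {map M.ι f₁} {Degree.linears M.top rs} {map M.ι (L[X].X- x)} {X- (M.ι x)} e′ map-X-)))
  where
  module L = Extension L
  module M = Extension M
  open PolynomialRing M.top using (_≋_; ≋-trans; *ₚ-cong; ∷-cong; ≋-refl; X-_)
  module L[X] = PolynomialRing L.top
  map-X- : map M.ι (L[X].X- x) ≋ X- (M.ι x)
  map-X- = ∷-cong (Homomorphism.-‿homo {F = L.top} {G = M.top} M.ι-homomorphism x)
             (∷-cong (Homomorphism.1#-homo {F = L.top} {G = M.top} M.ι-homomorphism) (≋-refl {[]}))

-- The induction hypothesis ranges over all fields, because the quotient by X - x lives over the
-- extension in which the root x was adjoined.
module SplittingStep (em : EM) (n : ℕ) (split : ∀ (F : Field ℓ) f → Degree.Monic F n f → SplitsSomewhere F f)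
                     (F : Field ℓ) (f : PolynomialRing.Poly F) (m : Degree.Monic F (suc n) f) where
  private
    factored : (L : Extension F) → IsAlgebraic L → ∀ x → let module L = PolynomialRing (Extension.top L) in
               (∃[ f₁ ] f₁ L.*ₚ (L.X- x) L.≋ map (Extension.ι L) f) → SplitsSomewhere F f
    factored L algL x (f₁ , e) = go (split L.top f₁ (ClassicalDegree.monic-factor em L.top {x} {n} {map L.ι f} {f₁} (monic-map L m) e))
      where
      module L = Extension L
      go : SplitsSomewhere L.top f₁ → SplitsSomewhere F f
      go (M , algM , rs , e′) = compose L M , algebraic-trans em L M algL algM , Extension.ι M x ∷ rs , compose-splitting L M f f₁ x rs e e′

    rooted : (Σ (Extension F) λ L → IsAlgebraic L × ∃[ x ] Extension._≈_ L (evalAt L f x) (Extension.0# L)) → SplitsSomewhere F f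
    rooted (L , algL , x , root) = factored L algL x (Degree.factor (Extension.top L) {map (Extension.ι L) f} {x} root)

  splitting-step : SplitsSomewhere F f
  splitting-step = rooted (RootExtension.root-extension em F f
    (n , λ z → Field.1≉0 F (Field.trans F (Field.sym F (Degree.leading m)) z)))

splitting : EM → ∀ n (F : Field ℓ) f → Degree.Monic F n f → SplitsSomewhere F f
splitting em zero F f m = trivialExtension F , trivial-algebraic F , [] ,
  ≡.subst (λ p → p ≋ 1ₚ) (≡.sym (List.map-id f)) (Degree.monic-0 F m)
  where open PolynomialRing F
splitting em (suc n) = SplittingStep.splitting-step em n (splitting em n)

-- Roots of unity

module Unity (F : Field ℓ) where
  open Field F hiding (zero)
  open FieldProperties F
  open PolynomialRing F
  open Degree F
  open SetoidReasoning setoid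

  ^-of-1 : ∀ {x} d → x ≈ 1# → x ^ d ≈ 1#
  ^-of-1 d e = trans (^-congˡ d e) (1^n≈1 d)

  ^-multiple : ∀ {x M m} → x ^ M ≈ 1# → M ∣ m → x ^ m ≈ 1#
  ^-multiple {x} {M} {m} e (∣.divides d m≡dM) = begin
    x ^ m          ≡⟨ ≡.cong (x ^_) (≡.trans m≡dM (ℕ.*-comm d M)) ⟩
    x ^ (M ℕ.* d)  ≈⟨ ^-assocʳ x M d ⟨
    (x ^ M) ^ d    ≈⟨ ^-of-1 d e ⟩
    1#             ∎

  root-nonzero : ∀ {x M} → x ^ suc M ≈ 1# → ¬ (x ≈ 0#)
  root-nonzero e x≈0 = 1≉0 (trans (sym e) (trans (*-congʳ x≈0) (zeroˡ _)))

  power-quotient : ∀ {x} a d → ¬ (x ≈ 0#) → x ^ a ≈ x ^ (a ℕ.+ d) → x ^ d ≈ 1#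
  power-quotient {x} a d x≉0 e = *-cancelˡ (^-nonzero a x≉0) (trans (sym (^-homo-* x a d)) (trans (sym e) (sym (*-identityʳ _))))

  record IsOrder (x : Carrier) (M : ℕ) : Set ℓ where
    field
      positive : 0 ℕ.< M
      isRoot   : x ^ M ≈ 1#
      minimal  : ∀ m → x ^ m ≈ 1# → M ∣ m

    nonzero : ¬ (x ≈ 0#)
    nonzero x≈0 = 1≉0 (trans (sym isRoot) (zero-power positive))
      where
      zero-power : ∀ {M} → 0 ℕ.< M → x ^ M ≈ 0#
      zero-power (s≤s _) = trans (*-congʳ x≈0) (zeroˡ _)

  order-exists : EM → ∀ {x m} → x ^ suc m ≈ 1# → ∃ (IsOrder x)
  order-exists em {x} {m} e with least em (λ m → x ^ suc m ≈ 1#) (m , e)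
  ... | M , root , minimal = suc M , record { positive = s≤s z≤n ; isRoot = root ; minimal = divisible }
    where
    divisible : ∀ m → x ^ m ≈ 1# → suc M ∣ m
    divisible m e with m DivMod.% suc M in eq
    ... | zero  = ∣.m%n≡0⇒n∣m m (suc M) eq
    ... | suc r = ⊥-elim (minimal r (ℕ.≤-pred (≡.subst (ℕ._< suc M) eq (DivMod.m%n<n m (suc M)))) (begin
      x ^ suc r                                           ≈⟨ *-identityʳ _ ⟨
      x ^ suc r * 1#                                      ≈⟨ *-congˡ (^-multiple {x} {suc M} root (∣.n∣m*n (m DivMod./ suc M))) ⟨
      x ^ suc r * x ^ (m DivMod./ suc M ℕ.* suc M)        ≈⟨ ^-homo-* x (suc r) _ ⟨
      x ^ (suc r ℕ.+ m DivMod./ suc M ℕ.* suc M)          ≡⟨ ≡.cong (λ k → x ^ (k ℕ.+ m DivMod./ suc M ℕ.* suc M)) eq ⟨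
      x ^ (m DivMod.% suc M ℕ.+ m DivMod./ suc M ℕ.* suc M) ≡⟨ ≡.cong (x ^_) (DivMod.m≡m%n+[m/n]*n m (suc M)) ⟨
      x ^ m                                               ≈⟨ e ⟩
      1#                                                  ∎))

  unity : ℕ → Poly
  unity M = (X^ M) +ₚ (-ₚ 1ₚ)

  eval-unity : ∀ M x → eval (unity M) x ≈ x ^ M - 1#
  eval-unity M x = trans (eval-+ (X^ M) (-ₚ 1ₚ) x) (+-cong (eval-X^ M x) (trans (eval-neg 1ₚ x) (-‿cong (eval-1 x))))

  monic-X^ : ∀ M → Monic M (X^ M)
  monic-X^ zero    = monic-1ₚ
  monic-X^ (suc M) = monic (leading (monic-X^ M)) (below-∷ 0# (bounded (monic-X^ M)))

  monic-unity : ∀ {M} → 0 ℕ.< M → Monic M (unity M)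
  monic-unity {suc M} _ = monic
    (trans (coeff-+ (X^ suc M) (-ₚ 1ₚ) (suc M)) (trans (+-identityʳ _) (leading (monic-X^ (suc M)))))
    (below-+ (bounded (monic-X^ (suc M))) (below-mono (s≤s z≤n) (below-neg (bounded monic-1ₚ))))

  -- The difference of two monic polynomials of degree n has degree below n; with n distinct roots
  -- it vanishes.
  monic-split : ∀ {n p xs} → Monic n p → Distinct xs → All (Root p) xs → length xs ≡ n → p ≋ linears xs
  monic-split {p = p} {xs} m d rs ≡.refl = ≋-trans (I.x≈[x-y]+y p (linears xs)) (+ₚ-cong (roots-bound d (All.map root (All.zip (rs , All.map linears-root⁻ (self-members xs)))) low) (≋-refl {linears xs}))
    where
    module I = RingIdentities polynomialRing
    root : ∀ {x} → Root p x × Root (linears xs) x → Root (p +ₚ (-ₚ linears xs)) x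
    root {x} (r , s) = begin
      eval (p +ₚ (-ₚ linears xs)) x         ≈⟨ eval-+ p (-ₚ linears xs) x ⟩
      eval p x + eval (-ₚ linears xs) x     ≈⟨ +-cong r (trans (eval-neg (linears xs) x) (-‿cong s)) ⟩
      0# - 0#                               ≈⟨ -‿inverseʳ 0# ⟩
      0#                                    ∎
    low : Below (length xs) (p +ₚ (-ₚ linears xs))
    low = below-pred (below-+ (bounded m) (below-neg (bounded (monic-linears xs)))) (begin
      coeff (p +ₚ (-ₚ linears xs)) (length xs)                     ≈⟨ coeff-+ p (-ₚ linears xs) (length xs) ⟩
      coeff p (length xs) + coeff (-ₚ linears xs) (length xs)      ≈⟨ +-cong (leading m) (trans (coeff-neg (linears xs) (length xs)) (-‿cong (leading (monic-linears xs)))) ⟩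
      1# - 1#                                                      ≈⟨ -‿inverseʳ 1# ⟩
      0#                                                           ∎)

  powers : Carrier → ℕ → List Carrier
  powers x M = applyUpTo (x ^_) M

  module _ {x M} (ord : IsOrder x M) where
    open IsOrder ord

    powers-distinct : Distinct (powers x M)
    powers-distinct = AllPairs.applyUpTo⁺₁ (x ^_) M λ {i} {j} i<j j<M e →
      let d = j ℕ.∸ i ; j≡ = ℕ.m+[n∸m]≡n (ℕ.<⇒≤ i<j) in
      ∣.>⇒∤ {{ℕ.>-nonZero (ℕ.m<n⇒0<n∸m i<j)}} (ℕ.≤-<-trans (ℕ.m∸n≤m j i) j<M)
        (minimal d (power-quotient i d nonzero (trans e (reflexive (≡.cong (x ^_) (≡.sym j≡))))))

    -- The powers 1, x, ..., x^(M-1) are M distinct roots. The existence of an element of order M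
    -- thus replaces any condition that M be prime to the characteristic.
    unity≋powers : unity M ≋ linears (powers x M)
    unity≋powers = monic-split (monic-unity positive) powers-distinct
      (All.applyUpTo⁺₂ (x ^_) M λ i → trans (eval-unity M (x ^ i)) (x≈y⇒x-y≈0 (begin
        (x ^ i) ^ M    ≈⟨ ^-assocʳ x i M ⟩
        x ^ (i ℕ.* M)  ≈⟨ ^-multiple {x} {M} isRoot (∣.n∣m*n i) ⟩
        1#             ∎)))
      (List.length-applyUpTo (x ^_) M)

    is-power : EM → ∀ {z} → z ^ M ≈ 1# → ∃[ i ] z ≈ x ^ i
    is-power em {z} e = go (Any.applyUpTo⁻ (x ^_) {n = M} any)
      where
      any : Any (z ≈_) (powers x M)
      any = ClassicalDegree.linears-root em F {powers x M} (trans (eval-cong (≋-sym unity≋powers) refl)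
              (trans (eval-unity M z) (x≈y⇒x-y≈0 e)))
      go : (∃[ i ] i ℕ.< M × z ≈ x ^ i) → ∃[ i ] z ≈ x ^ i
      go (i , _ , z≈) = i , z≈

module _ {F G : Field ℓ} where
  private
    module F = Field F
    module G = Field G
    module FU = Unity F
    module GU = Unity G
    module FP = FieldProperties F
    module GP = FieldProperties G

  -- A relation between powers of an element of order M depends only on the exponents modulo M, so
  -- it carries over to every z with z^M = 1, even in another field. This moves relations from y to
  -- its lift ζ.
  transfer-powers : ∀ {x M z} → FU.IsOrder x M → z GP.^ M G.≈ G.1# → ∀ a b → x FP.^ a F.≈ x FP.^ b → z GP.^ a G.≈ z GP.^ b
  transfer-powers {x} {M} {z} ord root a b e = go (ℕ.≤-total a b)
    where
    ordered : ∀ a b → a ℕ.≤ b → x FP.^ a F.≈ x FP.^ b → z GP.^ a G.≈ z GP.^ b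
    ordered a b a≤b e = G.trans (G.sym (G.*-identityʳ _)) (G.trans (G.*-congˡ (G.sym (GU.^-multiple {z} {M} root
      (FU.IsOrder.minimal ord d (FU.power-quotient a d (FU.IsOrder.nonzero ord) (F.trans e (F.reflexive (≡.cong (x FP.^_) (≡.sym b≡)))))))))
      (G.trans (G.sym (GP.^-homo-* z a d)) (G.reflexive (≡.cong (z GP.^_) b≡))))
      where
      d = b ℕ.∸ a
      b≡ = ℕ.m+[n∸m]≡n a≤b
    go : a ℕ.≤ b ⊎ b ℕ.≤ a → z GP.^ a G.≈ z GP.^ b
    go (inj₁ a≤b) = ordered a b a≤b e
    go (inj₂ b≤a) = G.sym (ordered b a b≤a (F.sym e))

module _ (em : EM) {F : Field ℓ} (finite : IsFinite F) (L : Extension F) where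
  private
    module F = Field F
    module F[X] = PolynomialRing F
    N = proj₁ finite
    module inv = Inverse (proj₂ finite)
  open Extension L hiding (zero)
  open FieldProperties top using (_^_)
  open PolynomialRing F using (X^_; coeff; _≋_; mk)
  open Degree F

  private
    evalAt-X^ : ∀ m x → evalAt L (X^ m) x ≈ x ^ m
    evalAt-X^ zero    x = evalAt-1 L x
    evalAt-X^ (suc m) x = trans (+-cong (Homomorphism.0#-homo {F = F} {G = top} ι-homomorphism) (*-congˡ (evalAt-X^ m x))) (+-identityˡ _)

    remainders : ∀ {n p x} → Monic n p → evalAt L p x ≈ 0# → ∀ m → ∃[ r ] Below n r × evalAt L r x ≈ x ^ m
    remainders {n} {p} {x} mp root m = let q , r , e , b = division mp (X^ m) in r , b ,
      trans (sym (trans (evalAt-+ L (q F[X].*ₚ p) r x) (trans (+-congʳ (trans (evalAt-* L q p x) (trans (*-congˡ root) (zeroʳ _)))) (+-identityˡ _))))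
        (trans (evalAt-cong L {q F[X].*ₚ p F[X].+ₚ r} {X^ m} (F[X].≋-sym e) refl) (evalAt-X^ m x))

  -- Modulo an equation of degree n, the remainder of X^m has n coefficients in a field of N
  -- elements, so there are at most N^n remainders and two of the first N^n + 1 powers agree.
  powers-repeat : ∀ {x} → FiniteSubring.Algebraic em L x → ∃[ i ] ∃[ j ] i ℕ.< j × x ^ i ≈ x ^ j
  powers-repeat {x} alg = repeat (monic-algebraic em L alg)
    where
    repeat : (∃[ n ] ∃[ p ] Monic n p × evalAt L p x ≈ 0#) → ∃[ i ] ∃[ j ] i ℕ.< j × x ^ i ≈ x ^ j
    repeat (n , p , mp , root) = go (Fin.pigeonhole (ℕ.n<1+n (N ℕ.^ n)) (λ m → Fin.funToFin (code (toℕ m))))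
      where
      rem : ∀ m → ∃[ r ] Below n r × evalAt L r x ≈ x ^ m
      rem = remainders mp root
      code : ℕ → Fin n → Fin N
      code m i = inv.from (coeff (proj₁ (rem m)) (toℕ i))
      same-code : ∀ {a b} → Fin.funToFin (code a) ≡ Fin.funToFin (code b) → ∀ i → code a i ≡ code b i
      same-code {a} {b} e i = ≡.trans (≡.sym (Fin.finToFun-funToFin (code a) i))
        (≡.trans (≡.cong (λ k → Fin.finToFun k i) e) (Fin.finToFun-funToFin (code b) i))
      same : ∀ {a b} → (∀ i → code a i ≡ code b i) → proj₁ (rem a) ≋ proj₁ (rem b)
      same {a} {b} codes = mk λ k → by-cases k (k ℕ.<? n)
        where
        coeffs : ∀ (i : Fin n) → coeff (proj₁ (rem a)) (toℕ i) F.≈ coeff (proj₁ (rem b)) (toℕ i)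
        coeffs i = F.trans (F.sym (inv.strictlyInverseˡ _)) (F.trans (F.reflexive (≡.cong inv.to (codes i))) (inv.strictlyInverseˡ _))
        by-cases : ∀ k → Dec (k ℕ.< n) → coeff (proj₁ (rem a)) k F.≈ coeff (proj₁ (rem b)) k
        by-cases k (yes k<n) = ≡.subst (λ k → coeff (proj₁ (rem a)) k F.≈ coeff (proj₁ (rem b)) k) (Fin.toℕ-fromℕ< k<n) (coeffs (Fin.fromℕ< k<n))
        by-cases k (no k≮n)  = F.trans (vanish (proj₁ (proj₂ (rem a))) k (ℕ.≮⇒≥ k≮n)) (F.sym (vanish (proj₁ (proj₂ (rem b))) k (ℕ.≮⇒≥ k≮n)))
      go : (∃[ a ] ∃[ b ] (toℕ a ℕ.< toℕ b) × Fin.funToFin (code (toℕ a)) ≡ Fin.funToFin (code (toℕ b))) → ∃[ i ] ∃[ j ] i ℕ.< j × x ^ i ≈ x ^ j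
      go (a , b , a<b , e) = toℕ a , toℕ b , a<b , trans (sym (proj₂ (proj₂ (rem (toℕ a)))))
        (trans (evalAt-cong L (same {toℕ a} {toℕ b} (same-code {toℕ a} {toℕ b} e)) refl) (proj₂ (proj₂ (rem (toℕ b)))))

  algebraic⇒unity : ∀ {x} → FiniteSubring.Algebraic em L x → ¬ (x ≈ 0#) → ∃ (Unity.IsOrder top x)
  algebraic⇒unity {x} alg x≉0 = go (powers-repeat alg)
    where
    go : (∃[ i ] ∃[ j ] i ℕ.< j × x ^ i ≈ x ^ j) → ∃ (Unity.IsOrder top x)
    go (i , j , i<j , e) = Unity.order-exists top em {x} {d} (Unity.power-quotient top {x} i (suc d) x≉0
      (trans e (reflexive (≡.cong (x ^_) (≡.sym (≡.trans (ℕ.+-suc i d) (ℕ.m+[n∸m]≡n i<j)))))))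
      where d = j ℕ.∸ suc i

-- Valuations

module ValuationProperties {F : Field ℓ} (V : Valuation F) where
  open Field F hiding (zero)
  open FieldProperties F
  open Valuation V
  private
    module Γ = OrderedAbelianGroup valueGroup
    module ≤⁺ = IsDecTotalOrder (Γ.≤⁺-isDecTotalOrder Γ.isDecTotalOrder)
    module E = ≤⁺.Eq
  open Γ using (_≤⁺_; _≈⁺_; _⊕_; ε; [_]) renaming (⊤⁺≈⊤⁺ to ∙≈∙)
  open RawMonoidDefs Γ.rawMonoid using () renaming (_×_ to _·_)

  infix 4 _≼_ _~_
  -- A preorder on the field in place of the order of the value group, so that valuations with
  -- unrelated value groups can be compared. Integrality of x is 1 ≼ x, membership in the maximal
  -- ideal is ¬ (x ≼ 1), and 0 is a largest element.
  record _≼_ (x y : Carrier) : Set ℓ where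
    constructor le
    field get : v x ≤⁺ v y
  open _≼_ public

  _~_ : Carrier → Carrier → Set ℓ
  x ~ y = x ≼ y × y ≼ x

  ≼-refl : ∀ {x} → x ≼ x
  ≼-refl = le ≤⁺.refl

  ≼-trans : ∀ {x y z} → x ≼ y → y ≼ z → x ≼ z
  ≼-trans (le p) (le q) = le (≤⁺.trans p q)

  ≼-total : ∀ x y → x ≼ y ⊎ y ≼ x
  ≼-total x y with ≤⁺.total (v x) (v y)
  ... | inj₁ p = inj₁ (le p)
  ... | inj₂ p = inj₂ (le p)

  ≈⇒≼ : ∀ {x y} → x ≈ y → x ≼ y
  ≈⇒≼ e = le (≤⁺.reflexive (v-cong e))

  ≼-resp : ∀ {x x′ y y′} → x ≈ x′ → y ≈ y′ → x ≼ y → x′ ≼ y′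
  ≼-resp e f p = ≼-trans (≈⇒≼ (sym e)) (≼-trans p (≈⇒≼ f))

  ⋠⇒≽ : ∀ {x y} → ¬ (x ≼ y) → y ≼ x
  ⋠⇒≽ {x} {y} ¬p with ≼-total x y
  ... | inj₁ p = ⊥-elim (¬p p)
  ... | inj₂ p = p

  ≼-+ : ∀ {x y z} → z ≼ x → z ≼ y → z ≼ x + y
  ≼-+ {x} {y} (le p) (le q) with v-+ x y
  ... | inj₁ r = le (≤⁺.trans p r)
  ... | inj₂ r = le (≤⁺.trans q r)

  private
    ⊕-monoʳ : ∀ c {a b} → a ≤⁺ b → c ⊕ a ≤⁺ c ⊕ b
    ⊕-monoʳ ⊤⁺    p            = _ Γ.≤⊤⁺
    ⊕-monoʳ [ c ] Γ.[ p ]      = Γ.[ Γ.∙-monoʳ-≤ c p ]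
    ⊕-monoʳ [ c ] (_ Γ.≤⊤⁺)    = _ Γ.≤⊤⁺

    v-0 : v 0# ≈⁺ ⊤⁺
    v-0 = Equivalence.from (v-∞ 0#) refl

    ≈∞ : ∀ {a} → ⊤⁺ ≤⁺ a → a ≈⁺ ⊤⁺
    ≈∞ (_ Γ.≤⊤⁺) = ∙≈∙

  ≼-0 : ∀ {x} → x ≼ 0#
  ≼-0 {x} = le (≤⁺.≤-respʳ-≈ (E.sym v-0) (v x Γ.≤⊤⁺))

  0-≼ : ∀ {x} → 0# ≼ x → x ≈ 0#
  0-≼ {x} (le p) = Equivalence.to (v-∞ x) (≈∞ (≤⁺.≤-respˡ-≈ v-0 p))

  ≼-*ˡ : ∀ z {x y} → x ≼ y → z * x ≼ z * y
  ≼-*ˡ z {x} {y} (le p) = le (≤⁺.≤-respˡ-≈ (E.sym (v-* z x)) (≤⁺.≤-respʳ-≈ (E.sym (v-* z y)) (⊕-monoʳ (v z) p)))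

  ≼-*ʳ : ∀ z {x y} → x ≼ y → x * z ≼ y * z
  ≼-*ʳ z p = ≼-resp (*-comm _ _) (*-comm _ _) (≼-*ˡ z p)

  ≼-* : ∀ {x x′ y y′} → x ≼ x′ → y ≼ y′ → x * y ≼ x′ * y′
  ≼-* {x} {x′} {y} {y′} p q = ≼-trans (≼-*ʳ y p) (≼-*ˡ x′ q)

  ≼-cancelˡ : ∀ {z x y} → ¬ (z ≈ 0#) → z * x ≼ z * y → x ≼ y
  ≼-cancelˡ {z} {x} {y} z≉0 p with inverse z z≉0
  ... | z′ , e = ≼-resp (reduce x) (reduce y) (≼-*ˡ z′ p)
    where
    reduce : ∀ x → z′ * (z * x) ≈ x
    reduce x = trans (solve 3 (λ z z′ x → z′ :* (z :* x) := (z :* z′) :* x) refl z z′ x) (trans (*-congʳ e) (*-identityˡ x))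

  ~-refl : ∀ {x} → x ~ x
  ~-refl = ≼-refl , ≼-refl

  ~-sym : ∀ {x y} → x ~ y → y ~ x
  ~-sym (p , q) = q , p

  ~-trans : ∀ {x y z} → x ~ y → y ~ z → x ~ z
  ~-trans (p , q) (p′ , q′) = ≼-trans p p′ , ≼-trans q′ q

  ≈⇒~ : ∀ {x y} → x ≈ y → x ~ y
  ≈⇒~ e = ≈⇒≼ e , ≈⇒≼ (sym e)

  ~-* : ∀ {x x′ y y′} → x ~ x′ → y ~ y′ → x * y ~ x′ * y′
  ~-* (p , q) (p′ , q′) = ≼-* p p′ , ≼-* q q′

  ~-^ : ∀ {x y} n → x ~ y → x ^ n ~ y ^ n
  ~-^ zero    p = ~-refl
  ~-^ (suc n) p = ~-* p (~-^ n p)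

  ~-cancelˡ : ∀ {z x y} → ¬ (z ≈ 0#) → z * x ~ z * y → x ~ y
  ~-cancelˡ z≉0 (p , q) = ≼-cancelˡ z≉0 p , ≼-cancelˡ z≉0 q

  ~-nonzero : ∀ {x y} → x ~ y → ¬ (x ≈ 0#) → ¬ (y ≈ 0#)
  ~-nonzero (p , q) x≉0 y≈0 = x≉0 (0-≼ (≼-resp y≈0 refl q))

  private
    1~-1 : 1# ~ - 1#
    1~-1 with ≼-total 1# (- 1#)
    ... | inj₁ p = p , ≼-resp (*-identityʳ _) (solve 0 ((:- con (+ 1)) :* (:- con (+ 1)) := con (+ 1)) refl) (≼-*ˡ (- 1#) p)
    ... | inj₂ p = ≼-resp (solve 0 ((:- con (+ 1)) :* (:- con (+ 1)) := con (+ 1)) refl) (*-identityʳ _) (≼-*ˡ (- 1#) p) , p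

  ~-neg : ∀ x → x ~ - x
  ~-neg x = ~-trans (≈⇒~ (sym (*-identityˡ x))) (~-trans (~-* 1~-1 ~-refl) (≈⇒~ (solve 1 (λ x → (:- con (+ 1)) :* x := :- x) refl x)))

  ≼-- : ∀ {x y z} → z ≼ x → z ≼ y → z ≼ x - y
  ≼-- p q = ≼-+ p (≼-trans q (proj₁ (~-neg _)))

  ^-mono : ∀ {x y} n → x ≼ y → x ^ n ≼ y ^ n
  ^-mono zero    p = ≼-refl
  ^-mono (suc n) p = ≼-* p (^-mono n p)

  -- This is torsion-freeness of ordered groups. If y ≼ x, then x yⁿ ≼ xⁿ⁺¹ ≼ yⁿ⁺¹, and yⁿ cancels.
  ^-cancel : ∀ {x y} n → ¬ (y ≈ 0#) → x ^ suc n ≼ y ^ suc n → x ≼ y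
  ^-cancel {x} {y} n y≉0 p with ≼-total x y
  ... | inj₁ q = q
  ... | inj₂ y≼x = ≼-cancelˡ (^-nonzero n y≉0) (≼-resp (*-comm _ _) (*-comm _ _) (≼-trans (≼-*ˡ x (^-mono n y≼x)) p))

  ~-root : ∀ {x y} n → ¬ (x ≈ 0#) → x ^ suc n ~ y ^ suc n → x ~ y
  ~-root {x} {y} n x≉0 (p , q) = ^-cancel n y≉0 p , ^-cancel n x≉0 q
    where
    y≉0 : ¬ (y ≈ 0#)
    y≉0 y≈0 = ~-nonzero (p , q) (^-nonzero (suc n) x≉0) (trans (*-congʳ y≈0) (zeroˡ _))

  private
    idempotent : ∀ {a} → ¬ (a ≈⁺ ⊤⁺) → a ≈⁺ a ⊕ a → a ≈⁺ [ ε ]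
    idempotent {⊤⁺}    a≉∞ _       = ⊥-elim (a≉∞ ∙≈∙)
    idempotent {[ a ]} _   Γ.[ p ] = Γ.[ GroupProperties.identityˡ-unique Γ.group a a (Γ.sym p) ]

  v-1 : v 1# ≈⁺ [ ε ]
  v-1 = idempotent (λ v1≈∞ → 1≉0 (Equivalence.to (v-∞ 1#) v1≈∞)) (E.trans (v-cong (sym (*-identityˡ 1#))) (v-* 1# 1#))

  v-finite : ∀ {x} → ¬ (x ≈ 0#) → ∃[ γ ] v x ≈⁺ [ γ ]
  v-finite {x} x≉0 = go (v x) E.refl
    where
    go : ∀ a → v x ≈⁺ a → ∃[ γ ] v x ≈⁺ [ γ ]
    go ⊤⁺    e = ⊥-elim (x≉0 (Equivalence.to (v-∞ x) e))
    go [ γ ] e = γ , e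

  finite-nonzero : ∀ {x γ} → v x ≈⁺ [ γ ] → ¬ (x ≈ 0#)
  finite-nonzero {x} {γ} e x≈0 with E.trans (E.sym (Equivalence.from (v-∞ x) x≈0)) e
  ... | ()

  private
    ⊕-cong : ∀ {a a′ b b′} → a ≈⁺ a′ → b ≈⁺ b′ → a ⊕ b ≈⁺ a′ ⊕ b′
    ⊕-cong ∙≈∙     _       = ∙≈∙
    ⊕-cong Γ.[ _ ] ∙≈∙     = ∙≈∙
    ⊕-cong Γ.[ p ] Γ.[ q ] = Γ.[ Γ.∙-cong p q ]

  v-*-finite : ∀ {x y γ δ} → v x ≈⁺ [ γ ] → v y ≈⁺ [ δ ] → v (x * y) ≈⁺ [ γ Γ.∙ δ ]
  v-*-finite {x} {y} p q = E.trans (v-* x y) (⊕-cong p q)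

  v-^ : ∀ {x γ} n → v x ≈⁺ [ γ ] → v (x ^ n) ≈⁺ [ n · γ ]
  v-^ zero    e = v-1
  v-^ (suc n) e = v-*-finite e (v-^ n e)

  v-≈⇒~ : ∀ {x y γ} → v x ≈⁺ [ γ ] → v y ≈⁺ [ γ ] → x ~ y
  v-≈⇒~ p q = le (≤⁺.reflexive (E.trans p (E.sym q))) , le (≤⁺.reflexive (E.trans q (E.sym p)))

  ~⇒v-≈ : ∀ {x y} → x ~ y → v x ≈⁺ v y
  ~⇒v-≈ (le p , le q) = ≤⁺.antisym p q

  -- Since every value is attained, divisibility by n in the value group amounts to n-th roots up to
  -- units; this and its converse let the later arguments speak about elements only.
  divisible⇒roots : ∀ n → IsDivisibleBy n valueGroup → ∀ {x} → ¬ (x ≈ 0#) → ∃[ y ] ¬ (y ≈ 0#) × y ^ n ~ x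
  divisible⇒roots n div {x} x≉0 =
    let γ , vx = v-finite x≉0
        δ , nδ≈γ = div γ
        y , vy = surjective δ
    in y , finite-nonzero vy , v-≈⇒~ (E.trans (v-^ n vy) Γ.[ nδ≈γ ]) vx

  roots⇒divisible : ∀ n → (∀ {x} → ¬ (x ≈ 0#) → ∃[ y ] ¬ (y ≈ 0#) × y ^ n ~ x) → IsDivisibleBy n valueGroup
  roots⇒divisible n roots γ =
    let x , vx = surjective γ
        y , y≉0 , yⁿ~x = roots (finite-nonzero vx)
        δ , vy = v-finite y≉0
    in δ , unbox (E.trans (E.sym (v-^ n vy)) (E.trans (~⇒v-≈ yⁿ~x) vx))
    where
    unbox : ∀ {a b} → [ a ] ≈⁺ [ b ] → a Γ.≈ b
    unbox Γ.[ p ] = p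

  -- For π ≠ 0 this says that the value of π is not n times another value, expressed without
  -- reference to the value group.
  NotPower : ℕ → Carrier → Set ℓ
  NotPower n π = ∀ {z} → ¬ (z ≈ 0#) → ¬ (z ^ n ~ π)

  -- the values of π ^ i, for i < n, are incongruent modulo n times the value group
  Incongruent : ℕ → Carrier → Set ℓ
  Incongruent n π = ∀ {x y} (i j : Fin n) → ¬ (x ≈ 0#) → ¬ (y ≈ 0#) → x ^ n * π ^ toℕ i ~ y ^ n * π ^ toℕ j → i ≡ j

  open Residue V public using (InValuationRing; InMaximalIdeal)

  integral⇒ : ∀ {x} → InValuationRing x → 1# ≼ x
  integral⇒ p = le (≤⁺.≤-respˡ-≈ (E.sym v-1) p)

  integral⇐ : ∀ {x} → 1# ≼ x → InValuationRing x
  integral⇐ (le p) = ≤⁺.≤-respˡ-≈ v-1 p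

  maximal⇒ : ∀ {x} → InMaximalIdeal x → ¬ (x ≼ 1#)
  maximal⇒ m (le p) = m (≤⁺.≤-respʳ-≈ v-1 p)

  maximal⇐ : ∀ {x} → ¬ (x ≼ 1#) → InMaximalIdeal x
  maximal⇐ m p = m (le (≤⁺.≤-respʳ-≈ (E.sym v-1) p))

  unity~1 : ∀ {x M} → x ^ suc M ≈ 1# → x ~ 1#
  unity~1 {x} {M} e = ~-root M (Unity.root-nonzero F {x} {M} e) (≈⇒~ (trans e (sym (1^n≈1 (suc M)))))

-- Restriction of valuations along embeddings

module Pullback (em : EM) {F G : Field ℓ} {φ : Field.Carrier F → Field.Carrier G}
                (hom : IsRingHomomorphism (Field.rawRing F) (Field.rawRing G) φ) (W : Valuation G) where
  private
    module F = Field F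
    module G = Field G
    module W = Valuation W
    module Δ = OrderedAbelianGroup W.valueGroup
    module ≤ = IsDecTotalOrder Δ.isDecTotalOrder
    module ≤⁺ = IsDecTotalOrder (Δ.≤⁺-isDecTotalOrder Δ.isDecTotalOrder)
    module E = ≤⁺.Eq
    module H = Homomorphism {F = F} {G = G} hom
    module WP = ValuationProperties W

    Value : Set _
    Value = Σ Δ.Carrier λ γ → ∃[ x ] W.v (φ x) Δ.≈⁺ [ γ ]

    ⊕-cong : ∀ {a a′ b b′} → a Δ.≈⁺ a′ → b Δ.≈⁺ b′ → a Δ.⊕ b Δ.≈⁺ a′ Δ.⊕ b′
    ⊕-cong Δ.⊤⁺≈⊤⁺ _        = Δ.⊤⁺≈⊤⁺
    ⊕-cong Δ.[ _ ] Δ.⊤⁺≈⊤⁺  = Δ.⊤⁺≈⊤⁺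
    ⊕-cong Δ.[ p ] Δ.[ q ]  = Δ.[ Δ.∙-cong p q ]

    unbox : ∀ {a b} → [ a ] Δ.≈⁺ [ b ] → a Δ.≈ b
    unbox Δ.[ p ] = p

    inverse-value : ((γ , _) : Value) → ∃[ x ] W.v (φ x) Δ.≈⁺ [ γ Δ.⁻¹ ]
    inverse-value (γ , x , e) = y , E.trans vy Δ.[ GroupProperties.inverseʳ-unique Δ.group γ δ (unbox (E.trans (E.sym (WP.v-*-finite e vy))
        (E.trans (W.v-cong (G.trans (G.sym (H.*-homo x y)) (G.trans (H.φ-cong xy≈1) H.1#-homo))) WP.v-1))) ]
      where
      x≉0 : ¬ (x F.≈ F.0#)
      x≉0 x≈0 = WP.finite-nonzero e (G.trans (H.φ-cong x≈0) H.0#-homo)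
      y = proj₁ (F.inverse x x≉0)
      xy≈1 = proj₂ (F.inverse x x≉0)
      y≉0 : ¬ (y F.≈ F.0#)
      y≉0 = FieldProperties.inverse-nonzero F xy≈1
      δ = proj₁ (WP.v-finite (H.φ-nonzero y≉0))
      vy = proj₂ (WP.v-finite (H.φ-nonzero y≉0))

  group : OrderedAbelianGroup ℓ
  group = record
    { abelianGroup = record
      { Carrier = Value
      ; _≈_ = λ a b → proj₁ a Δ.≈ proj₁ b
      ; _∙_ = λ (γ , x , e) (δ , y , f) → γ Δ.∙ δ , x F.* y , E.trans (W.v-cong (H.*-homo x y)) (WP.v-*-finite e f)
      ; ε = Δ.ε , F.1# , E.trans (W.v-cong H.1#-homo) WP.v-1
      ; _⁻¹ = λ a → proj₁ a Δ.⁻¹ , inverse-value a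
      ; isAbelianGroup = record
        { isGroup = record
          { isMonoid = record
            { isSemigroup = record
              { isMagma = record
                { isEquivalence = record { refl = Δ.refl ; sym = Δ.sym ; trans = Δ.trans }
                ; ∙-cong = Δ.∙-cong
                }
              ; assoc = λ a b c → Δ.assoc (proj₁ a) (proj₁ b) (proj₁ c)
              }
            ; identity = (λ a → Δ.identityˡ (proj₁ a)) , (λ a → Δ.identityʳ (proj₁ a))
            }
          ; inverse = (λ a → Δ.inverseˡ (proj₁ a)) , (λ a → Δ.inverseʳ (proj₁ a))
          ; ⁻¹-cong = Δ.⁻¹-cong
          }
        ; comm = λ a b → Δ.comm (proj₁ a) (proj₁ b)
        }
      }
    ; _≤_ = λ a b → proj₁ a Δ.≤ proj₁ b
    ; isDecTotalOrder = record
      { isTotalOrder = record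
        { isPartialOrder = record
          { isPreorder = record
            { isEquivalence = record { refl = Δ.refl ; sym = Δ.sym ; trans = Δ.trans }
            ; reflexive = ≤.reflexive
            ; trans = ≤.trans
            }
          ; antisym = ≤.antisym
          }
        ; total = λ a b → ≤.total (proj₁ a) (proj₁ b)
        }
      ; _≟_ = λ a b → proj₁ a ≤.≟ proj₁ b
      ; _≤?_ = λ a b → proj₁ a ≤.≤? proj₁ b
      }
    ; ∙-monoʳ-≤ = λ c → Δ.∙-monoʳ-≤ (proj₁ c)
    }

  private
    module Γ = OrderedAbelianGroup group

    forget : Value ⁺ → Δ.Carrier ⁺
    forget = map⁺ proj₁

  ≈-reflect : ∀ {a b} → forget a Δ.≈⁺ forget b → a Γ.≈⁺ b
  ≈-reflect {⊤⁺}    {⊤⁺}    _       = Γ.⊤⁺≈⊤⁺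
  ≈-reflect {[ a ]} {[ b ]} Δ.[ p ] = Γ.[ p ]
  ≈-reflect {⊤⁺}    {[ b ]} ()
  ≈-reflect {[ a ]} {⊤⁺}    ()

  private
    ≈-preserve : ∀ {a b} → a Γ.≈⁺ b → forget a Δ.≈⁺ forget b
    ≈-preserve Γ.⊤⁺≈⊤⁺ = Δ.⊤⁺≈⊤⁺
    ≈-preserve Γ.[ p ] = Δ.[ p ]

    ≤-reflect : ∀ {a b} → forget a Δ.≤⁺ forget b → a Γ.≤⁺ b
    ≤-reflect {a}     {⊤⁺}    _       = _ Γ.≤⊤⁺
    ≤-reflect {[ a ]} {[ b ]} Δ.[ p ] = Γ.[ p ]
    ≤-reflect {⊤⁺}    {[ b ]} ()

    ≤-preserve : ∀ {a b} → a Γ.≤⁺ b → forget a Δ.≤⁺ forget b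
    ≤-preserve Γ.[ p ]   = Δ.[ p ]
    ≤-preserve (_ Γ.≤⊤⁺) = _ Δ.≤⊤⁺

    forget-⊕ : ∀ a b → forget (a Γ.⊕ b) Δ.≈⁺ forget a Δ.⊕ forget b
    forget-⊕ ⊤⁺    b     = Δ.⊤⁺≈⊤⁺
    forget-⊕ [ a ] ⊤⁺    = Δ.⊤⁺≈⊤⁺
    forget-⊕ [ a ] [ b ] = E.refl

    value : ∀ x a → W.v (φ x) Δ.≈⁺ a → Value ⁺
    value x ⊤⁺    e = ⊤⁺
    value x [ γ ] e = [ γ , x , e ]

    forget-value : ∀ x a e → forget (value x a e) Δ.≈⁺ a
    forget-value x ⊤⁺    e = Δ.⊤⁺≈⊤⁺
    forget-value x [ γ ] e = E.refl

    val : F.Carrier → Value ⁺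
    val x = value x (W.v (φ x)) E.refl

  forget-val : ∀ x → forget (val x) Δ.≈⁺ W.v (φ x)
  forget-val x = forget-value x (W.v (φ x)) E.refl

  valuation : Valuation F
  valuation = record
    { valueGroup = group
    ; v = val
    ; v-cong = λ {x} {y} e → ≈-reflect (E.trans (forget-val x) (E.trans (W.v-cong (H.φ-cong e)) (E.sym (forget-val y))))
    ; v-∞ = λ x → mk⇔
        (λ e → H.φ-injective em (G.trans (Equivalence.to (W.v-∞ (φ x)) (E.trans (E.sym (forget-val x)) (≈-preserve e))) (G.sym H.0#-homo)))
        (λ e → ≈-reflect (E.trans (forget-val x) (Equivalence.from (W.v-∞ (φ x)) (G.trans (H.φ-cong e) H.0#-homo))))
    ; v-* = λ x y → ≈-reflect (E.trans (forget-val (x F.* y)) (E.trans (W.v-cong (H.*-homo x y)) (E.trans (W.v-* (φ x) (φ y))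
        (E.trans (⊕-cong (E.sym (forget-val x)) (E.sym (forget-val y))) (E.sym (forget-⊕ (val x) (val y)))))))
    ; v-+ = λ x y → Sum.map
        (λ p → ≤-reflect (≤⁺.≤-respˡ-≈ (E.sym (forget-val x)) (≤⁺.≤-respʳ-≈ (E.trans (W.v-cong (G.sym (H.+-homo x y))) (E.sym (forget-val (x F.+ y)))) p)))
        (λ p → ≤-reflect (≤⁺.≤-respˡ-≈ (E.sym (forget-val y)) (≤⁺.≤-respʳ-≈ (E.trans (W.v-cong (G.sym (H.+-homo x y))) (E.sym (forget-val (x F.+ y)))) p)))
        (W.v-+ (φ x) (φ y))
    ; surjective = λ (γ , x , e) → x , ≈-reflect (E.trans (forget-val x) e)
    }

  private module VP = ValuationProperties valuation

  pull⇒ : ∀ {x y} → x VP.≼ y → φ x WP.≼ φ y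
  pull⇒ {x} {y} (VP.le p) = WP.le (≤⁺.≤-respˡ-≈ (forget-val x) (≤⁺.≤-respʳ-≈ (forget-val y) (≤-preserve p)))

  pull⇐ : ∀ {x y} → φ x WP.≼ φ y → x VP.≼ y
  pull⇐ {x} {y} (WP.le p) = VP.le (≤-reflect (≤⁺.≤-respˡ-≈ (E.sym (forget-val x)) (≤⁺.≤-respʳ-≈ (E.sym (forget-val y)) p)))

module ExtendsProperties {K : Field ℓ} (L : Extension K) {V : Valuation K} {W : Valuation (Extension.top L)} (ext : Extends L V W) where
  private
    module V = Valuation V
    module W = Valuation W
    module Γ = OrderedAbelianGroup V.valueGroup
    module Δ = OrderedAbelianGroup W.valueGroup
    module ≤⁺ = IsDecTotalOrder (Δ.≤⁺-isDecTotalOrder Δ.isDecTotalOrder)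
    module VP = ValuationProperties V
    module WP = ValuationProperties W
  open Extends ext
  open Extension L using (ι)

  private
    mono⁺ : ∀ {a b} → a Γ.≤⁺ b → map⁺ j a Δ.≤⁺ map⁺ j b
    mono⁺ Γ.[ p ]   = Δ.[ IsOrderMonomorphism.mono j-order p ]
    mono⁺ (_ Γ.≤⊤⁺) = _ Δ.≤⊤⁺

    cancel⁺ : ∀ {a b} → map⁺ j a Δ.≤⁺ map⁺ j b → a Γ.≤⁺ b
    cancel⁺ {a}     {⊤⁺}    _       = _ Γ.≤⊤⁺
    cancel⁺ {[ a ]} {[ b ]} Δ.[ p ] = Γ.[ IsOrderMonomorphism.cancel j-order p ]
    cancel⁺ {⊤⁺}    {[ b ]} ()

  extends⇒ : ∀ {x y} → x VP.≼ y → ι x WP.≼ ι y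
  extends⇒ {x} {y} (VP.le p) = WP.le (≤⁺.≤-respˡ-≈ (≤⁺.Eq.sym (extends x)) (≤⁺.≤-respʳ-≈ (≤⁺.Eq.sym (extends y)) (mono⁺ p)))

  extends⇐ : ∀ {x y} → ι x WP.≼ ι y → x VP.≼ y
  extends⇐ {x} {y} (WP.le p) = VP.le (cancel⁺ (≤⁺.≤-respˡ-≈ (extends x) (≤⁺.≤-respʳ-≈ (extends y) p)))

equivalent-≼ : {F : Field ℓ} {V W : Valuation F} → Equivalent V W →
               ∀ {x y} → ValuationProperties._≼_ V x y → ValuationProperties._≼_ W x y
equivalent-≼ {V = V} {W = W} eq {x} {y} (ValuationProperties.le p) =
  ValuationProperties.le (≤⁺.≤-respˡ-≈ (≤⁺.Eq.sym (commutes x)) (≤⁺.≤-respʳ-≈ (≤⁺.Eq.sym (commutes y)) (mono⁺ p)))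
  where
  open Equivalent eq
  module Γ = OrderedAbelianGroup (Valuation.valueGroup V)
  module Δ = OrderedAbelianGroup (Valuation.valueGroup W)
  module ≤⁺ = IsDecTotalOrder (Δ.≤⁺-isDecTotalOrder Δ.isDecTotalOrder)
  mono⁺ : ∀ {a b} → a Γ.≤⁺ b → map⁺ j a Δ.≤⁺ map⁺ j b
  mono⁺ Γ.[ p ]   = Δ.[ IsOrderIsomorphism.mono j-order p ]
  mono⁺ (_ Γ.≤⊤⁺) = _ Δ.≤⊤⁺

module PullbackExtends (em : EM) {K : Field ℓ} {V : Valuation K} (A B : Extension K) (φ : A ↪ B)
                       {W : Valuation (Extension.top B)} (ext : Extends B V W) where
  private
    module A = Extension A
    module B = Extension B
    module V = Valuation V
    module W = Valuation W
    module Γ = OrderedAbelianGroup V.valueGroup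
    module Δ = OrderedAbelianGroup W.valueGroup
    module E = IsDecTotalOrder.Eq (Δ.≤⁺-isDecTotalOrder Δ.isDecTotalOrder)
    module P = Pullback em {F = A.top} {G = B.top} (_↪_.homomorphism φ) W
    module Θ = OrderedAbelianGroup P.group
  open Extends ext
  open _↪_ φ using (⟦_⟧; fixes)

  private
    map⁺-j : ∀ {a b} → a Γ.≈⁺ b → map⁺ j a Δ.≈⁺ map⁺ j b
    map⁺-j Γ.⊤⁺≈⊤⁺ = Δ.⊤⁺≈⊤⁺
    map⁺-j Γ.[ p ] = Δ.[ IsGroupMonomorphism.⟦⟧-cong j-group p ]

    value-ι : ∀ x → W.v ⟦ A.ι x ⟧ Δ.≈⁺ map⁺ j (V.v x)
    value-ι x = E.trans (W.v-cong (fixes x)) (extends x)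

    lift : Γ.Carrier → Θ.Carrier
    lift γ = j γ , A.ι (proj₁ (V.surjective γ)) , E.trans (value-ι (proj₁ (V.surjective γ))) (map⁺-j (proj₂ (V.surjective γ)))

    forget-lift : ∀ a → map⁺ proj₁ (map⁺ lift a) Δ.≈⁺ map⁺ j a
    forget-lift ⊤⁺    = Δ.⊤⁺≈⊤⁺
    forget-lift [ a ] = E.refl

  pullback-extends : Extends A V P.valuation
  pullback-extends = record
    { j = lift
    ; j-group = record
      { isGroupHomomorphism = record
        { isMonoidHomomorphism = record
          { isMagmaHomomorphism = record
            { isRelHomomorphism = record { cong = J.⟦⟧-cong }
            ; homo = IsGroupHomomorphism.homo J.isGroupHomomorphism
            }
          ; ε-homo = J.ε-homo
          }
        ; ⁻¹-homo = J.⁻¹-homo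
        }
      ; injective = J.injective
      }
    ; j-order = record
      { isOrderHomomorphism = record { cong = J.⟦⟧-cong ; mono = IsOrderMonomorphism.mono j-order }
      ; injective = J.injective
      ; cancel = IsOrderMonomorphism.cancel j-order
      }
    ; extends = λ x → P.≈-reflect (E.trans (P.forget-val (A.ι x)) (E.trans (value-ι x) (E.sym (forget-lift (V.v x)))))
    }
    where module J = IsGroupMonomorphism j-group

module Henselian (em : EM) {K : Field ℓ} {V : Valuation K} (henselian : IsHenselian V) where
  open IsHenselian henselian

  module _ (A B : Extension K) (algebraic : IsAlgebraic A) {W : Valuation (Extension.top A)} {W′ : Valuation (Extension.top B)}
           (ext : Extends A V W) (ext′ : Extends B V W′) (φ : A ↪ B) where
    private
      module P = Pullback em {F = Extension.top A} {G = Extension.top B} (_↪_.homomorphism φ) W′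
      extP : Extends A V P.valuation
      extP = PullbackExtends.pullback-extends em A B φ ext′
    open _↪_ φ using (⟦_⟧)

    -- The restriction of W′ along φ is a second extension of V to A, hence equivalent to W. Below,
    -- φ is an automorphism, an inclusion or the passage to a conjugate.
    embedding⇒ : ∀ {x y} → ValuationProperties._≼_ W x y → ValuationProperties._≼_ W′ ⟦ x ⟧ ⟦ y ⟧
    embedding⇒ p = P.pull⇒ (equivalent-≼ (unique A algebraic W P.valuation ext extP) p)

    embedding⇐ : ∀ {x y} → ValuationProperties._≼_ W′ ⟦ x ⟧ ⟦ y ⟧ → ValuationProperties._≼_ W x y
    embedding⇐ p = equivalent-≼ (unique A algebraic P.valuation W extP ext) (P.pull⇐ p)

-- Residue fields

-- A residue map x ↦ x̄ is total; its values at non-integral elements carry no information.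
record ResidueMap {F : Field ℓ} (V : Valuation F) (k : Field ℓ) : Set ℓ where
  private
    module F = Field F
    module k = Field k
  open ValuationProperties V using (_≼_)
  field
    red           : F.Carrier → k.Carrier
    lift          : k.Carrier → F.Carrier
    lift-integral : ∀ a → F.1# ≼ lift a
    red-lift      : ∀ a → red (lift a) k.≈ a
    red-+         : ∀ {x y} → F.1# ≼ x → F.1# ≼ y → red (x F.+ y) k.≈ red x k.+ red y
    red-*         : ∀ {x y} → F.1# ≼ x → F.1# ≼ y → red (x F.* y) k.≈ red x k.* red y
    red-1         : red F.1# k.≈ k.1#
    red-≈0⇒       : ∀ {x} → F.1# ≼ x → red x k.≈ k.0# → ¬ (x ≼ F.1#)
    red-≈0⇐       : ∀ {x} → F.1# ≼ x → ¬ (x ≼ F.1#) → red x k.≈ k.0#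

residueMap : EM → {F : Field ℓ} (V : Valuation F) → ResidueMap V (residueField V)
residueMap em {F = F} V = record
  { red = red
  ; lift = proj₁
  ; lift-integral = λ a → integral⇒ (proj₂ a)
  ; red-lift = λ a → near (red-value (integral⇒ (proj₂ a)))
  ; red-+ = λ {x} {y} p q → near (trans (red-value (≼-+ p q)) (sym (+-cong (red-value p) (red-value q))))
  ; red-* = λ {x} {y} p q → near (trans (red-value (integral-* p q)) (sym (*-cong (red-value p) (red-value q))))
  ; red-1 = near (red-value ≼-refl)
  ; red-≈0⇒ = λ p e x≼1 → maximal⇒ e (≼-resp (sym (trans (+-congˡ -0#≈0#) (trans (+-identityʳ _) (red-value p)))) refl x≼1)
  ; red-≈0⇐ = λ p ¬x≼1 → maximal⇐ λ e → ¬x≼1 (≼-resp (trans (+-congˡ -0#≈0#) (trans (+-identityʳ _) (red-value p))) refl e)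
  }
  where
  open Field F
  open FieldProperties F
  open ValuationProperties V
  module k = Field (residueField V)
  red : Carrier → k.Carrier
  red x with em {P = 1# ≼ x}
  ... | yes p = x , integral⇐ p
  ... | no _  = k.0#
  red-value : ∀ {x} → 1# ≼ x → proj₁ (red x) ≈ x
  red-value {x} p with em {P = 1# ≼ x}
  ... | yes _ = refl
  ... | no ¬p = ⊥-elim (¬p p)
  near : ∀ {x y} → x ≈ y → InMaximalIdeal (x - y)
  near e = maximal⇐ λ p → 1≉0 (0-≼ (≼-resp (x≈y⇒x-y≈0 e) refl p))
  integral-* : ∀ {x y} → 1# ≼ x → 1# ≼ y → 1# ≼ x * y
  integral-* p q = ≼-resp (*-identityˡ 1#) refl (≼-* p q)

module ResidueMapProperties (em : EM) {F k : Field ℓ} {V : Valuation F} (R : ResidueMap V k) where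
  private
    module F = Field F
    module FP = FieldProperties F
    module F[X] = PolynomialRing F
    module k[X] = PolynomialRing k
  open Field k hiding (zero)
  open FieldProperties k
  open ValuationProperties V
  open ResidueMap R public
  open FP.Division em

  Integral : F.Carrier → Set ℓ
  Integral x = F.1# ≼ x

  IntegralPoly : F[X].Poly → Set ℓ
  IntegralPoly = All Integral

  integral-* : ∀ {x y} → Integral x → Integral y → Integral (x F.* y)
  integral-* p q = ≼-resp (F.*-identityˡ F.1#) F.refl (≼-* p q)

  integral-^ : ∀ {x} n → Integral x → Integral (x FP.^ n)
  integral-^ zero    p = ≼-refl
  integral-^ (suc n) p = integral-* p (integral-^ n p)

  integral-neg : ∀ {x} → Integral x → Integral (F.- x)
  integral-neg p = ≼-trans p (proj₁ (~-neg _))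

  red-0 : red F.0# ≈ 0#
  red-0 = red-≈0⇐ ≼-0 λ p → F.1≉0 (0-≼ p)

  red-neg : ∀ {x} → Integral x → red (F.- x) ≈ - red x
  red-neg {x} p = trans (solve 2 (λ a b → a := (b :+ a) :- b) refl (red (F.- x)) (red x))
    (trans (+-congʳ (trans (sym (red-+ p (integral-neg p))) (trans red-zero red-0))) (+-identityˡ _))
    where
    red-zero : red (x F.- x) ≈ red F.0#
    red-zero = trans (red-≈0⇐ (≼-- p p) (λ q → F.1≉0 (0-≼ (≼-resp (F.-‿inverseʳ x) F.refl q)))) (sym red-0)

  red-minus : ∀ {x y} → Integral x → Integral y → red (x F.- y) ≈ red x - red y
  red-minus p q = trans (red-+ p (integral-neg q)) (+-congˡ (red-neg q))

  red-≈⇐ : ∀ {x y} → Integral x → Integral y → ¬ (x F.- y ≼ F.1#) → red x ≈ red y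
  red-≈⇐ p q d = x-y≈0⇒x≈y (trans (sym (red-minus p q)) (red-≈0⇐ (≼-- p q) d))

  red-≈⇒ : ∀ {x y} → Integral x → Integral y → red x ≈ red y → ¬ (x F.- y ≼ F.1#)
  red-≈⇒ p q e = red-≈0⇒ (≼-- p q) (trans (red-minus p q) (x≈y⇒x-y≈0 e))

  red-cong : ∀ {x y} → Integral x → x F.≈ y → red x ≈ red y
  red-cong p e = red-≈⇐ p (≼-resp F.refl e p) λ q → F.1≉0 (0-≼ (≼-resp (FP.x≈y⇒x-y≈0 e) F.refl q))

  red-^ : ∀ {x} n → Integral x → red (x FP.^ n) ≈ red x ^ n
  red-^ zero    p = red-1
  red-^ (suc n) p = trans (red-* p (integral-^ n p)) (*-congˡ (red-^ n p))

  red-unit : ∀ {x} → x ~ F.1# → ¬ (red x ≈ 0#)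
  red-unit (p , q) e = red-≈0⇒ q e p

  red-nonzero : ∀ {x} → Integral x → ¬ (red x ≈ 0#) → x ~ F.1#
  red-nonzero {x} p e = x≼1 em , p
    where
    x≼1 : Dec (x ≼ F.1#) → x ≼ F.1#
    x≼1 (yes q) = q
    x≼1 (no ¬q) = ⊥-elim (e (red-≈0⇐ p ¬q))

  lift-poly : k[X].Poly → F[X].Poly
  lift-poly = map lift

  lift-poly-integral : ∀ p → IntegralPoly (lift-poly p)
  lift-poly-integral []      = []
  lift-poly-integral (a ∷ p) = lift-integral a ∷ lift-poly-integral p

  red-lift-poly : ∀ p → map red (lift-poly p) k[X].≋ p
  red-lift-poly []      = k[X].≋-refl
  red-lift-poly (a ∷ p) = k[X].∷-cong (red-lift a) (red-lift-poly p)

  integral-coeff : ∀ {p} → IntegralPoly p → ∀ n → Integral (F[X].coeff p n)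
  integral-coeff []       n       = ≼-0
  integral-coeff (a ∷ as) zero    = a
  integral-coeff (a ∷ as) (suc n) = integral-coeff as n

  coeff-red : ∀ p n → k[X].coeff (map red p) n ≈ red (F[X].coeff p n)
  coeff-red []      n       = sym red-0
  coeff-red (a ∷ p) zero    = refl
  coeff-red (a ∷ p) (suc n) = coeff-red p n

  red-poly-cong : ∀ {p q} → IntegralPoly p → p F[X].≋ q → map red p k[X].≋ map red q
  red-poly-cong {p} {q} ip e = k[X].mk λ n →
    trans (coeff-red p n) (trans (red-cong (integral-coeff ip n) (F[X].at e n)) (sym (coeff-red q n)))

  integral-+ₚ : ∀ {p q} → IntegralPoly p → IntegralPoly q → IntegralPoly (p F[X].+ₚ q)
  integral-+ₚ []       bs       = bs
  integral-+ₚ (a ∷ as) []       = a ∷ as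
  integral-+ₚ (a ∷ as) (b ∷ bs) = ≼-+ a b ∷ integral-+ₚ as bs

  red-+ₚ : ∀ {p q} → IntegralPoly p → IntegralPoly q → map red (p F[X].+ₚ q) k[X].≋ map red p k[X].+ₚ map red q
  red-+ₚ []       bs       = k[X].≋-refl
  red-+ₚ (a ∷ as) []       = k[X].≋-refl
  red-+ₚ (a ∷ as) (b ∷ bs) = k[X].∷-cong (red-+ a b) (red-+ₚ as bs)

  integral-• : ∀ {a p} → Integral a → IntegralPoly p → IntegralPoly (a F[X].• p)
  integral-• a []       = []
  integral-• a (b ∷ bs) = integral-* a b ∷ integral-• a bs

  red-• : ∀ {a p} → Integral a → IntegralPoly p → map red (a F[X].• p) k[X].≋ red a k[X].• map red p
  red-• a []       = k[X].≋-refl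
  red-• a (b ∷ bs) = k[X].∷-cong (red-* a b) (red-• a bs)

  integral-*ₚ : ∀ {p q} → IntegralPoly p → IntegralPoly q → IntegralPoly (p F[X].*ₚ q)
  integral-*ₚ []       bs = []
  integral-*ₚ (a ∷ as) bs = integral-+ₚ (integral-• a bs) (≼-0 ∷ integral-*ₚ as bs)

  red-*ₚ : ∀ {p q} → IntegralPoly p → IntegralPoly q → map red (p F[X].*ₚ q) k[X].≋ map red p k[X].*ₚ map red q
  red-*ₚ                  []       bs = k[X].≋-refl
  red-*ₚ {a ∷ p} {q} (ia ∷ ip) iq = k[X].≋-trans
    (red-+ₚ {a F[X].• q} {F.0# ∷ p F[X].*ₚ q} (integral-• ia iq) (≼-0 ∷ integral-*ₚ ip iq))
    (k[X].+ₚ-cong (red-• ia iq) (k[X].∷-cong red-0 (red-*ₚ ip iq)))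

  integral-X- : ∀ {a} → Integral a → IntegralPoly (F[X].X- a)
  integral-X- a = integral-neg a ∷ ≼-refl ∷ []

  integral-linears : ∀ {as} → All Integral as → IntegralPoly (Degree.linears F as)
  integral-linears []       = ≼-refl ∷ []
  integral-linears (a ∷ as) = integral-*ₚ (integral-linears as) (integral-X- a)

  red-linears : ∀ {as} → All Integral as → map red (Degree.linears F as) k[X].≋ Degree.linears k (map red as)
  red-linears                []         = k[X].∷-cong red-1 (k[X].≋-refl {[]})
  red-linears {a ∷ as} (ia ∷ ias) = k[X].≋-trans (red-*ₚ (integral-linears ias) (integral-X- ia))
    (k[X].*ₚ-cong (red-linears ias) (k[X].∷-cong (red-neg ia) (k[X].∷-cong red-1 (k[X].≋-refl {[]}))))

  integral-eval : ∀ {p x} → IntegralPoly p → Integral x → Integral (F[X].eval p x)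
  integral-eval []       x = ≼-0
  integral-eval (a ∷ as) x = ≼-+ a (integral-* x (integral-eval as x))

  red-eval : ∀ {p x} → IntegralPoly p → Integral x → red (F[X].eval p x) ≈ k[X].eval (map red p) (red x)
  red-eval []       x = red-0
  red-eval (a ∷ as) x = trans (red-+ a (integral-* x (integral-eval as x)))
    (+-congˡ (trans (red-* x (integral-eval as x)) (*-congˡ (red-eval as x))))

  red-below : ∀ {n p} → Degree.Below F n p → Degree.Below k n (map red p)
  red-below {n} {p} b = Degree.below λ m n≤m → trans (coeff-red p m)
    (trans (red-≈0⇐ (≼-resp F.refl (F.sym (Degree.vanish b m n≤m)) ≼-0) (λ q → F.1≉0 (0-≼ (≼-resp (Degree.vanish b m n≤m) F.refl q)))) refl)

  private
    least-coeff : ∀ p → ∃[ n ] ∀ m → F[X].coeff p n ≼ F[X].coeff p m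
    least-coeff []      = 0 , λ m → ≼-refl
    least-coeff (a ∷ p) = go (least-coeff p)
      where
      go : (∃[ n ] ∀ m → F[X].coeff p n ≼ F[X].coeff p m) → ∃[ n ] ∀ m → F[X].coeff (a ∷ p) n ≼ F[X].coeff (a ∷ p) m
      go (n , least) with ≼-total a (F[X].coeff p n)
      ... | inj₁ q = 0 , λ { zero → ≼-refl ; (suc m) → ≼-trans q (least m) }
      ... | inj₂ q = suc n , λ { zero → q ; (suc m) → least m }

    quotients : ∀ c p → F[X].Poly
    quotients c p = map (_/ c) p

    coeff-quotients : ∀ {c} → ¬ (c F.≈ F.0#) → ∀ p n → c F.* F[X].coeff (quotients c p) n F.≈ F[X].coeff p n
    coeff-quotients c≉0 []      n       = F.zeroʳ _
    coeff-quotients c≉0 (a ∷ p) zero    = y*x/y≈x c≉0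
    coeff-quotients c≉0 (a ∷ p) (suc n) = coeff-quotients c≉0 p n

  -- dividing a nonzero polynomial by a coefficient of least value makes it primitive
  primitive-part : ∀ {p} → ¬ (p F[X].≋ []) →
              ∃[ c ] ∃[ p′ ] ¬ (c F.≈ F.0#) × c F[X].• p′ F[X].≋ p × IntegralPoly p′ × ¬ (map red p′ k[X].≋ [])
  primitive-part {p} p≉0 = c , quotients c p , c≉0 , F[X].mk (λ n → F.trans (F[X].coeff-• c (quotients c p) n) (coeff-quotients c≉0 p n)) ,
                      all-integral p is-least , nonzero
    where
    n = proj₁ (least-coeff p)
    is-least = proj₂ (least-coeff p)
    c = F[X].coeff p n
    c≉0 : ¬ (c F.≈ F.0#)
    c≉0 c≈0 = p≉0 (F[X].mk λ m → 0-≼ (≼-resp c≈0 F.refl (is-least m)))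
    all-integral : ∀ q → (∀ m → c ≼ F[X].coeff q m) → IntegralPoly (quotients c q)
    all-integral []      _ = []
    all-integral (a ∷ q) l = ≼-cancelˡ c≉0 (≼-resp (F.sym (F.*-identityʳ c)) (F.sym (y*x/y≈x c≉0)) (l 0)) ∷ all-integral q (λ m → l (suc m))
    nonzero : ¬ (map red (quotients c p) k[X].≋ [])
    nonzero e = 1≉0 (trans (sym red-1) (trans (red-cong ≼-refl (FP.*-cancelˡ c≉0 (F.trans (F.*-identityʳ c) (F.sym (coeff-quotients c≉0 p n)))))
      (trans (sym (coeff-red (quotients c p) n)) (k[X].at e n))))

-- The inputs are comparisons rather than `Extends`: for E/K they come from the extension of V, but
-- for L/E they come from uniqueness, both fields carrying extensions of V.
module ResidueExtension (em : EM) {F : Field ℓ} (L : Extension F) {V : Valuation F} {W : Valuation (Extension.top L)}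
    (extends⇒ : ∀ {x y} → ValuationProperties._≼_ V x y → ValuationProperties._≼_ W (Extension.ι L x) (Extension.ι L y))
    (extends⇐ : ∀ {x y} → ValuationProperties._≼_ W (Extension.ι L x) (Extension.ι L y) → ValuationProperties._≼_ V x y)
    {k l : Field ℓ} (R : ResidueMap V k) (S : ResidueMap W l) where
  private
    module F = Field F
    module L = Extension L
    module k = Field k
    module l = Field l
    module VP = ValuationProperties V
    module WP = ValuationProperties W
    module R = ResidueMapProperties em R
    module S = ResidueMapProperties em S
    module H = Homomorphism {F = F} {G = L.top} L.ι-homomorphism

  ι-integral : ∀ {x} → R.Integral x → S.Integral (L.ι x)
  ι-integral p = WP.≼-resp H.1#-homo L.refl (extends⇒ p)

  integral-ι : ∀ {x} → S.Integral (L.ι x) → R.Integral x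
  integral-ι p = extends⇐ (WP.≼-resp (L.sym H.1#-homo) L.refl p)

  -- Defined through one chosen lift; `transport` shows that any other lift has the same image.
  ρ : k.Carrier → l.Carrier
  ρ a = S.red (L.ι (R.lift a))

  private
    ι-lift : ∀ a → S.Integral (L.ι (R.lift a))
    ι-lift a = ι-integral (R.lift-integral a)

    transport : ∀ {x y} → R.Integral x → R.Integral y → R.red x k.≈ R.red y → S.red (L.ι x) l.≈ S.red (L.ι y)
    transport p q e = S.red-≈⇐ (ι-integral p) (ι-integral q) λ d → R.red-≈⇒ p q e
      (extends⇐ (WP.≼-resp (L.sym (H.minus-homo _ _)) (L.sym H.1#-homo) d))

  ρ-red : ∀ {x} → R.Integral x → ρ (R.red x) l.≈ S.red (L.ι x)
  ρ-red p = transport (R.lift-integral _) p (R.red-lift _)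

  private
    ρ-via : ∀ a {x} → R.Integral x → R.red x k.≈ a → ρ a l.≈ S.red (L.ι x)
    ρ-via a p e = transport (R.lift-integral a) p (k.trans (R.red-lift a) (k.sym e))

  residueExtension : Extension k
  residueExtension = record
    { top = l
    ; ι = ρ
    ; ι-homomorphism = record
      { isSemiringHomomorphism = record
        { isNearSemiringHomomorphism = record
          { +-isMonoidHomomorphism = record
            { isMagmaHomomorphism = record
              { isRelHomomorphism = record { cong = λ {a} {b} e → ρ-via a (R.lift-integral b) (k.trans (R.red-lift b) (k.sym e)) }
              ; homo = λ a b → l.trans (ρ-via (a k.+ b) (VP.≼-+ (R.lift-integral a) (R.lift-integral b))
                    (k.trans (R.red-+ (R.lift-integral a) (R.lift-integral b)) (k.+-cong (R.red-lift a) (R.red-lift b))))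
                  (l.trans (S.red-cong (ι-integral (VP.≼-+ (R.lift-integral a) (R.lift-integral b))) (H.+-homo _ _)) (S.red-+ (ι-lift a) (ι-lift b)))
              }
            ; ε-homo = l.trans (ρ-via k.0# VP.≼-0 R.red-0) (l.trans (S.red-cong (ι-integral VP.≼-0) H.0#-homo) S.red-0)
            }
          ; *-homo = λ a b → l.trans (ρ-via (a k.* b) (R.integral-* (R.lift-integral a) (R.lift-integral b))
                (k.trans (R.red-* (R.lift-integral a) (R.lift-integral b)) (k.*-cong (R.red-lift a) (R.red-lift b))))
              (l.trans (S.red-cong (ι-integral (R.integral-* (R.lift-integral a) (R.lift-integral b))) (H.*-homo _ _)) (S.red-* (ι-lift a) (ι-lift b)))
          }
        ; 1#-homo = l.trans (ρ-via k.1# VP.≼-refl R.red-1) (l.trans (S.red-cong (ι-integral VP.≼-refl) H.1#-homo) S.red-1)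
        }
      ; -‿homo = λ a → l.trans (ρ-via (k.- a) (R.integral-neg (R.lift-integral a)) (k.trans (R.red-neg (R.lift-integral a)) (k.-‿cong (R.red-lift a))))
          (l.trans (S.red-cong (ι-integral (R.integral-neg (R.lift-integral a))) (H.-‿homo _)) (S.red-neg (ι-lift a)))
      }
    }

  map-ι-integral : ∀ {p} → R.IntegralPoly p → S.IntegralPoly (map L.ι p)
  map-ι-integral []       = []
  map-ι-integral (a ∷ as) = ι-integral a ∷ map-ι-integral as

  map-ρ-red : ∀ {p} → R.IntegralPoly p → PolynomialRing._≋_ l (map ρ (map R.red p)) (map S.red (map L.ι p))
  map-ρ-red []       = PolynomialRing.≋-refl l
  map-ρ-red (a ∷ as) = PolynomialRing.∷-cong l (ρ-red a) (map-ρ-red as)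

  red-evalAt : ∀ {p x} → R.IntegralPoly p → S.Integral x →
               evalAt residueExtension (map R.red p) (S.red x) l.≈ S.red (evalAt L p x)
  red-evalAt ip ix = l.trans (PolynomialRing.eval-cong l (map-ρ-red ip) l.refl) (l.sym (S.red-eval (map-ι-integral ip) ix))

  -- Take an equation of a lift of a. After division by a coefficient of least value it is integral
  -- and stays nonzero under reduction.
  residue-algebraic : IsAlgebraic L → IsAlgebraic residueExtension
  residue-algebraic alg a = go (alg (S.lift a))
    where
    go : FiniteSubring.Algebraic em L (S.lift a) → FiniteSubring.Algebraic em residueExtension a
    go (p , nz , root) = reduce (R.primitive-part (ClassicalDegree.nonzero⇒≉[] em F nz))
      where
      open PolynomialRing F using (_•_; _≋_)
      reduce : (∃[ c ] ∃[ p′ ] ¬ (c F.≈ F.0#) × c • p′ ≋ p × R.IntegralPoly p′ × ¬ (PolynomialRing._≋_ k (map R.red p′) [])) →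
               FiniteSubring.Algebraic em residueExtension a
      reduce (c , p′ , c≉0 , e , ip′ , nz′) = map R.red p′ , (n , ¬z) ,
        l.trans (evalAt-cong residueExtension {map R.red p′} {map R.red p′} (PolynomialRing.≋-refl k) (l.sym (S.red-lift a)))
          (l.trans (red-evalAt ip′ (S.lift-integral a)) (l.trans (S.red-cong (S.integral-eval (map-ι-integral ip′) (S.lift-integral a)) root′) S.red-0))
        where
        n = proj₁ (ClassicalDegree.exact-degree em k nz′)
        ¬z = proj₁ (proj₂ (ClassicalDegree.exact-degree em k nz′))
        root′ : evalAt L p′ (S.lift a) L.≈ L.0#
        root′ = FieldProperties.*-cancel-0 L.top (H.φ-nonzero c≉0) (L.trans (L.sym (PolynomialRing.eval-• L.top (L.ι c) (map L.ι p′) (S.lift a)))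
          (L.trans (PolynomialRing.eval-cong L.top (PolynomialRing.≋-sym L.top (map-• {F = F} {G = L.top} L.ι-homomorphism c p′)) L.refl)
            (L.trans (evalAt-cong L {c • p′} {p} e L.refl) root)))

-- Operators with prescribed eigenvalues

module Operator {k : Field ℓ} (N : Extension k) (τ : N ↪ N) where
  private
    module k = Field k
    module k[X] = PolynomialRing k
    module T = Homomorphism {F = Extension.top N} {G = Extension.top N} (_↪_.homomorphism τ)
    module I = Homomorphism {F = k} {G = Extension.top N} (Extension.ι-homomorphism N)
  open Extension N hiding (zero)
  open FieldProperties top
  open SemiringSum semiring
  open Mult semiring using () renaming (_×_ to _·_)
  open SetoidReasoning setoid
  open _↪_ τ using (⟦_⟧; fixes)

  iter : ℕ → Carrier → Carrier
  iter zero    x = x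
  iter (suc n) x = ⟦ iter n x ⟧

  -- The action of k[X] on N in which X acts as τ; `act p x` is p(τ)(x).
  act : k[X].Poly → Carrier → Carrier
  act []      x = 0#
  act (c ∷ p) x = ι c * x + ⟦ act p x ⟧

  iter-cong : ∀ n {x y} → x ≈ y → iter n x ≈ iter n y
  iter-cong zero    e = e
  iter-cong (suc n) e = T.φ-cong (iter-cong n e)

  τ-scale : ∀ c x → ⟦ ι c * x ⟧ ≈ ι c * ⟦ x ⟧
  τ-scale c x = trans (T.*-homo (ι c) x) (*-congʳ (fixes c))

  act-congʳ : ∀ p {x y} → x ≈ y → act p x ≈ act p y
  act-congʳ []      e = refl
  act-congʳ (c ∷ p) e = +-cong (*-congˡ e) (T.φ-cong (act-congʳ p e))

  act-+ : ∀ p q x → act (p k[X].+ₚ q) x ≈ act p x + act q x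
  act-+ []      q       x = sym (+-identityˡ _)
  act-+ (c ∷ p) []      x = sym (+-identityʳ _)
  act-+ (c ∷ p) (d ∷ q) x = begin
    ι (c k.+ d) * x + ⟦ act (p k[X].+ₚ q) x ⟧            ≈⟨ +-cong (*-congʳ (I.+-homo c d)) (trans (T.φ-cong (act-+ p q x)) (T.+-homo _ _)) ⟩
    (ι c + ι d) * x + (⟦ act p x ⟧ + ⟦ act q x ⟧)         ≈⟨ solve 5 (λ c d x p q → (c :+ d) :* x :+ (p :+ q) := (c :* x :+ p) :+ (d :* x :+ q)) refl _ _ _ _ _ ⟩
    (ι c * x + ⟦ act p x ⟧) + (ι d * x + ⟦ act q x ⟧)     ∎

  act-• : ∀ a p x → act (a k[X].• p) x ≈ ι a * act p x
  act-• a []      x = sym (zeroʳ _)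
  act-• a (c ∷ p) x = begin
    ι (a k.* c) * x + ⟦ act (a k[X].• p) x ⟧   ≈⟨ +-cong (*-congʳ (I.*-homo a c)) (trans (T.φ-cong (act-• a p x)) (τ-scale a _)) ⟩
    ι a * ι c * x + ι a * ⟦ act p x ⟧          ≈⟨ solve 4 (λ a c x y → a :* c :* x :+ a :* y := a :* (c :* x :+ y)) refl _ _ _ _ ⟩
    ι a * (ι c * x + ⟦ act p x ⟧)              ∎

  act-* : ∀ p q x → act (p k[X].*ₚ q) x ≈ act p (act q x)
  act-* []      q x = refl
  act-* (c ∷ p) q x = begin
    act ((c k[X].• q) k[X].+ₚ (k.0# ∷ p k[X].*ₚ q)) x            ≈⟨ act-+ (c k[X].• q) (k.0# ∷ p k[X].*ₚ q) x ⟩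
    act (c k[X].• q) x + (ι k.0# * x + ⟦ act (p k[X].*ₚ q) x ⟧)  ≈⟨ +-cong (act-• c q x) (trans (+-congʳ (trans (*-congʳ I.0#-homo) (zeroˡ x)))
                                                                      (trans (+-identityˡ _) (T.φ-cong (act-* p q x)))) ⟩
    ι c * act q x + ⟦ act p (act q x) ⟧                          ∎

  -- p(τ) commutes with τ - c, so the kernel of p(τ) is preserved when the search for an eigenvector
  -- passes from x to (τ - c)(x).
  act-commute : ∀ p {x y c} → y ≈ ⟦ x ⟧ - ι c * x → act p y ≈ ⟦ act p x ⟧ - ι c * act p x
  act-commute []      {x} {y} {c} e = trans (solve 1 (λ c → con (+ 0) := con (+ 0) :- c :* con (+ 0)) refl (ι c)) (+-congʳ (sym T.0#-homo))
  act-commute (d ∷ p) {x} {y} {c} e = begin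
    ι d * y + ⟦ act p y ⟧ ≈⟨ +-cong (*-congˡ e) (trans (T.φ-cong (act-commute p e)) (trans (T.minus-homo _ _) (+-congˡ (-‿cong (τ-scale c _))))) ⟩
    ι d * (⟦ x ⟧ - ι c * x) + (⟦ ⟦ act p x ⟧ ⟧ - ι c * ⟦ act p x ⟧)
      ≈⟨ solve 6 (λ c d x tx p tp → d :* (tx :- c :* x) :+ (tp :- c :* p) := (d :* tx :+ tp) :- c :* (d :* x :+ p)) refl (ι c) (ι d) x ⟦ x ⟧ ⟦ act p x ⟧ ⟦ ⟦ act p x ⟧ ⟧ ⟩
    (ι d * ⟦ x ⟧ + ⟦ ⟦ act p x ⟧ ⟧) - ι c * (ι d * x + ⟦ act p x ⟧) ≈⟨ +-congʳ (trans (T.+-homo _ _) (+-congʳ (τ-scale d x))) ⟨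
    ⟦ ι d * x + ⟦ act p x ⟧ ⟧ - ι c * (ι d * x + ⟦ act p x ⟧) ∎

  τ-sum : ∀ {n} (t : Fin n → Carrier) → ⟦ sum t ⟧ ≈ sum (λ i → ⟦ t i ⟧)
  τ-sum {zero}  t = T.0#-homo
  τ-sum {suc n} t = trans (T.+-homo _ _) (+-congˡ (τ-sum (t ∘ suc)))

  act-sum : ∀ p x → act p x ≈ sum {length p} (λ i → ι (k[X].coeff p (toℕ i)) * iter (toℕ i) x)
  act-sum []      x = refl
  act-sum (c ∷ p) x = +-congˡ (trans (T.φ-cong (act-sum p x)) (trans (τ-sum (λ (i : Fin (length p)) → ι (k[X].coeff p (toℕ i)) * iter (toℕ i) x))
    (sum-cong-≋ (λ (i : Fin (length p)) → τ-scale (k[X].coeff p (toℕ i)) (iter (toℕ i) x)))))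

  iter-multiple : ∀ {n m x} → iter n x ≈ x → n ∣ m → iter m x ≈ x
  iter-multiple {n} {m} {x} e (∣.divides d ≡.refl) = go d
    where
    iter-+ : ∀ a b x → iter (a ℕ.+ b) x ≈ iter a (iter b x)
    iter-+ zero    b x = refl
    iter-+ (suc a) b x = T.φ-cong (iter-+ a b x)
    go : ∀ d → iter (d ℕ.* n) x ≈ x
    go zero    = refl
    go (suc d) = trans (iter-+ n (d ℕ.* n) x) (trans (iter-cong n (go d)) e)

  -- where τⁿ = 1, such a polynomial takes the same value at τ as at 1
  act-supported : EM → ∀ {n p x} → (∀ i → ¬ (k[X].coeff p i k.≈ k.0#) → n ∣ i) → iter n x ≈ x →
                  k[X].eval p k.1# k.≈ k.0# → act p x ≈ 0#
  act-supported em {n} {p} {x} supp e root = begin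
    act p x ≈⟨ act-sum p x ⟩
    sum {length p} (λ i → ι (k[X].coeff p (toℕ i)) * iter (toℕ i) x) ≈⟨ sum-cong-≋ {length p} (λ i → term (toℕ i) em) ⟩
    sum {length p} (λ i → ι (k[X].coeff p (toℕ i)) * x) ≈⟨ *-distribʳ-sum {length p} x (λ i → ι (k[X].coeff p (toℕ i))) ⟨
    sum {length p} (λ i → ι (k[X].coeff p (toℕ i))) * x ≈⟨ *-congʳ (value p) ⟩
    ι (k[X].eval p k.1#) * x ≈⟨ *-congʳ (trans (I.φ-cong root) I.0#-homo) ⟩
    0# * x ≈⟨ zeroˡ x ⟩
    0# ∎
    where
    term : ∀ i → Dec (k[X].coeff p i k.≈ k.0#) → ι (k[X].coeff p i) * iter i x ≈ ι (k[X].coeff p i) * x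
    term i (yes z) = trans (*-congʳ c≈0) (trans (zeroˡ _) (sym (trans (*-congʳ c≈0) (zeroˡ _))))
      where c≈0 = trans (I.φ-cong z) I.0#-homo
    term i (no ¬z) = *-congˡ (iter-multiple {n} e (supp i ¬z))
    value : ∀ p → sum {length p} (λ i → ι (k[X].coeff p (toℕ i))) ≈ ι (k[X].eval p k.1#)
    value []      = sym I.0#-homo
    value (c ∷ p) = trans (+-congˡ (value p)) (sym (trans (I.φ-cong (k.+-congˡ (k.*-identityˡ _))) (I.+-homo _ _)))

  -- The polynomial 1 + X + ... + X^(n-1). Where τ has period n, its action is the relative trace.
  ones : ℕ → k[X].Poly
  ones zero    = []
  ones (suc n) = k.1# ∷ ones n

  act-ones-suc : ∀ n x → act (ones (suc n)) x ≈ x + ⟦ act (ones n) x ⟧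
  act-ones-suc n x = +-congʳ (trans (*-congʳ I.1#-homo) (*-identityˡ x))

  act-ones-iter : ∀ n x → act (ones (suc n)) x ≈ act (ones n) x + iter n x
  act-ones-iter zero    x = trans (act-ones-suc 0 x) (trans (+-congˡ T.0#-homo) (trans (+-identityʳ x) (sym (+-identityˡ x))))
  act-ones-iter (suc n) x = begin
    act (ones (suc (suc n))) x                       ≈⟨ act-ones-suc (suc n) x ⟩
    x + ⟦ act (ones (suc n)) x ⟧                     ≈⟨ +-congˡ (trans (T.φ-cong (act-ones-iter n x)) (T.+-homo _ _)) ⟩
    x + (⟦ act (ones n) x ⟧ + iter (suc n) x)        ≈⟨ +-assoc _ _ _ ⟨
    (x + ⟦ act (ones n) x ⟧) + iter (suc n) x        ≈⟨ +-congʳ (act-ones-suc n x) ⟨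
    act (ones (suc n)) x + iter (suc n) x            ∎

  act-ones-difference : ∀ n y → act (ones n) (⟦ y ⟧ - y) ≈ iter n y - y
  act-ones-difference zero    y = sym (-‿inverseʳ y)
  act-ones-difference (suc n) y = begin
    act (ones (suc n)) (⟦ y ⟧ - y)                    ≈⟨ act-ones-suc n _ ⟩
    (⟦ y ⟧ - y) + ⟦ act (ones n) (⟦ y ⟧ - y) ⟧        ≈⟨ +-congˡ (trans (T.φ-cong (act-ones-difference n y)) (T.minus-homo _ _)) ⟩
    (⟦ y ⟧ - y) + (iter (suc n) y - ⟦ y ⟧)            ≈⟨ solve 3 (λ a b c → (a :- b) :+ (c :- a) := c :- b) refl ⟦ y ⟧ y (iter (suc n) y) ⟩
    iter (suc n) y - y                                ∎

  ones-kernel-iter : ∀ n {x} → act (ones n) x ≈ 0# → iter n x ≈ x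
  ones-kernel-iter n {x} e = begin
    iter n x                     ≈⟨ +-identityˡ _ ⟨
    0# + iter n x                ≈⟨ +-congʳ e ⟨
    act (ones n) x + iter n x    ≈⟨ act-ones-iter n x ⟨
    act (ones (suc n)) x         ≈⟨ act-ones-suc n x ⟩
    x + ⟦ act (ones n) x ⟧       ≈⟨ +-congˡ (trans (T.φ-cong e) T.0#-homo) ⟩
    x + 0#                       ≈⟨ +-identityʳ x ⟩
    x                            ∎

  act-ones-fixed : ∀ n {x} → ⟦ x ⟧ ≈ x → act (ones n) x ≈ n · x
  act-ones-fixed zero    e = refl
  act-ones-fixed (suc n) {x} e = trans (act-ones-suc n x) (+-congˡ (trans (T.φ-cong (act-ones-fixed n e)) (fixed n)))
    where
    fixed : ∀ n → ⟦ n · x ⟧ ≈ n · x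
    fixed zero    = T.0#-homo
    fixed (suc n) = trans (T.+-homo _ _) (+-cong e (fixed n))

  -- A product of operators τ - c kills x. Either τ - c already kills x for the first c, or (τ -
  -- c)(x) is a nonzero vector of the same kernel that the remaining factors kill.
  eigenvector : EM → ∀ n cs {x} → act (ones n) x ≈ 0# → ¬ (x ≈ 0#) → act (Degree.linears k cs) x ≈ 0# →
                ∃[ c ] ∃[ z ] act (ones n) z ≈ 0# × ¬ (z ≈ 0#) × ⟦ z ⟧ ≈ ι c * z
  eigenvector em n []       {x} w x≉0 e = ⊥-elim (x≉0 (trans (sym (trans (+-cong (trans (*-congʳ I.1#-homo) (*-identityˡ x)) T.0#-homo) (+-identityʳ x))) e))
  eigenvector em n (c ∷ cs) {x} w x≉0 e = go em
    where
    y = ⟦ x ⟧ - ι c * x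
    y≈ : act (k[X].X- c) x ≈ y
    y≈ = begin
      ι (k.- c) * x + ⟦ ι k.1# * x + ⟦ 0# ⟧ ⟧ ≈⟨ +-cong (*-congʳ (I.-‿homo c)) (T.φ-cong (trans (+-cong (trans (*-congʳ I.1#-homo) (*-identityˡ x)) T.0#-homo) (+-identityʳ x))) ⟩
      - ι c * x + ⟦ x ⟧                       ≈⟨ solve 3 (λ c x t → (:- c) :* x :+ t := t :- c :* x) refl (ι c) x ⟦ x ⟧ ⟩
      y                                       ∎
    go : Dec (y ≈ 0#) → _
    go (yes y≈0) = c , x , w , x≉0 , x-y≈0⇒x≈y y≈0
    go (no y≉0)  = eigenvector em n cs
      (trans (act-commute (ones n) refl) (trans (+-cong (trans (T.φ-cong w) T.0#-homo) (-‿cong (trans (*-congˡ w) (zeroʳ _)))) (-‿inverseʳ 0#)))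
      y≉0
      (trans (act-congʳ (Degree.linears k cs) (sym y≈)) (trans (sym (act-* (Degree.linears k cs) (k[X].X- c) x)) e))

-- The properties of the reduction of P(bX)/b^deg(P) that are used: it splits over k, has 1 among
-- its roots, and is a polynomial in Xⁿ.
record Supported {k : Field ℓ} (n : ℕ) : Set ℓ where
  open PolynomialRing k
  open Degree k
  open Field k
  field
    roots   : List Carrier
    support : ∀ i → ¬ (coeff (linears roots) i ≈ 0#) → n ∣ i
    at-1    : eval (linears roots) 1# ≈ 0#

map-linears : {F G : Field ℓ} {φ : Field.Carrier F → Field.Carrier G} (hom : IsRingHomomorphism (Field.rawRing F) (Field.rawRing G) φ) →
              ∀ as → PolynomialRing._≋_ G (map φ (Degree.linears F as)) (Degree.linears G (map φ as))
map-linears {F = F} {G = G} {φ} hom [] = PolynomialRing.∷-cong G H.1#-homo (PolynomialRing.≋-refl G {[]})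
  where module H = Homomorphism {F = F} {G = G} hom
map-linears {F = F} {G = G} {φ} hom (a ∷ as) = ≋-trans (map-*ₚ {F = F} {G = G} hom (Degree.linears F as) (F[X].X- a))
  (*ₚ-cong (map-linears {F = F} {G = G} hom as) (∷-cong (H.-‿homo a) (∷-cong H.1#-homo (≋-refl {[]}))))
  where
  module H = Homomorphism {F = F} {G = G} hom
  module F[X] = PolynomialRing F
  open PolynomialRing G using (≋-trans; *ₚ-cong; ∷-cong; ≋-refl)

prime-part : ∀ {r} → Prime r → ∀ M → 0 ℕ.< M → ∃[ a ] ∃[ m ] M ≡ m ℕ.* r ℕ.^ a × ¬ (r ∣ m)
prime-part {r} pr M 0<M = go M M ℕ.≤-refl 0<M
  where
  1<r : 1 ℕ.< r
  1<r = ℕ.nonTrivial⇒n>1 r {{Primality.prime⇒nonTrivial pr}}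
  go : ∀ N M → M ℕ.≤ N → 0 ℕ.< M → ∃[ a ] ∃[ m ] M ≡ m ℕ.* r ℕ.^ a × ¬ (r ∣ m)
  go N M M≤N 0<M with r ∣.∣? M
  ... | no r∤M = 0 , M , ≡.sym (ℕ.*-identityʳ M) , r∤M
  go zero    M M≤N 0<M | yes _ = ⊥-elim (ℕ.<-irrefl ≡.refl (ℕ.≤-trans 0<M M≤N))
  go (suc N) M M≤N 0<M | yes (∣.divides zero    M≡) = ⊥-elim (ℕ.<-irrefl (≡.sym M≡) 0<M)
  go (suc N) M M≤N 0<M | yes (∣.divides (suc d) M≡) with go N (suc d)
      (ℕ.≤-pred (ℕ.≤-trans (≡.subst (suc d ℕ.<_) (≡.sym M≡) (ℕ.m<m*n (suc d) r 1<r)) M≤N)) (s≤s z≤n)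
  ... | a , m , e , r∤m = suc a , m , ≡.trans M≡ (≡.trans (≡.cong (ℕ._* r) e) (≡.trans (ℕ.*-assoc m (r ℕ.^ a) r) (≡.cong (m ℕ.*_) (ℕ.*-comm (r ℕ.^ a) r)))) , r∤m

-- The tame case

module TameContradiction (em : EM) {k : Field ℓ} (N : Extension k) (τ : N ↪ N) {r : ℕ} (pr : Prime r)
    (supported : ∀ a → Supported {k = k} (r ℕ.^ a))
    (torsion : ∀ {x} → ¬ (Extension._≈_ N x (Extension.0# N)) → ∃ (Unity.IsOrder (Extension.top N) x))
    (r≉0 : ¬ (Extension._≈_ N (RawMonoidDefs._×_ (RawRing.+-rawMonoid (Extension.rawRing N)) r (Extension.1# N)) (Extension.0# N))) where
  private
    module k = Field k
    module k[X] = PolynomialRing k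
    module I = Homomorphism {F = k} {G = Extension.top N} (Extension.ι-homomorphism N)
    module T = Homomorphism {F = Extension.top N} {G = Extension.top N} (_↪_.homomorphism τ)
    module kP = FieldProperties k
  open Extension N hiding (zero)
  open FieldProperties top
  open _↪_ τ using (⟦_⟧; fixes)
  open Operator N τ
  open Mult semiring using (×-congʳ; ×-assoc-*)

  private
    -- Only exponents divisible by r^a occur in the supported polynomial, so its value at z is its
    -- value at 1, namely 0. Thus z is one of its roots, and these lie in k.
    power-root-in-base : ∀ a {z} → z ^ (r ℕ.^ a) ≈ 1# → InBase N z
    power-root-in-base a {z} e = find (Any.map⁻ (ClassicalDegree.linears-root em top {map ι roots} root))
      where
      open Supported (supported a)
      n = length (Degree.linears k roots)
      term : ∀ i → Dec (k[X].coeff (Degree.linears k roots) i k.≈ k.0#) →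
             ι (k[X].coeff (Degree.linears k roots) i) * z ^ i ≈ ι (k[X].coeff (Degree.linears k roots) i) * 1# ^ i
      term i (yes c≈0) = trans (*-congʳ ι≈0) (trans (zeroˡ _) (sym (trans (*-congʳ ι≈0) (zeroˡ _))))
        where ι≈0 = trans (I.φ-cong c≈0) I.0#-homo
      term i (no c≉0) = *-congˡ (trans (Unity.^-multiple top {z} {r ℕ.^ a} e (support i c≉0)) (sym (1^n≈1 i)))
      same : evalAt N (Degree.linears k roots) z ≈ evalAt N (Degree.linears k roots) 1#
      same = trans (FiniteSubring.evalAt-below em N {n} z (Degree.below-length k (Degree.linears k roots)))
        (trans (SemiringSum.sum-cong-≋ semiring {n} (λ i → term (toℕ i) em))
          (sym (FiniteSubring.evalAt-below em N {n} 1# (Degree.below-length k (Degree.linears k roots)))))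
      root : PolynomialRing.eval top (Degree.linears top (map ι roots)) z ≈ 0#
      root = trans (PolynomialRing.eval-cong top (PolynomialRing.≋-sym top (map-linears {F = k} {G = top} ι-homomorphism roots)) refl)
        (trans same (trans (PolynomialRing.eval-cong top {map ι (Degree.linears k roots)} (PolynomialRing.≋-refl top) (sym I.1#-homo))
          (trans (eval-map {F = k} {G = top} ι-homomorphism (Degree.linears k roots) k.1#) (trans (I.φ-cong at-1) I.0#-homo))))
      find : ∀ {as} → Any (λ c → z ≈ ι c) as → InBase N z
      find (here {x = c} e) = c , sym e
      find (there any) = find any

    fixed-base : ∀ {x} → InBase N x → ⟦ x ⟧ ≈ x
    fixed-base (a , e) = trans (T.φ-cong (sym e)) (trans (fixes a) e)

    iter-eigen : ∀ n {c z} → ⟦ z ⟧ ≈ ι c * z → iter n z ≈ ι (c kP.^ n) * z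
    iter-eigen zero    {c} {z} e = sym (trans (*-congʳ I.1#-homo) (*-identityˡ z))
    iter-eigen (suc n) {c} {z} e = trans (T.φ-cong (iter-eigen n e)) (trans (τ-scale _ z) (trans (*-congˡ e)
      (trans (solve 3 (λ a b z → a :* (b :* z) := (b :* a) :* z) refl (ι (c kP.^ n)) (ι c) z) (*-congʳ (sym (I.*-homo c _))))))

    coprime-orders : ∀ {c m} → c kP.^ r k.≈ k.1# → c kP.^ m k.≈ k.1# → ¬ (r ∣ m) → c k.≈ k.1#
    coprime-orders {c} {m} cr cm r∤m = go r pr cr r∤m
      where
      go : ∀ r → Prime r → c kP.^ r k.≈ k.1# → ¬ (r ∣ m) → c k.≈ k.1#
      go zero    pr _  _   = ⊥-elim (Primality.¬prime[0] pr)
      go (suc r) pr cr r∤m = order (Unity.order-exists k em {c} {r} cr)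
        where
        order : ∃ (Unity.IsOrder k c) → c k.≈ k.1#
        order (O , ord) = cases (Primality.prime⇒irreducible pr (minimal (suc r) cr))
          where
          open Unity.IsOrder ord
          cases : O ≡ 1 ⊎ O ≡ suc r → c k.≈ k.1#
          cases (inj₁ ≡.refl) = k.trans (k.sym (k.*-identityʳ c)) isRoot
          cases (inj₂ ≡.refl) = ⊥-elim (r∤m (minimal m cm))

    -- Write the order of z as m r^a with r not dividing m. Then z^m is an r^a-th root of unity, so
    -- it lies in k and is fixed by τ, whence c^m = 1. Period r gives c^r = 1, and so c = 1.
    eigen-trivial : ∀ {c z} → act (ones r) z ≈ 0# → ¬ (z ≈ 0#) → ⟦ z ⟧ ≈ ι c * z → c k.≈ k.1#
    eigen-trivial {c} {z} w z≉0 e = go (torsion z≉0)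
      where
      cr : c kP.^ r k.≈ k.1#
      cr = I.φ-injective em (trans (*-cancelˡ z≉0 (trans (*-comm _ _) (trans (sym (iter-eigen r e)) (trans (ones-kernel-iter r w) (sym (*-identityʳ z)))))) (sym I.1#-homo))
      go : ∃ (Unity.IsOrder top z) → c k.≈ k.1#
      go (M , ord) = split (prime-part pr M positive)
        where
        open Unity.IsOrder ord
        split : (∃[ a ] ∃[ m ] M ≡ m ℕ.* r ℕ.^ a × ¬ (r ∣ m)) → c k.≈ k.1#
        split (a , m , M≡ , r∤m) = coprime-orders {c} {m} cr cm r∤m
          where
          zm-fixed : ⟦ z ^ m ⟧ ≈ z ^ m
          zm-fixed = fixed-base (power-root-in-base a (trans (^-assocʳ z m (r ℕ.^ a)) (trans (^-congʳ z (≡.sym M≡)) isRoot)))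
          cm : c kP.^ m k.≈ k.1#
          cm = I.φ-injective em (trans (*-cancelˡ (^-nonzero m z≉0) (trans (*-comm _ _) (trans (*-congʳ (I.^-homo c m)) (trans (sym (^-distrib-* (ι c) z m))
            (trans (^-congˡ m (sym e)) (trans (sym (T.^-homo z m)) (trans zm-fixed (sym (*-identityʳ _))))))))) (sym I.1#-homo))

  -- Otherwise τ(y) - y is a nonzero element of trace zero and leads to an eigenvector of trace
  -- zero. Its eigenvalue is 1 by `eigen-trivial`, so its trace is r times itself, which is not 0.
  tame-fixed : ∀ {y} → iter r y ≈ y → ⟦ y ⟧ ≈ y
  tame-fixed {y} period = go em
    where
    go : Dec (⟦ y ⟧ - y ≈ 0#) → ⟦ y ⟧ ≈ y
    go (yes e) = x-y≈0⇒x≈y e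
    go (no ¬e) = ⊥-elim (absurd (eigenvector em r roots kernel ¬e (act-supported em {r} {Degree.linears k roots}
        (λ i ¬z → ∣.∣-trans (∣.∣-reflexive (≡.sym (ℕ.*-identityʳ r))) (support i ¬z)) (ones-kernel-iter r kernel) at-1)))
      where
      open Supported (supported 1)
      kernel : act (ones r) (⟦ y ⟧ - y) ≈ 0#
      kernel = trans (act-ones-difference r y) (x≈y⇒x-y≈0 period)
      absurd : (∃[ c ] ∃[ z ] act (ones r) z ≈ 0# × ¬ (z ≈ 0#) × ⟦ z ⟧ ≈ ι c * z) → ⊥
      absurd (c , z , w , z≉0 , e) = z≉0 (*-cancel-0 r≉0 (trans (×-assoc-* r 1# z) (trans (×-congʳ r (*-identityˡ z))
          (trans (sym (act-ones-fixed r z-fixed)) w))))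
        where
        z-fixed : ⟦ z ⟧ ≈ z
        z-fixed = trans e (trans (*-congʳ (trans (I.φ-cong (eigen-trivial w z≉0 e)) I.1#-homo)) (*-identityˡ z))

-- Conjugates of a root of the uniformiser

-- The value of π generates the value group but may be negative, as the isomorphism with ℤ is one of
-- groups only. Negative multiples are moved to the other side as x π^m ~ 1, which keeps all
-- exponents natural.
discrete-uniformiser : {K : Field ℓ} {V : Valuation K} → IsDiscrete V →
  let open Field K ; open FieldProperties K ; open ValuationProperties V in
  ∃[ π ] ¬ (π ≈ 0#) × ¬ (π ~ 1#) × (∀ {x} → ¬ (x ≈ 0#) → ∃[ m ] (x ~ π ^ m ⊎ x * π ^ m ~ 1#))
discrete-uniformiser {K = K} {V = V} (f , iso) = π , finite-nonzero vπ , π≁1 , λ x≉0 → values (v-finite x≉0)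
  where
  open Field K hiding (zero)
  open FieldProperties K
  open ValuationProperties V
  open Valuation V
  module Γ = OrderedAbelianGroup valueGroup
  module E = IsDecTotalOrder.Eq (Γ.≤⁺-isDecTotalOrder Γ.isDecTotalOrder)
  module f = IsGroupIsomorphism iso
  open RawMonoidDefs Γ.rawMonoid using () renaming (_×_ to _·_)
  γ = f (+ 1)
  π = proj₁ (surjective γ)
  vπ = proj₂ (surjective γ)
  homo : ∀ i j → f (i ℤ.+ j) Γ.≈ f i Γ.∙ f j
  homo = IsGroupHomomorphism.homo f.isGroupHomomorphism
  multiple : ∀ m → m · γ Γ.≈ f (+ m)
  multiple zero    = Γ.sym f.ε-homo
  multiple (suc m) = Γ.trans (Γ.∙-congˡ (multiple m)) (Γ.sym (homo (+ 1) (+ m)))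
  vπ^ : ∀ m → v (π ^ m) Γ.≈⁺ [ f (+ m) ]
  vπ^ m = E.trans (v-^ m vπ) Γ.[ multiple m ]
  unbox : ∀ {a b} → [ a ] Γ.≈⁺ [ b ] → a Γ.≈ b
  unbox Γ.[ p ] = p
  π≁1 : ¬ (π ~ 1#)
  π≁1 e with f.injective (Γ.trans (unbox (E.trans (E.sym vπ) (E.trans (~⇒v-≈ e) v-1))) (Γ.sym f.ε-homo))
  ... | ()
  values : ∀ {x} → (∃[ δ ] v x Γ.≈⁺ [ δ ]) → ∃[ m ] (x ~ π ^ m ⊎ x * π ^ m ~ 1#)
  values {x} (δ , vx) = by-sign (proj₁ (f.surjective δ)) (Γ.sym (proj₂ (f.surjective δ) ≡.refl))
    where
    by-sign : ∀ i → δ Γ.≈ f i → ∃[ m ] (x ~ π ^ m ⊎ x * π ^ m ~ 1#)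
    by-sign (+ m)    e = m , inj₁ (v-≈⇒~ (E.trans vx Γ.[ e ]) (vπ^ m))
    by-sign -[1+ m ] e = suc m , inj₂ (v-≈⇒~ (E.trans (v-*-finite vx (vπ^ (suc m))) Γ.[ sum≈ ]) v-1)
      where
      sum≈ : δ Γ.∙ f (+ suc m) Γ.≈ Γ.ε
      sum≈ = Γ.trans (Γ.∙-congʳ e) (Γ.trans (Γ.sym (homo -[1+ m ] (+ suc m)))
        (Γ.trans (Γ.reflexive (≡.cong f (ℤ.+-inverseˡ (+ suc m)))) f.ε-homo))

automorphism⇒embedding : {F : Field ℓ} {L : Extension F} → Automorphism L → L ↪ L
automorphism⇒embedding σ = record
  { ⟦_⟧ = ⟦_⟧ ; homomorphism = IsRingIsomorphism.isRingHomomorphism isomorphism ; fixes = fixes }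
  where open Automorphism σ

compose-automorphism : {F : Field ℓ} {L : Extension F} → Automorphism L → Automorphism L → Automorphism L
compose-automorphism {L = L} σ τ = record
  { ⟦_⟧ = λ x → σ.⟦ τ.⟦ x ⟧ ⟧
  ; isomorphism = Composition.isRingIsomorphism (Extension.trans L) τ.isomorphism σ.isomorphism
  ; fixes = λ a → Extension.trans L (IsRingIsomorphism.⟦⟧-cong σ.isomorphism (τ.fixes a)) (σ.fixes a)
  }
  where
  module σ = Automorphism σ
  module τ = Automorphism τ

identity-automorphism : {F : Field ℓ} (L : Extension F) → Automorphism L
identity-automorphism L = record
  { ⟦_⟧ = id ; isomorphism = Identity.isRingIsomorphism (Extension.rawRing L) (Extension.refl L) ; fixes = λ a → Extension.refl L }

module Enumerate (em : EM) (F : Field ℓ) where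
  open Field F hiding (zero)
  open PolynomialRing F
  open Degree F

  -- A list of distinct elements of C is prolonged as long as it is incomplete. It consists of roots
  -- of p, so `roots-bound` stops it from reaching `length p` elements.
  enumerate-roots : ∀ {p} → ¬ (p ≋ []) → (C : Carrier → Set ℓ) → (∀ {x} → C x → Root p x) →
                    ∃[ xs ] Distinct xs × All C xs × (∀ {x} → C x → Any (x ≈_) xs)
  enumerate-roots {p} p≉0 C root = go (length p) [] [] [] ℕ.≤-refl
    where
    go : ∀ fuel xs → Distinct xs → All C xs → length p ℕ.≤ length xs ℕ.+ fuel →
         ∃[ xs ] Distinct xs × All C xs × (∀ {x} → C x → Any (x ≈_) xs)
    go fuel xs d all bound with em {P = ∃[ x ] C x × ¬ Any (x ≈_) xs}
    ... | no ¬∃ = xs , d , all , λ {x} c → complete c em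
      where
      complete : ∀ {x} → C x → Dec (Any (x ≈_) xs) → Any (x ≈_) xs
      complete c (yes a) = a
      complete c (no ¬a) = ⊥-elim (¬∃ (_ , c , ¬a))
    go zero xs d all bound | yes _ = ⊥-elim (p≉0 (roots-bound d (All.map root all)
      (below-mono (≡.subst (length p ℕ.≤_) (ℕ.+-identityʳ _) bound) (below-length p))))
    go (suc fuel) xs d all bound | yes (x , c , new) = go fuel (x ∷ xs) (All.¬Any⇒All¬ xs new ∷ d) (c ∷ all)
      (≡.subst (length p ℕ.≤_) (ℕ.+-suc (length xs) fuel) bound)

module Conjugates (em : EM) {K : Field ℓ} {V : Valuation K} (henselian : IsHenselian V) (discrete : IsDiscrete V)
                  (E : Extension K) (galois : IsGalois E) {W : Valuation (Extension.top E)} (ext : Extends E V W)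
                  {k : Field ℓ} (R : ResidueMap W k) where
  private
    module K = Field K
    module KP = FieldProperties K
    module k = Field k
    module k[X] = PolynomialRing k
    module VP = ValuationProperties V
    module I = Homomorphism {F = K} {G = Extension.top E} (Extension.ι-homomorphism E)
  open Extension E hiding (zero)
  open FieldProperties top
  open Division em
  open PolynomialRing top
  open Degree top
  open Unity top using (monic-split)
  open ValuationProperties W
  open ResidueMapProperties em R
  open ExtendsProperties E ext using (extends⇒; extends⇐)
  open IsGalois galois
  open SetoidReasoning setoid

  private
    π = proj₁ (discrete-uniformiser {V = V} discrete)
    π≉0 : ¬ (π K.≈ K.0#)
    π≉0 = proj₁ (proj₂ (discrete-uniformiser {V = V} discrete))
    π≁1 : ¬ (π VP.~ K.1#)
    π≁1 = proj₁ (proj₂ (proj₂ (discrete-uniformiser {V = V} discrete)))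
    values : ∀ {x} → ¬ (x K.≈ K.0#) → ∃[ m ] (x VP.~ π KP.^ m ⊎ x K.* π KP.^ m VP.~ K.1#)
    values = proj₂ (proj₂ (proj₂ (discrete-uniformiser {V = V} discrete)))

  ι~ : ∀ {x y} → x VP.~ y → ι x ~ ι y
  ι~ (p , q) = extends⇒ p , extends⇒ q

  uniformiser : Carrier
  uniformiser = ι π

  uniformiser≉0 : ¬ (uniformiser ≈ 0#)
  uniformiser≉0 = I.φ-nonzero π≉0

  -- b has value w(π)/n
  module _ {n-1 : ℕ} (b : Carrier) (b^n~π : b ^ suc n-1 ~ uniformiser) where
    private
      n = suc n-1

      b≉0 : ¬ (b ≈ 0#)
      b≉0 b≈0 = ~-nonzero (~-sym b^n~π) uniformiser≉0 (trans (*-congʳ b≈0) (zeroˡ _))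

      b≁1 : ¬ (b ~ 1#)
      b≁1 e = π≁1 (extends⇐ (proj₁ ιπ~) , extends⇐ (proj₂ ιπ~))
        where
        ιπ~ : ι π ~ ι K.1#
        ιπ~ = ~-trans (~-sym b^n~π) (~-trans (~-^ n e) (≈⇒~ (trans (1^n≈1 n) (sym I.1#-homo))))

      -- The value of b is nonzero, because n times it is the value of π, and the value group has no
      -- torsion.
      exponent-unique : ∀ {x y} → b ^ x ~ b ^ y → x ≡ y
      exponent-unique {x} {y} e = go (ℕ.<-cmp x y)
        where
        strict : ∀ {x y} → x ℕ.< y → ¬ (b ^ x ~ b ^ y)
        strict {x} {y} x<y e = b≁1 (~-root d b≉0 (~-trans (~-sym (~-cancelˡ (^-nonzero x b≉0) (~-trans (≈⇒~ (*-identityʳ _))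
            (~-trans e (≈⇒~ (trans (^-congʳ b (≡.sym y≡)) (^-homo-* b x (suc d)))))))) (≈⇒~ (sym (1^n≈1 (suc d))))))
          where
          d = y ℕ.∸ suc x
          y≡ : x ℕ.+ suc d ≡ y
          y≡ = ≡.trans (ℕ.+-suc x d) (ℕ.m+[n∸m]≡n x<y)
        go : Tri (x ℕ.< y) (x ≡ y) (y ℕ.< x) → x ≡ y
        go (tri< x<y _ _) = ⊥-elim (strict x<y e)
        go (tri≈ _ x≡y _) = x≡y
        go (tri> _ _ y<x) = ⊥-elim (strict y<x (~-sym e))

      -- Conjugates form the orbit of b under the automorphisms, so that the product of the X - bᵢ
      -- is invariant by construction. The orbit is finite since it consists of roots of an equation
      -- of b over K.
      Conjugate : Carrier → Set ℓ
      Conjugate y = ∃[ σ ] Automorphism.⟦_⟧ {L = E} σ b ≈ y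

      module _ (σ : Automorphism E) where
        open Automorphism σ
        module S = Homomorphism {F = top} {G = top} (IsRingIsomorphism.isRingHomomorphism isomorphism)

        σ~ : ∀ {x y} → x ~ y → ⟦ x ⟧ ~ ⟦ y ⟧
        σ~ (p , q) = preserve p , preserve q
          where
          preserve : ∀ {x y} → x ≼ y → ⟦ x ⟧ ≼ ⟦ y ⟧
          preserve = Henselian.embedding⇒ em henselian E E algebraic ext ext (automorphism⇒embedding σ)

        -- Uniqueness says that σ preserves comparisons, not yet that σ(x) and x have equal values.
        -- For b the comparison passes through π, which σ fixes: σ(b)ⁿ ~ σ(π) = π ~ bⁿ.
        conjugate~ : ⟦ b ⟧ ~ b
        conjugate~ = ~-root n-1 (S.φ-nonzero b≉0) (~-trans (≈⇒~ (sym (S.^-homo b n)))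
          (~-trans (σ~ b^n~π) (~-trans (≈⇒~ (fixes π)) (~-sym b^n~π))))

      algebraic-b = algebraic b
      p = proj₁ algebraic-b

      map-nonzero : ¬ (map ι p ≋ [])
      map-nonzero e = I.φ-nonzero (proj₂ (proj₁ (proj₂ algebraic-b)))
        (trans (sym (coeff-map {F = K} {G = top} ι-homomorphism p (proj₁ (proj₁ (proj₂ algebraic-b))))) (at e _))

      conjugate-root : ∀ {x} → Conjugate x → Root (map ι p) x
      conjugate-root {x} (σ , e) = begin
        eval (map ι p) x                ≈⟨ eval-cong {map ι p} {map ⟦_⟧ (map ι p)} (mk λ m → trans (coeff-map {F = K} {G = top} ι-homomorphism p m)
                                             (trans (sym (fixes _)) (trans (S.φ-cong σ (sym (coeff-map {F = K} {G = top} ι-homomorphism p m)))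
                                               (sym (coeff-map {F = top} {G = top} (IsRingIsomorphism.isRingHomomorphism isomorphism) (map ι p) m))))) (sym e) ⟩
        eval (map ⟦_⟧ (map ι p)) ⟦ b ⟧  ≈⟨ eval-map {F = top} {G = top} (IsRingIsomorphism.isRingHomomorphism isomorphism) (map ι p) b ⟩
        ⟦ eval (map ι p) b ⟧            ≈⟨ S.φ-cong σ (proj₂ (proj₂ algebraic-b)) ⟩
        ⟦ 0# ⟧                          ≈⟨ S.0#-homo σ ⟩
        0#                              ∎
        where open Automorphism σ

      conjugates = Enumerate.enumerate-roots em top map-nonzero Conjugate conjugate-root
      bs = proj₁ conjugates
      distinct = proj₁ (proj₂ conjugates)
      all-conjugate = proj₁ (proj₂ (proj₂ conjugates))
      complete : ∀ {x} → Conjugate x → Any (x ≈_) bs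
      complete = proj₂ (proj₂ (proj₂ conjugates))
      t = length bs

      -- σ permutes the conjugates of b
      fixed-linears : ∀ (σ : Automorphism E) → map (Automorphism.⟦_⟧ σ) (linears bs) ≋ linears bs
      fixed-linears σ = ≋-trans (map-linears {F = top} {G = top} hom bs) (≋-sym (monic-split (monic-linears bs)
          (AllPairs.map⁺ (AllPairs.map (λ x≉y e → x≉y (S.φ-injective σ em e)) distinct))
          (All.map⁺ (All.map (λ {x} (τ , e) → linears-root⁻ (complete (compose-automorphism σ τ , S.φ-cong σ e))) all-conjugate))
          (List.length-map ⟦_⟧ bs)))
        where
        open Automorphism σ
        hom = IsRingIsomorphism.isRingHomomorphism isomorphism

      coefficient-in-base : ∀ i → InBase E (coeff (linears bs) i)
      coefficient-in-base i = fixedField (coeff (linears bs) i) λ σ →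
        trans (sym (coeff-map {F = top} {G = top} (IsRingIsomorphism.isRingHomomorphism (Automorphism.isomorphism σ)) (linears bs) i)) (at (fixed-linears σ) i)

      -- With P = `linears bs` of degree t, the polynomial `linears cs` is P(bX)/b^t.
      cs = map (_/ b) bs

      coeff-zero-X- : ∀ p a → coeff (p *ₚ (X- a)) 0 ≈ - a * coeff p 0
      coeff-zero-X- p a = trans (at (*ₚ-comm p (X- a)) 0) (trans (coeff-+ ((- a) • p) (0# ∷ 1ₚ *ₚ p) 0) (trans (+-identityʳ _) (coeff-• (- a) p 0)))

      coeff-suc-X- : ∀ p a i → coeff (p *ₚ (X- a)) (suc i) ≈ coeff p i - a * coeff p (suc i)
      coeff-suc-X- p a i = begin
        coeff (p *ₚ (X- a)) (suc i)                  ≈⟨ at (*ₚ-comm p (X- a)) (suc i) ⟩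
        coeff ((X- a) *ₚ p) (suc i)                  ≈⟨ coeff-suc-* (- a) 1ₚ p i ⟩
        - a * coeff p (suc i) + coeff (1ₚ *ₚ p) i    ≈⟨ +-congˡ (at (*ₚ-identityˡ p) i) ⟩
        - a * coeff p (suc i) + coeff p i            ≈⟨ solve 3 (λ a p q → (:- a) :* q :+ p := p :- a :* q) refl a (coeff p i) (coeff p (suc i)) ⟩
        coeff p i - a * coeff p (suc i)              ∎

      -- P(bX) = b^t Q(X) coefficient by coefficient, where the roots of Q are those of P divided by
      -- b.
      scaled : ∀ as i → coeff (linears as) i * b ^ i ≈ b ^ length as * coeff (linears (map (_/ b) as)) i
      scaled []       zero    = *-comm _ _
      scaled []       (suc i) = trans (zeroˡ _) (sym (zeroʳ _))
      scaled (a ∷ as) zero    = begin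
        coeff (linears (a ∷ as)) 0 * b ^ 0            ≈⟨ *-congʳ (coeff-zero-X- (linears as) a) ⟩
        - a * coeff (linears as) 0 * b ^ 0            ≈⟨ *-assoc _ _ _ ⟩
        - a * (coeff (linears as) 0 * b ^ 0)          ≈⟨ *-cong (-‿cong (sym (y*x/y≈x b≉0))) (scaled as 0) ⟩
        - (b * (a / b)) * (b ^ length as * q)         ≈⟨ solve 4 (λ b c s q → (:- (b :* c)) :* (s :* q) := b :* s :* ((:- c) :* q)) refl b (a / b) (b ^ length as) q ⟩
        b ^ suc (length as) * (- (a / b) * q)         ≈⟨ *-congˡ (coeff-zero-X- (linears (map (_/ b) as)) (a / b)) ⟨
        b ^ suc (length as) * coeff (linears (map (_/ b) (a ∷ as))) 0 ∎
        where q = coeff (linears (map (_/ b) as)) 0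
      scaled (a ∷ as) (suc i) = begin
        coeff (linears (a ∷ as)) (suc i) * (b * b ^ i) ≈⟨ *-congʳ (coeff-suc-X- (linears as) a i) ⟩
        (p₀ - a * p₁) * (b * b ^ i)                    ≈⟨ solve 5 (λ p₀ a p₁ b bi → (p₀ :- a :* p₁) :* (b :* bi) := b :* (p₀ :* bi) :- a :* (p₁ :* (b :* bi))) refl p₀ a p₁ b (b ^ i) ⟩
        b * (p₀ * b ^ i) - a * (p₁ * (b * b ^ i))      ≈⟨ +-cong (*-congˡ (scaled as i)) (-‿cong (*-cong (sym (y*x/y≈x b≉0)) (scaled as (suc i)))) ⟩
        b * (s * q₀) - b * (a / b) * (s * q₁)          ≈⟨ solve 5 (λ b s q₀ c q₁ → b :* (s :* q₀) :- b :* c :* (s :* q₁) := b :* s :* (q₀ :- c :* q₁)) refl b s q₀ (a / b) q₁ ⟩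
        b * s * (q₀ - (a / b) * q₁)                    ≈⟨ *-congˡ (coeff-suc-X- (linears (map (_/ b) as)) (a / b) i) ⟨
        b * s * coeff (linears (map (_/ b) (a ∷ as))) (suc i) ∎
        where
        p₀ = coeff (linears as) i
        p₁ = coeff (linears as) (suc i)
        q₀ = coeff (linears (map (_/ b) as)) i
        q₁ = coeff (linears (map (_/ b) as)) (suc i)
        s = b ^ length as

      quotient-unit : ∀ {a} → Conjugate a → a / b ~ 1#
      quotient-unit (σ , e) = ~-cancelˡ b≉0 (~-trans (≈⇒~ (trans (y*x/y≈x b≉0) (sym e))) (~-trans (conjugate~ σ) (≈⇒~ (sym (*-identityʳ b)))))

      units : All (_~ 1#) cs
      units = All.map⁺ (All.map quotient-unit all-conjugate)

      integral-cs : All Integral cs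
      integral-cs = All.map proj₂ units

      -- If the i-th coefficient of P(bX)/b^t is a unit, that of P has value (t - i) w(b). Lying in
      -- K, it has a multiple of w(π) = n w(b) as its value. The two cases are the two signs of this
      -- multiple.
      unit-exponent : ∀ {i} → coeff (linears cs) i ~ 1# → ∃[ m ] (n ℕ.* m ℕ.+ i ≡ t ⊎ i ≡ t ℕ.+ n ℕ.* m)
      unit-exponent {i} u = go (coefficient-in-base i)
        where
        Pi~ : coeff (linears bs) i * b ^ i ~ b ^ t
        Pi~ = ~-trans (≈⇒~ (scaled bs i)) (~-trans (~-* ~-refl u) (≈⇒~ (*-identityʳ _)))
        π^~ : ∀ m → ι (π KP.^ m) ~ b ^ (n ℕ.* m)
        π^~ m = ~-trans (≈⇒~ (I.^-homo π m)) (~-trans (~-^ m (~-sym b^n~π)) (≈⇒~ (^-assocʳ b n m)))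
        go : InBase E (coeff (linears bs) i) → ∃[ m ] (n ℕ.* m ℕ.+ i ≡ t ⊎ i ≡ t ℕ.+ n ℕ.* m)
        go (a , ιa≈) = by-value (values a≉0)
          where
          ιa*b^i~ : ι a * b ^ i ~ b ^ t
          ιa*b^i~ = ~-trans (≈⇒~ (*-congʳ ιa≈)) Pi~
          a≉0 : ¬ (a K.≈ K.0#)
          a≉0 a≈0 = ~-nonzero (~-sym ιa*b^i~) (^-nonzero t b≉0) (trans (*-congʳ (trans (I.φ-cong a≈0) I.0#-homo)) (zeroˡ _))
          by-value : (∃[ m ] (a VP.~ π KP.^ m ⊎ a K.* π KP.^ m VP.~ K.1#)) → ∃[ m ] (n ℕ.* m ℕ.+ i ≡ t ⊎ i ≡ t ℕ.+ n ℕ.* m)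
          by-value (m , inj₁ e) = m , inj₁ (exponent-unique (~-trans (≈⇒~ (^-homo-* b (n ℕ.* m) i))
            (~-trans (~-* (~-trans (~-sym (π^~ m)) (~-sym (ι~ e))) ~-refl) ιa*b^i~)))
          by-value (m , inj₂ e) = m , inj₂ (exponent-unique (~-trans (≈⇒~ (sym (*-identityˡ _))) (~-trans (~-* (~-sym one) ~-refl)
            (~-trans (≈⇒~ (solve 3 (λ a p b → (a :* p) :* b := (a :* b) :* p) refl (ι a) (b ^ (n ℕ.* m)) (b ^ i)))
              (~-trans (~-* ιa*b^i~ ~-refl) (≈⇒~ (sym (^-homo-* b t (n ℕ.* m)))))))))
            where
            one : ι a * b ^ (n ℕ.* m) ~ 1#
            one = ~-trans (~-* ~-refl (~-sym (π^~ m))) (~-trans (≈⇒~ (sym (I.*-homo _ _))) (~-trans (ι~ e) (≈⇒~ I.1#-homo)))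

      reduced : map red (linears cs) k[X].≋ Degree.linears k (map red cs)
      reduced = red-linears integral-cs

      coeff-unit : ∀ {i} → ¬ (k[X].coeff (Degree.linears k (map red cs)) i k.≈ k.0#) → coeff (linears cs) i ~ 1#
      coeff-unit {i} ¬z = red-nonzero (integral-coeff (integral-linears integral-cs) i)
        λ z → ¬z (k.trans (k.sym (k[X].at reduced i)) (k.trans (coeff-red (linears cs) i) z))

      -- The conjugates of b have the same value as b, so no quotient bᵢ/b reduces to 0 and 0 is not
      -- a root of the reduction.
      constant-unit : ¬ (k[X].coeff (Degree.linears k (map red cs)) 0 k.≈ k.0#)
      constant-unit z = none units (Any.map⁻ (ClassicalDegree.linears-root em k {map red cs} (k.trans (eval-at-0 (Degree.linears k (map red cs))) z)))
        where
        eval-at-0 : ∀ p → k[X].eval p k.0# k.≈ k[X].coeff p 0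
        eval-at-0 []      = k.refl
        eval-at-0 (a ∷ p) = k.trans (k.+-congˡ (k.zeroˡ _)) (k.+-identityʳ a)
        none : ∀ {cs} → All (_~ 1#) cs → ¬ Any (λ c → k.0# k.≈ red c) cs
        none (u ∷ us) (here e)    = red-unit u (k.sym e)
        none (u ∷ us) (there any) = none us any

      -- The exponent 0 survives reduction by `constant-unit`, and `unit-exponent` at 0 compares it
      -- with t.
      n∣t : n ∣ t
      n∣t = go (unit-exponent (coeff-unit constant-unit))
        where
        go : (∃[ m ] (n ℕ.* m ℕ.+ 0 ≡ t ⊎ 0 ≡ t ℕ.+ n ℕ.* m)) → n ∣ t
        go (m , inj₁ e) = ∣.divides m (≡.trans (≡.sym e) (≡.trans (ℕ.+-identityʳ _) (ℕ.*-comm n m)))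
        go (m , inj₂ e) = ≡.subst (n ∣_) (≡.sym (ℕ.m+n≡0⇒m≡0 t (≡.sym e))) (n ∣.∣0)

    supported : Supported {k = k} (suc n-1)
    supported = record
      { roots   = map red cs
      ; support = λ i ¬z → divisible i (unit-exponent (coeff-unit ¬z))
      -- b is one of its own conjugates, and b / b = 1.
      ; at-1    = Degree.linears-root⁻ k (Any.map⁺ (Any.map⁺ (Any.map one (complete (identity-automorphism E , refl)))))
      }
      where
      divisible : ∀ i → (∃[ m ] (n ℕ.* m ℕ.+ i ≡ t ⊎ i ≡ t ℕ.+ n ℕ.* m)) → n ∣ i
      divisible i (m , inj₁ e) = ∣.∣m+n∣m⇒∣n (≡.subst (n ∣_) (≡.sym e) n∣t) (∣.m∣m*n m)
      divisible i (m , inj₂ e) = ≡.subst (n ∣_) (≡.sym e) (∣.∣m∣n⇒∣m+n n∣t (∣.m∣m*n m))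
      one : ∀ {a} → b ≈ a → k.1# k.≈ red (a / b)
      one {a} e = k.trans (k.sym red-1) (red-cong ≼-refl (*-cancelˡ b≉0 (trans (*-identityʳ b) (trans e (sym (y*x/y≈x b≉0))))))

  -- Taking r-th roots up to units a times, starting from the uniformiser, produces an element b
  -- with b^(r^a) ~ π.
  supported-powers : ∀ {r} → 0 ℕ.< r → IsDivisibleBy r (Valuation.valueGroup W) → ∀ a → Supported {k = k} (r ℕ.^ a)
  supported-powers {r} 0<r div a = go (r ℕ.^ a) (ℕ.m^n>0 r {{ℕ.>-nonZero 0<r}} a) (power-root a)
    where
    power-root : ∀ a → ∃[ b ] ¬ (b ≈ 0#) × b ^ (r ℕ.^ a) ~ uniformiser
    power-root zero    = uniformiser , uniformiser≉0 , ≈⇒~ (*-identityʳ _)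
    power-root (suc a) = step (power-root a)
      where
      step : (∃[ b ] ¬ (b ≈ 0#) × b ^ (r ℕ.^ a) ~ uniformiser) → ∃[ b ] ¬ (b ≈ 0#) × b ^ (r ℕ.^ suc a) ~ uniformiser
      step (b , b≉0 , e) = let c , c≉0 , e′ = divisible⇒roots r div b≉0 in
        c , c≉0 , ~-trans (≈⇒~ (sym (^-assocʳ c r (r ℕ.^ a)))) (~-trans (~-^ (r ℕ.^ a) e′) e)
    go : ∀ n → 0 ℕ.< n → (∃[ b ] ¬ (b ≈ 0#) × b ^ n ~ uniformiser) → Supported {k = k} n
    go (suc n-1) _ (b , _ , e) = supported {n-1} b e

-- Split division algebras

NoZeroDivisors : {F : Field ℓ} → FAlgebra F → Set ℓ
NoZeroDivisors A = ∀ {x y} → x * y ≈ 0# → ¬ (y ≈ 0#) → x ≈ 0#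
  where open FAlgebra A

module SplitDomain (em : EM) {F : Field ℓ} (A : FAlgebra F)
    (domain : NoZeroDivisors A) where
  private
    module F = Field F
    B = extensionAlgebra (trivialExtension F)
    module FS = SemiringSum F.semiring
  open FAlgebra A hiding (zero)
  open SemiringSum semiring
  open IsRingHomomorphism ι-homomorphism using (*-homo; 0#-homo; 1#-homo) renaming (⟦⟧-cong to ι-cong)
  open RingProperties ring using ([y-z]x≈yx-zx)
  open GroupProperties (Ring.+-group ring) using () renaming (x∙y⁻¹≈ε⇒x≈y to x-y≈0⇒x≈y; x≈y⇒x∙y⁻¹≈ε to x≈y⇒x-y≈0)
  open SetoidReasoning setoid

  private
    sum-single : ∀ {n} (t : Fin n → Carrier) i → (∀ j → j ≢ i → t j ≈ 0#) → sum t ≈ t i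
    sum-single {suc n} t i z = trans (sum-remove {i = i} t) (trans (+-congˡ (trans
      (sum-cong-≋ {x = Vector.removeAt t i} {y = λ _ → 0#} λ j → z (punchIn i j) (Fin.punchInᵢ≢i i j)) (sum-replicate-zero n))) (+-identityʳ _))

    diagonal-diagonal : ∀ {n} x (i : Fin n) → diagonal A n x i i ≈ x
    diagonal-diagonal x i with i Fin.≟ i
    ... | yes _ = refl
    ... | no ¬e = ⊥-elim (¬e ≡.refl)

    diagonal-off : ∀ {n} x (i j : Fin n) → i ≢ j → diagonal A n x i j ≈ 0#
    diagonal-off x i j i≢j with i Fin.≟ j
    ... | yes e = ⊥-elim (i≢j e)
    ... | no _  = refl

    module _ {m n : ℕ} (f : (Fin (suc m) → Fin (suc m) → Carrier) → Fin (suc n) → Fin (suc n) → F.Carrier)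
             (iso : IsRingIsomorphism (matrixRing A (suc m)) (matrixRing B (suc n)) f)
             (scalar : ∀ a → RawRing._≈_ (matrixRing B (suc n)) (f (diagonal A (suc m) (ι a))) (diagonal B (suc n) a)) where
      open IsRingIsomorphism iso using (injective; surjective) renaming (⟦⟧-cong to f-cong; *-homo to f-*; 0#-homo to f-0)
      module MA = RawRing (matrixRing A (suc m))
      module MB = RawRing (matrixRing B (suc n))

      unit : MB.Carrier
      unit zero    zero    = F.1#
      unit zero    (suc j) = F.0#
      unit (suc i) j       = F.0#

      zeros : ∀ {k} (t : Fin k → F.Carrier) → (∀ i → t i F.≈ F.0#) → FS.sum t F.≈ F.0#
      zeros {k} t z = F.trans (FS.sum-cong-≋ {x = t} {y = λ _ → F.0#} z) (FS.sum-replicate-zero k)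

      left-unit : ∀ M i j → (unit MB.* M) i j F.≈ unit i zero F.* M zero j
      left-unit M i j = F.trans (F.+-congˡ (zeros (λ l → unit i (suc l) F.* M (suc l) j) λ l → F.trans (F.*-congʳ (column i l)) (F.zeroˡ _))) (F.+-identityʳ _)
        where
        column : ∀ i l → unit i (suc l) F.≈ F.0#
        column zero    l = F.refl
        column (suc i) l = F.refl

      right-unit : ∀ M i j → (M MB.* unit) i j F.≈ M i zero F.* unit zero j
      right-unit M i j = F.trans (F.+-congˡ (zeros (λ l → M i (suc l) F.* F.0#) λ l → F.zeroʳ _)) (F.+-identityʳ _)

      MB-*-cong : ∀ {M M′ N N′} → M MB.≈ M′ → N MB.≈ N′ → M MB.* N MB.≈ M′ MB.* N′
      MB-*-cong p q i j = FS.sum-cong-≋ λ l → F.*-cong (p i l) (q l j)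

      -- For the matrix unit with entry 1 in the top left corner, unit M unit is the corner entry of
      -- M times unit. The preimage P of this unit among the matrices over A inherits the property
      -- in `sandwich`.
      compress : ∀ M → (unit MB.* M) MB.* unit MB.≈ diagonal B (suc n) (M zero zero) MB.* unit
      compress M i j = F.trans (right-unit (unit MB.* M) i j) (F.trans (F.*-congʳ (F.trans (left-unit M i zero) (entry i)))
        (F.sym (right-unit (diagonal B (suc n) (M zero zero)) i j)))
        where
        entry : ∀ i → unit i zero F.* M zero zero F.≈ diagonal B (suc n) (M zero zero) i zero
        entry zero    = F.*-identityˡ _
        entry (suc i) = F.zeroˡ _

      idempotent : ∃[ P ] f P MB.≈ unit
      idempotent = proj₁ (surjective unit) , proj₂ (surjective unit) (λ i j → refl)

      P = proj₁ idempotent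

      -- because P corresponds to a matrix unit
      sandwich : ∀ Y → ∃[ c ] (P MA.* Y) MA.* P MA.≈ diagonal A (suc m) (ι c) MA.* P
      sandwich Y = c , injective λ i j → F.trans (f-* (P MA.* Y) P i j) (F.trans (MB-*-cong {f (P MA.* Y)} {unit MB.* f Y} {f P} {unit} (λ i j → F.trans (f-* P Y i j)
            (MB-*-cong {f P} {unit} {f Y} {f Y} (proj₂ idempotent) (λ _ _ → F.refl) i j)) (proj₂ idempotent) i j)
          (F.trans (compress (f Y) i j) (F.trans (MB-*-cong {diagonal B (suc n) c} {f (diagonal A (suc m) (ι c))} {unit} {f P}
            (λ i j → F.sym (scalar c i j)) (λ i j → F.sym (proj₂ idempotent i j)) i j) (F.sym (f-* (diagonal A (suc m) (ι c)) P i j)))))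
        where c = f Y zero zero

      P≉0 : ¬ (∀ i j → P i j ≈ 0#)
      P≉0 z = F.1≉0 (F.trans (F.sym (proj₂ idempotent zero zero)) (F.trans (f-cong z zero zero) (f-0 zero zero)))

      entry : ∃[ i ] ∃[ j ] ¬ (P i j ≈ 0#)
      entry = go em
        where
        go : Dec (∃[ i ] ∃[ j ] ¬ (P i j ≈ 0#)) → ∃[ i ] ∃[ j ] ¬ (P i j ≈ 0#)
        go (yes e) = e
        go (no ¬e) = ⊥-elim (P≉0 λ i j → zero? i j em)
          where
          zero? : ∀ i j → Dec (P i j ≈ 0#) → P i j ≈ 0#
          zero? i j (yes z) = z
          zero? i j (no ¬z) = ⊥-elim (¬e (i , j , ¬z))

      i₀ = proj₁ entry
      j₀ = proj₁ (proj₂ entry)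
      d  = P i₀ j₀
      d≉0 : ¬ (d ≈ 0#)
      d≉0 = proj₂ (proj₂ entry)

      -- Let Y have the single entry y at (j₀, i₀). The entry of P Y P = c P at (i₀, j₀) reads d y d
      -- = c d, and d cancels because A has no zero divisors.
      scaled : ∀ y → ∃[ c ] d * y ≈ ι c
      scaled y = c , x-y≈0⇒x≈y (d * y) (ι c) (domain (trans ([y-z]x≈yx-zx d (d * y) (ι c)) (x≈y⇒x-y≈0 (begin
          d * y * d                       ≈⟨ *-congʳ (row {i₀} y-at) ⟨
          (P MA.* Y) i₀ i₀ * d            ≈⟨ sum-single (λ l → (P MA.* Y) i₀ l * P l j₀) i₀ (λ l l≢ → trans (*-congʳ (row-off l l≢)) (zeroˡ _)) ⟨
          ((P MA.* Y) MA.* P) i₀ j₀       ≈⟨ proj₂ (sandwich Y) i₀ j₀ ⟩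
          (diagonal A (suc m) (ι c) MA.* P) i₀ j₀ ≈⟨ sum-single (λ l → diagonal A (suc m) (ι c) i₀ l * P l j₀) i₀
                                                     (λ l l≢ → trans (*-congʳ (diagonal-off (ι c) i₀ l (λ e → l≢ (≡.sym e)))) (zeroˡ _)) ⟩
          diagonal A (suc m) (ι c) i₀ i₀ * d ≈⟨ *-congʳ (diagonal-diagonal (ι c) i₀) ⟩
          ι c * d                         ∎))) d≉0)
        where
        Y : MA.Carrier
        Y k l = diagonal A (suc m) (diagonal A (suc m) y l i₀) k j₀
        c = proj₁ (sandwich Y)
        y-at : Y j₀ i₀ ≈ y
        y-at = trans (diagonal-diagonal _ j₀) (diagonal-diagonal y i₀)
        row : ∀ {l x} → Y j₀ l ≈ x → (P MA.* Y) i₀ l ≈ d * x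
        row {l} e = trans (sum-single (λ k → P i₀ k * Y k l) j₀ (λ k k≢ → trans (*-congˡ (diagonal-off _ k j₀ k≢)) (zeroʳ _))) (*-congˡ e)
        row-off : ∀ l → l ≢ i₀ → (P MA.* Y) i₀ l ≈ 0#
        row-off l l≢ = trans (row {l} (trans (diagonal-diagonal _ j₀) (diagonal-off y l i₀ l≢))) (zeroʳ d)

      -- The case y = 1 of `scaled` shows that d is itself a nonzero scalar, so it can be divided
      -- out of d y.
      scalars : ∀ y → ∃[ c ] ι c ≈ y
      scalars y = e F.* c , (begin
        ι (e F.* c)          ≈⟨ *-homo e c ⟩
        ι e * ι c            ≈⟨ *-congˡ (proj₂ (scaled y)) ⟨
        ι e * (d * y)        ≈⟨ *-assoc _ _ _ ⟨
        ι e * d * y          ≈⟨ *-congʳ (*-congˡ d≈) ⟩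
        ι e * ι c₁ * y       ≈⟨ *-congʳ (*-homo e c₁) ⟨
        ι (e F.* c₁) * y     ≈⟨ *-congʳ (trans (ι-cong (F.trans (F.*-comm e c₁) (proj₂ (F.inverse c₁ c₁≉0)))) 1#-homo) ⟩
        1# * y               ≈⟨ *-identityˡ y ⟩
        y                    ∎)
        where
        c = proj₁ (scaled y)
        c₁ = proj₁ (scaled 1#)
        d≈ : d ≈ ι c₁
        d≈ = trans (sym (*-identityʳ d)) (proj₂ (scaled 1#))
        c₁≉0 : ¬ (c₁ F.≈ F.0#)
        c₁≉0 z = d≉0 (trans d≈ (trans (ι-cong z) 0#-homo))
        e = proj₁ (F.inverse c₁ c₁≉0)

  split-domain : BrauerEquivalent A B → ∀ y → ∃[ c ] ι c ≈ y
  split-domain (m , n , f , iso , scalar) = scalars f iso scalar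

-- Cyclic algebras

-- The opposite of the cyclic algebra ⨁ L uʲ (j < r) with u a = σ(a) u and uʳ = π,
-- realised as the L-linear endomorphisms of V = ⨁ L uʲ commuting with left multiplication U by u.
module CyclicAlgebra (em : EM) {F : Field ℓ} (L : Extension F) (σ : L ↪ L) (r-1 : ℕ)
    (π : Extension.Carrier L) (σπ≈π : Extension._≈_ L (_↪_.⟦_⟧ σ π) π)
    (period : ∀ x → Extension._≈_ L (Operator.iter L σ (suc r-1) x) x) where
  private
    module F = Field F
    module S = Homomorphism {F = Extension.top L} {G = Extension.top L} (_↪_.homomorphism σ)
    module I = Homomorphism {F = F} {G = Extension.top L} (Extension.ι-homomorphism L)
  open Extension L hiding (zero)
  open FieldProperties top
  open SemiringSum semiring
  open SetoidReasoning setoid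
  open _↪_ σ using (⟦_⟧; fixes)
  open Operator L σ using (iter)

  r : ℕ
  r = suc r-1

  V : Set ℓ
  V = Fin r → Carrier

  infix 4 _≐_
  record _≐_ (v w : V) : Set ℓ where
    constructor pointwise
    field at : ∀ i → v i ≈ w i
  open _≐_ public

  ≐-refl : ∀ {v} → v ≐ v
  ≐-refl = pointwise λ _ → refl

  ≐-sym : ∀ {v w} → v ≐ w → w ≐ v
  ≐-sym e = pointwise λ i → sym (at e i)

  ≐-trans : ∀ {u v w} → u ≐ v → v ≐ w → u ≐ w
  ≐-trans e f = pointwise λ i → trans (at e i) (at f i)

  0ᵛ : V
  0ᵛ _ = 0#

  infixl 6 _⊞_
  infixr 7 _⊡_
  _⊞_ : V → V → V
  (v ⊞ w) i = v i + w i

  _⊡_ : Carrier → V → V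
  (a ⊡ v) i = a * v i

  comb : ∀ {n} → (Fin n → Carrier) → (Fin n → V) → V
  comb c w i = sum (λ j → c j * w j i)

  ⊞-cong : ∀ {v v′ w w′} → v ≐ v′ → w ≐ w′ → v ⊞ w ≐ v′ ⊞ w′
  ⊞-cong e f = pointwise λ i → +-cong (at e i) (at f i)

  ⊡-cong : ∀ {a b v w} → a ≈ b → v ≐ w → a ⊡ v ≐ b ⊡ w
  ⊡-cong e f = pointwise λ i → *-cong e (at f i)

  comb-cong : ∀ {n} {c d : Fin n → Carrier} {v w : Fin n → V} → (∀ j → c j ≈ d j) → (∀ j → v j ≐ w j) → comb c v ≐ comb d w
  comb-cong e f = pointwise λ i → sum-cong-≋ λ j → *-cong (e j) (at (f j) i)

  -- The rule is u a uⁱ = σ(a) uⁱ⁺¹, and the last coordinate returns to the first through uʳ = π.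
  U : V → V
  U v zero    = π * ⟦ v (fromℕ r-1) ⟧
  U v (suc i) = ⟦ v (inject₁ i) ⟧

  U-cong : ∀ {v w} → v ≐ w → U v ≐ U w
  U-cong e = pointwise λ { zero → *-congˡ (S.φ-cong (at e (fromℕ r-1))) ; (suc i) → S.φ-cong (at e (inject₁ i)) }

  U-⊞ : ∀ v w → U (v ⊞ w) ≐ U v ⊞ U w
  U-⊞ v w = pointwise λ { zero → trans (*-congˡ (S.+-homo _ _)) (distribˡ _ _ _) ; (suc i) → S.+-homo _ _ }

  U-⊡ : ∀ a v → U (a ⊡ v) ≐ ⟦ a ⟧ ⊡ U v
  U-⊡ a v = pointwise λ { zero → trans (*-congˡ (S.*-homo _ _)) (solve 3 (λ p a v → p :* (a :* v) := a :* (p :* v)) refl π ⟦ a ⟧ ⟦ v (fromℕ r-1) ⟧)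
                        ; (suc i) → S.*-homo _ _ }

  U-0 : U 0ᵛ ≐ 0ᵛ
  U-0 = pointwise λ { zero → trans (*-congˡ S.0#-homo) (zeroʳ π) ; (suc i) → S.0#-homo }

  U-comb : ∀ {n} (c : Fin n → Carrier) w → U (comb c w) ≐ comb (λ j → ⟦ c j ⟧) (λ j → U (w j))
  U-comb {zero}  c w = U-0
  U-comb {suc n} c w = ≐-trans (U-⊞ (c zero ⊡ w zero) (comb (c ∘ suc) (w ∘ suc))) (⊞-cong (U-⊡ (c zero) (w zero)) (U-comb (c ∘ suc) (w ∘ suc)))

  iterU : ℕ → V → V
  iterU zero    v = v
  iterU (suc n) v = U (iterU n v)

  iterU-cong : ∀ n {v w} → v ≐ w → iterU n v ≐ iterU n w
  iterU-cong zero    e = e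
  iterU-cong (suc n) e = U-cong (iterU-cong n e)

  iterU-suc : ∀ n v → iterU n (U v) ≐ U (iterU n v)
  iterU-suc zero    v = ≐-refl
  iterU-suc (suc n) v = U-cong (iterU-suc n v)

  iterU-swap : ∀ m n v → iterU m (iterU n v) ≐ iterU n (iterU m v)
  iterU-swap zero    n v = ≐-refl
  iterU-swap (suc m) n v = ≐-trans (U-cong (iterU-swap m n v)) (≐-sym (iterU-suc n (iterU m v)))

  iterU-⊡ : ∀ n a v → iterU n (a ⊡ v) ≐ iter n a ⊡ iterU n v
  iterU-⊡ zero    a v = ≐-refl
  iterU-⊡ (suc n) a v = ≐-trans (U-cong (iterU-⊡ n a v)) (U-⊡ (iter n a) (iterU n v))

  iterU-comb : ∀ n {m} (c : Fin m → Carrier) w → iterU n (comb c w) ≐ comb (λ j → iter n (c j)) (λ j → iterU n (w j))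
  iterU-comb zero    c w = ≐-refl
  iterU-comb (suc n) c w = ≐-trans (U-cong (iterU-comb n c w)) (U-comb (λ j → iter n (c j)) (λ j → iterU n (w j)))

  δ : ∀ {m n} → Fin m → Fin n → Carrier
  δ zero    zero    = 1#
  δ zero    (suc j) = 0#
  δ (suc i) zero    = 0#
  δ (suc i) (suc j) = δ i j

  e : Fin r → V
  e j i = δ j i

  private
    δ-inject : ∀ {m n} (i : Fin m) (j : Fin n) → δ (inject₁ i) (inject₁ j) ≡ δ i j
    δ-inject zero    zero    = ≡.refl
    δ-inject zero    (suc j) = ≡.refl
    δ-inject (suc i) zero    = ≡.refl
    δ-inject (suc i) (suc j) = δ-inject i j

    δ-last : ∀ {n} (i : Fin n) → δ (inject₁ i) (fromℕ n) ≡ 0#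
    δ-last zero    = ≡.refl
    δ-last (suc i) = δ-last i

    δ-last′ : ∀ {n} (i : Fin n) → δ (fromℕ n) (inject₁ i) ≡ 0#
    δ-last′ zero    = ≡.refl
    δ-last′ (suc i) = δ-last′ i

    δ-fromℕ : ∀ n → δ (fromℕ n) (fromℕ n) ≡ 1#
    δ-fromℕ zero    = ≡.refl
    δ-fromℕ (suc n) = δ-fromℕ n

    σδ : ∀ {m n} (i : Fin m) (j : Fin n) → ⟦ δ i j ⟧ ≈ δ i j
    σδ zero    zero    = S.1#-homo
    σδ zero    (suc j) = S.0#-homo
    σδ (suc i) zero    = S.0#-homo
    σδ (suc i) (suc j) = σδ i j

    U-e : ∀ (j : Fin r-1) → U (e (inject₁ j)) ≐ e (suc j)
    U-e j = pointwise λ { zero → trans (*-congˡ (trans (S.φ-cong (reflexive (δ-last j))) S.0#-homo)) (zeroʳ π)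
                        ; (suc i) → trans (S.φ-cong (reflexive (δ-inject j i))) (σδ j i) }

    U-e-last : U (e (fromℕ r-1)) ≐ π ⊡ e zero
    U-e-last = pointwise λ { zero → *-congˡ (trans (S.φ-cong (reflexive (δ-fromℕ r-1))) S.1#-homo)
                           ; (suc i) → trans (trans (S.φ-cong (reflexive (δ-last′ i))) S.0#-homo) (sym (zeroʳ π)) }

  sum-δ : ∀ {n} (v : Fin n → Carrier) i → sum (λ j → v j * δ j i) ≈ v i
  sum-δ {suc n} v zero    = trans (+-cong (*-identityʳ _) (trans (sum-cong-≋ {y = λ _ → 0#} λ j → zeroʳ (v (suc j))) (sum-replicate-zero n))) (+-identityʳ _)
  sum-δ {suc n} v (suc i) = trans (+-cong (zeroʳ _) (sum-δ (v ∘ suc) i)) (+-identityˡ _)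

  decompose : ∀ v → v ≐ comb v e
  decompose v = pointwise λ i → sym (sum-δ v i)

  e≐iterU : ∀ j → e j ≐ iterU (toℕ j) (e zero)
  e≐iterU j = go (toℕ j) j ≡.refl
    where
    go : ∀ n j → toℕ j ≡ n → e j ≐ iterU n (e zero)
    go zero    zero    _ = ≐-refl
    go (suc n) (suc j) p = ≐-trans (≐-sym (U-e j)) (U-cong (go n (inject₁ j) (≡.trans (Fin.toℕ-inject₁ j) (ℕ.suc-injective p))))

  private
    U^r-e₀ : iterU r (e zero) ≐ π ⊡ e zero
    U^r-e₀ = ≐-trans (U-cong (≡.subst (λ n → iterU n (e zero) ≐ e (fromℕ r-1)) (Fin.toℕ-fromℕ r-1) (≐-sym (e≐iterU (fromℕ r-1))))) U-e-last

    iter-π : ∀ n → iter n π ≈ π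
    iter-π zero    = refl
    iter-π (suc n) = trans (S.φ-cong (iter-π n)) σπ≈π

    U^r-e : ∀ j → iterU r (e j) ≐ π ⊡ e j
    U^r-e j = ≐-trans (iterU-cong r (e≐iterU j)) (≐-trans (iterU-swap r (toℕ j) (e zero)) (≐-trans (iterU-cong (toℕ j) U^r-e₀)
      (≐-trans (iterU-⊡ (toℕ j) π (e zero)) (⊡-cong (iter-π (toℕ j)) (≐-sym (e≐iterU j))))))

  -- U is only σ-semilinear, but its r-th iterate is L-linear because σʳ = 1; so it is enough to
  -- compare it with π on the powers of u, which commute with it.
  U^r : ∀ v → iterU r v ≐ π ⊡ v
  U^r v = ≐-trans (iterU-cong r (decompose v)) (≐-trans (iterU-comb r v e) (≐-trans (comb-cong {c = λ j → iter r (v j)} {d = v} {w = λ j → π ⊡ e j} (λ j → period (v j)) U^r-e)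
    (pointwise λ i → begin
      sum (λ j → v j * (π * e j i)) ≈⟨ sum-cong-≋ (λ j → solve 3 (λ v p e → v :* (p :* e) := p :* (v :* e)) refl (v j) π (e j i)) ⟩
      sum (λ j → π * (v j * e j i)) ≈⟨ *-distribˡ-sum π (λ j → v j * e j i) ⟨
      π * comb v e i                ≈⟨ *-congˡ (at (decompose v) i) ⟨
      π * v i                       ∎)))

  -- With endomorphisms as elements the ring laws are those of composition, and associativity of a
  -- product given by formulas on V does not have to be verified.
  record Endomorphism : Set ℓ where
    field
      apply : V → V
      cong  : ∀ {v w} → v ≐ w → apply v ≐ apply w
      add   : ∀ v w → apply (v ⊞ w) ≐ apply v ⊞ apply w
      scale : ∀ a v → apply (a ⊡ v) ≐ a ⊡ apply v
      comm  : ∀ v → apply (U v) ≐ U (apply v)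

    apply-0 : apply 0ᵛ ≐ 0ᵛ
    apply-0 = ≐-trans (cong (pointwise λ i → sym (zeroˡ 0#))) (≐-trans (scale 0# 0ᵛ) (pointwise λ i → zeroˡ _))

    apply-comb : ∀ {n} (c : Fin n → Carrier) w → apply (comb c w) ≐ comb c (λ j → apply (w j))
    apply-comb {zero}  c w = apply-0
    apply-comb {suc n} c w = ≐-trans (add (c zero ⊡ w zero) (comb (c ∘ suc) (w ∘ suc))) (⊞-cong (scale (c zero) (w zero)) (apply-comb (c ∘ suc) (w ∘ suc)))

    apply-iterU : ∀ n v → apply (iterU n v) ≐ iterU n (apply v)
    apply-iterU zero    v = ≐-refl
    apply-iterU (suc n) v = ≐-trans (comm (iterU n v)) (U-cong (apply-iterU n v))

    value : V
    value = apply (e zero)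

    -- `e zero` is the unit 1 of the cyclic algebra and v = Σ vⱼ uʲ, so linearity and commutation
    -- with U make the endomorphism right multiplication by its value at 1.
    apply-value : ∀ v → apply v ≐ comb v (λ j → iterU (toℕ j) value)
    apply-value v = ≐-trans (cong (decompose v)) (≐-trans (apply-comb v e)
      (comb-cong {c = v} (λ _ → refl) (λ j → ≐-trans (cong (e≐iterU j)) (apply-iterU (toℕ j) (e zero)))))
  open Endomorphism public

  rightMultiplication : V → Endomorphism
  rightMultiplication x = record
    { apply = R
    ; cong  = λ p → comb-cong {v = λ j → iterU (toℕ j) x} (at p) (λ _ → ≐-refl)
    ; add   = λ v w → pointwise λ i → trans (sum-cong-≋ (λ j → distribʳ (iterU (toℕ j) x i) (v j) (w j))) (∑-distrib-+ (λ j → v j * iterU (toℕ j) x i) (λ j → w j * iterU (toℕ j) x i))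
    ; scale = λ a v → pointwise λ i → trans (sum-cong-≋ (λ j → *-assoc a (v j) (iterU (toℕ j) x i))) (sym (*-distribˡ-sum a (λ j → v j * iterU (toℕ j) x i)))
    ; comm  = λ v → ≐-sym (commutes v)
    }
    where
    R : V → V
    R v = comb v (λ j → iterU (toℕ j) x)
    commutes : ∀ v → U (R v) ≐ R (U v)
    -- The summation index shifts by one, and the last term returns to the front since Uʳ is
    -- multiplication by π.
    commutes v = ≐-trans (U-comb v (λ j → iterU (toℕ j) x)) (pointwise λ i → begin
      sum (λ (j : Fin (suc r-1)) → ⟦ v j ⟧ * iterU (suc (toℕ j)) x i)    ≈⟨ sum-init-last (λ (j : Fin (suc r-1)) → ⟦ v j ⟧ * iterU (suc (toℕ j)) x i) ⟩
      sum (λ (j : Fin r-1) → ⟦ v (inject₁ j) ⟧ * iterU (suc (toℕ (inject₁ j))) x i) + ⟦ v (fromℕ r-1) ⟧ * iterU (suc (toℕ (fromℕ r-1))) x i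
        ≈⟨ +-cong (sum-cong-≋ (λ (j : Fin r-1) → *-congˡ (reflexive (≡.cong (λ n → iterU (suc n) x i) (Fin.toℕ-inject₁ j)))))
                  (*-congˡ (trans (reflexive (≡.cong (λ n → iterU (suc n) x i) (Fin.toℕ-fromℕ r-1))) (at (U^r x) i))) ⟩
      sum (λ (j : Fin r-1) → ⟦ v (inject₁ j) ⟧ * iterU (suc (toℕ j)) x i) + ⟦ v (fromℕ r-1) ⟧ * (π * x i)
        ≈⟨ solve 4 (λ s a p x → s :+ a :* (p :* x) := p :* a :* x :+ s) refl (sum (λ (j : Fin r-1) → ⟦ v (inject₁ j) ⟧ * iterU (suc (toℕ j)) x i)) ⟦ v (fromℕ r-1) ⟧ π (x i) ⟩
      π * ⟦ v (fromℕ r-1) ⟧ * x i + sum (λ (j : Fin r-1) → ⟦ v (inject₁ j) ⟧ * iterU (suc (toℕ j)) x i) ∎)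

  value-rightMultiplication : ∀ x → value (rightMultiplication x) ≐ x
  value-rightMultiplication x = pointwise λ i → trans (+-cong (*-identityˡ _)
    (trans (sum-cong-≋ {y = λ _ → 0#} (λ (j : Fin r-1) → zeroˡ (iterU (suc (toℕ j)) x i))) (sum-replicate-zero r-1))) (+-identityʳ _)

  infix 4 _≅_
  record _≅_ (S T : Endomorphism) : Set ℓ where
    constructor equal
    field on : ∀ v → apply S v ≐ apply T v
  open _≅_ public

  from-value : ∀ {S T} → value S ≐ value T → S ≅ T
  from-value {S} {T} p = equal λ v → ≐-trans (apply-value S v) (≐-trans
    (comb-cong {c = v} (λ _ → refl) (λ j → iterU-cong (toℕ j) p)) (≐-sym (apply-value T v)))

  algebraRing : Ring ℓ ℓ
  algebraRing = record
    { Carrier = Endomorphism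
    ; _≈_ = _≅_
    ; _+_ = plus
    ; _*_ = times
    ; -_ = minus
    ; 0# = nought
    ; 1# = one
    ; isRing = record
      { +-isAbelianGroup = record
        { isGroup = record
          { isMonoid = record
            { isSemigroup = record
              { isMagma = record
                { isEquivalence = record
                  { refl = equal λ v → ≐-refl
                  ; sym = λ p → equal λ v → ≐-sym (on p v)
                  ; trans = λ p q → equal λ v → ≐-trans (on p v) (on q v)
                  }
                ; ∙-cong = λ p q → equal λ v → ⊞-cong (on p v) (on q v)
                }
              ; assoc = λ S T Q → equal λ v → pointwise λ i → +-assoc _ _ _
              }
            ; identity = (λ S → equal λ v → pointwise λ i → +-identityˡ _) , (λ S → equal λ v → pointwise λ i → +-identityʳ _)
            }
          ; inverse = (λ S → equal λ v → pointwise λ i → -‿inverseˡ _) , (λ S → equal λ v → pointwise λ i → -‿inverseʳ _)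
          ; ⁻¹-cong = λ p → equal λ v → pointwise λ i → -‿cong (at (on p v) i)
          }
        ; comm = λ S T → equal λ v → pointwise λ i → +-comm _ _
        }
      ; *-cong = λ {S} {S′} {T} {T′} p q → equal λ v → ≐-trans (cong S (on q v)) (on p (apply T′ v))
      ; *-assoc = λ S T Q → equal λ v → ≐-refl
      ; *-identity = (λ S → equal λ v → ≐-refl) , (λ S → equal λ v → ≐-refl)
      ; distrib = (λ S T Q → equal λ v → add S (apply T v) (apply Q v)) , (λ S T Q → equal λ v → ≐-refl)
      }
    }
    where
    plus times : Endomorphism → Endomorphism → Endomorphism
    plus S T = record
      { apply = λ v → apply S v ⊞ apply T v
      ; cong = λ p → ⊞-cong (cong S p) (cong T p)
      ; add = λ v w → ≐-trans (⊞-cong (add S v w) (add T v w)) (pointwise λ i →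
          solve 4 (λ a b c d → (a :+ b) :+ (c :+ d) := (a :+ c) :+ (b :+ d)) refl (apply S v i) (apply S w i) (apply T v i) (apply T w i))
      ; scale = λ a v → ≐-trans (⊞-cong (scale S a v) (scale T a v)) (pointwise λ i → sym (distribˡ a _ _))
      ; comm = λ v → ≐-trans (⊞-cong (comm S v) (comm T v)) (≐-sym (U-⊞ (apply S v) (apply T v)))
      }
    times S T = record
      { apply = λ v → apply S (apply T v)
      ; cong = λ p → cong S (cong T p)
      ; add = λ v w → ≐-trans (cong S (add T v w)) (add S (apply T v) (apply T w))
      ; scale = λ a v → ≐-trans (cong S (scale T a v)) (scale S a (apply T v))
      ; comm = λ v → ≐-trans (cong S (comm T v)) (comm S (apply T v))
      }
    minus : Endomorphism → Endomorphism
    minus S = record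
      { apply = λ v i → - apply S v i
      ; cong = λ p → pointwise λ i → -‿cong (at (cong S p) i)
      ; add = λ v w → pointwise λ i → trans (-‿cong (at (add S v w) i)) (solve 2 (λ a b → :- (a :+ b) := (:- a) :+ (:- b)) refl (apply S v i) (apply S w i))
      ; scale = λ a v → pointwise λ i → trans (-‿cong (at (scale S a v) i)) (solve 2 (λ a b → :- (a :* b) := a :* (:- b)) refl a (apply S v i))
      ; comm = λ v → pointwise λ
          { zero → trans (-‿cong (at (comm S v) zero)) (trans (solve 2 (λ p a → :- (p :* a) := p :* (:- a)) refl π _) (*-congˡ (sym (S.-‿homo _))))
          ; (suc i) → trans (-‿cong (at (comm S v) (suc i))) (sym (S.-‿homo _)) }
      }
    nought one : Endomorphism
    nought = record
      { apply = λ v → 0ᵛ ; cong = λ _ → ≐-refl ; add = λ v w → pointwise λ i → sym (+-identityˡ 0#)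
      ; scale = λ a v → pointwise λ i → sym (zeroʳ a) ; comm = λ v → ≐-sym U-0 }
    one = record
      { apply = λ v → v ; cong = λ p → p ; add = λ v w → ≐-refl ; scale = λ a v → ≐-refl ; comm = λ v → ≐-refl }

  scalar : F.Carrier → Endomorphism
  scalar a = record
    { apply = ι a ⊡_
    ; cong = ⊡-cong refl
    ; add = λ v w → pointwise λ i → distribˡ _ _ _
    ; scale = λ b v → pointwise λ i → solve 3 (λ a b v → a :* (b :* v) := b :* (a :* v)) refl (ι a) b (v i)
    ; comm = λ v → ≐-trans (⊡-cong (sym (fixes a)) ≐-refl) (≐-sym (U-⊡ (ι a) v))
    }

  algebra : FAlgebra F
  algebra = record
    { ring = algebraRing
    ; ι = scalar
    ; ι-homomorphism = record
      { isSemiringHomomorphism = record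
        { isNearSemiringHomomorphism = record
          { +-isMonoidHomomorphism = record
            { isMagmaHomomorphism = record
              { isRelHomomorphism = record { cong = λ p → equal λ v → ⊡-cong (I.φ-cong p) ≐-refl }
              ; homo = λ a b → equal λ v → pointwise λ i → trans (*-congʳ (I.+-homo a b)) (distribʳ _ _ _)
              }
            ; ε-homo = equal λ v → pointwise λ i → trans (*-congʳ I.0#-homo) (zeroˡ _)
            }
          ; *-homo = λ a b → equal λ v → pointwise λ i → trans (*-congʳ (I.*-homo a b)) (*-assoc _ _ _)
          }
        ; 1#-homo = equal λ v → pointwise λ i → trans (*-congʳ I.1#-homo) (*-identityˡ _)
        }
      ; -‿homo = λ a → equal λ v → pointwise λ i → trans (*-congʳ (I.-‿homo a)) (solve 2 (λ a v → (:- a) :* v := :- (a :* v)) refl (ι a) (v i))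
      }
    ; ι-central = λ a S → equal λ v → ≐-sym (scale S (ι a) v)
    }

-- Division property and Brauer class of the cyclic algebra

module CyclicDivisionAlgebra (em : EM) {F : Field ℓ} (L : Extension F) (σ : L ↪ L) (r-2 : ℕ)
    (π : Extension.Carrier L) (σπ≈π : Extension._≈_ L (_↪_.⟦_⟧ σ π) π)
    (period : ∀ x → Extension._≈_ L (Operator.iter L σ (suc (suc r-2)) x) x)
    (fixedField : ∀ x → Extension._≈_ L (_↪_.⟦_⟧ σ x) x → InBase L x)
    {s : ℕ} (b : Fin s → Extension.Carrier L) (spanning : ∀ x → Span.InSpan em (extensionAlgebra L) b x)
    (ζ : Extension.Carrier L)
    (moved : ∀ (j : Fin (suc r-2)) → ¬ (Extension._≈_ L (Operator.iter L σ (suc (toℕ j)) ζ) ζ))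
    (W : Valuation (Extension.top L))
    (σ~ : ∀ x → ValuationProperties._~_ W (_↪_.⟦_⟧ σ x) x)
    (π≉0 : ¬ (Extension._≈_ L π (Extension.0# L)))
    (ramified : ValuationProperties.Incongruent W (suc (suc r-2)) π) where
  private
    module F = Field F
    module S = Homomorphism {F = Extension.top L} {G = Extension.top L} (_↪_.homomorphism σ)
    module LS = Span em (extensionAlgebra L)
  open Extension L hiding (zero)
  open FieldProperties top
  open SemiringSum semiring
  open SetoidReasoning setoid
  open _↪_ σ using (⟦_⟧)
  open Operator L σ using (iter)
  open ValuationProperties W
  open CyclicAlgebra em L σ (suc r-2) π σπ≈π period
  private module A = FAlgebra algebra

  private
    -- Its value is r times the value of vⱼ uʲ if u is given the value w(π)/r. Taking r-th powers
    -- keeps this inside L, so no valuation with a larger value group has to be constructed.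
    size : V → Fin r → Carrier
    size v j = v j ^ r * π ^ toℕ j

    -- z generates the value min_j w(v_j^r π^j), a norm on V that is multiplicative for the product of the algebra
    record HasNorm (v : V) (z : Carrier) : Set ℓ where
      field
        nonzero  : ¬ (z ≈ 0#)
        minimum  : ∀ j → z ≼ size v j
        attained : ∃[ j ] size v j ≼ z

    0^r : 0# ^ r ≈ 0#
    0^r = zeroˡ _

    size-zero : ∀ v j → v j ≈ 0# → size v j ≈ 0#
    size-zero v j e = trans (*-congʳ (trans (^-congˡ r e) 0^r)) (zeroˡ _)

    norm-nonzero : ∀ {v z} → HasNorm v z → ¬ (v ≐ 0ᵛ)
    norm-nonzero {v} {z} N e = let j , p = HasNorm.attained N in
      HasNorm.nonzero N (0-≼ (≼-resp (size-zero v j (at e j)) refl p))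

    norm-cong : ∀ {v w z} → v ≐ w → HasNorm v z → HasNorm w z
    norm-cong {v} {w} e N = record
      { nonzero  = nonzero
      ; minimum  = λ j → ≼-trans (minimum j) (≈⇒≼ (same j))
      ; attained = let j , p = attained in j , ≼-trans (≈⇒≼ (sym (same j))) p
      }
      where
      open HasNorm N
      same : ∀ j → size v j ≈ size w j
      same j = *-congʳ (^-congˡ r (at e j))

    minimal-index : ∀ {n} (t : Fin (suc n) → Carrier) → ∃[ i ] ∀ j → t i ≼ t j
    minimal-index {zero}  t = zero , λ { zero → ≼-refl }
    minimal-index {suc n} t = go (minimal-index (t ∘ suc))
      where
      go : (∃[ i ] ∀ j → t (suc i) ≼ t (suc j)) → ∃[ i ] ∀ j → t i ≼ t j
      go (i , m) with ≼-total (t zero) (t (suc i))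
      ... | inj₁ p = zero , λ { zero → ≼-refl ; (suc j) → ≼-trans p (m j) }
      ... | inj₂ p = suc i , λ { zero → p ; (suc j) → m j }

    norm-exists : ∀ {v} → ¬ (v ≐ 0ᵛ) → ∃ (HasNorm v)
    norm-exists {v} v≉0 = go (minimal-index (size v))
      where
      go : (∃[ i ] ∀ j → size v i ≼ size v j) → ∃ (HasNorm v)
      go (i , m) = size v i , record { nonzero = nz ; minimum = m ; attained = i , ≼-refl }
        where
        coordinate-zero : size v i ≈ 0# → ∀ j → Dec (v j ≈ 0#) → v j ≈ 0#
        coordinate-zero z j (yes e) = e
        coordinate-zero z j (no ¬e) = ⊥-elim (*-nonzero (^-nonzero r ¬e) (^-nonzero (toℕ j) π≉0) (0-≼ (≼-resp z refl (m j))))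
        nz : ¬ (size v i ≈ 0#)
        nz z = v≉0 (pointwise λ j → coordinate-zero z j em)

    norm-⊡ : ∀ {a v z} → ¬ (a ≈ 0#) → HasNorm v z → HasNorm (a ⊡ v) (a ^ r * z)
    norm-⊡ {a} {v} {z} a≉0 N = record
      { nonzero  = *-nonzero (^-nonzero r a≉0) nonzero
      ; minimum  = λ j → ≼-trans (≼-*ˡ (a ^ r) (minimum j)) (≈⇒≼ (sym (size-⊡ j)))
      ; attained = let j , p = attained in j , ≼-trans (≈⇒≼ (size-⊡ j)) (≼-*ˡ (a ^ r) p)
      }
      where
      open HasNorm N
      size-⊡ : ∀ j → size (a ⊡ v) j ≈ a ^ r * size v j
      size-⊡ j = trans (*-congʳ (^-distrib-* a (v j) r)) (*-assoc _ _ _)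

    -- U moves the coordinates cyclically and multiplies each size by π up to units, as σ preserves
    -- values. At the return to coordinate 0 the sizes match because πʳ = π π^(r-1).
    norm-U : ∀ {v z} → HasNorm v z → HasNorm (U v) (π * z)
    norm-U {v} {z} N = record
      { nonzero  = *-nonzero π≉0 nonzero
      ; minimum  = λ { zero → ≼-trans (≼-*ˡ π (minimum (fromℕ (suc r-2)))) (proj₂ size-zero-U)
                     ; (suc i) → ≼-trans (≼-*ˡ π (minimum (inject₁ i))) (proj₂ (size-suc-U i)) }
      ; attained = attained′ (proj₁ attained) (proj₂ attained) (Top.view (proj₁ attained))
      }
      where
      open HasNorm N
      size-zero-U : size (U v) zero ~ π * size v (fromℕ (suc r-2))
      size-zero-U = ~-trans (≈⇒~ (*-identityʳ _)) (~-trans (≈⇒~ (^-distrib-* π _ r)) (~-trans (~-* ~-refl (~-^ r (σ~ _)))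
        (≈⇒~ (trans (*-assoc π _ _) (*-congˡ (trans (*-comm _ _) (*-congˡ (^-congʳ π (≡.sym (Fin.toℕ-fromℕ (suc r-2)))))))))))
      size-suc-U : ∀ i → size (U v) (suc i) ~ π * size v (inject₁ i)
      size-suc-U i = ~-trans (~-* (~-^ r (σ~ _)) ~-refl) (≈⇒~ (trans (*-congˡ (*-congˡ (^-congʳ π (≡.sym (Fin.toℕ-inject₁ i)))))
        (solve 3 (λ a p q → a :* (p :* q) := p :* (a :* q)) refl (v (inject₁ i) ^ r) π (π ^ toℕ (inject₁ i)))))
      attained′ : ∀ j → size v j ≼ z → Top.View j → ∃[ j ] size (U v) j ≼ π * z
      attained′ _ p Top.‵fromℕ       = zero , ≼-trans (proj₁ size-zero-U) (≼-*ˡ π p)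
      attained′ _ p (Top.‵inject₁ i) = suc i , ≼-trans (proj₁ (size-suc-U i)) (≼-*ˡ π p)

    norm-iterU : ∀ n {v z} → HasNorm v z → HasNorm (iterU n v) (π ^ n * z)
    norm-iterU zero    {v} {z} N = record
      { nonzero = λ e → nonzero (trans (sym (*-identityˡ z)) e)
      ; minimum = λ j → ≼-trans (≈⇒≼ (*-identityˡ z)) (minimum j)
      ; attained = proj₁ attained , ≼-trans (proj₂ attained) (≈⇒≼ (sym (*-identityˡ z))) }
      where open HasNorm N
    norm-iterU (suc n) {v} {z} N = record
      { nonzero = λ e → nonzero (trans (sym (*-assoc π (π ^ n) z)) e)
      ; minimum = λ j → ≼-trans (≈⇒≼ (*-assoc π (π ^ n) z)) (minimum j)
      ; attained = proj₁ attained , ≼-trans (proj₂ attained) (≈⇒≼ (sym (*-assoc π (π ^ n) z))) }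
      where open HasNorm (norm-U (norm-iterU n N))

    -- The smaller of two different norms survives: at the coordinate where it is attained, the
    -- other vector contributes a strictly larger value and cannot cancel it.
    norm-⊞ : ∀ {v w z z′} → HasNorm v z → HasNorm w z′ → ¬ (z′ ≼ z) → HasNorm (v ⊞ w) z
    norm-⊞ {v} {w} {z} {z′} N N′ z≺z′ = record
      { nonzero  = N.nonzero
      ; minimum  = λ j → min j (≼-total (v j) (w j))
      ; attained = proj₁ N.attained , ≼-trans (≼-*ʳ (π ^ toℕ j₀) (^-mono r sum≼)) (proj₂ N.attained)
      }
      where
      module N = HasNorm N
      module N′ = HasNorm N′
      min : ∀ j → v j ≼ w j ⊎ w j ≼ v j → z ≼ size (v ⊞ w) j
      min j (inj₁ p) = ≼-trans (N.minimum j) (≼-*ʳ (π ^ toℕ j) (^-mono r (≼-+ ≼-refl p)))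
      min j (inj₂ p) = ≼-trans (≼-trans (⋠⇒≽ z≺z′) (N′.minimum j)) (≼-*ʳ (π ^ toℕ j) (^-mono r (≼-+ p ≼-refl)))
      j₀ = proj₁ N.attained
      w⋠v : ¬ (w j₀ ≼ v j₀)
      w⋠v p = z≺z′ (≼-trans (N′.minimum j₀) (≼-trans (≼-*ʳ (π ^ toℕ j₀) (^-mono r p)) (proj₂ N.attained)))
      v≈ : (v j₀ + w j₀) - w j₀ ≈ v j₀
      v≈ = solve 2 (λ v w → (v :+ w) :- w := v) refl (v j₀) (w j₀)
      sum≼ : v j₀ + w j₀ ≼ v j₀
      sum≼ = go (≼-total (v j₀ + w j₀) (w j₀))
        where
        go : v j₀ + w j₀ ≼ w j₀ ⊎ w j₀ ≼ v j₀ + w j₀ → v j₀ + w j₀ ≼ v j₀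
        go (inj₁ p) = ≼-resp refl v≈ (≼-- ≼-refl p)
        go (inj₂ p) = ⊥-elim (w⋠v (≼-resp refl v≈ (≼-- p ≼-refl)))

    -- Nonzero summands with pairwise different norms cannot cancel, so a sum that has any has the
    -- norm of one of them. That norm is again some z j, which keeps the induction going.
    norm-sum : ∀ {n} (c : Fin n → Carrier) (v : Fin n → V) (z : Fin n → Carrier) →
               (∀ j → c j ⊡ v j ≐ 0ᵛ ⊎ HasNorm (c j ⊡ v j) (z j)) →
               (∀ i j → HasNorm (c i ⊡ v i) (z i) → HasNorm (c j ⊡ v j) (z j) → z i ~ z j → i ≡ j) →
               (∀ j → c j ⊡ v j ≐ 0ᵛ) ⊎ ∃[ j ] HasNorm (c j ⊡ v j) (z j) × HasNorm (comb c v) (z j)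
    norm-sum {zero}  c v z terms separate = inj₁ λ ()
    norm-sum {suc n} c v z terms separate = go (terms zero)
      (norm-sum (c ∘ suc) (v ∘ suc) (z ∘ suc) (terms ∘ suc) (λ i j N N′ e → Fin.suc-injective (separate (suc i) (suc j) N N′ e)))
      where
      comb-zero : ∀ {n} (c : Fin n → Carrier) (v : Fin n → V) → (∀ j → c j ⊡ v j ≐ 0ᵛ) → comb c v ≐ 0ᵛ
      comb-zero {n} c v all = pointwise λ i → trans (sum-cong-≋ {x = λ j → c j * v j i} {y = λ _ → 0#} (λ j → at (all j) i)) (sum-replicate-zero n)
      tail = comb (c ∘ suc) (v ∘ suc)
      go : c zero ⊡ v zero ≐ 0ᵛ ⊎ HasNorm (c zero ⊡ v zero) (z zero) →
           (∀ j → c (suc j) ⊡ v (suc j) ≐ 0ᵛ) ⊎ ∃[ j ] HasNorm (c (suc j) ⊡ v (suc j)) (z (suc j)) × HasNorm tail (z (suc j)) →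
           (∀ j → c j ⊡ v j ≐ 0ᵛ) ⊎ ∃[ j ] HasNorm (c j ⊡ v j) (z j) × HasNorm (comb c v) (z j)
      go (inj₁ h) (inj₁ t) = inj₁ λ { zero → h ; (suc j) → t j }
      go (inj₁ h) (inj₂ (j , Nj , N)) = inj₂ (suc j , Nj , norm-cong (pointwise λ i → sym (trans (+-congʳ (at h i)) (+-identityˡ _))) N)
      go (inj₂ N₀) (inj₁ t) = inj₂ (zero , N₀ , norm-cong (pointwise λ i → sym (trans (+-congˡ (at (comb-zero (c ∘ suc) (v ∘ suc) t) i)) (+-identityʳ _))) N₀)
      go (inj₂ N₀) (inj₂ (j , Nj , N)) = compare em em
        where
        compare : Dec (z (suc j) ≼ z zero) → Dec (z zero ≼ z (suc j)) → _
        compare (no p) _       = inj₂ (zero , N₀ , norm-⊞ N₀ N p)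
        compare (yes p) (no q) = inj₂ (suc j , Nj , norm-cong (pointwise λ i → +-comm _ _) (norm-⊞ N N₀ q))
        compare (yes p) (yes q) with separate zero (suc j) N₀ Nj (q , p)
        ... | ()

    -- The product is Σ yⱼ uʲ x, and its nonzero summands have the norms yⱼʳ πʲ z. These differ
    -- because the values of the πʲ are incongruent modulo r.
    product-nonzero : ∀ {x y} → ¬ (x ≐ 0ᵛ) → ¬ (y ≐ 0ᵛ) → ¬ (comb y (λ j → iterU (toℕ j) x) ≐ 0ᵛ)
    product-nonzero {x} {y} x≉0 y≉0 prod≈0 = go (norm-exists x≉0)
      where
      go : ∃ (HasNorm x) → ⊥
      go (z , N) = conclude (norm-sum y (λ j → iterU (toℕ j) x) weight (λ j → term j em) separate)
        where
        weight : Fin r → Carrier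
        weight j = y j ^ r * (π ^ toℕ j * z)
        term : ∀ j → Dec (y j ≈ 0#) → y j ⊡ iterU (toℕ j) x ≐ 0ᵛ ⊎ HasNorm (y j ⊡ iterU (toℕ j) x) (weight j)
        term j (yes e) = inj₁ (pointwise λ i → trans (*-congʳ e) (zeroˡ _))
        term j (no ¬e) = inj₂ (norm-⊡ ¬e (norm-iterU (toℕ j) N))
        coefficient-nonzero : ∀ {j} → HasNorm (y j ⊡ iterU (toℕ j) x) (weight j) → ¬ (y j ≈ 0#)
        coefficient-nonzero M e = norm-nonzero M (pointwise λ i → trans (*-congʳ e) (zeroˡ _))
        separate : ∀ i j → HasNorm (y i ⊡ iterU (toℕ i) x) (weight i) → HasNorm (y j ⊡ iterU (toℕ j) x) (weight j) → weight i ~ weight j → i ≡ j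
        separate i j M M′ e = ramified i j (coefficient-nonzero M) (coefficient-nonzero M′)
          (~-cancelˡ (HasNorm.nonzero N) (~-trans (≈⇒~ (rotate i)) (~-trans e (≈⇒~ (sym (rotate j))))))
          where
          rotate : ∀ i → z * (y i ^ r * π ^ toℕ i) ≈ weight i
          rotate i = solve 3 (λ z a p → z :* (a :* p) := a :* (p :* z)) refl z (y i ^ r) (π ^ toℕ i)
        conclude : (∀ j → y j ⊡ iterU (toℕ j) x ≐ 0ᵛ) ⊎ (∃[ j ] HasNorm (y j ⊡ iterU (toℕ j) x) (weight j) × HasNorm (comb y (λ j → iterU (toℕ j) x)) (weight j)) → ⊥
        conclude (inj₂ (_ , _ , M)) = norm-nonzero M prod≈0
        conclude (inj₁ all) = y≉0 (pointwise λ j → vanishing j em)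
          where
          vanishing : ∀ j → Dec (y j ≈ 0#) → y j ≈ 0#
          vanishing j (yes e) = e
          vanishing j (no ¬e) = ⊥-elim (norm-nonzero (norm-⊡ ¬e (norm-iterU (toℕ j) N)) (all j))

    apply-nonzero : ∀ {T v} → ¬ (T ≅ A.0#) → ¬ (v ≐ 0ᵛ) → ¬ (apply T v ≐ 0ᵛ)
    apply-nonzero {T} {v} T≉0 v≉0 p = product-nonzero (λ e → T≉0 (from-value {T} {A.0#} e)) v≉0 (≐-trans (≐-sym (apply-value T v)) p)

  domain : ∀ {S T} → S A.* T ≅ A.0# → ¬ (T ≅ A.0#) → S ≅ A.0#
  domain {S} {T} p T≉0 = go em
    where
    go : Dec (S ≅ A.0#) → S ≅ A.0#
    go (yes q) = q
    go (no ¬q) = ⊥-elim (apply-nonzero {S} ¬q (λ e → T≉0 (from-value {T} {A.0#} e)) (on p (e zero)))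

  private
    -- 1, T(1), T(u), ..., T(u^(r-1)) are r + 1 vectors in an r-dimensional space over L. Since T is
    -- injective, 1 occurs in their relation, so 1 = T(v), and right multiplication by v inverts T.
    right-inverse : ∀ {T} → ¬ (T ≅ A.0#) → ∃[ S ] T A.* S ≅ A.1#
    right-inverse {T} T≉0 = go (Dependence.dependent em top r vectors)
      where
      vectors : Fin (suc r) → Fin r → Carrier
      vectors zero    = e zero
      vectors (suc j) = apply T (e j)
      go : (∃[ c ] Dependence.Nontrivial em top c × (∀ i → sum (λ j → c j * vectors j i) ≈ 0#)) → ∃[ S ] T A.* S ≅ A.1#
      go (c , (k , ck≉0) , rel) = rightMultiplication v , from-value {T A.* rightMultiplication v} {A.1#}
          (≐-trans (cong T (value-rightMultiplication v)) Tv≐e)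
        where
        d : Fin r → Carrier
        d j = c (suc j)
        relation : c zero ⊡ e zero ⊞ apply T d ≐ 0ᵛ
        relation = ≐-trans (⊞-cong ≐-refl (≐-trans (cong T (decompose d)) (apply-comb T d e))) (pointwise rel)
        c₀≉0 : ¬ (c zero ≈ 0#)
        c₀≉0 c₀≈0 = apply-nonzero {T} {d} T≉0 (λ d≐0 → ck≉0 (all d≐0 k))
            (≐-trans (pointwise λ i → sym (trans (+-congʳ (trans (*-congʳ c₀≈0) (zeroˡ _))) (+-identityˡ _))) relation)
          where
          all : d ≐ 0ᵛ → ∀ k → c k ≈ 0#
          all d≐0 zero    = c₀≈0
          all d≐0 (suc k) = at d≐0 k
        c′ = proj₁ (inverse (c zero) c₀≉0)
        v : V
        v = (- c′) ⊡ d
        Tv≐e : apply T v ≐ e zero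
        Tv≐e = ≐-trans (scale T (- c′) d) (pointwise λ i → begin
          - c′ * apply T d i                                  ≈⟨ solve 4 (λ c₀ c t e → (:- c) :* t := (c₀ :* c) :* e :- c :* (c₀ :* e :+ t)) refl (c zero) c′ (apply T d i) (e zero i) ⟩
          c zero * c′ * e zero i - c′ * (c zero * e zero i + apply T d i) ≈⟨ +-cong (*-congʳ (proj₂ (inverse (c zero) c₀≉0))) (-‿cong (trans (*-congˡ (at relation i)) (zeroʳ c′))) ⟩
          1# * e zero i - 0#                                  ≈⟨ solve 1 (λ e → con (+ 1) :* e :- con (+ 0) := e) refl (e zero i) ⟩
          e zero i                                            ∎)

    simple : ∀ (I : A.Carrier → Set ℓ) → IsTwoSidedIdeal algebra I → (∀ x → I x → x A.≈ A.0#) ⊎ (∀ x → I x)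
    simple I ideal = go em
      where
      open IsTwoSidedIdeal ideal
      go : Dec (∃[ T ] I T × ¬ (T ≅ A.0#)) → (∀ x → I x → x A.≈ A.0#) ⊎ (∀ x → I x)
      go (yes (T , IT , T≉0)) = let S , TS≅1 = right-inverse {T} T≉0 in
        inj₂ λ X → I-resp-≈ {A.1# A.* X} {X} (A.*-identityˡ X) (I-*ʳ X (I-resp-≈ {T A.* S} {A.1#} TS≅1 (I-*ʳ S IT)))
      go (no ¬∃) = inj₁ λ T IT → vanishing T IT em
        where
        vanishing : ∀ T → I T → Dec (T ≅ A.0#) → T ≅ A.0#
        vanishing T IT (yes p) = p
        vanishing T IT (no ¬p) = ⊥-elim (¬∃ (T , IT , ¬p))

    iter-zero-coordinate : ∀ j a i → iterU (toℕ j) (a ⊡ e zero) i ≈ iter (toℕ j) a * δ j i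
    iter-zero-coordinate j a i = trans (at (iterU-⊡ (toℕ j) a (e zero)) i) (*-congˡ (sym (at (e≐iterU j) i)))

    -- Commuting with ζ gives ζ xᵢ = xᵢ σⁱ(ζ) for the value x of T; as σⁱ moves ζ for 0 < i < r,
    -- only x₀ survives. Commuting with u gives σ(x₀) = x₀.
    central : ∀ T → (∀ S → T A.* S ≅ S A.* T) → ∃[ a ] scalar a ≅ T
    central T commutes = a , from-value {scalar a} {T} (pointwise λ { zero → trans (*-congʳ ιa≈) (*-identityʳ _)
                                                              ; (suc i) → trans (zeroʳ _) (sym (x-suc i)) })
      where
      x = value T
      -- T is applied to ζ in two ways: by its L-linearity, and through its commuting with right
      -- multiplication by ζ.
      coordinate : ∀ i → ζ * x i ≈ x i * iter (toℕ i) ζ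
      coordinate i = begin
        ζ * x i                                                    ≈⟨ at (scale T ζ (e zero)) i ⟨
        apply T (ζ ⊡ e zero) i                                     ≈⟨ at (cong T (value-rightMultiplication (ζ ⊡ e zero))) i ⟨
        apply T (value (rightMultiplication (ζ ⊡ e zero))) i       ≈⟨ at (on (commutes (rightMultiplication (ζ ⊡ e zero))) (e zero)) i ⟩
        sum (λ j → x j * iterU (toℕ j) (ζ ⊡ e zero) i)             ≈⟨ sum-cong-≋ (λ j → trans (*-congˡ (iter-zero-coordinate j ζ i)) (sym (*-assoc (x j) (iter (toℕ j) ζ) (δ j i)))) ⟩
        sum (λ j → x j * iter (toℕ j) ζ * δ j i)                   ≈⟨ sum-δ (λ j → x j * iter (toℕ j) ζ) i ⟩
        x i * iter (toℕ i) ζ                                       ∎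
      x-suc : ∀ i → x (suc i) ≈ 0#
      x-suc i = *-cancel-0 {iter (suc (toℕ i)) ζ - ζ} (λ z → moved i (x-y≈0⇒x≈y z)) (begin
        (iter (suc (toℕ i)) ζ - ζ) * x (suc i)                     ≈⟨ solve 3 (λ s z x → (s :- z) :* x := x :* s :- z :* x) refl (iter (suc (toℕ i)) ζ) ζ (x (suc i)) ⟩
        x (suc i) * iter (suc (toℕ i)) ζ - ζ * x (suc i)           ≈⟨ x≈y⇒x-y≈0 (sym (coordinate (suc i))) ⟩
        0#                                                         ∎)
      u = rightMultiplication (U (e zero))
      x₀-fixed : ⟦ x zero ⟧ ≈ x zero
      x₀-fixed = begin
        ⟦ x zero ⟧                                         ≈⟨ at (comm T (e zero)) (suc zero) ⟨
        apply T (U (e zero)) (suc zero)                    ≈⟨ at (cong T (value-rightMultiplication (U (e zero)))) (suc zero) ⟨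
        apply T (value u) (suc zero)                       ≈⟨ at (on (commutes u) (e zero)) (suc zero) ⟩
        x zero * ⟦ 1# ⟧ + sum (λ j → x (suc j) * iterU (suc (toℕ j)) (U (e zero)) (suc zero))
          ≈⟨ +-cong (trans (*-congˡ S.1#-homo) (*-identityʳ _))
                    (trans (sum-cong-≋ {y = λ _ → 0#} (λ j → trans (*-congʳ (x-suc j)) (zeroˡ (iterU (suc (toℕ j)) (U (e zero)) (suc zero))))) (sum-replicate-zero (suc r-2))) ⟩
        x zero + 0#                                        ≈⟨ +-identityʳ _ ⟩
        x zero                                             ∎
      a = proj₁ (fixedField (x zero) x₀-fixed)
      ιa≈ = proj₂ (fixedField (x zero) x₀-fixed)

    module AS = Span em algebra
    module AΣ = SemiringSum A.semiring

    generators : Fin (r ℕ.* s) → A.Carrier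
    generators k = rightMultiplication (b (proj₂ (remQuot {r} s k)) ⊡ e (proj₁ (remQuot {r} s k)))

    value-sum : ∀ {n} (t : Fin n → A.Carrier) i → value (AΣ.sum t) i ≈ sum (λ j → value (t j) i)
    value-sum {zero}  t i = refl
    value-sum {suc n} t i = +-congˡ (value-sum (t ∘ suc) i)

    generates : ∀ T → AS.InSpan generators T
    generates T = c , from-value {AS.lc c generators} {T} (pointwise λ i → begin
        value (AS.lc c generators) i                                    ≈⟨ value-sum (λ k → scalar (c k) A.* generators k) i ⟩
        sum (λ k → ι (c k) * value (generators k) i)                    ≈⟨ sum-cong-≋ (λ k → *-congˡ {ι (c k)} (at (value-rightMultiplication (b (proj₂ (remQuot {r} s k)) ⊡ e (proj₁ (remQuot {r} s k)))) i)) ⟩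
        sum (λ k → entry i (remQuot {r} s k))                           ≈⟨ SumCombine.sum-combine ring r {s} (λ k → entry i (remQuot {r} s k)) ⟩
        sum (λ (j : Fin r) → sum (λ (l : Fin s) → entry i (remQuot {r} s (combine {r} j l)))) ≈⟨ sum-cong-≋ (λ (j : Fin r) → begin
            sum (λ (l : Fin s) → entry i (remQuot {r} s (combine {r} j l)))       ≈⟨ sum-cong-≋ (λ (l : Fin s) → reflexive (≡.cong (entry i) (Fin.remQuot-combine {r} j l))) ⟩
            sum (λ l → ι (proj₁ (spanning (x j)) l) * (b l * δ j i))    ≈⟨ sum-cong-≋ (λ l → *-assoc (ι (proj₁ (spanning (x j)) l)) (b l) (δ j i)) ⟨
            sum (λ l → ι (proj₁ (spanning (x j)) l) * b l * δ j i)      ≈⟨ *-distribʳ-sum (δ j i) (λ l → ι (proj₁ (spanning (x j)) l) * b l) ⟨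
            LS.lc (proj₁ (spanning (x j))) b * δ j i                    ≈⟨ *-congʳ (proj₂ (spanning (x j))) ⟩
            x j * δ j i                                                 ∎) ⟩
        sum (λ j → x j * δ j i)                                         ≈⟨ sum-δ x i ⟩
        x i                                                             ∎)
      where
      x = value T
      c : Fin (r ℕ.* s) → F.Carrier
      c k = proj₁ (spanning (x (proj₁ (remQuot {r} s k)))) (proj₂ (remQuot {r} s k))
      entry : Fin r → Fin r × Fin s → Carrier
      entry i k = ι (proj₁ (spanning (x (proj₁ k))) (proj₂ k)) * (b (proj₂ k) * δ (proj₁ k) i)

  centralSimple : IsCentralSimple algebra
  centralSimple = record
    { finiteDimensional = AS.spanning⇒hasDimension generates
    ; central = central
    ; 1≉0 = λ p → 1≉0 (at (on p (e zero)) zero)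
    ; simple = simple
    }

  -- If the algebra were split, it would consist of scalars, being a domain. Right multiplication by
  -- ζ is not a scalar, for σ fixes the scalars and moves ζ.
  brauer-nontrivial : ¬ BrauerGroupTrivial F
  brauer-nontrivial trivial = moved zero (begin
    ⟦ ζ ⟧    ≈⟨ S.φ-cong ζ≈ ⟩
    ⟦ ι a ⟧  ≈⟨ _↪_.fixes σ a ⟩
    ι a      ≈⟨ ζ≈ ⟨
    ζ        ∎)
    where
    Z = rightMultiplication (ζ ⊡ e zero)
    scalars = SplitDomain.split-domain em algebra (λ {S} {T} → domain {S} {T}) (trivial algebra centralSimple) Z
    a = proj₁ scalars
    ζ≈ : ζ ≈ ι a
    ζ≈ = begin
      ζ            ≈⟨ *-identityʳ ζ ⟨
      ζ * 1#       ≈⟨ at (value-rightMultiplication (ζ ⊡ e zero)) zero ⟨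
      value Z zero ≈⟨ at (on (proj₂ scalars) (e zero)) zero ⟨
      ι a * 1#     ≈⟨ *-identityʳ _ ⟩
      ι a          ∎

-- Simple extensions

module PolynomialComposition {F : Field ℓ} (L : Extension F) where
  private
    module L = Extension L
    module I = Homomorphism {F = F} {G = L.top} L.ι-homomorphism
    module LP = FieldProperties L.top
  open PolynomialRing F

  evalAt-const : ∀ a x → evalAt L (a ∷ []) x L.≈ L.ι a
  evalAt-const a x = L.trans (L.+-congˡ (L.zeroʳ x)) (L.+-identityʳ _)

  evalAt-⊚ : ∀ p q x → evalAt L (p ⊚ q) x L.≈ evalAt L p (evalAt L q x)
  evalAt-⊚ []      q x = L.refl
  evalAt-⊚ (a ∷ p) q x = L.trans (evalAt-+ L (a ∷ []) (q *ₚ (p ⊚ q)) x)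
    (L.+-cong (evalAt-const a x) (L.trans (evalAt-* L q (p ⊚ q) x) (L.*-congˡ (evalAt-⊚ p q x))))

  evalAt-X^ : ∀ n x → evalAt L (X^ n) x L.≈ x LP.^ n
  evalAt-X^ zero    x = evalAt-1 L x
  evalAt-X^ (suc n) x = L.trans (L.+-cong I.0#-homo (L.*-congˡ (evalAt-X^ n x))) (L.+-identityˡ _)

  evalAt-neg : ∀ p x → evalAt L (-ₚ p) x L.≈ L.- evalAt L p x
  evalAt-neg []      x = L.sym LP.-0#≈0#
  evalAt-neg (a ∷ p) x = L.trans (L.+-cong (I.-‿homo a) (L.*-congˡ (evalAt-neg p x)))
    (LP.solve 3 (λ a x p → (LP.:- a) LP.:+ x LP.:* (LP.:- p) LP.:= LP.:- (a LP.:+ x LP.:* p)) L.refl (L.ι a) x (evalAt L p x))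

-- The field F(x) is carried by all of F[X], with equality of the values at x. Every element thus
-- comes with a polynomial expression, and embeddings and endomorphisms are given by substitution.
module SimpleExtension (em : EM) {F : Field ℓ} (L : Extension F) (algebraic : IsAlgebraic L) (x : Extension.Carrier L) where
  private
    module F = Field F
    module L = Extension L
    module LP = FieldProperties L.top
    module I = Homomorphism {F = F} {G = L.top} L.ι-homomorphism
  open PolynomialRing F
  open PolynomialComposition L

  value : Poly → L.Carrier
  value p = evalAt L p x

  -- p represents the element p(x) of F[x]
  infix 4 _≃_
  record _≃_ (p q : Poly) : Set ℓ where
    constructor same
    field values : value p L.≈ value q
  open _≃_ public

  private
    value-+ : ∀ p q → value (p +ₚ q) L.≈ value p L.+ value q
    value-+ p q = evalAt-+ L p q x

    value-* : ∀ p q → value (p *ₚ q) L.≈ value p L.* value q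
    value-* p q = evalAt-* L p q x

    value-neg : ∀ p → value (-ₚ p) L.≈ L.- value p
    value-neg p = evalAt-neg p x

    from-≋ : ∀ {p q} → p ≋ q → p ≃ q
    from-≋ {p} {q} e = same (evalAt-cong L {p} {q} e L.refl)

    module P = CommutativeRing polynomialRing

    simpleRing : CommutativeRing ℓ ℓ
    simpleRing = record
      { Carrier = Poly
      ; _≈_ = _≃_
      ; _+_ = _+ₚ_
      ; _*_ = _*ₚ_
      ; -_ = -ₚ_
      ; 0# = []
      ; 1# = 1ₚ
      ; isCommutativeRing = record
        { isRing = record
          { +-isAbelianGroup = record
            { isGroup = record
              { isMonoid = record
                { isSemigroup = record
                  { isMagma = record
                    { isEquivalence = record
                      { refl = same L.refl ; sym = λ p → same (L.sym (values p)) ; trans = λ p q → same (L.trans (values p) (values q)) }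
                    ; ∙-cong = λ {p} {p′} {q} {q′} e f → same (L.trans (value-+ p q) (L.trans (L.+-cong (values e) (values f)) (L.sym (value-+ p′ q′))))
                    }
                  ; assoc = λ p q r → from-≋ (P.+-assoc p q r)
                  }
                ; identity = (λ p → from-≋ (P.+-identityˡ p)) , (λ p → from-≋ (P.+-identityʳ p))
                }
              ; inverse = (λ p → from-≋ (P.-‿inverseˡ p)) , (λ p → from-≋ (P.-‿inverseʳ p))
              ; ⁻¹-cong = λ {p} {q} e → same (L.trans (value-neg p) (L.trans (L.-‿cong (values e)) (L.sym (value-neg q))))
              }
            ; comm = λ p q → from-≋ (P.+-comm p q)
            }
          ; *-cong = λ {p} {p′} {q} {q′} e f → same (L.trans (value-* p q) (L.trans (L.*-cong (values e) (values f)) (L.sym (value-* p′ q′))))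
          ; *-assoc = λ p q r → from-≋ (P.*-assoc p q r)
          ; *-identity = (λ p → from-≋ (P.*-identityˡ p)) , (λ p → from-≋ (P.*-identityʳ p))
          ; distrib = (λ p q r → from-≋ (P.distribˡ p q r)) , (λ p q r → from-≋ (P.distribʳ p q r))
          }
        ; *-comm = λ p q → from-≋ (P.*-comm p q)
        }
      }

    -- read off from the minimal polynomial of z, whose constant term does not vanish
    polynomial-inverse : ∀ z → ¬ (z L.≈ L.0#) → ∃[ h ] z L.* evalAt L h z L.≈ L.1#
    polynomial-inverse z z≉0 = go (MinimalPolynomial.minimalPolynomial L em z {proj₁ (algebraic z)} (ClassicalDegree.nonzero⇒≉[] em F {proj₁ (algebraic z)} (proj₁ (proj₂ (algebraic z)))) (proj₂ (proj₂ (algebraic z))))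
      where
      open Degree F
      go : (∃[ n ] ∃[ g ] Monic n g × evalAt L g z L.≈ L.0# × (∀ q → evalAt L q z L.≈ L.0# → g divides q)) → ∃[ h ] z L.* evalAt L h z L.≈ L.1#
      go (n , [] , m , root , minimal) = ⊥-elim (monic-nonzero m ≋-refl)
      go (n , a ∷ h , m , root , minimal) = (F.- c) • h , L.trans (L.*-congˡ (L.trans (evalAt-cong L {(F.- c) • h} {((F.- c) ∷ []) *ₚ h} (ClassicalDegree.•≋* em F (F.- c) h) L.refl)
          (L.trans (evalAt-* L ((F.- c) ∷ []) h z) (L.*-congʳ (L.trans (evalAt-const (F.- c) z) (I.-‿homo c))))))
          (L.trans (LP.solve 4 (λ z c h a → z LP.:* ((LP.:- c) LP.:* h) LP.:= a LP.:* c LP.:- c LP.:* (a LP.:+ z LP.:* h)) L.refl z (L.ι c) (evalAt L h z) (L.ι a))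
            (L.trans (L.+-cong (L.trans (L.sym (I.*-homo a c)) (L.trans (I.φ-cong (proj₂ (F.inverse a a≉0))) I.1#-homo)) (L.-‿cong (L.trans (L.*-congˡ root) (L.zeroʳ _))))
              (LP.solve 0 (LP.con (+ 1) LP.:- LP.con (+ 0) LP.:= LP.con (+ 1)) L.refl)))
        where
        tail-below : ∀ {n} → Monic n (a ∷ h) → Below n h
        tail-below m = below-tail (bounded m)
        a≉0 : ¬ (a F.≈ F.0#)
        a≉0 a≈0 = monic-nonzero m (≋-trans (∷-cong a≈0 h≋[]) 0∷[]≋[])
          where
          h-root : evalAt L h z L.≈ L.0#
          h-root = LP.*-cancel-0 z≉0 (L.trans (L.sym (L.+-identityˡ _)) (L.trans (L.+-congʳ (L.sym (L.trans (I.φ-cong a≈0) I.0#-homo))) root))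
          h≋[] : h ≋ []
          h≋[] = let u , e = minimal h h-root in ≋-trans (≋-sym e) (*ₚ-cong {u} {[]} {a ∷ h} {a ∷ h}
            (below-0 (below-quotient {0} {n} {u} {a ∷ h} m (below-cong (≋-sym e) (tail-below m)))) ≋-refl)
        c = proj₁ (F.inverse a a≉0)

  simpleField : Field ℓ
  simpleField = record
    { commutativeRing = simpleRing
    ; 1≉0 = λ (same e) → L.1≉0 (L.trans (L.sym (evalAt-1 L x)) e)
    ; inverse = λ p p≉0 → let h , e = polynomial-inverse (value p) (λ z → p≉0 (same z)) in
        -- For z = p(x) the inverse is h(z), hence the class of h(p(X)).
        h ⊚ p , same (L.trans (value-* p (h ⊚ p)) (L.trans (L.*-congˡ (evalAt-⊚ h p x)) (L.trans e (L.sym (evalAt-1 L x)))))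
    }

  private module S = Field simpleField

  simple : Extension F
  simple = record
    { top = simpleField
    ; ι = λ a → a ∷ []
    ; ι-homomorphism = record
      { isSemiringHomomorphism = record
        { isNearSemiringHomomorphism = record
          { +-isMonoidHomomorphism = record
            { isMagmaHomomorphism = record
              { isRelHomomorphism = record { cong = λ e → from-≋ (∷-cong e (≋-refl {[]})) }
              ; homo = λ a b → S.refl {(a F.+ b) ∷ []}
              }
            ; ε-homo = from-≋ 0∷[]≋[]
            }
          ; *-homo = λ a b → from-≋ (∷-cong (F.sym (F.+-identityʳ (a F.* b))) (≋-refl {[]}))
          }
        ; 1#-homo = S.refl {1ₚ}
        }
      ; -‿homo = λ a → S.refl {(F.- a) ∷ []}
      }
    }

  generator : Poly
  generator = X^ 1

  -- Evaluation at z respects equality in F(x) because z satisfies every relation that x satisfies.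
  conjugate : ∀ z → (∀ p → value p L.≈ L.0# → evalAt L p z L.≈ L.0#) → simple ↪ L
  conjugate z vanish = record
    { ⟦_⟧ = λ p → evalAt L p z
    ; homomorphism = record
      { isSemiringHomomorphism = record
        { isNearSemiringHomomorphism = record
          { +-isMonoidHomomorphism = record
            { isMagmaHomomorphism = record
              { isRelHomomorphism = record { cong = λ {p} {q} (same e) → LP.x-y≈0⇒x≈y (L.trans (L.sym (difference p q z))
                  (vanish (p +ₚ (-ₚ q)) (L.trans (difference p q x) (LP.x≈y⇒x-y≈0 e)))) }
              ; homo = λ p q → evalAt-+ L p q z
              }
            ; ε-homo = L.refl
            }
          ; *-homo = λ p q → evalAt-* L p q z
          }
        ; 1#-homo = evalAt-1 L z
        }
      ; -‿homo = λ p → evalAt-neg p z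
      }
    ; fixes = λ a → evalAt-const a z
    }
    where
    difference : ∀ p q z → evalAt L (p +ₚ (-ₚ q)) z L.≈ evalAt L p z L.- evalAt L q z
    difference p q z = L.trans (evalAt-+ L p (-ₚ q) z) (L.+-congˡ (evalAt-neg q z))

  inclusion : simple ↪ L
  inclusion = conjugate x (λ p e → e)

  -- As xⁱ lies in F(x), substituting Xⁱ keeps the map inside F(x), where it can be iterated;
  -- `conjugate` only lands in L.
  power-endomorphism : ∀ i → (∀ p → value p L.≈ L.0# → evalAt L p (x LP.^ i) L.≈ L.0#) → simple ↪ simple
  power-endomorphism i vanish = record
    { ⟦_⟧ = _⊚ (X^ i)
    ; homomorphism = record
      { isSemiringHomomorphism = record
        { isNearSemiringHomomorphism = record
          { +-isMonoidHomomorphism = record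
            { isMagmaHomomorphism = record
              { isRelHomomorphism = record { cong = λ {p} {q} e → same (L.trans (at-power p) (L.trans (C.φ-cong {p} {q} e) (L.sym (at-power q)))) }
              ; homo = λ p q → same (L.trans (at-power (p +ₚ q)) (L.trans (C.+-homo p q) (L.sym (L.trans (value-+ (p ⊚ X^ i) (q ⊚ X^ i)) (L.+-cong (at-power p) (at-power q))))))
              }
            ; ε-homo = S.refl {[]}
            }
          ; *-homo = λ p q → same (L.trans (at-power (p *ₚ q)) (L.trans (C.*-homo p q) (L.sym (L.trans (value-* (p ⊚ X^ i) (q ⊚ X^ i)) (L.*-cong (at-power p) (at-power q))))))
          }
        ; 1#-homo = same (L.trans (at-power 1ₚ) (L.trans (evalAt-1 L (x LP.^ i)) (L.sym (evalAt-1 L x))))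
        }
      ; -‿homo = λ p → same (L.trans (at-power (-ₚ p)) (L.trans (C.-‿homo p) (L.sym (L.trans (value-neg (p ⊚ X^ i)) (L.-‿cong (at-power p))))))
      }
    ; fixes = λ a → same (L.trans (at-power (a ∷ [])) (L.trans (evalAt-const a (x LP.^ i)) (L.sym (evalAt-const a x))))
    }
    where
    module C = Homomorphism {F = simpleField} {G = L.top} (_↪_.homomorphism (conjugate (x LP.^ i) vanish))
    at-power : ∀ p → value (p ⊚ X^ i) L.≈ evalAt L p (x LP.^ i)
    at-power p = L.trans (evalAt-⊚ p (X^ i) x) (evalAt-cong L {p} {p} ≋-refl (evalAt-X^ i x))

  evalAt-iter : ∀ i vanish n p z → evalAt L (Operator.iter simple (power-endomorphism i vanish) n p) z L.≈ evalAt L p (z LP.^ (i ℕ.^ n))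
  evalAt-iter i vanish zero    p z = evalAt-cong L {p} {p} ≋-refl (L.sym (L.*-identityʳ z))
  evalAt-iter i vanish (suc n) p z = L.trans (evalAt-⊚ (Operator.iter simple (power-endomorphism i vanish) n p) (X^ i) z)
    (L.trans (evalAt-cong L {Operator.iter simple (power-endomorphism i vanish) n p} ≋-refl (evalAt-X^ i z))
      (L.trans (evalAt-iter i vanish n p (z LP.^ i)) (evalAt-cong L {p} {p} ≋-refl (LP.^-assocʳ z i (i ℕ.^ n)))))

embedding-algebraic : EM → {F : Field ℓ} {A B : Extension F} → A ↪ B → IsAlgebraic B → IsAlgebraic A
embedding-algebraic em {F} {A} {B} φ alg x = let p , nz , root = alg ⟦ x ⟧ in
  p , nz , φ-injective em (B.trans (evaluate p) (B.trans root (B.sym 0#-homo)))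
  where
  module A = Extension A
  module B = Extension B
  open _↪_ φ
  open Homomorphism {F = A.top} {G = B.top} homomorphism
  evaluate : ∀ p → ⟦ evalAt A p x ⟧ B.≈ evalAt B p ⟦ x ⟧
  evaluate []      = 0#-homo
  evaluate (a ∷ p) = B.trans (+-homo _ _) (B.+-cong (fixes a) (B.trans (*-homo _ _) (B.*-congˡ (evaluate p))))

-- Fixed fields, periods and incongruent values

module FixedField {F : Field ℓ} (L : Extension F) (σ : L ↪ L) where
  private
    module L = Extension L
    module LP = FieldProperties L.top
  open _↪_ σ
  open Homomorphism {F = L.top} {G = L.top} homomorphism
  open L using (_≈_; _+_; _*_; -_)

  fixedField : Field ℓ
  fixedField = record
    { commutativeRing = record
      { Carrier = Σ L.Carrier λ x → ⟦ x ⟧ ≈ x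
      ; _≈_ = λ a b → proj₁ a ≈ proj₁ b
      ; _+_ = λ (x , p) (y , q) → x + y , L.trans (+-homo x y) (L.+-cong p q)
      ; _*_ = λ (x , p) (y , q) → x * y , L.trans (*-homo x y) (L.*-cong p q)
      ; -_ = λ (x , p) → - x , L.trans (-‿homo x) (L.-‿cong p)
      ; 0# = L.0# , 0#-homo
      ; 1# = L.1# , 1#-homo
      ; isCommutativeRing = record
        { isRing = record
          { +-isAbelianGroup = record
            { isGroup = record
              { isMonoid = record
                { isSemigroup = record
                  { isMagma = record
                    { isEquivalence = record { refl = L.refl ; sym = L.sym ; trans = L.trans }
                    ; ∙-cong = L.+-cong
                    }
                  ; assoc = λ a b c → L.+-assoc _ _ _
                  }
                ; identity = (λ a → L.+-identityˡ _) , (λ a → L.+-identityʳ _)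
                }
              ; inverse = (λ a → L.-‿inverseˡ _) , (λ a → L.-‿inverseʳ _)
              ; ⁻¹-cong = L.-‿cong
              }
            ; comm = λ a b → L.+-comm _ _
            }
          ; *-cong = L.*-cong
          ; *-assoc = λ a b c → L.*-assoc _ _ _
          ; *-identity = (λ a → L.*-identityˡ _) , (λ a → L.*-identityʳ _)
          ; distrib = (λ a b c → L.distribˡ _ _ _) , (λ a b c → L.distribʳ _ _ _)
          }
        ; *-comm = λ a b → L.*-comm _ _
        }
      }
    ; 1≉0 = L.1≉0
    ; inverse = λ (x , p) x≉0 → let y , e = L.inverse x x≉0 in
        (y , LP.*-cancelˡ x≉0 (L.trans (L.*-congʳ (L.sym p)) (L.trans (L.sym (*-homo x y)) (L.trans (φ-cong e) (L.trans 1#-homo (L.sym e)))))) , e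
    }

  fixedExtension : Extension F
  fixedExtension = record
    { top = fixedField
    ; ι = λ a → L.ι a , fixes a
    ; ι-homomorphism = record
      { isSemiringHomomorphism = record
        { isNearSemiringHomomorphism = record
          { +-isMonoidHomomorphism = record
            { isMagmaHomomorphism = record { isRelHomomorphism = record { cong = I.φ-cong } ; homo = I.+-homo }
            ; ε-homo = I.0#-homo
            }
          ; *-homo = I.*-homo
          }
        ; 1#-homo = I.1#-homo
        }
      ; -‿homo = I.-‿homo
      }
    }
    where module I = Homomorphism {F = F} {G = L.top} L.ι-homomorphism

  overFixed : Extension fixedField
  overFixed = record
    { top = L.top
    ; ι = proj₁
    ; ι-homomorphism = record
      { isSemiringHomomorphism = record
        { isNearSemiringHomomorphism = record
          { +-isMonoidHomomorphism = record
            { isMagmaHomomorphism = record { isRelHomomorphism = record { cong = λ e → e } ; homo = λ a b → L.refl }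
            ; ε-homo = L.refl
            }
          ; *-homo = λ a b → L.refl
          }
        ; 1#-homo = L.refl
        }
      ; -‿homo = λ a → L.refl
      }
    }

  overFixed-σ : overFixed ↪ overFixed
  overFixed-σ = record { ⟦_⟧ = ⟦_⟧ ; homomorphism = homomorphism ; fixes = proj₂ }

  fixed-inclusion : fixedExtension ↪ L
  fixed-inclusion = record
    { ⟦_⟧ = proj₁
    ; homomorphism = Extension.ι-homomorphism overFixed
    ; fixes = λ a → L.refl
    }

module Period {k : Field ℓ} (N : Extension k) (τ : N ↪ N) where
  open Extension N hiding (zero)
  open FieldProperties top using (_^_; ^-congˡ; ^-assocʳ)
  open _↪_ τ using (⟦_⟧)
  open Operator N τ using (iter; iter-cong; iter-multiple)
  private module T = Homomorphism {F = top} {G = top} (_↪_.homomorphism τ)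

  iter-+ : ∀ a b x → iter (a ℕ.+ b) x ≈ iter a (iter b x)
  iter-+ zero    b x = refl
  iter-+ (suc a) b x = T.φ-cong (iter-+ a b x)

  iter-power : ∀ {y i} → ⟦ y ⟧ ≈ y ^ i → ∀ m → iter m y ≈ y ^ (i ℕ.^ m)
  iter-power {y} {i} e zero    = sym (*-identityʳ y)
  iter-power {y} {i} e (suc m) = trans (T.φ-cong (iter-power e m)) (trans (T.^-homo y (i ℕ.^ m)) (trans (^-congˡ (i ℕ.^ m) e) (^-assocʳ y i (i ℕ.^ m))))

  least-period : EM → ∀ {n y} → iter (suc n) y ≈ y → ∃[ p ] iter (suc p) y ≈ y × (∀ m → iter m y ≈ y → suc p ∣ m)
  least-period em {n} {y} e = go (least em (λ n → iter (suc n) y ≈ y) (n , e))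
    where
    go : (∃[ p ] iter (suc p) y ≈ y × (∀ m → m ℕ.< p → ¬ (iter (suc m) y ≈ y))) → ∃[ p ] iter (suc p) y ≈ y × (∀ m → iter m y ≈ y → suc p ∣ m)
    go (p , root , minimal) = p , root , λ m e → divisible m e (m DivMod.% suc p) ≡.refl
      where
      divisible : ∀ m → iter m y ≈ y → ∀ s → m DivMod.% suc p ≡ s → suc p ∣ m
      divisible m e zero    eq = ∣.m%n≡0⇒n∣m m (suc p) eq
      divisible m e (suc s) eq = ⊥-elim (minimal s (ℕ.≤-pred (≡.subst (ℕ._< suc p) eq (DivMod.m%n<n m (suc p))))
        (trans (iter-cong (suc s) (sym (iter-multiple {suc p} root (∣.n∣m*n (m DivMod./ suc p)))))
          (trans (sym (iter-+ (suc s) (m DivMod./ suc p ℕ.* suc p) y))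
            (trans (reflexive (≡.cong (λ a → iter a y) (≡.trans (≡.cong (ℕ._+ m DivMod./ suc p ℕ.* suc p) (≡.sym eq)) (≡.sym (DivMod.m≡m%n+[m/n]*n m (suc p)))))) e))))

  -- The least period divides r and is not 1, so it is r itself.
  prime-period : EM → ∀ {r y} → Prime r → iter r y ≈ y → ¬ (iter 1 y ≈ y) → ∀ m → 0 ℕ.< m → m ℕ.< r → ¬ (iter m y ≈ y)
  prime-period em {zero}  pr _ _ = ⊥-elim (Primality.¬prime[0] pr)
  prime-period em {suc r} {y} pr e y≉ (suc m) 0<m m<r em≈ = go (least-period em {r} e)
    where
    go : (∃[ p ] iter (suc p) y ≈ y × (∀ m → iter m y ≈ y → suc p ∣ m)) → ⊥
    go (p , root , minimal) = cases (Primality.prime⇒irreducible pr (minimal (suc r) e))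
      where
      cases : suc p ≡ 1 ⊎ suc p ≡ suc r → ⊥
      cases (inj₁ q) = y≉ (≡.subst (λ n → iter n y ≈ y) q root)
      cases (inj₂ q) = ℕ.<⇒≱ m<r (≡.subst (ℕ._≤ suc m) q (∣.∣⇒≤ (minimal (suc m) em≈)))

module Indivisible {F : Field ℓ} (V : Valuation F) {r : ℕ} (pr : Prime r) {π : Field.Carrier F}
    (π≉0 : ¬ (Field._≈_ F π (Field.0# F)))
    (indivisible : ValuationProperties.NotPower V r π) where
  open Field F hiding (zero)
  open FieldProperties F
  open ValuationProperties V

  private
    quotient-root : ∀ {a b} → ¬ (a ≈ 0#) → ¬ (b ≈ 0#) → ¬ (a ^ r ~ π * b ^ r)
    quotient-root {a} {b} a≉0 b≉0 e = indivisible {a * b′} (*-nonzero a≉0 (inverse-nonzero bb′≈1))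
      (~-cancelˡ (^-nonzero r b≉0) (~-trans (≈⇒~ (trans (sym (^-distrib-* b (a * b′) r)) (^-congˡ r cancel))) (~-trans e (≈⇒~ (*-comm _ _)))))
      where
      b′ = proj₁ (inverse b b≉0)
      bb′≈1 = proj₂ (inverse b b≉0)
      cancel : b * (a * b′) ≈ a
      cancel = trans (solve 3 (λ a b c → b :* (a :* c) := a :* (b :* c)) refl a b b′) (trans (*-congˡ bb′≈1) (*-identityʳ a))

    -- By Bézout, x m and y r differ by 1. Raising t^r ~ π^m to the power x then exhibits π, for
    -- either sign, as a quotient of r-th powers up to units.
    no-root : ∀ {m t} → 0 ℕ.< m → m ℕ.< r → ¬ (t ≈ 0#) → ¬ (t ^ r ~ π ^ m)
    no-root {m} {t} 0<m m<r t≉0 e = go (Coprime.coprime-Bézout (Coprime.sym (Coprime.prime⇒coprime pr {{ℕ.>-nonZero 0<m}} m<r)))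
      where
      power : ∀ x → (t ^ x) ^ r ~ π ^ (x ℕ.* m)
      power x = ~-trans (≈⇒~ (trans (^-assocʳ t x r) (trans (^-congʳ t (ℕ.*-comm x r)) (sym (^-assocʳ t r x)))))
        (~-trans (~-^ x e) (≈⇒~ (trans (^-assocʳ π m x) (^-congʳ π (ℕ.*-comm m x)))))
      go : GCD.Bézout.Identity 1 m r → ⊥
      go (GCD.Bézout.Identity.+- x y eq) = quotient-root (^-nonzero x t≉0) (^-nonzero y π≉0)
        (~-trans (power x) (≈⇒~ (trans (^-congʳ π (≡.sym eq)) (*-congˡ (sym (^-assocʳ π y r))))))
      go (GCD.Bézout.Identity.-+ x y eq) = quotient-root (^-nonzero y π≉0) (^-nonzero x t≉0)
        (~-trans (≈⇒~ (trans (^-assocʳ π y r) (^-congʳ π (≡.sym eq)))) (~-* ~-refl (~-sym (power x))))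

    ordered : ∀ {c d i j} → ¬ (c ≈ 0#) → ¬ (d ≈ 0#) → i ℕ.< j → j ℕ.< r → ¬ (c ^ r * π ^ i ~ d ^ r * π ^ j)
    ordered {c} {d} {i} {j} c≉0 d≉0 i<j j<r e = no-root {j ℕ.∸ i} (ℕ.m<n⇒0<n∸m i<j) (ℕ.≤-<-trans (ℕ.m∸n≤m j i) j<r)
      (*-nonzero c≉0 (inverse-nonzero dd′≈1))
      (~-cancelˡ (^-nonzero r d≉0) (~-trans (≈⇒~ (trans (sym (^-distrib-* d (c * d′) r)) (^-congˡ r cancel))) c^r~))
      where
      d′ = proj₁ (inverse d d≉0)
      dd′≈1 = proj₂ (inverse d d≉0)
      cancel : d * (c * d′) ≈ c
      cancel = trans (solve 3 (λ a b c → b :* (a :* c) := a :* (b :* c)) refl c d d′) (trans (*-congˡ dd′≈1) (*-identityʳ c))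
      c^r~ : c ^ r ~ d ^ r * π ^ (j ℕ.∸ i)
      c^r~ = ~-cancelˡ (^-nonzero i π≉0) (~-trans (≈⇒~ (*-comm _ _)) (~-trans e (≈⇒~ (trans (*-congˡ (trans (^-congʳ π (≡.sym (ℕ.m+[n∸m]≡n (ℕ.<⇒≤ i<j)))) (^-homo-* π i _)))
        (solve 3 (λ a p q → a :* (p :* q) := p :* (a :* q)) refl (d ^ r) (π ^ i) (π ^ (j ℕ.∸ i)))))))

  exponents-equal : ∀ {c d i j} → ¬ (c ≈ 0#) → ¬ (d ≈ 0#) → i ℕ.< r → j ℕ.< r → c ^ r * π ^ i ~ d ^ r * π ^ j → i ≡ j
  exponents-equal {i = i} {j} c≉0 d≉0 i<r j<r e = go (ℕ.<-cmp i j)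
    where
    go : Tri (i ℕ.< j) (i ≡ j) (j ℕ.< i) → i ≡ j
    go (tri< i<j _ _) = ⊥-elim (ordered c≉0 d≉0 i<j j<r e)
    go (tri≈ _ i≡j _) = i≡j
    go (tri> _ _ j<i) = ⊥-elim (ordered d≉0 c≉0 j<i i<r (~-sym e))

-- Lifting automorphisms of the residue field

map-unity : {F : Field ℓ} (L : Extension F) → ∀ M → PolynomialRing._≋_ (Extension.top L) (map (Extension.ι L) (Unity.unity F M)) (Unity.unity (Extension.top L) M)
map-unity {F = F} L M = L[X].≋-trans (map-+ₚ {F = F} {G = L.top} L.ι-homomorphism (F[X].X^ M) (F[X].-ₚ F[X].1ₚ))
  (L[X].+ₚ-cong (powers M) (L[X].∷-cong (L.trans (I.-‿homo F.1#) (L.-‿cong I.1#-homo)) (L[X].≋-refl {[]})))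
  where
  module F = Field F
  module L = Extension L
  module F[X] = PolynomialRing F
  module L[X] = PolynomialRing L.top
  module I = Homomorphism {F = F} {G = L.top} L.ι-homomorphism
  powers : ∀ M → map L.ι (F[X].X^ M) L[X].≋ L[X].X^ M
  powers zero    = L[X].∷-cong I.1#-homo (L[X].≋-refl {[]})
  powers (suc M) = L[X].∷-cong I.0#-homo (powers M)

evalAt-unity : {F : Field ℓ} (L : Extension F) → ∀ M x → let open Extension L ; open FieldProperties top in
               evalAt L (Unity.unity F M) x ≈ x ^ M - 1#
evalAt-unity {F = F} L M x = trans (PolynomialRing.eval-cong top {map ι (Unity.unity F M)} {Unity.unity top M} (map-unity L M) refl) (Unity.eval-unity top M x)
  where open Extension L

map-divides : {F : Field ℓ} (L : Extension F) → ∀ {g p} → Degree._divides_ F g p →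
              Degree._divides_ (Extension.top L) (map (Extension.ι L) g) (map (Extension.ι L) p)
map-divides {F = F} L {g} {p} (r , e) = map ι r , PolynomialRing.≋-trans top
  (PolynomialRing.≋-sym top (map-*ₚ {F = F} {G = top} ι-homomorphism r g)) (map-cong-≋ {F = F} {G = top} ι-homomorphism e)
  where open Extension L

-- Stands in for the isomorphism k(x) ≅ k(z): evaluation at x and evaluation at z annihilate the
-- same polynomials.
module SameKernel (em : EM) {k : Field ℓ} (A B : Extension k) {x : Extension.Carrier A} {z : Extension.Carrier B}
    {d : ℕ} {f : PolynomialRing.Poly k} (mf : Degree.Monic k d f)
    (rootA : Extension._≈_ A (evalAt A f x) (Extension.0# A))
    (minimal : ∀ p → Extension._≈_ A (evalAt A p x) (Extension.0# A) → Degree._divides_ k f p)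
    (rootB : Extension._≈_ B (evalAt B f z) (Extension.0# B)) where
  private
    module A = Extension A
    module B = Extension B
  open PolynomialRing k
  open Degree k
  open ClassicalDegree em k

  A⇒B : ∀ p → evalAt A p x A.≈ A.0# → evalAt B p z B.≈ B.0#
  A⇒B p e = MinimalPolynomial.divides-evalAt B em z {f} {p} (minimal p e) rootB

  -- Let g be the minimal polynomial of z and f = u g. Then g(x) = 0 or u(x) = 0; the latter would
  -- make f divide u, so that the nonconstant g would divide 1.
  B⇒A : ∀ p → evalAt B p z B.≈ B.0# → evalAt A p x A.≈ A.0#
  B⇒A p e = go (MinimalPolynomial.minimalPolynomial B em z {f} (monic-nonzero mf) rootB)
    where
    go : (∃[ n ] ∃[ g ] Monic n g × evalAt B g z B.≈ B.0# × (∀ q → evalAt B q z B.≈ B.0# → g divides q)) → evalAt A p x A.≈ A.0#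
    go (n , g , mg , rootg , ming) = MinimalPolynomial.divides-evalAt A em x {g} {p} (ming p e) (gx≈0 em)
      where
      u = proj₁ (ming f rootB)
      ug≋f : u *ₚ g ≋ f
      ug≋f = proj₂ (ming f rootB)
      gx≈0 : Dec (evalAt A g x A.≈ A.0#) → evalAt A g x A.≈ A.0#
      gx≈0 (yes e) = e
      gx≈0 (no ¬e) = ⊥-elim (contradiction-degree n mg (minimal u ux≈0))
        where
        ux≈0 : evalAt A u x A.≈ A.0#
        ux≈0 = FieldProperties.*-cancel-0 A.top ¬e (A.trans (A.*-comm _ _) (A.trans (A.sym (evalAt-* A u g x))
          (A.trans (evalAt-cong A {u *ₚ g} {f} ug≋f A.refl) rootA)))
        contradiction-degree : ∀ n → Monic n g → f divides u → ⊥
        contradiction-degree zero    mg _ = B.1≉0 (B.trans (B.sym (evalAt-1 B z)) (B.trans (evalAt-cong B {1ₚ} {g} (≋-sym (monic-0 mg)) B.refl) rootg))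
        contradiction-degree (suc n) mg (t , tf≋u) = unit-degree {n} {g} {t} mg (monic-cancel {d} {f} {t *ₚ g} {1ₚ} mf
          (≋-trans (RingIdentities.[xy]z≈[xz]y polynomialRing t g f) (≋-trans (*ₚ-cong {t *ₚ f} {u} {g} {g} tf≋u ≋-refl) (≋-trans ug≋f (≋-sym (*ₚ-identityˡ f))))))

  powersB⇒A : ∀ a b → let open FieldProperties in _^_ B.top z a B.≈ _^_ B.top z b → _^_ A.top x a A.≈ _^_ A.top x b
  powersB⇒A a b e = FieldProperties.x-y≈0⇒x≈y A.top (A.trans (A.sym (difference A x))
      (B⇒A ((X^ a) +ₚ (-ₚ (X^ b))) (B.trans (difference B z) (FieldProperties.x≈y⇒x-y≈0 B.top e))))
    where
    difference : (L : Extension k) (x : Extension.Carrier L) →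
                 Extension._≈_ L (evalAt L ((X^ a) +ₚ (-ₚ (X^ b))) x)
                   (Extension._-_ L (FieldProperties._^_ (Extension.top L) x a) (FieldProperties._^_ (Extension.top L) x b))
    difference L x = trans (evalAt-+ L (X^ a) (-ₚ (X^ b)) x) (+-cong (evalAt-X^ a x) (trans (evalAt-neg (X^ b) x) (-‿cong (evalAt-X^ b x))))
      where
      open Extension L
      open PolynomialComposition L

over-base : {K : Field ℓ} (E : Extension K) {A B : Extension (Extension.top E)} → A ↪ B → compose E A ↪ compose E B
over-base E φ = record { ⟦_⟧ = _↪_.⟦_⟧ φ ; homomorphism = _↪_.homomorphism φ ; fixes = λ a → _↪_.fixes φ (Extension.ι E a) }

module TowerPullback (em : EM) {K : Field ℓ} {V : Valuation K} (E : Extension K) (A B : Extension (Extension.top E)) (φ : A ↪ B)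
    {W : Valuation (Extension.top B)} (ext : Extends (compose E B) V W) where
  private module P = Pullback em {F = Extension.top A} {G = Extension.top B} (_↪_.homomorphism φ) W

  towerValuation : Valuation (Extension.top A)
  towerValuation = P.valuation

  tower-extends : Extends (compose E A) V towerValuation
  tower-extends = PullbackExtends.pullback-extends em (compose E A) (compose E B) (over-base E φ) ext

  tower⇒ : ∀ {x y} → ValuationProperties._≼_ towerValuation x y → ValuationProperties._≼_ W (_↪_.⟦_⟧ φ x) (_↪_.⟦_⟧ φ y)
  tower⇒ = P.pull⇒

  tower⇐ : ∀ {x y} → ValuationProperties._≼_ W (_↪_.⟦_⟧ φ x) (_↪_.⟦_⟧ φ y) → ValuationProperties._≼_ towerValuation x y
  tower⇐ = P.pull⇐

-- The automorphism y ↦ yⁱ of k(y)/k is to be lifted; L is a splitting field over E of Xᴹ - 1, where M is the order of y.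
record LiftingData (ℓ : Level) : Set (lsuc ℓ) where
  field
    {K}        : Field ℓ
    {V}        : Valuation K
    henselian  : IsHenselian V
    E          : Extension K
    algebraicE : IsAlgebraic E
    {W}        : Valuation (Extension.top E)
    extE       : Extends E V W
    {k}        : Field ℓ
    R          : ResidueMap W k
    N          : Extension k
    τ          : N ↪ N
    {y}        : Extension.Carrier N
    {M}        : ℕ
    ord        : Unity.IsOrder (Extension.top N) y M
    {i}        : ℕ
    τy≈y^i     : Extension._≈_ N (_↪_.⟦_⟧ τ y) (FieldProperties._^_ (Extension.top N) y i)
    L          : Extension (Extension.top E)
    algebraicL : IsAlgebraic L
    rs         : List (Extension.Carrier L)
    split      : PolynomialRing._≋_ (Extension.top L) (map (Extension.ι L) (Unity.unity (Extension.top E) M)) (Degree.linears (Extension.top L) rs)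
    {WL}       : Valuation (Extension.top L)
    extL       : Extends (compose E L) V WL
    {l}        : Field ℓ
    S          : ResidueMap WL l

-- The nested modules fix one choice after another: the minimal polynomial f of y, a root of unity ζ
-- reducing to a root of f, the minimal polynomial g of ζ over E, the roots of g in L, and the prime
-- r with an element π.
module Lifting (em : EM) (D : LiftingData ℓ) where
  open LiftingData D
  private
    module E = Extension E
    module L = Extension L
    module N = Extension N
    module k = Field k
    module l = Field l
    module E[X] = PolynomialRing E.top
    module L[X] = PolynomialRing L.top
    module k[X] = PolynomialRing k
    module l[X] = PolynomialRing l
    module LP = FieldProperties L.top
    module lP = FieldProperties l
    module NP = FieldProperties N.top
    module WP = ValuationProperties W
    module LV = ValuationProperties WL
    module R = ResidueMapProperties em R
    module S = ResidueMapProperties em S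
    module T = Homomorphism {F = N.top} {G = N.top} (_↪_.homomorphism τ)
    open Unity.IsOrder ord

    E↪L : E ↪ compose E L
    E↪L = record { ⟦_⟧ = L.ι ; homomorphism = L.ι-homomorphism ; fixes = λ a → L.refl }

    ι⇒ : ∀ {x z} → x WP.≼ z → L.ι x LV.≼ L.ι z
    ι⇒ = Henselian.embedding⇒ em henselian E (compose E L) algebraicE extE extL E↪L

    ι⇐ : ∀ {x z} → L.ι x LV.≼ L.ι z → x WP.≼ z
    ι⇐ = Henselian.embedding⇐ em henselian E (compose E L) algebraicE extE extL E↪L

    module ρ = ResidueExtension em L {W} {WL} ι⇒ ι⇐ R S
    kl = ρ.residueExtension

    unityN : evalAt N (Unity.unity k M) y N.≈ N.0#
    unityN = N.trans (evalAt-unity N M y) (NP.x≈y⇒x-y≈0 isRoot)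

    M-1 : ∃[ m ] M ≡ suc m
    M-1 = go M positive
      where
      go : ∀ M → 0 ℕ.< M → ∃[ m ] M ≡ suc m
      go (suc m) _ = m , ≡.refl

    unity⇒unit : ∀ {z} → z LP.^ M L.≈ L.1# → z LV.~ L.1#
    unity⇒unit {z} e = LV.unity~1 {z} {proj₁ M-1} (≡.subst (λ n → z LP.^ n L.≈ L.1#) (proj₂ M-1) e)

    unity-L : Unity.unity L.top M L[X].≋ Degree.linears L.top rs
    unity-L = L[X].≋-trans (L[X].≋-sym (map-unity L M)) split

    root⇒unity : ∀ {z} → Any (z L.≈_) rs → z LP.^ M L.≈ L.1#
    root⇒unity {z} any = LP.x-y≈0⇒x≈y (L.trans (L.sym (Unity.eval-unity L.top M z)) (L.trans (L[X].eval-cong unity-L L.refl) (Degree.linears-root⁻ L.top any)))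

    rs-unity : All (λ z → z LP.^ M L.≈ L.1#) rs
    rs-unity = All.map root⇒unity (Degree.self-members L.top rs)

    rs-integral : All S.Integral rs
    rs-integral = All.map (λ e → proj₂ (unity⇒unit e)) rs-unity

    integral-X^ : ∀ M → S.IntegralPoly (L[X].X^ M)
    integral-X^ zero    = LV.≼-refl ∷ []
    integral-X^ (suc M) = LV.≼-0 ∷ integral-X^ M

    integral-unity : S.IntegralPoly (Unity.unity L.top M)
    integral-unity = S.integral-+ₚ (integral-X^ M) (S.integral-neg LV.≼-refl ∷ [])

    red-unity : map S.red (Unity.unity L.top M) l[X].≋ Unity.unity l M
    red-unity = l[X].≋-trans (S.red-+ₚ {L[X].X^ M} {L[X].-ₚ L[X].1ₚ} (integral-X^ M) (S.integral-neg LV.≼-refl ∷ []))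
        (l[X].+ₚ-cong (red-X^ M) (l[X].∷-cong (l.trans (S.red-neg LV.≼-refl) (l.-‿cong S.red-1)) (l[X].≋-refl {[]})))
      where
      red-X^ : ∀ M → map S.red (L[X].X^ M) l[X].≋ l[X].X^ M
      red-X^ zero    = l[X].∷-cong S.red-1 (l[X].≋-refl {[]})
      red-X^ (suc M) = l[X].∷-cong S.red-0 (red-X^ M)

    unity-l : Unity.unity l M l[X].≋ Degree.linears l (map S.red rs)
    unity-l = l[X].≋-trans (l[X].≋-sym red-unity) (l[X].≋-trans (S.red-poly-cong integral-unity unity-L) (S.red-linears rs-integral))

  residualExtension : Extension k
  residualExtension = kl

  reduce : L.Carrier → l.Carrier
  reduce = S.red

  module WithMinimal {d : ℕ} {f : k[X].Poly} (monic-f : Degree.Monic k d f) (root-f : evalAt N f y N.≈ N.0#)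
                     (minimal-f : ∀ p → evalAt N p y N.≈ N.0# → Degree._divides_ k f p) where
    -- f divides X^M - 1, whose roots over l are the residues of its roots in L. As f is not
    -- constant, one of these residues is a root of f.
    lifted-root : ∃[ ζ ] ζ LP.^ M L.≈ L.1# × evalAt kl f (S.red ζ) l.≈ l.0#
    lifted-root = go (ClassicalDegree.divisor-of-linears em l (map S.red rs) {d} {map ρ.ρ f} {proj₁ divides-l} (monic-map kl monic-f) (proj₂ divides-l))
      where
      divides-l : Degree._divides_ l (map ρ.ρ f) (Degree.linears l (map S.red rs))
      divides-l = let u , e = map-divides kl {f} {Unity.unity k M} (minimal-f (Unity.unity k M) unityN) in
        u , l[X].≋-trans e (l[X].≋-trans (map-unity kl M) unity-l)
      find : ∀ {b} {xs} → All (λ z → z LP.^ M L.≈ L.1#) xs → Any (b l.≈_) (map S.red xs) → ∃[ ζ ] ζ LP.^ M L.≈ L.1# × b l.≈ S.red ζ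
      find {xs = x ∷ xs} (u ∷ us) (here e)    = x , u , e
      find {xs = x ∷ xs} (u ∷ us) (there any) = find us any
      go : ClassicalDegree.Splits em l (map S.red rs) d (map ρ.ρ f) → ∃[ ζ ] ζ LP.^ M L.≈ L.1# × evalAt kl f (S.red ζ) l.≈ l.0#
      go ([] , e , len , sub) = ⊥-elim (N.1≉0 (N.trans (N.sym (evalAt-1 N y)) (N.trans (evalAt-cong N {k[X].1ₚ} {f} (k[X].≋-sym f≋1) N.refl) root-f)))
        where
        f≋1 : f k[X].≋ k[X].1ₚ
        f≋1 = Degree.monic-0 k (≡.subst (λ n → Degree.Monic k n f) (≡.sym len) monic-f)
      go (b ∷ bs , e , len , sub) = let ζ , u , b≈ = find rs-unity (Any.map l.reflexive (Sublist.Any-resp-⊆ sub (here ≡.refl))) in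
        ζ , u , l.trans (l[X].eval-cong e (l.sym b≈)) (Degree.linears-root⁻ l {b ∷ bs} (here l.refl))

    module WithRoot (ζ : L.Carrier) (ζ^M : ζ LP.^ M L.≈ L.1#) (root-ζ : evalAt kl f (S.red ζ) l.≈ l.0#) where
      private
        ζ-integral : S.Integral ζ
        ζ-integral = proj₂ (unity⇒unit ζ^M)

        module Kernel = SameKernel em N kl {y} {S.red ζ} monic-f root-f minimal-f root-ζ

      -- Together with the next two, this shows that y, ζ and the residue of ζ satisfy the same
      -- relations between powers. Hence ζ has order M, and reduction is injective on the powers of
      -- ζ.
      powers-y⇒ζ : ∀ a b → y NP.^ a N.≈ y NP.^ b → ζ LP.^ a L.≈ ζ LP.^ b
      powers-y⇒ζ = transfer-powers {F = N.top} {G = L.top} ord ζ^M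

      powers-red⇒y : ∀ a b → S.red ζ lP.^ a l.≈ S.red ζ lP.^ b → y NP.^ a N.≈ y NP.^ b
      powers-red⇒y = Kernel.powersB⇒A

      powers-ζ⇒y : ∀ a b → ζ LP.^ a L.≈ ζ LP.^ b → y NP.^ a N.≈ y NP.^ b
      powers-ζ⇒y a b e = powers-red⇒y a b (l.trans (l.sym (S.red-^ a ζ-integral)) (l.trans (S.red-cong (S.integral-^ a ζ-integral) e) (S.red-^ b ζ-integral)))

      private
        ζ-order : Unity.IsOrder L.top ζ M
        ζ-order = record { positive = positive ; isRoot = ζ^M ; minimal = λ m e → minimal m (powers-ζ⇒y m 0 e) }

        unity-root-ζ : evalAt L (Unity.unity E.top M) ζ L.≈ L.0#
        unity-root-ζ = L.trans (evalAt-unity L M ζ) (LP.x≈y⇒x-y≈0 ζ^M)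

      module WithConjugates {n : ℕ} {g : E[X].Poly} (monic-g : Degree.Monic E.top n g) (root-g : evalAt L g ζ L.≈ L.0#)
                            (minimal-g : ∀ p → evalAt L p ζ L.≈ L.0# → Degree._divides_ E.top g p) where
        g-splits : ClassicalDegree.Splits em L.top (Unity.powers L.top ζ M) n (map L.ι g)
        g-splits = let u , e = map-divides L {g} {Unity.unity E.top M} (minimal-g (Unity.unity E.top M) unity-root-ζ) in
          ClassicalDegree.divisor-of-linears em L.top (Unity.powers L.top ζ M) {n} {map L.ι g} {u} (monic-map L monic-g)
            (L[X].≋-trans e (L[X].≋-trans (map-unity L M) (Unity.unity≋powers L.top ζ-order)))

        module WithSplitting (zs : List L.Carrier) (g≋zs : map L.ι g L[X].≋ Degree.linears L.top zs) (length-zs : length zs ≡ n)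
                             (zs⊆ : zs ⊆ Unity.powers L.top ζ M) where
          private
            zs-distinct : Degree.Distinct L.top zs
            zs-distinct = Degree.distinct-⊆ L.top zs⊆ (Unity.powers-distinct L.top ζ-order)

            Power : L.Carrier → Set ℓ
            Power z = ∃[ j ] z L.≈ ζ LP.^ j

            zs-powers : All Power zs
            zs-powers = Sublist.All-resp-⊆ zs⊆ (All.applyUpTo⁺₂ (ζ LP.^_) M λ j → j , L.refl)

            power-integral : ∀ {z} → Power z → S.Integral z
            power-integral (j , e) = LV.≼-resp L.refl (L.sym e) (S.integral-^ j ζ-integral)

            red-power-injective : ∀ {z z′} → Power z → Power z′ → S.red z l.≈ S.red z′ → z L.≈ z′
            red-power-injective {z} {z′} (a , e) (b , e′) p = L.trans e (L.trans (powers-y⇒ζ a b (powers-red⇒y a b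
                (l.trans (l.sym (red-of a e)) (l.trans p (red-of b e′))))) (L.sym e′))
              where
              red-of : ∀ {z} a → z L.≈ ζ LP.^ a → S.red z l.≈ S.red ζ lP.^ a
              red-of a e = l.trans (S.red-cong (power-integral (a , e)) e) (S.red-^ a ζ-integral)

            zs-integral : All S.Integral zs
            zs-integral = All.map power-integral zs-powers

            g-root⇒vanish : ∀ {z} → evalAt L g z L.≈ L.0# → ∀ p → evalAt L p ζ L.≈ L.0# → evalAt L p z L.≈ L.0#
            g-root⇒vanish {z} r p e = MinimalPolynomial.divides-evalAt L em z {g} {p} (minimal-g p e) r

          module Simple = SimpleExtension em L algebraicL ζ
          open Simple using (simple; simpleField; conjugate; inclusion; power-endomorphism; generator)

          private
            module SE = Extension simple

            module Pulled = TowerPullback em E simple L inclusion extL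

          W′ : Valuation simpleField
          W′ = Pulled.towerValuation

          private
            module SV = ValuationProperties W′

            extS : Extends (compose E simple) V W′
            extS = Pulled.tower-extends

            simple-algebraic : IsAlgebraic simple
            simple-algebraic = embedding-algebraic em {A = simple} {B = L} inclusion algebraicL

            simple-algebraic-K : IsAlgebraic (compose E simple)
            simple-algebraic-K = algebraic-trans em E simple algebraicE simple-algebraic

            -- Evaluation at a conjugate z embeds E(ζ) into L over K, so comparisons that hold at z
            -- can be carried back to ζ.
            conjugate⇐ : ∀ {z} r {p q} → evalAt L p z LV.≼ evalAt L q z → p SV.≼ q
            conjugate⇐ {z} r = Henselian.embedding⇐ em henselian (compose E simple) (compose E L) simple-algebraic-K extS extL (over-base E (conjugate z (g-root⇒vanish r)))

            lift-f = R.lift-poly f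

            residue-of-lift-f : ∀ {z} → S.Integral z → S.red (evalAt L lift-f z) l.≈ evalAt kl f (S.red z)
            residue-of-lift-f {z} iz = l.trans (l.sym (ρ.red-evalAt (R.lift-poly-integral f) iz))
              (evalAt-cong kl {map R.red lift-f} {f} (R.red-lift-poly f) l.refl)

            integral-lift-f : ∀ {z} → S.Integral z → S.Integral (evalAt L lift-f z)
            integral-lift-f iz = S.integral-eval (ρ.map-ι-integral (R.lift-poly-integral f)) iz

            -- by uniqueness of the valuation, all conjugates of ζ reduce to roots of f
            conjugate-residue : ∀ {z} → Power z → evalAt L g z L.≈ L.0# → evalAt kl f (S.red z) l.≈ l.0#
            conjugate-residue {z} pz r = l.trans (l.sym (residue-of-lift-f (power-integral pz))) (S.red-≈0⇐ (integral-lift-f (power-integral pz)) λ small →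
              S.red-≈0⇒ (integral-lift-f ζ-integral) (l.trans (residue-of-lift-f ζ-integral) root-ζ)
                (LV.≼-resp L.refl (evalAt-1 L ζ) (Pulled.tower⇒ (conjugate⇐ {z} r {lift-f} {E[X].1ₚ} (LV.≼-resp L.refl (L.sym (evalAt-1 L z)) small)))))

            zs-roots : All (λ z → evalAt L g z L.≈ L.0#) zs
            zs-roots = All.map (λ {z} any → L.trans (L[X].eval-cong g≋zs L.refl) (Degree.linears-root⁻ L.top any)) (Degree.self-members L.top zs)

            -- The n conjugates of ζ are powers of ζ, so their residues are distinct, and by
            -- `conjugate-residue` all of these are roots of f.
            n≤d : n ℕ.≤ d
            n≤d = ℕ.≮⇒≥ λ d<n → Degree.monic-nonzero l (monic-map kl monic-f) (Degree.roots-bound l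
              (red-distinct zs-distinct zs-powers)
              (All.map⁺ (All.map (λ (pz , r) → conjugate-residue pz r) (All.zip (zs-powers , zs-roots))))
              (Degree.below-mono l (≡.subst (suc d ℕ.≤_) (≡.sym (≡.trans (List.length-map S.red zs) length-zs)) d<n) (Degree.bounded (monic-map kl monic-f))))
              where
              red-distinct : ∀ {xs} → Degree.Distinct L.top xs → All Power xs → Degree.Distinct l (map S.red xs)
              red-distinct []       []       = []
              red-distinct (d ∷ ds) (p ∷ ps) = All.map⁺ (All.map (λ (x≉y , q) e → x≉y (red-power-injective p q e)) (All.zip (d , ps))) ∷ red-distinct ds ps

            vanish-below : ∀ {p} → Degree.Below k d p → evalAt kl p (S.red ζ) l.≈ l.0# → p k[X].≋ []
            vanish-below {p} b e = let u , uf≋p = minimal-f p (Kernel.B⇒A p e) in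
              k[X].≋-trans (k[X].≋-sym uf≋p) (k[X].*ₚ-cong {u} {[]} {f} {f} (Degree.below-0 k (Degree.below-quotient k {0} {d} {u} {f} monic-f
                (Degree.below-cong k (k[X].≋-sym uf≋p) b))) k[X].≋-refl)

          reduce-mod-g : ∀ p → ∃[ q ] Degree.Below E.top n q × evalAt L q ζ L.≈ evalAt L p ζ
          reduce-mod-g p = let u , q , e , b = Degree.division E.top monic-g p in
            q , b , L.sym (L.trans (evalAt-cong L {p} {u E[X].*ₚ g E[X].+ₚ q} e L.refl) (L.trans (evalAt-+ L (u E[X].*ₚ g) q ζ)
              (L.trans (L.+-congʳ (L.trans (evalAt-* L u g ζ) (L.trans (L.*-congˡ root-g) (L.zeroʳ _)))) (L.+-identityˡ _))))

          -- Write the element as q(ζ) with deg q < n ≤ d. Divided by a coefficient of least value,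
          -- q reduces to a nonzero polynomial of degree below d, which does not vanish at the
          -- residue of ζ; so q(ζ) has the value of that coefficient.
          unramified : ∀ p → ¬ (p SE.≈ SE.0#) → ∃[ c ] ¬ (c E.≈ E.0#) × SE.ι c SV.~ p
          unramified p p≉0 = go (reduce-mod-g p)
            where
            go : (∃[ q ] Degree.Below E.top n q × evalAt L q ζ L.≈ evalAt L p ζ) → ∃[ c ] ¬ (c E.≈ E.0#) × SE.ι c SV.~ p
            go (q , bq , e) = primitive′ (R.primitive-part q≉0)
              where
              q≉0 : ¬ (q E[X].≋ [])
              q≉0 z = p≉0 (Simple.same (L.trans (L.sym e) (evalAt-cong L {q} {[]} z L.refl)))
              primitive′ : (∃[ c ] ∃[ q′ ] ¬ (c E.≈ E.0#) × c E[X].• q′ E[X].≋ q × R.IntegralPoly q′ × ¬ (map R.red q′ k[X].≋ [])) → ∃[ c ] ¬ (c E.≈ E.0#) × SE.ι c SV.~ p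
              primitive′ (c , q′ , c≉0 , cq′≋q , iq′ , q′≉0) = c , c≉0 , Pulled.tower⇐ (proj₁ in-L) , Pulled.tower⇐ (proj₂ in-L)
                where
                b′ : Degree.Below E.top n q′
                b′ = Degree.below λ m n≤m → FieldProperties.*-cancel-0 E.top c≉0 (E.trans (E.sym (E[X].coeff-• c q′ m)) (E.trans (E[X].at cq′≋q m) (Degree.vanish bq m n≤m)))
                unit : evalAt L q′ ζ LV.~ L.1#
                unit = S.red-nonzero (S.integral-eval (ρ.map-ι-integral iq′) ζ-integral) λ z →
                  q′≉0 (vanish-below (Degree.below-mono k n≤d (R.red-below b′)) (l.trans (ρ.red-evalAt iq′ ζ-integral) z))
                in-L : evalAt L (c ∷ []) ζ LV.~ evalAt L p ζ
                in-L = LV.~-sym (LV.~-trans (LV.≈⇒~ (L.trans (L.sym e) (L.trans (evalAt-cong L {q} {(c ∷ []) E[X].*ₚ q′}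
                    (E[X].≋-trans (E[X].≋-sym cq′≋q) (ClassicalDegree.•≋* em E.top c q′)) L.refl) (evalAt-* L (c ∷ []) q′ ζ))))
                  (LV.~-trans (LV.~-* LV.~-refl unit) (LV.≈⇒~ (L.*-identityʳ _))))

          private
            -- g has integral coefficients, so it can be reduced; τ shows that its reduction vanishes at y^i
            g-coefficient-integral : ∀ m → R.Integral (E[X].coeff g m)
            g-coefficient-integral m = ρ.integral-ι (LV.≼-resp L.refl (L.trans (L.sym (L[X].at g≋zs m)) (coeff-map {F = E.top} {G = L.top} L.ι-homomorphism g m))
              (S.integral-coeff (S.integral-linears zs-integral) m))

            g-integral : R.IntegralPoly g
            g-integral = from-coefficients g g-coefficient-integral
              where
              from-coefficients : ∀ p → (∀ m → R.Integral (E[X].coeff p m)) → R.IntegralPoly p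
              from-coefficients []      _ = []
              from-coefficients (a ∷ p) c = c 0 ∷ from-coefficients p (λ m → c (suc m))

            ḡ = map R.red g

            ḡ-root-y : evalAt N ḡ y N.≈ N.0#
            ḡ-root-y = Kernel.B⇒A ḡ (l.trans (ρ.red-evalAt g-integral ζ-integral) (l.trans (S.red-cong (S.integral-eval (ρ.map-ι-integral g-integral) ζ-integral) root-g) S.red-0))

            ḡ-root-y^i : evalAt N ḡ (y NP.^ i) N.≈ N.0#
            ḡ-root-y^i = N.trans (evalAt-cong N {ḡ} {ḡ} k[X].≋-refl (N.sym τy≈y^i)) (N.trans (N.sym (τ-evalAt ḡ)) (N.trans (T.φ-cong ḡ-root-y) T.0#-homo))
              where
              τ-evalAt : ∀ p → _↪_.⟦_⟧ τ (evalAt N p y) N.≈ evalAt N p (_↪_.⟦_⟧ τ y)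
              τ-evalAt []      = T.0#-homo
              τ-evalAt (a ∷ p) = N.trans (T.+-homo _ _) (N.+-cong (_↪_.fixes τ a) (N.trans (T.*-homo _ _) (N.*-congˡ (τ-evalAt p))))

            ḡ-root-red : evalAt kl ḡ (S.red ζ lP.^ i) l.≈ l.0#
            ḡ-root-red = l.trans (evalAt-cong kl {ḡ} {ḡ} k[X].≋-refl (l.sym (lc.evalAt-X^ i (S.red ζ)))) (l.trans (l.sym (lc.evalAt-⊚ ḡ (k[X].X^ i) (S.red ζ)))
              (Kernel.A⇒B (ḡ k[X].⊚ k[X].X^ i) (N.trans (nc.evalAt-⊚ ḡ (k[X].X^ i) y) (N.trans (evalAt-cong N {ḡ} {ḡ} k[X].≋-refl (nc.evalAt-X^ i y)) ḡ-root-y^i))))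
              where
              module lc = PolynomialComposition kl
              module nc = PolynomialComposition N

          -- The i-th power of the residue of ζ is a root of the reduction of g, so it is the
          -- residue of a conjugate of ζ. That conjugate and ζⁱ are powers of ζ with equal residues,
          -- hence equal.
          ζ^i-conjugate : evalAt L g (ζ LP.^ i) L.≈ L.0#
          ζ^i-conjugate = go zs-powers zs-roots (Any.map⁻ (ClassicalDegree.linears-root em l {map S.red zs} (l.trans (l.sym same-value) ḡ-root-red)))
            where
            same-value : evalAt kl ḡ (S.red ζ lP.^ i) l.≈ l[X].eval (Degree.linears l (map S.red zs)) (S.red ζ lP.^ i)
            same-value = l[X].eval-cong (l[X].≋-trans (ρ.map-ρ-red g-integral) (l[X].≋-trans (S.red-poly-cong (ρ.map-ι-integral g-integral) g≋zs) (S.red-linears zs-integral))) l.refl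
            go : ∀ {xs} → All Power xs → All (λ z → evalAt L g z L.≈ L.0#) xs → Any (λ z → S.red ζ lP.^ i l.≈ S.red z) xs → evalAt L g (ζ LP.^ i) L.≈ L.0#
            go (p ∷ _)  (r ∷ _)  (here e)    = L.trans (evalAt-cong L {g} {g} E[X].≋-refl
              (red-power-injective (i , L.refl) p (l.trans (S.red-^ i ζ-integral) e))) r
            go (_ ∷ ps) (_ ∷ rs) (there any) = go ps rs any

          σ : simple ↪ simple
          σ = power-endomorphism i (g-root⇒vanish ζ^i-conjugate)

          private module σ = _↪_ σ

          σ-period : ∀ {m} → y NP.^ (i ℕ.^ m) N.≈ y → ∀ p → Operator.iter simple σ m p SE.≈ p
          σ-period {m} e p = Simple.same (L.trans (Simple.evalAt-iter i (g-root⇒vanish ζ^i-conjugate) m p ζ)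
            (evalAt-cong L {p} {p} E[X].≋-refl (L.trans (powers-y⇒ζ (i ℕ.^ m) 1 (N.trans e (N.sym (N.*-identityʳ y)))) (L.*-identityʳ ζ))))

          σ-moves : ∀ {m} → Operator.iter simple σ m generator SE.≈ generator → y NP.^ (i ℕ.^ m) N.≈ y
          σ-moves {m} (Simple.same e) = N.trans (powers-ζ⇒y (i ℕ.^ m) 1 (L.trans (L.sym (generator-value (ζ LP.^ (i ℕ.^ m))))
              (L.trans (L.sym (Simple.evalAt-iter i (g-root⇒vanish ζ^i-conjugate) m generator ζ)) (L.trans e (L.trans (generator-value ζ) (L.sym (L.*-identityʳ ζ)))))))
              (N.*-identityʳ y)
            where
            generator-value : ∀ z → evalAt L generator z L.≈ z
            generator-value z = L.trans (PolynomialComposition.evalAt-X^ L 1 z) (L.*-identityʳ z)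

          ι~ : ∀ {a b} → a WP.~ b → SE.ι a SV.~ SE.ι b
          ι~ (p , q) = mono p , mono q
            where
            mono : ∀ {a b} → a WP.≼ b → SE.ι a SV.≼ SE.ι b
            mono p = Pulled.tower⇐ (LV.≼-resp (L.sym (PolynomialComposition.evalAt-const L _ ζ)) (L.sym (PolynomialComposition.evalAt-const L _ ζ)) (ι⇒ p))

          ι~⁻ : ∀ {a b} → SE.ι a SV.~ SE.ι b → a WP.~ b
          ι~⁻ (p , q) = cancel p , cancel q
            where
            cancel : ∀ {a b} → SE.ι a SV.≼ SE.ι b → a WP.≼ b
            cancel p = ι⇐ (LV.≼-resp (PolynomialComposition.evalAt-const L _ ζ) (PolynomialComposition.evalAt-const L _ ζ) (Pulled.tower⇒ p))

          -- Uniqueness makes σ preserve comparisons, and by `unramified` every nonzero element can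
          -- be compared with an element of E of the same value, which σ fixes.
          σ~ : ∀ p → σ.⟦ p ⟧ SV.~ p
          σ~ p = go em
            where
            module H = Homomorphism {F = simpleField} {G = simpleField} σ.homomorphism
            σ-mono : ∀ {p q} → p SV.≼ q → σ.⟦ p ⟧ SV.≼ σ.⟦ q ⟧
            σ-mono = Henselian.embedding⇒ em henselian (compose E simple) (compose E simple) simple-algebraic-K extS extS (over-base E σ)
            go : Dec (p SE.≈ SE.0#) → σ.⟦ p ⟧ SV.~ p
            go (yes e) = SV.≈⇒~ (SE.trans (H.φ-cong e) (SE.trans H.0#-homo (SE.sym e)))
            go (no ¬e) = let c , c≉0 , u , v = unramified p ¬e in
              SV.~-trans (SV.~-sym (SV.~-trans (SV.≈⇒~ (SE.sym (σ.fixes c))) (σ-mono u , σ-mono v))) (u , v)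

          module Fixed = FixedField simple σ

          fixed-algebraic : IsAlgebraic Fixed.fixedExtension
          fixed-algebraic = embedding-algebraic em {A = Fixed.fixedExtension} {B = simple} Fixed.fixed-inclusion simple-algebraic

          spanned : ∀ p → Span.InSpan em (extensionAlgebra Fixed.overFixed) {n} (λ j → FieldProperties._^_ simpleField generator (toℕ j)) p
          spanned p = let q , b , e = reduce-mod-g p in
            (λ j → Extension.ι Fixed.fixedExtension (E[X].coeff q (toℕ j))) ,
            SE.trans (SE.sym (FiniteSubring.evalAt-below em simple {n} {q} generator b)) (SE.trans (evalAt-generator q) (Simple.same e))
            where
            module H = Homomorphism {F = simpleField} {G = L.top} (_↪_.homomorphism inclusion)
            evalAt-generator : ∀ q → evalAt simple q generator SE.≈ q
            evalAt-generator q = Simple.same (L.trans (pushed q) (evalAt-cong L {q} {q} E[X].≋-refl (L.trans (PolynomialComposition.evalAt-X^ L 1 ζ) (L.*-identityʳ ζ))))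
              where
              pushed : ∀ q → evalAt L (evalAt simple q generator) ζ L.≈ evalAt L q (evalAt L generator ζ)
              pushed []      = L.refl
              pushed (a ∷ q) = L.trans (H.+-homo (a ∷ []) (generator SE.* evalAt simple q generator))
                (L.+-cong (_↪_.fixes inclusion a) (L.trans (H.*-homo generator (evalAt simple q generator)) (L.*-congˡ (pushed q))))

          module WithPrime {r-2 : ℕ} (pr : Prime (suc (suc r-2))) (y-period : Operator.iter N τ (suc (suc r-2)) y N.≈ y)
              (y-moved : ¬ (_↪_.⟦_⟧ τ y N.≈ y)) {π : E.Carrier} (π≉0 : ¬ (π E.≈ E.0#))
              (indivisible : WP.NotPower (suc (suc r-2)) π) where
            private
              r : ℕ
              r = suc (suc r-2)
              module SP = FieldProperties simpleField
              module EP = FieldProperties E.top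
              module SI = Homomorphism {F = E.top} {G = simpleField} SE.ι-homomorphism

              iter-y : ∀ m → Operator.iter N τ m y N.≈ y NP.^ (i ℕ.^ m)
              iter-y = Period.iter-power N τ {y} {i} τy≈y^i

              iter-same : ∀ m p → Operator.iter Fixed.overFixed Fixed.overFixed-σ m p ≡ Operator.iter simple σ m p
              iter-same zero    p = ≡.refl
              iter-same (suc m) p = ≡.cong σ.⟦_⟧ (iter-same m p)

              period : ∀ p → Operator.iter Fixed.overFixed Fixed.overFixed-σ r p SE.≈ p
              period p = ≡.subst (SE._≈ p) (≡.sym (iter-same r p)) (σ-period {r} (N.trans (N.sym (iter-y r)) y-period) p)

              moved : ∀ (j : Fin (suc r-2)) → ¬ (Operator.iter Fixed.overFixed Fixed.overFixed-σ (suc (toℕ j)) generator SE.≈ generator)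
              moved j e = Period.prime-period N τ em pr y-period y-moved (suc (toℕ j)) (s≤s z≤n) (s≤s (Fin.toℕ<n j))
                (N.trans (iter-y (suc (toℕ j))) (σ-moves {suc (toℕ j)} (≡.subst (SE._≈ generator) (iter-same (suc (toℕ j)) generator) e)))

              -- By `unramified` the coefficients may be replaced by elements of E with the same
              -- values; in E, `exponents-equal` applies.
              ramified : SV.Incongruent r (SE.ι π)
              ramified {x} {z} a b x≉0 z≉0 e =
                let c , c≉0 , c~ = unramified x x≉0
                    d , d≉0 , d~ = unramified z z≉0
                in Fin.toℕ-injective (Indivisible.exponents-equal W pr π≉0 indivisible {c} {d} {toℕ a} {toℕ b} c≉0 d≉0 (Fin.toℕ<n a) (Fin.toℕ<n b)
                     (ι~⁻ (SV.~-trans (monomial c (toℕ a)) (SV.~-trans (SV.~-* (SV.~-^ r c~) SV.~-refl)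
                       (SV.~-trans e (SV.~-sym (SV.~-trans (monomial d (toℕ b)) (SV.~-* (SV.~-^ r d~) SV.~-refl))))))))
                where
                monomial : ∀ c j → SE.ι (c EP.^ r E.* π EP.^ j) SV.~ SE.ι c SP.^ r SE.* SE.ι π SP.^ j
                monomial c j = SV.≈⇒~ (SE.trans (SI.*-homo (c EP.^ r) (π EP.^ j)) (SE.*-cong (SI.^-homo c r) (SI.^-homo π j)))

            contradiction : ¬ Dim≤1 E.top
            contradiction dim = CyclicDivisionAlgebra.brauer-nontrivial em Fixed.overFixed Fixed.overFixed-σ r-2 (SE.ι π) (σ.fixes π) period
              (λ p e → (p , e) , SE.refl {p}) {n} (λ j → generator SP.^ toℕ j) spanned generator moved W′ σ~ (SI.φ-nonzero {π} π≉0) (λ {x} {y} → ramified {x} {y}) (dim Fixed.fixedExtension fixed-algebraic)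

-- Traces

module Trace (em : EM) {k : Field ℓ} (N : Extension k) {n : ℕ} {b : Fin n → Extension.Carrier N} (basis : IsBasis (extensionAlgebra N) b) where
  private
    module k = Field k
    module kΣ = SemiringSum k.semiring
    module kM = Mult k.semiring
    module I = Homomorphism {F = k} {G = Extension.top N} (Extension.ι-homomorphism N)
  open Extension N hiding (zero)
  open FieldProperties top
  open Span em (extensionAlgebra N)
  open SemiringSum semiring
  open IsBasis basis

  co : Carrier → Fin n → k.Carrier
  co x = proj₁ (spanning x)

  co-unique : ∀ {x} c → lc c b ≈ x → ∀ i → c i k.≈ co x i
  co-unique {x} c e i = FieldProperties.x-y≈0⇒x≈y k (independent (λ j → c j k.- co x j) (trans (lc-+ c (λ j → k.- co x j) b)
    (trans (+-cong e negated) (-‿inverseʳ x))) i)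
    where
    negated : lc (λ j → k.- co x j) b ≈ - x
    negated = trans (lc-cong {a = b} (λ j → k.sym (RingProperties.-1*x≈-x k.ring (co x j))) (λ j → refl))
      (trans (lc-• (k.- k.1#) (co x) b) (trans (*-cong (trans (I.-‿homo k.1#) (-‿cong I.1#-homo)) (proj₂ (spanning x)))
        (solve 1 (λ x → (:- con (+ 1)) :* x := :- x) refl x)))

  co-cong : ∀ {x y} → x ≈ y → ∀ i → co x i k.≈ co y i
  co-cong {x} e = co-unique (co x) (trans (proj₂ (spanning x)) e)

  co-lc : ∀ {m} (c : Fin m → k.Carrier) (v : Fin m → Carrier) i → co (lc c v) i k.≈ kΣ.sum (λ j → c j k.* co (v j) i)
  co-lc c v i = k.sym (co-unique (λ i → kΣ.sum (λ j → c j k.* co (v j) i))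
    (trans (sym (lc-lc c (λ j → co (v j)) b)) (lc-cong {c = c} (λ _ → k.refl) (λ j → proj₂ (spanning (v j))))) i)

  record Linear : Set ℓ where
    field
      map₁  : Carrier → Carrier
      cong₁ : ∀ {x y} → x ≈ y → map₁ x ≈ map₁ y
      add₁  : ∀ x y → map₁ (x + y) ≈ map₁ x + map₁ y
      scale₁ : ∀ a x → map₁ (ι a * x) ≈ ι a * map₁ x

    linear-lc : ∀ {m} (c : Fin m → k.Carrier) v → map₁ (lc c v) ≈ lc c (λ j → map₁ (v j))
    linear-lc {zero}  c v = trans (cong₁ (sym (zeroʳ (ι k.0#)))) (trans (scale₁ k.0# 0#) (trans (*-congʳ I.0#-homo) (zeroˡ _)))
    linear-lc {suc m} c v = trans (add₁ _ _) (+-cong (scale₁ (c zero) (v zero)) (linear-lc (c ∘ suc) (v ∘ suc)))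
  open Linear public

  tr : (Carrier → Carrier) → k.Carrier
  tr f = kΣ.sum (λ i → co (f (b i)) i)

  tr-cong : ∀ {f g} → (∀ x → f x ≈ g x) → tr f k.≈ tr g
  tr-cong e = kΣ.sum-cong-≋ λ i → co-cong (e (b i)) i

  -- In coordinates both sides are the same double sum, with the order of summation exchanged.
  tr-comm : ∀ f g → tr (λ x → map₁ f (map₁ g x)) k.≈ tr (λ x → map₁ g (map₁ f x))
  tr-comm f g = k.trans (expand f g) (k.trans (kΣ.∑-comm (λ i j → co (map₁ g (b i)) j k.* co (map₁ f (b j)) i))
      (k.trans (kΣ.sum-cong-≋ {n} λ j → kΣ.sum-cong-≋ {n} λ i → k.*-comm (co (map₁ g (b i)) j) (co (map₁ f (b j)) i)) (k.sym (expand g f))))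
    where
    expand : ∀ f g → tr (λ x → map₁ f (map₁ g x)) k.≈ kΣ.sum (λ i → kΣ.sum (λ j → co (map₁ g (b i)) j k.* co (map₁ f (b j)) i))
    expand f g = kΣ.sum-cong-≋ λ i → k.trans (co-cong (trans (cong₁ f (sym (proj₂ (spanning (map₁ g (b i)))))) (linear-lc f (co (map₁ g (b i))) b)) i)
      (co-lc (co (map₁ g (b i))) (λ j → map₁ f (b j)) i)

  Tr : Carrier → k.Carrier
  Tr x = tr (x *_)

  Tr-cong : ∀ {x y} → x ≈ y → Tr x k.≈ Tr y
  Tr-cong {x} {y} e = tr-cong {x *_} {y *_} λ z → *-congʳ e

  Tr-+ : ∀ x y → Tr (x + y) k.≈ Tr x k.+ Tr y
  Tr-+ x y = k.trans (kΣ.sum-cong-≋ λ i → k.trans (co-cong (distribʳ (b i) x y) i) (co-+ (x * b i) (y * b i) i))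
      (kΣ.∑-distrib-+ (λ i → co (x * b i) i) (λ i → co (y * b i) i))
    where
    co-+ : ∀ x y i → co (x + y) i k.≈ co x i k.+ co y i
    co-+ x y i = k.sym (co-unique (λ i → co x i k.+ co y i) (trans (lc-+ (co x) (co y) b) (+-cong (proj₂ (spanning x)) (proj₂ (spanning y)))) i)

  Tr-1 : Tr 1# k.≈ n kM.× k.1#
  Tr-1 = k.trans (kΣ.sum-cong-≋ {n} {y = λ _ → k.1#} diagonal-entry) (kΣ.sum-replicate n)
    where
    diagonal-entry : ∀ i → co (1# * b i) i k.≈ k.1#
    diagonal-entry i = k.trans (co-cong (*-identityˡ (b i)) i) (unit i)
      where
      indicator : ∀ {m} → Fin m → Fin m → k.Carrier
      indicator zero    zero    = k.1#
      indicator zero    (suc j) = k.0#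
      indicator (suc i) zero    = k.0#
      indicator (suc i) (suc j) = indicator i j
      lc-indicator : ∀ {m} (v : Fin m → Carrier) i → lc (indicator i) v ≈ v i
      lc-indicator v zero    = trans (+-cong (trans (*-congʳ I.1#-homo) (*-identityˡ _)) (lc-zero (v ∘ suc) (λ _ → k.refl))) (+-identityʳ _)
      lc-indicator v (suc i) = trans (+-cong (trans (*-congʳ I.0#-homo) (zeroˡ _)) (lc-indicator (v ∘ suc) i)) (+-identityˡ _)
      indicator-self : ∀ {m} (i : Fin m) → indicator i i ≡ k.1#
      indicator-self zero    = ≡.refl
      indicator-self (suc i) = indicator-self i
      unit : ∀ i → co (b i) i k.≈ k.1#
      unit i = k.trans (k.sym (co-unique (indicator i) (lc-indicator b i) i)) (k.reflexive (indicator-self i))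

  -- Multiplication by σ(x) is multiplication by x conjugated by σ, and `tr-comm` cancels the
  -- conjugation.
  Tr-automorphism : ∀ (σ : Automorphism N) x → Tr (Automorphism.⟦_⟧ σ x) k.≈ Tr x
  Tr-automorphism σ x = k.trans (tr-cong conjugated) (k.trans (tr-comm forward backward) (tr-cong λ z → *-congˡ (left-inverse z)))
    where
    open Automorphism σ
    module S = Homomorphism {F = top} {G = top} (IsRingIsomorphism.isRingHomomorphism isomorphism)
    inv : Carrier → Carrier
    inv z = proj₁ (IsRingIsomorphism.surjective isomorphism z)
    right-inverse : ∀ z → ⟦ inv z ⟧ ≈ z
    right-inverse z = proj₂ (IsRingIsomorphism.surjective isomorphism z) refl
    left-inverse : ∀ z → inv ⟦ z ⟧ ≈ z
    left-inverse z = S.φ-injective em (right-inverse ⟦ z ⟧)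
    forward backward : Linear
    forward = record { map₁ = ⟦_⟧ ; cong₁ = S.φ-cong ; add₁ = S.+-homo ; scale₁ = λ a y → trans (S.*-homo _ _) (*-congʳ (fixes a)) }
    backward = record
      { map₁ = λ z → x * inv z
      ; cong₁ = λ e → *-congˡ (S.φ-injective em (trans (right-inverse _) (trans e (sym (right-inverse _)))))
      ; add₁ = λ y z → trans (*-congˡ (S.φ-injective em (trans (right-inverse _) (sym (trans (S.+-homo _ _) (+-cong (right-inverse y) (right-inverse z))))))) (distribˡ _ _ _)
      ; scale₁ = λ a y → trans (*-congˡ (S.φ-injective em (trans (right-inverse _) (sym (trans (S.*-homo _ _) (*-cong (fixes a) (right-inverse y)))))))
          (solve 3 (λ x a y → x :* (a :* y) := a :* (x :* y)) refl x (ι a) (inv y))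
      }
    conjugated : ∀ z → ⟦ x ⟧ * z ≈ ⟦ x * inv z ⟧
    conjugated z = sym (trans (S.*-homo _ _) (*-congˡ (right-inverse z)))

-- Endomorphisms of prime order

module Iterates {k : Field ℓ} (N : Extension k) (τ : N ↪ N) where
  open Extension N hiding (zero)
  open FieldProperties top
  open _↪_ τ using (⟦_⟧; homomorphism; fixes)
  open Operator N τ using (iter; iter-cong)
  open Period N τ
  private module T = Homomorphism {F = top} {G = top} homomorphism

  iter-homomorphism : ∀ m → IsRingHomomorphism rawRing rawRing (iter m)
  iter-homomorphism zero    = Identity.isRingHomomorphism rawRing refl
  iter-homomorphism (suc m) = Composition.isRingHomomorphism trans (iter-homomorphism m) homomorphism

  iterate : ℕ → N ↪ N
  iterate m = record { ⟦_⟧ = iter m ; homomorphism = iter-homomorphism m ; fixes = iter-fixes m }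
    where
    iter-fixes : ∀ m a → iter m (ι a) ≈ ι a
    iter-fixes zero    a = refl
    iter-fixes (suc m) a = trans (T.φ-cong (iter-fixes m a)) (fixes a)

  iter-iterate : ∀ m n x → Operator.iter N (iterate m) n x ≈ iter (n ℕ.* m) x
  iter-iterate m zero    x = refl
  iter-iterate m (suc n) x = trans (iter-cong m (iter-iterate m n x)) (sym (iter-+ m (n ℕ.* m) x))

  -- τᵃ raises y to the power iᵃ, and among these exponents two agree modulo M. The common initial
  -- iterate cancels because it is injective.
  power-periodic : EM → ∀ {y i M} → Unity.IsOrder top y M → ⟦ y ⟧ ≈ y ^ i → ∃[ n ] iter (suc n) y ≈ y
  power-periodic em {y} {i} {M} ord e = by-order M ord
    where
    by-order : ∀ M → Unity.IsOrder top y M → ∃[ n ] iter (suc n) y ≈ y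
    by-order zero ord with Unity.IsOrder.positive ord
    ... | ()
    by-order (suc M) ord = go (Fin.pigeonhole (ℕ.n<1+n (suc M)) (λ a → Fin.fromℕ< (DivMod.m%n<n (i ℕ.^ toℕ a) (suc M))))
      where
      open Unity.IsOrder ord
      reduce : ∀ m → y ^ m ≈ y ^ (m DivMod.% suc M)
      reduce m = trans (^-congʳ y (DivMod.m≡m%n+[m/n]*n m (suc M))) (trans (^-homo-* y (m DivMod.% suc M) (m DivMod./ suc M ℕ.* suc M))
        (trans (*-congˡ (Unity.^-multiple top {y} {suc M} isRoot (∣.n∣m*n (m DivMod./ suc M)))) (*-identityʳ _)))
      go : (∃[ a ] ∃[ b ] (toℕ {suc (suc M)} a ℕ.< toℕ {suc (suc M)} b) ×
             Fin.fromℕ< (DivMod.m%n<n (i ℕ.^ toℕ a) (suc M)) ≡ Fin.fromℕ< (DivMod.m%n<n (i ℕ.^ toℕ b) (suc M))) → ∃[ n ] iter (suc n) y ≈ y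
      go (a , b , a<b , eq) = d , sym (Homomorphism.φ-injective {F = top} {G = top} (iter-homomorphism (toℕ a)) em (trans (iter-power e (toℕ a)) (trans powers
          (trans (sym (iter-power e (toℕ b))) (trans (reflexive (≡.cong (λ n → iter n y) (≡.sym b≡))) (iter-+ (toℕ a) (suc d) y))))))
        where
        d = toℕ b ℕ.∸ suc (toℕ a)
        b≡ : toℕ a ℕ.+ suc d ≡ toℕ b
        b≡ = ≡.trans (ℕ.+-suc (toℕ a) d) (ℕ.m+[n∸m]≡n a<b)
        powers : y ^ (i ℕ.^ toℕ a) ≈ y ^ (i ℕ.^ toℕ b)
        powers = trans (reduce (i ℕ.^ toℕ a)) (trans (^-congʳ y (Fin.fromℕ<-injective _ _ (DivMod.m%n<n (i ℕ.^ toℕ a) (suc M)) (DivMod.m%n<n (i ℕ.^ toℕ b) (suc M)) eq)) (sym (reduce (i ℕ.^ toℕ b))))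

  -- If r is a prime factor of the least period r m, then τ^m moves y and has period r there.
  prime-iterate : EM → ∀ {n y} → iter (suc n) y ≈ y → ¬ (⟦ y ⟧ ≈ y) →
                  ∃[ r ] ∃[ m ] Prime r × ¬ (iter m y ≈ y) × iter (r ℕ.* m) y ≈ y
  prime-iterate em {n} {y} e moved = go (least-period em {n} e)
    where
    go : (∃[ p ] iter (suc p) y ≈ y × (∀ m → iter m y ≈ y → suc p ∣ m)) → ∃[ r ] ∃[ m ] Prime r × ¬ (iter m y ≈ y) × iter (r ℕ.* m) y ≈ y
    go (p , root , minimal) = split (factorise (suc p))
      where
      split : PrimeFactorisation (suc p) → ∃[ r ] ∃[ m ] Prime r × ¬ (iter m y ≈ y) × iter (r ℕ.* m) y ≈ y
      split record { factors = []     ; isFactorisation = eq ; factorsPrime = _ } = ⊥-elim (moved (≡.subst (λ n → iter n y ≈ y) eq root))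
      split record { factors = r ∷ rs ; isFactorisation = eq ; factorsPrime = pr ∷ _ } =
        r , product rs , pr , (λ fixed → small (product rs) eq (minimal (product rs) fixed)) , ≡.subst (λ n → iter n y ≈ y) eq root
        where
        small : ∀ m → suc p ≡ r ℕ.* m → ¬ (suc p ∣ m)
        small zero    eq′ _ with ≡.trans eq′ (ℕ.*-zeroʳ r)
        ... | ()
        small (suc m) eq′ d = ℕ.<⇒≱ (≡.subst (suc m ℕ.<_) (≡.trans (ℕ.*-comm (suc m) r) (≡.sym eq′))
          (ℕ.m<m*n (suc m) r (ℕ.nonTrivial⇒n>1 r {{Primality.prime⇒nonTrivial pr}}))) (∣.∣⇒≤ d)

module TraceOne (em : EM) {k : Field ℓ} (N : Extension k) (τ : N ↪ N) where
  open Extension N hiding (zero)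
  open FieldProperties top
  open PolynomialRing top
  open Degree top
  open _↪_ τ using (⟦_⟧)
  open Operator N τ using (iter; act; ones; act-ones-suc; act-ones-iter)
  private module T = Homomorphism {F = top} {G = top} (_↪_.homomorphism τ)

  -- if all Σⱼ τʲ(y)ˡ vanished, so would Σⱼ P(τʲ y) for every P; but P = ∏_{0<j<r} (X - τʲ y) gives P(y) ≠ 0
  trace-one : ∀ {r-1 y} → iter (suc r-1) y ≈ y → (∀ m → 0 ℕ.< m → m ℕ.< suc r-1 → ¬ (iter m y ≈ y)) →
              ∃[ z ] act (ones (suc r-1)) z ≈ 1#
  trace-one {r-1} {y} period distinct = go em
    where
    r : ℕ
    r = suc r-1
    trace : Carrier → Carrier
    trace = act (ones r)
    sums : ℕ → Poly → Carrier
    sums zero    P = 0#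
    sums (suc j) P = sums j P + eval P (iter j y)
    trace-power : ∀ j l → act (ones j) (y ^ l) ≈ sums j (X^ l)
    trace-power zero    l = refl
    trace-power (suc j) l = trans (act-ones-iter j (y ^ l)) (+-cong (trace-power j l)
      (trans (Homomorphism.^-homo {F = top} {G = top} (Iterates.iter-homomorphism N τ j) y l) (sym (eval-X^ l (iter j y)))))
    sums-+ : ∀ j P Q → sums j (P +ₚ Q) ≈ sums j P + sums j Q
    sums-+ zero    P Q = sym (+-identityˡ 0#)
    sums-+ (suc j) P Q = trans (+-cong (sums-+ j P Q) (eval-+ P Q (iter j y))) (solve 4 (λ a b c d → (a :+ b) :+ (c :+ d) := (a :+ c) :+ (b :+ d)) refl _ _ _ _)
    sums-• : ∀ j a P → sums j (a • P) ≈ a * sums j P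
    sums-• zero    a P = sym (zeroʳ a)
    sums-• (suc j) a P = trans (+-cong (sums-• j a P) (eval-• a P (iter j y))) (sym (distribˡ a _ _))
    sums-cong : ∀ j {P Q} → P ≋ Q → sums j P ≈ sums j Q
    sums-cong zero    e = refl
    sums-cong (suc j) e = +-cong (sums-cong j e) (eval-cong e refl)
    -- `shift l P` is X^l P; it lets P be taken apart into monomials.
    shift : ℕ → Poly → Poly
    shift zero    P = P
    shift (suc l) P = 0# ∷ shift l P
    shift-∷ : ∀ l a P → shift l (a ∷ P) ≋ (a • X^ l) +ₚ shift (suc l) P
    shift-∷ zero    a P = ∷-cong (sym (trans (+-identityʳ _) (*-identityʳ a))) ≋-refl
    shift-∷ (suc l) a P = ∷-cong (sym (trans (+-identityʳ _) (zeroʳ a))) (shift-∷ l a P)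
    shift-[] : ∀ l → shift l [] ≋ []
    shift-[] zero    = ≋-refl
    shift-[] (suc l) = ≋-trans (∷-cong refl (shift-[] l)) 0∷[]≋[]
    sums-zero : ∀ j → sums j [] ≈ 0#
    sums-zero zero    = refl
    sums-zero (suc j) = trans (+-congʳ (sums-zero j)) (+-identityˡ 0#)
    vanishing : (∀ l → trace (y ^ l) ≈ 0#) → ∀ l P → sums r (shift l P) ≈ 0#
    vanishing z l []      = trans (sums-cong r (shift-[] l)) (sums-zero r)
    vanishing z l (a ∷ P) = trans (sums-cong r (shift-∷ l a P)) (trans (sums-+ r (a • X^ l) (shift (suc l) P))
      (trans (+-cong (trans (sums-• r a (X^ l)) (trans (*-congˡ (trans (sym (trace-power r l)) (z l))) (zeroʳ a))) (vanishing z (suc l) P)) (+-identityˡ 0#)))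
    others : ℕ → List Carrier
    others zero    = []
    others (suc j) = iter (suc j) y ∷ others j
    P = linears (others r-1)
    sums-others : ∀ j → j ℕ.≤ r-1 → sums (suc j) P ≈ eval P y
    sums-others zero    _   = +-identityˡ _
    sums-others (suc j) j<  = trans (+-cong (sums-others j (ℕ.<⇒≤ j<)) (linears-root⁻ (member (suc j) (s≤s z≤n) r-1 j<))) (+-identityʳ _)
      where
      member : ∀ m → 0 ℕ.< m → ∀ n → m ℕ.≤ n → Any (iter m y ≈_) (others n)
      member m 0<m zero    m≤n = ⊥-elim (ℕ.<⇒≱ 0<m m≤n)
      member m 0<m (suc n) m≤n with ℕ.m≤n⇒m<n∨m≡n m≤n
      ... | inj₁ (s≤s m≤n′) = there (member m 0<m n m≤n′)
      ... | inj₂ ≡.refl     = here refl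
    not-other : ∀ n → n ℕ.≤ r-1 → ¬ Any (y ≈_) (others n)
    not-other (suc n) n<  (here e)    = distinct (suc n) (s≤s z≤n) (s≤s n<) (sym e)
    not-other (suc n) n<  (there any) = not-other n (ℕ.<⇒≤ n<) any
    go : Dec (∃[ l ] ¬ (trace (y ^ l) ≈ 0#)) → ∃[ z ] trace z ≈ 1#
    go (no ¬∃) = ⊥-elim (not-other r-1 ℕ.≤-refl (ClassicalDegree.linears-root em top {others r-1}
        (trans (sym (sums-others r-1 ℕ.≤-refl)) (vanishing (λ l → zero? l em) 0 P))))
      where
      zero? : ∀ l → Dec (trace (y ^ l) ≈ 0#) → trace (y ^ l) ≈ 0#
      zero? l (yes e) = e
      zero? l (no ¬e) = ⊥-elim (¬∃ (l , ¬e))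
    -- A trace s is fixed by τ, and so is its inverse. Multiplication by a fixed element passes
    -- through the trace, so division by s normalises it to 1.
    go (yes (l , s≉0)) = y ^ l * s′ , trans (scaled r) ss′≈1
      where
      s = trace (y ^ l)
      s′ = proj₁ (inverse s s≉0)
      ss′≈1 = proj₂ (inverse s s≉0)
      s-fixed : ⟦ s ⟧ ≈ s
      s-fixed = begin
        ⟦ s ⟧                               ≈⟨ solve 2 (λ a b → b := (a :+ b) :- a) refl (y ^ l) ⟦ s ⟧ ⟩
        (y ^ l + ⟦ s ⟧) - y ^ l             ≈⟨ +-congʳ (trans (sym (act-ones-suc r (y ^ l))) (act-ones-iter r (y ^ l))) ⟩
        (s + iter r (y ^ l)) - y ^ l        ≈⟨ +-congʳ (+-congˡ (trans (Homomorphism.^-homo {F = top} {G = top} (Iterates.iter-homomorphism N τ r) y l) (^-congˡ l period))) ⟩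
        (s + y ^ l) - y ^ l                 ≈⟨ solve 2 (λ s a → (s :+ a) :- a := s) refl s (y ^ l) ⟩
        s                                   ∎
        where open SetoidReasoning setoid
      s′-fixed : ⟦ s′ ⟧ ≈ s′
      s′-fixed = *-cancelˡ s≉0 (trans (*-congʳ (sym s-fixed)) (trans (sym (T.*-homo s s′)) (trans (T.φ-cong ss′≈1) (trans T.1#-homo (sym ss′≈1)))))
      scaled : ∀ j → act (ones j) (y ^ l * s′) ≈ act (ones j) (y ^ l) * s′
      scaled zero    = sym (zeroˡ s′)
      scaled (suc j) = trans (act-ones-suc j _) (trans (+-congˡ (trans (T.φ-cong (scaled j)) (trans (T.*-homo _ _) (*-congˡ s′-fixed))))
        (trans (sym (distribʳ s′ _ _)) (*-congʳ (sym (act-ones-suc j _)))))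

-- Residual extensions of prime degree

multiple-homo : {F G : Field ℓ} {φ : Field.Carrier F → Field.Carrier G} (hom : IsRingHomomorphism (Field.rawRing F) (Field.rawRing G) φ) → ∀ n →
  let module F = Field F ; module G = Field G in
  φ (RawMonoidDefs._×_ (RawRing.+-rawMonoid F.rawRing) n F.1#) G.≈ RawMonoidDefs._×_ (RawRing.+-rawMonoid G.rawRing) n G.1#
multiple-homo {F = F} {G = G} hom zero    = Homomorphism.0#-homo {F = F} {G = G} hom
multiple-homo {F = F} {G = G} hom (suc n) = G.trans (H.+-homo _ _) (G.+-cong H.1#-homo (multiple-homo {F = F} {G = G} hom n))
  where
  module G = Field G
  module H = Homomorphism {F = F} {G = G} hom

module Core (em : EM) {K : Field ℓ} {V : Valuation K} (henselian : IsHenselian V) (discrete : IsDiscrete V)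
    (E : Extension K) (galois : IsGalois E) (dim : Dim≤1 (Extension.top E)) {W : Valuation (Extension.top E)} (ext : Extends E V W)
    {k₀ k : Field ℓ} (R₀ : ResidueMap V k₀) (R : ResidueMap W k) (finite : IsFinite k₀) where
  private
    module E = Extension E
    module k₀ = Field k₀
    module WP = ValuationProperties W
    module ρ = ResidueExtension em E (ExtendsProperties.extends⇒ E ext) (ExtendsProperties.extends⇐ E ext) R₀ R
    algebraicE = IsGalois.algebraic galois

    _·₀1 : ℕ → k₀.Carrier
    n ·₀1 = RawMonoidDefs._×_ (RawRing.+-rawMonoid k₀.rawRing) n k₀.1#

  -- The primes r for which endomorphisms of order r are excluded. The first condition is stated in
  -- the residue field of K, from which it passes to every extension of k.
  Good : ℕ → Set ℓ
  Good r = ¬ (r ·₀1 k₀.≈ k₀.0#) ⊎ ¬ IsDivisibleBy r (Valuation.valueGroup W)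

  -- Since E/K is algebraic, so is k over the finite residue field of K, and N is algebraic over
  -- that field through k.
  torsion : (N : Extension k) → IsAlgebraic N → ∀ {x} → ¬ (Extension._≈_ N x (Extension.0# N)) → ∃ (Unity.IsOrder (Extension.top N) x)
  torsion N algN {x} = algebraic⇒unity em finite (compose ρ.residueExtension N)
    (algebraic-trans em ρ.residueExtension N (ρ.residue-algebraic algebraicE) algN x)

  multiple-nonzero : (N : Extension k) → ∀ {n} → ¬ (n ·₀1 k₀.≈ k₀.0#) →
    ¬ (Extension._≈_ N (RawMonoidDefs._×_ (RawRing.+-rawMonoid (Extension.rawRing N)) n (Extension.1# N)) (Extension.0# N))
  multiple-nonzero N {n} nz e = Homomorphism.φ-nonzero {F = k₀} {G = Extension.top N} (Extension.ι-homomorphism M) nz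
    (Extension.trans N (multiple-homo {F = k₀} {G = Extension.top N} (Extension.ι-homomorphism M) n) e)
    where M = compose ρ.residueExtension N

  private
    unramified-root : ∀ {r} → ¬ IsDivisibleBy r (Valuation.valueGroup W) →
      ∃[ π ] ¬ (π E.≈ E.0#) × WP.NotPower r π
    unramified-root {r} ¬div = go em
      where
      open FieldProperties E.top using (_^_)
      go : Dec (∃[ π ] ¬ (π E.≈ E.0#) × WP.NotPower r π) → ∃[ π ] ¬ (π E.≈ E.0#) × WP.NotPower r π
      go (yes e) = e
      go (no ¬e) = ⊥-elim (¬div (WP.roots⇒divisible r λ {x} x≉0 → root x x≉0 em))
        where
        root : ∀ x → ¬ (x E.≈ E.0#) → Dec (∃[ z ] ¬ (z E.≈ E.0#) × z ^ r WP.~ x) → ∃[ z ] ¬ (z E.≈ E.0#) × z ^ r WP.~ x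
        root x x≉0 (yes p) = p
        root x x≉0 (no ¬p) = ⊥-elim (¬e (x , x≉0 , λ {z} z≉0 e → ¬p (z , z≉0 , e)))

    -- Supplies the choices required by the modules of `Lifting`, each from the existence statement
    -- that provides it.
    module Wild (N : Extension k) (τ : N ↪ N) {y : Extension.Carrier N} {M : ℕ} (ord : Unity.IsOrder (Extension.top N) y M)
        {i : ℕ} (τy≈y^i : Extension._≈_ N (_↪_.⟦_⟧ τ y) (FieldProperties._^_ (Extension.top N) y i))
        {r-2 : ℕ} (pr : Prime (suc (suc r-2))) (period : Extension._≈_ N (Operator.iter N τ (suc (suc r-2)) y) y)
        (moved : ¬ (Extension._≈_ N (_↪_.⟦_⟧ τ y) y))
        {π : E.Carrier} (π≉0 : ¬ (π E.≈ E.0#))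
        (indivisible : WP.NotPower (suc (suc r-2)) π) where
      private
        module N = Extension N
        positive = Unity.IsOrder.positive ord

      with-splitting : SplitsSomewhere E.top (Unity.unity E.top M) → ⊥
      with-splitting (L , algL , rs , split) = with-valuation (IsHenselian.extension henselian (compose E L) (algebraic-trans em E L algebraicE algL))
        where
        module L = Extension L
        with-valuation : (Σ (Valuation L.top) λ w → Extends (compose E L) V w) → ⊥
        with-valuation (WL , extL) = with-minimal (MinimalPolynomial.minimalPolynomial N em y {Unity.unity k M}
            (Degree.monic-nonzero k (Unity.monic-unity k positive))
            (N.trans (evalAt-unity N M y) (FieldProperties.x≈y⇒x-y≈0 N.top (Unity.IsOrder.isRoot ord))))
          where
          D : LiftingData ℓ
          D = record
            { henselian = henselian ; E = E ; algebraicE = algebraicE ; extE = ext ; R = R ; N = N ; τ = τ ; ord = ord ; i = i ; τy≈y^i = τy≈y^i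
            ; L = L ; algebraicL = algL ; rs = rs ; split = split ; extL = extL ; S = residueMap em WL }
          with-minimal : (∃[ d ] ∃[ f ] Degree.Monic k d f × evalAt N f y N.≈ N.0# × (∀ p → evalAt N p y N.≈ N.0# → Degree._divides_ k f p)) → ⊥
          with-minimal (d , f , mf , root-f , min-f) = with-root (Lifting.WithMinimal.lifted-root em D mf root-f min-f)
            where
            module WM = Lifting.WithMinimal em D mf root-f min-f
            kl = Lifting.residualExtension em D
            with-root : (∃[ ζ ] FieldProperties._^_ L.top ζ M L.≈ L.1# × Extension._≈_ kl (evalAt kl f (Lifting.reduce em D ζ)) (Extension.0# kl)) → ⊥
            with-root (ζ , ζ^M , root-ζ) = with-conjugates (MinimalPolynomial.minimalPolynomial L em ζ {Unity.unity E.top M}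
                (Degree.monic-nonzero E.top (Unity.monic-unity E.top positive))
                (L.trans (evalAt-unity L M ζ) (FieldProperties.x≈y⇒x-y≈0 L.top ζ^M)))
              where
              with-conjugates : (∃[ n ] ∃[ g ] Degree.Monic E.top n g × evalAt L g ζ L.≈ L.0# × (∀ p → evalAt L p ζ L.≈ L.0# → Degree._divides_ E.top g p)) → ⊥
              with-conjugates (n , g , mg , root-g , min-g) = with-roots (WM.WithRoot.WithConjugates.g-splits ζ ζ^M root-ζ mg root-g min-g)
                where
                with-roots : ClassicalDegree.Splits em L.top (Unity.powers L.top ζ M) n (map L.ι g) → ⊥
                with-roots (zs , g≋zs , len , sub) = WM.WithRoot.WithConjugates.WithSplitting.WithPrime.contradiction ζ ζ^M root-ζ mg root-g min-g zs g≋zs len sub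
                  pr period moved π≉0 indivisible dim

      wild-contradiction : ⊥
      wild-contradiction = with-splitting (splitting em M E.top (Unity.unity E.top M) (Unity.monic-unity E.top positive))

  -- When the value group is divisible by r, `Good r` can only mean that r is nonzero in the residue
  -- field, and this is what the tame argument requires.
  rigid : (N : Extension k) → IsAlgebraic N → (τ : N ↪ N) → ∀ {r y} → Prime r → Good r →
          Extension._≈_ N (Operator.iter N τ r y) y → Extension._≈_ N (_↪_.⟦_⟧ τ y) y
  rigid N algN τ {r} {y} pr good period = by-divisibility em
    where
    open Extension N
    open FieldProperties top using (_^_)
    open _↪_ τ using (⟦_⟧)
    module T = Homomorphism {F = top} {G = top} (_↪_.homomorphism τ)
    by-divisibility : Dec (IsDivisibleBy r (Valuation.valueGroup W)) → ⟦ y ⟧ ≈ y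
    by-divisibility (yes div) = TameContradiction.tame-fixed em N τ pr
        (Conjugates.supported-powers em henselian discrete E galois ext R (ℕ.<-trans (s≤s z≤n) (ℕ.nonTrivial⇒n>1 r {{Primality.prime⇒nonTrivial pr}})) div)
        (torsion N algN) (multiple-nonzero N {r} (r≉0 good)) period
      where
      r≉0 : Good r → ¬ (r ·₀1 k₀.≈ k₀.0#)
      r≉0 (inj₁ nz)   = nz
      r≉0 (inj₂ ¬div) = ⊥-elim (¬div div)
    by-divisibility (no ¬div) = by-motion em
      where
      by-motion : Dec (⟦ y ⟧ ≈ y) → ⟦ y ⟧ ≈ y
      by-motion (yes e) = e
      by-motion (no moved) = ⊥-elim (with-order (torsion N algN (λ y≈0 → moved (trans (T.φ-cong y≈0) (trans T.0#-homo (sym y≈0))))))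
        where
        with-order : ∃ (Unity.IsOrder top y) → ⊥
        with-order (M , ord) = with-power (Unity.is-power top ord em (trans (sym (T.^-homo y M)) (trans (T.φ-cong (Unity.IsOrder.isRoot ord)) T.1#-homo)))
          where
          with-power : (∃[ i ] ⟦ y ⟧ ≈ y ^ i) → ⊥
          with-power (i , e) = with-π (unramified-root {r} ¬div)
            where
            with-π : (∃[ π ] ¬ (π E.≈ E.0#) × WP.NotPower r π) → ⊥
            with-π (π , π≉0 , indivisible) = by-size r pr period indivisible
              where
              by-size : ∀ r → Prime r → Operator.iter N τ r y ≈ y → WP.NotPower r π → ⊥
              by-size zero          pr _ _ = Primality.¬prime[0] pr
              by-size (suc zero)    pr _ _ = Primality.¬prime[1] pr
              by-size (suc (suc _)) pr period indivisible = Wild.wild-contradiction N τ ord {i} e pr period moved π≉0 indivisible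

  -- Some iterate has prime period at y and moves it; if its prime were good, `rigid` would forbid
  -- this.
  bad-iterate : (N : Extension k) → IsAlgebraic N → (τ : N ↪ N) → ∀ {y} → ¬ (Extension._≈_ N (_↪_.⟦_⟧ τ y) y) →
                ∃[ r ] ∃[ m ] Prime r × ¬ Good r × ¬ (Extension._≈_ N (Operator.iter N τ m y) y) × Extension._≈_ N (Operator.iter N τ (r ℕ.* m) y) y
  bad-iterate N algN τ {y} moved = with-order (torsion N algN (λ y≈0 → moved (trans (T.φ-cong y≈0) (trans T.0#-homo (sym y≈0)))))
    where
    open Extension N
    open FieldProperties top using (_^_)
    open _↪_ τ using (⟦_⟧)
    open Iterates N τ
    module T = Homomorphism {F = top} {G = top} (_↪_.homomorphism τ)
    Result : Set ℓ
    Result = ∃[ r ] ∃[ m ] Prime r × ¬ Good r × ¬ (Operator.iter N τ m y ≈ y) × Operator.iter N τ (r ℕ.* m) y ≈ y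
    with-order : ∃ (Unity.IsOrder top y) → Result
    with-order (M , ord) = with-power (Unity.is-power top ord em (trans (sym (T.^-homo y M)) (trans (T.φ-cong (Unity.IsOrder.isRoot ord)) T.1#-homo)))
      where
      with-power : (∃[ i ] ⟦ y ⟧ ≈ y ^ i) → Result
      with-power (i , e) = with-period (power-periodic em {y} {i} ord e)
        where
        with-period : (∃[ n ] Operator.iter N τ (suc n) y ≈ y) → Result
        with-period (n , period) = with-prime (prime-iterate em {n} {y} period moved)
          where
          with-prime : (∃[ r ] ∃[ m ] Prime r × ¬ (Operator.iter N τ m y ≈ y) × Operator.iter N τ (r ℕ.* m) y ≈ y) → Result
          with-prime (r , m , pr , moved′ , period′) = r , m , pr ,
            (λ good → moved′ (rigid N algN (iterate m) pr good (trans (iter-iterate m r y) period′))) , moved′ , period′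

  -- A root y ≠ 0 of p in an algebraic extension is a root of unity, so its minimal polynomial is a
  -- product of distinct factors X - yʲ. Separability is thus automatic, and with y as the only root
  -- the polynomial is linear.
  algebraically-closed : (∀ {r} → Prime r → Good r) → IsAlgebraicallyClosed k
  algebraically-closed good p nc = with-root (RootExtension.root-extension em k p nc)
    where
    open Field k hiding (zero)
    open PolynomialRing k
    open Degree k
    with-root : (Σ (Extension k) λ N → IsAlgebraic N × ∃[ x ] Extension._≈_ N (evalAt N p x) (Extension.0# N)) → ∃[ x ] eval p x ≈ 0#
    with-root (N , algN , y , root) = from-base (in-base em)
      where
      module N = Extension N
      module I = Homomorphism {F = k} {G = N.top} N.ι-homomorphism
      from-base : InBase N y → ∃[ x ] eval p x ≈ 0#
      from-base (a , ιa≈y) = a , I.φ-injective em (N.trans (N.sym (eval-map {F = k} {G = N.top} N.ι-homomorphism p a))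
        (N.trans (PolynomialRing.eval-cong N.top {map N.ι p} {map N.ι p} (PolynomialRing.≋-refl N.top) ιa≈y) (N.trans root (N.sym I.0#-homo))))
      in-base : Dec (y N.≈ N.0#) → InBase N y
      in-base (yes y≈0) = 0# , N.trans I.0#-homo (N.sym y≈0)
      in-base (no y≉0) = with-order (torsion N algN y≉0)
        where
        with-order : ∃ (Unity.IsOrder N.top y) → InBase N y
        with-order (M , ord) = with-minimal (MinimalPolynomial.minimalPolynomial N em y {Unity.unity k M} (monic-nonzero (Unity.monic-unity k positive)) unity-root)
          where
          open Unity.IsOrder ord
          unity-root : evalAt N (Unity.unity k M) y N.≈ N.0#
          unity-root = N.trans (evalAt-unity N M y) (FieldProperties.x≈y⇒x-y≈0 N.top isRoot)
          with-minimal : (∃[ n ] ∃[ g ] Monic n g × evalAt N g y N.≈ N.0# × (∀ q → evalAt N q y N.≈ N.0# → g divides q)) → InBase N y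
          with-minimal (n , g , mg , root-g , min-g) = with-splitting (ClassicalDegree.divisor-of-linears em N.top (Unity.powers N.top y M) {n} {map N.ι g} {proj₁ g∣}
              (monic-map N mg) (PolynomialRing.≋-trans N.top (proj₂ g∣) (PolynomialRing.≋-trans N.top (map-unity N M) (Unity.unity≋powers N.top ord))))
            where
            g∣ = map-divides N {g} {Unity.unity k M} (min-g (Unity.unity k M) unity-root)
            -- a root z = yⁱ ≠ y of the minimal polynomial of y would give the nontrivial endomorphism y ↦ z of k(y)
            only-root : ∀ {z} → (∃[ i ] z N.≈ FieldProperties._^_ N.top y i) → evalAt N g z N.≈ N.0# → z N.≈ y
            only-root {z} (i , z≈) root-z = decide em
              where
              vanish′ : ∀ q → evalAt N q y N.≈ N.0# → evalAt N q (FieldProperties._^_ N.top y i) N.≈ N.0#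
              vanish′ q e = MinimalPolynomial.divides-evalAt N em _ {g} {q} (min-g q e) (N.trans (evalAt-cong N {g} {g} ≋-refl (N.sym z≈)) root-z)
              module Sy = SimpleExtension em N algN y
              generator-at : ∀ x → evalAt N Sy.generator x N.≈ x
              generator-at x = N.trans (PolynomialComposition.evalAt-X^ N 1 x) (N.*-identityʳ x)
              decide : Dec (z N.≈ y) → z N.≈ y
              decide (yes e) = e
              decide (no z≉y) = ⊥-elim (absurd (bad-iterate Sy.simple (embedding-algebraic em {A = Sy.simple} {B = N} Sy.inclusion algN) (Sy.power-endomorphism i vanish′) {Sy.generator} moved))
                where
                moved : ¬ (Extension._≈_ Sy.simple (_↪_.⟦_⟧ (Sy.power-endomorphism i vanish′) Sy.generator) Sy.generator)
                moved (Sy.same e) = z≉y (N.trans z≈ (N.trans (N.sym (N.trans (Sy.evalAt-iter i vanish′ 1 Sy.generator y)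
                  (N.trans (generator-at _) (FieldProperties.^-congʳ N.top y (ℕ.*-identityʳ i))))) (N.trans e (generator-at y))))
                absurd : (∃[ r ] ∃[ m ] Prime r × ¬ Good r × _) → ⊥
                absurd (_ , _ , pr , ¬good , _) = ¬good (good pr)
            with-splitting : ClassicalDegree.Splits em N.top (Unity.powers N.top y M) n (map N.ι g) → InBase N y
            with-splitting (zs , g≋zs , len , sub) = by-length zs len g≋zs
                (Degree.distinct-⊆ N.top sub (Unity.powers-distinct N.top ord)) (Sublist.All-resp-⊆ sub (All.applyUpTo⁺₂ (FieldProperties._^_ N.top y) M λ j → j , N.refl))
              where
              root-of : ∀ {zs z} → PolynomialRing._≋_ N.top (map N.ι g) (Degree.linears N.top zs) → Any (z N.≈_) zs → evalAt N g z N.≈ N.0#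
              root-of e any = N.trans (PolynomialRing.eval-cong N.top e N.refl) (Degree.linears-root⁻ N.top any)
              by-length : ∀ zs → length zs ≡ n → PolynomialRing._≋_ N.top (map N.ι g) (Degree.linears N.top zs) → Degree.Distinct N.top zs →
                          All (λ z → ∃[ j ] z N.≈ FieldProperties._^_ N.top y j) zs → InBase N y
              by-length [] ≡.refl _ _ _ = ⊥-elim (N.1≉0 (N.trans (N.sym (evalAt-1 N y)) (N.trans (evalAt-cong N {1ₚ} {g} (≋-sym (monic-0 mg)) N.refl) root-g)))
              -- Here g = X + g₀, hence y = - g₀.
              by-length (z ∷ []) ≡.refl _ _ _ = - coeff g 0 , N.trans (I.-‿homo _) (N.sym (GroupProperties.inverseʳ-unique N.+-group (N.ι (coeff g 0)) y linear-value))
                where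
                linear-value : N.ι (coeff g 0) N.+ y N.≈ N.0#
                linear-value = N.trans (N.sym (N.trans (evalAt-cong N {g} {coeff g 0 ∷ 1# ∷ []} (mk λ { zero → refl ; (suc zero) → leading mg ; (suc (suc m)) → vanish (bounded mg) (suc (suc m)) (s≤s (s≤s z≤n)) }) N.refl)
                  (N.+-congˡ (N.trans (N.*-congˡ (N.trans (N.+-cong I.1#-homo (N.zeroʳ y)) (N.+-identityʳ _))) (N.*-identityʳ y))))) root-g
              by-length (z ∷ z′ ∷ zs) _ e ((z≉z′ ∷ _) ∷ _) (p ∷ p′ ∷ _) = ⊥-elim (z≉z′ (N.trans (only-root {z} p (root-of {z ∷ z′ ∷ zs} e (here N.refl)))
                (N.sym (only-root {z′} p′ (root-of {z ∷ z′ ∷ zs} e (there (here N.refl)))))))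

  module PExtension {q : ℕ} (characteristic : HasCharacteristic k₀ q) where
    -- If r vanished in the field, q would divide r, so q = 1 or q = r; and q = 1 would give 1 = 0.
    good-≢ : ∀ {r} → Prime r → r ≢ q → Good r
    good-≢ {r} pr r≢q = inj₁ λ z → absurd (Primality.prime⇒irreducible pr (Equivalence.to (characteristic r) z))
      where
      absurd : q ≡ 1 ⊎ q ≡ r → ⊥
      absurd (inj₁ ≡.refl) = k₀.1≉0 (k₀.trans (k₀.sym (k₀.+-identityʳ k₀.1#)) (Equivalence.from (characteristic 1) ∣.∣-refl))
      absurd (inj₂ ≡.refl) = r≢q ≡.refl

    -- A finite extension of p-power degree has no automorphism of order q ≠ p over a field of characteristic q:
    -- if z has relative trace 1, then the degree is Tr(1) = q Tr(z) = 0 in k.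
    module _ (N : Extension k) {p a : ℕ} (pp : Prime p) (dimension : HasDimension (extensionAlgebra N) (p ℕ.^ a)) (p≢q : p ≢ q)
             (σ : Automorphism N) {m : ℕ} (pq : Prime q) {y : Extension.Carrier N} where
      private
        module N = Extension N
        module k = Field k
        module kM = Mult k.semiring
        module Tr = Trace em N (proj₂ dimension)
        embedding = automorphism⇒embedding σ
        module It = Iterates N embedding
        τ = It.iterate m
        module T = Operator N τ

        power-not-divisible : ∀ a → ¬ (q ∣ p ℕ.^ a)
        power-not-divisible zero    d = Primality.¬prime[1] (≡.subst Prime (∣.∣1⇒≡1 d) pq)
        power-not-divisible (suc a) d = split (Primality.euclidsLemma p (p ℕ.^ a) pq d)
          where
          cases : q ≡ 1 ⊎ q ≡ p → ⊥
          cases (inj₁ e) = Primality.¬prime[1] (≡.subst Prime e pq)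
          cases (inj₂ e) = p≢q (≡.sym e)
          split : q ∣ p ⊎ q ∣ p ℕ.^ a → ⊥
          split (inj₁ d′) = cases (Primality.prime⇒irreducible pp d′)
          split (inj₂ d′) = power-not-divisible a d′

        multiple-k : ∀ n → ρ.ρ (n ·₀1) k.≈ n kM.× k.1#
        multiple-k n = multiple-homo {F = k₀} {G = k} (Extension.ι-homomorphism ρ.residueExtension) n
        module P = Homomorphism {F = k₀} {G = k} (Extension.ι-homomorphism ρ.residueExtension)

        q·1≈0 : q kM.× k.1# k.≈ k.0#
        q·1≈0 = k.trans (k.sym (multiple-k q)) (k.trans (P.φ-cong (Equivalence.from (characteristic q) ∣.∣-refl)) P.0#-homo)

        degree≉0 : ¬ ((p ℕ.^ a) kM.× k.1# k.≈ k.0#)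
        degree≉0 z = P.φ-nonzero (λ z′ → power-not-divisible a (Equivalence.to (characteristic (p ℕ.^ a)) z′)) (k.trans (multiple-k (p ℕ.^ a)) z)

        Tr-iter : ∀ j x → Tr.Tr (Operator.iter N embedding j x) k.≈ Tr.Tr x
        Tr-iter zero    x = k.refl
        Tr-iter (suc j) x = k.trans (Tr.Tr-automorphism σ (Operator.iter N embedding j x)) (Tr-iter j x)

        -- Tr is invariant under σ, so each of the j iterates of x contributes Tr(x).
        Tr-ones : ∀ j x → Tr.Tr (T.act (T.ones j) x) k.≈ j kM.× Tr.Tr x
        Tr-ones zero    x = RingProperties.x+x≈x⇒x≈0 k.ring (Tr.Tr N.0#) (k.trans (k.sym (Tr.Tr-+ N.0# N.0#)) (Tr.Tr-cong (N.+-identityˡ N.0#)))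
        Tr-ones (suc j) x = k.trans (Tr.Tr-cong (T.act-ones-iter j x)) (k.trans (Tr.Tr-+ (T.act (T.ones j) x) (T.iter j x))
          (k.trans (k.+-cong (Tr-ones j x) (k.trans (Tr.Tr-cong (It.iter-iterate m j x)) (Tr-iter (j ℕ.* m) x))) (k.+-comm _ _)))

      no-automorphism : ¬ (Operator.iter N embedding m y N.≈ y) → ¬ (Operator.iter N embedding (q ℕ.* m) y N.≈ y)
      no-automorphism moved period = by-size q pq ≡.refl
        where
        period′ : T.iter q y N.≈ y
        period′ = N.trans (It.iter-iterate m q y) period
        by-size : ∀ r → Prime r → r ≡ q → ⊥
        by-size zero    pr _ = Primality.¬prime[0] pr
        by-size (suc r) pr e = with-trace-one (TraceOne.trace-one em N τ {r} {y} (≡.subst (λ n → T.iter n y N.≈ y) (≡.sym e) period′)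
            (Period.prime-period N τ em pr (≡.subst (λ n → T.iter n y N.≈ y) (≡.sym e) period′) moved))
          where
          with-trace-one : (∃[ z ] T.act (T.ones (suc r)) z N.≈ N.1#) → ⊥
          with-trace-one (z , trace≈1) = degree≉0 (k.trans (k.sym Tr.Tr-1) (k.trans (Tr.Tr-cong (N.sym trace≈1)) (k.trans (Tr-ones (suc r) z)
            (k.trans (k.reflexive (≡.cong (kM._× Tr.Tr z) e)) (k.trans (kM.×-congʳ q (k.sym (k.*-identityˡ _))) (k.trans (k.sym (kM.×-assoc-* q k.1# (Tr.Tr z)))
              (k.trans (k.*-congʳ q·1≈0) (k.zeroˡ _))))))))

    -- A Galois extension is trivial once no automorphism moves anything. An automorphism that moves
    -- y has an iterate of bad prime period at y; this prime must be q, and differs from p because p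
    -- is good, so `no-automorphism` applies.
    p-extension-trivial : ∀ {p} → Prime p → Good p → (N : Extension k) → IsFinitePExtension p N → ∀ y → InBase N y
    p-extension-trivial {p} pp good N (galoisN , a , dimension) y = IsGalois.fixedField galoisN y λ σ → decide σ em
      where
      module N = Extension N
      decide : ∀ σ → Dec (Automorphism.⟦_⟧ {L = N} σ y N.≈ y) → Automorphism.⟦_⟧ {L = N} σ y N.≈ y
      decide σ (yes e) = e
      decide σ (no moved) = ⊥-elim (absurd (bad-iterate N (IsGalois.algebraic galoisN) (automorphism⇒embedding σ) moved))
        where
        absurd : (∃[ r ] ∃[ m ] Prime r × ¬ Good r × ¬ (Operator.iter N (automorphism⇒embedding σ) m y N.≈ y) × Operator.iter N (automorphism⇒embedding σ) (r ℕ.* m) y N.≈ y) → ⊥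
        absurd (r , m , pr , bad , moved′ , period) = compare (r ℕ.≟ q)
          where
          compare : Dec (r ≡ q) → ⊥
          compare (no r≢q)     = bad (good-≢ pr r≢q)
          compare (yes ≡.refl) = no-automorphism N {p} {a} pp dimension (λ { ≡.refl → bad good }) σ {m} pr {y} moved′ period

    maximal-p-extension-trivial : ∀ {p} → Prime p → Good p → MaximalPExtensionTrivial p k
    maximal-p-extension-trivial {p} pp good Ω _ x = mk⇔ to from
      where
      module Ω = Extension Ω
      base : trivialExtension k ↪ Ω
      base = record { ⟦_⟧ = Ω.ι ; homomorphism = Ω.ι-homomorphism ; fixes = λ a → Ω.refl }
      to : InMaximalPExtension p Ω x → InBase Ω x
      -- All finite p-extensions are trivial, so k itself is an intermediate field that contains
      -- them; membership in F(p) is tested on it.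
      to x∈ = x∈ (trivialExtension k) base λ N φ pext y → let a , e = p-extension-trivial pp good N pext y in
        a , Ω.trans (Ω.sym (_↪_.fixes φ a)) (Homomorphism.φ-cong {F = Extension.top N} {G = Ω.top} (_↪_.homomorphism φ) e)
      from : InBase Ω x → InMaximalPExtension p Ω x
      from (a , e) M ψ _ = Extension.ι M a , Ω.trans (_↪_.fixes ψ a) e

-- `HasCharacteristic` does not state primality. In a finite field two multiples of 1 agree, which
-- excludes q = 0, and a proper factorisation of q would give zero divisors. The case p = q of the
-- conclusion relies on this.
characteristic-prime : EM → {k : Field ℓ} → IsFinite k → ∀ {q} → HasCharacteristic k q → Prime q
characteristic-prime em {k} (N , inv) {q} characteristic = by-size q ≡.refl
  where
  open Field k hiding (zero)
  open Mult semiring using (×-homo-+; ×1-homo-*) renaming (_×_ to _·_)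
  module inv = Inverse inv
  q≢0 : q ≢ 0
  q≢0 ≡.refl = go (Fin.pigeonhole (ℕ.n<1+n N) (λ a → inv.from (toℕ a · 1#)))
    where
    go : (∃[ a ] ∃[ b ] (toℕ {suc N} a ℕ.< toℕ {suc N} b) × inv.from (toℕ a · 1#) ≡ inv.from (toℕ b · 1#)) → ⊥
    go (a , b , a<b , e) = ℕ.<-irrefl (≡.sym (∣.0∣⇒≡0 (Equivalence.to (characteristic d) d·1≈0))) (ℕ.m<n⇒0<n∸m a<b)
      where
      d = toℕ b ℕ.∸ toℕ a
      same : toℕ a · 1# ≈ toℕ b · 1#
      same = trans (sym (inv.strictlyInverseˡ _)) (trans (reflexive (≡.cong inv.to e)) (inv.strictlyInverseˡ _))
      d·1≈0 : d · 1# ≈ 0#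
      d·1≈0 = GroupProperties.identityʳ-unique +-group (toℕ a · 1#) (d · 1#) (trans (sym (×-homo-+ 1# (toℕ a) d))
        (trans (reflexive (≡.cong (_· 1#) (ℕ.m+[n∸m]≡n (ℕ.<⇒≤ a<b)))) (sym same)))
  irreducible : ∀ {d} → d ∣ q → d ≡ 1 ⊎ d ≡ q
  irreducible {d} (∣.divides e q≡) = go em
    where
    product≈0 : (e · 1#) * (d · 1#) ≈ 0#
    product≈0 = trans (sym (×1-homo-* e d)) (trans (reflexive (≡.cong (_· 1#) (≡.sym q≡))) (Equivalence.from (characteristic q) ∣.∣-refl))
    go : Dec (e · 1# ≈ 0#) → d ≡ 1 ⊎ d ≡ q
    go (yes z) = inj₁ (ℕ.*-cancelˡ-≡ d 1 e {{ℕ.≢-nonZero e≢0}} (≡.trans (≡.sym q≡) (≡.trans q≡e (≡.sym (ℕ.*-identityʳ e)))))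
      where
      e≢0 : e ≢ 0
      e≢0 ≡.refl = q≢0 q≡
      q≡e : q ≡ e
      q≡e = ∣.∣-antisym (Equivalence.to (characteristic e) z) (∣.divides d (≡.trans q≡ (ℕ.*-comm e d)))
    go (no ¬z) = inj₂ (∣.∣-antisym (∣.divides e q≡) (Equivalence.to (characteristic d) (FieldProperties.*-cancel-0 k ¬z product≈0)))
  by-size : ∀ n → q ≡ n → Prime q
  by-size zero          e      = ⊥-elim (q≢0 e)
  by-size (suc zero)    ≡.refl = ⊥-elim (1≉0 (trans (sym (+-identityʳ 1#)) (Equivalence.from (characteristic 1) ∣.∣-refl)))
  by-size (suc (suc n)) ≡.refl = Primality.irreducible⇒prime irreducible

theorem2p1 : (∀ {a} → ExcludedMiddle a) →
    ∀ {ℓ} (K : Field ℓ) (v : Valuation K) →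
    IsHenselian v → IsDiscrete v → IsFinite (residueField v) →
    (q : ℕ) → HasCharacteristic (residueField v) q →
    (E : Extension K) → IsGalois E → Dim≤1 (Extension.top E) →
    (w : Valuation (Extension.top E)) → Extends E v w →
    ((p : ℕ) → Prime p → p ≢ q → MaximalPExtensionTrivial p (residueField w)) ×
    (¬ IsDivisibleBy q (Valuation.valueGroup w) →
    MaximalPExtensionTrivial q (residueField w) ×
    IsAlgebraicallyClosed (residueField w))
theorem2p1 em K v henselian discrete finite q characteristic E galois dim w ext =
  (λ p pp p≢q → P.maximal-p-extension-trivial pp (P.good-≢ pp p≢q)) ,
  λ ¬div → P.maximal-p-extension-trivial (characteristic-prime em {residueField v} finite characteristic) (inj₂ ¬div) ,
  C.algebraically-closed (λ {r} pr → by-cases ¬div pr (r ℕ.≟ q))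
  where
  module C = Core em henselian discrete E galois dim ext (residueMap em v) (residueMap em w) finite
  module P = C.PExtension characteristic
  by-cases : ∀ {r} → ¬ IsDivisibleBy q (Valuation.valueGroup w) → Prime r → Dec (r ≡ q) → C.Good r
  by-cases ¬div pr (no r≢q)     = P.good-≢ pr r≢q
  by-cases ¬div pr (yes ≡.refl) = inj₂ ¬div
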